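{- There is an absolute constant $c>0$ such that for any prime $p$ there exist finite subsets $A\subset\mathbb{F}_p((t))$ of arbitrarily large cardinality such that \[\lvert A+A\rvert\leq \lvert A\rvert^{2-\frac{c}{\log p}}\quad\text{and}\quad \lvert AA\rvert\leq \lvert A\rvert^{2-\frac{c}{\log p}}.\]
   Context: $\mathbb{F}_p((t))$ is the field of formal Laurent series over $\mathbb{F}_p$. For a finite set $A$ in a ring, $A+A=\{a+b: a,b\in A\}$ and $AA=\{ab: a,b\in A\}$. -}

module Defs where

open import Data.Nat using (ℕ; zero; suc; _+_; _*_; _∸_; _^_; _≤_; _<_; ∣_-_∣)
open import Data.Nat.Divisibility using (_∣_)
open import Data.Integer as ℤ using (ℤ; +_; -[1+_])
open import Data.List using (List; []; _∷_; length; map; concatMap; upTo)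
open import Data.Nat.ListAction using (sum)
open import Data.List.Relation.Unary.All using (All)
open import Data.List.Relation.Unary.Any using (Any)
open import Data.List.Relation.Unary.AllPairs using (AllPairs)
open import Data.Product using (Σ; ∃; _×_)
open import Relation.Nullary using (¬_)

-- A formal Laurent series  t^val * Σ_{n ≥ 0} co n * t^n .
-- Coefficients are natural numbers read modulo p (see _≈[_]_), so that
-- modulo the equivalence below this is exactly F_p((t)).
record Laurent : Set where
  constructor laurent
  field
    val : ℤ
    co  : ℕ → ℕ
open Laurent public

coeff : Laurent → ℤ → ℕ
coeff x k with k ℤ.- val x
... | + n      = co x n
... | -[1+ _ ] = 0

_≈[_]_ : Laurent → ℕ → Laurent → Set
x ≈[ p ] y = ∀ (k : ℤ) → p ∣ ∣ coeff x k - coeff y k ∣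

_⊕_ : Laurent → Laurent → Laurent
x ⊕ y = laurent v (λ n → coeff x (v ℤ.+ + n) + coeff y (v ℤ.+ + n))
  where v = val x ℤ.⊓ val y

_⊗_ : Laurent → Laurent → Laurent
x ⊗ y = laurent (val x ℤ.+ val y)
  (λ n → sum (map (λ i → co x i * co y (n ∸ i)) (upTo (suc n))))

-- A finite set of elements of F_p((t)) is given by a list of pairwise
-- distinct (mod p) elements; its cardinality is the length of the list.
DistinctMod : ℕ → List Laurent → Set
DistinctMod p A = AllPairs (λ x y → ¬ (x ≈[ p ] y)) A

sumList : List Laurent → List Laurent
sumList A = concatMap (λ a → map (λ b → a ⊕ b) A) A

prodList : List Laurent → List Laurent
prodList A = concatMap (λ a → map (λ b → a ⊗ b) A) A

-- "the set of (classes mod p of) elements of L has a cardinality s with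
--  s ^ e₁ ≤ x ^ e₂": witnessed by a list S covering L up to ≈[p].
-- (The number of distinct classes in L is the least length of such an S.)
CardPowBound : ℕ → List Laurent → ℕ → ℕ → ℕ → Set
CardPowBound p L e₁ x e₂ =
  Σ (List Laurent) λ S →
    All (λ l → Any (λ s → l ≈[ p ] s) S) L × (length S ^ e₁ ≤ x ^ e₂)

{-# OPTIONS --safe #-}
module Submission where

-- The sets consist of functions on a curve of the Garcia–Stichtenoth tower  y^p + y = x^(p+1) / (x^p + x),  which
-- is realised inside F_p((t)) by expanding all coordinates at the totally ramified point at infinity.
--
-- With J large and Λ = (J σ + p) r, functions regular away from infinity with poles there of order at most 2 Λ are
-- determined by 2 Λ + 1 coefficients, while for a modulus Π of degree σ in x_0 with completely split roots, J-jets at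
-- the ≥ σ r / 2 residue rings of Π and Λ + 1 coefficients at infinity can be prescribed freely (simultaneous
-- approximation, proved level by level in place of Riemann–Roch).  A is the set of functions whose jets vanish on each
-- pair of residue rings exactly to orders (i , M - i) for some i ≤ M.  All sums lie in the whole space, of size
-- p^(2 Λ + 1), while |A| is p^(Λ + 1) times the number of jet patterns.  Products vanish on each pair to orders
-- (i , 2M - i) with i ≤ 2M, so they fall into (2M + 1)^(n/2) subspaces of large codimension, whereas A gained a factor
-- (M + 1)^(n/2); for M large both sets are smaller than |A|² by a factor exponential in n, and log |A| = O(n log p).

open import Level using (0ℓ)
open import Algebra.Bundles using (CommutativeRing)
open import Algebra.Solver.Ring.AlmostCommutativeRing using (AlmostCommutativeRing; fromCommutativeRing; _-Raw-AlmostCommutative⟶_)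
import Algebra.Solver.Ring
import Algebra.Properties.Ring
import Algebra.Properties.CommutativeSemiring.Exp
import Algebra.Properties.CommutativeSemiring.Binomial
import Algebra.Properties.Monoid.Sum
import Algebra.Properties.Semiring.Mult
import Algebra.Properties.Semiring.Mult.TCOptimised
import Relation.Binary.Reasoning.Setoid
open import Data.Nat as ℕ using (ℕ; zero; suc; NonZero; ⌊_/2⌋; ⌈_/2⌉)
import Data.Nat.Properties as ℕₚ
open import Data.Nat.Combinatorics using (_C_; nCn≡1; nCk≡n!/k![n-k]!; k![n∸k]!∣n!)
open import Data.Nat.Coprimality using (Coprime; coprime-Bézout)
open import Data.Nat.Divisibility as ℕ∣ using (_∣_; divides)
open import Data.Nat.DivMod as DM using (m/n*n≡m; m≡m%n+[m/n]*n; [m+kn]%n≡m%n; m*n%n≡0; m%n<n; m<n⇒m%n≡m; %-distribˡ-+; %-distribˡ-*)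
open import Data.Nat.GCD using (module Bézout)
open import Data.Nat.Induction using (<-rec)
open import Data.Nat.ListAction using (sum)
open import Data.Nat.Logarithm using (⌈log₂_⌉; ⌈log₂⌉-mono-≤; ⌈log₂⌈n/2⌉⌉≡⌈log₂n⌉∸1; ⌈log₂2^n⌉≡n)
open import Data.Nat.Primality using (Prime; euclidsLemma; prime⇒nonTrivial; prime⇒nonZero; prime⇒irreducible)
import Data.Nat.Solver
open import Data.Integer as ℤ using (ℤ; +_; -[1+_]; _⊖_)
import Data.Integer.Properties as ℤₚ
import Data.Integer.Divisibility.Signed as ℤ∣
import Data.Integer.Solver
open import Data.Empty using (⊥; ⊥-elim)
open import Data.Unit using (⊤; tt)
open import Data.Maybe using (Maybe; just; nothing; maybe′)
open import Data.Product using (Σ; ∃; _,_; _×_; proj₁; proj₂)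
open import Data.Sum using (_⊎_; inj₁; inj₂)
open import Data.Fin as Fin using (Fin; toℕ; inject₁; fromℕ)
import Data.Fin.Properties as Finₚ
open import Data.Vec as Vec using (Vec; []; _∷_)
open import Data.List as List using (List; []; _∷_; _++_; length; map; concatMap; filter; allFin; lookup; applyUpTo; upTo)
import Data.List.Properties as Listₚ
open import Data.List.Membership.Propositional using (_∈_)
import Data.List.Membership.Propositional.Properties as ∈ₚ
open import Data.List.Relation.Unary.All as All using (All; []; _∷_)
import Data.List.Relation.Unary.All.Properties as Allₚ
open import Data.List.Relation.Unary.Any as Any using (Any; here; there)
import Data.List.Relation.Unary.Any.Properties as Anyₚ
open import Data.List.Relation.Unary.AllPairs using (AllPairs; []; _∷_)
import Data.List.Relation.Unary.AllPairs.Properties as AllPairsₚ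
open import Function using (_∘_)
open import Relation.Nullary using (¬_; Dec; yes; no; contradiction)
open import Relation.Binary.Definitions using (tri<; tri≈; tri>)
open import Relation.Binary.PropositionalEquality as ≡ using (_≡_)

-- The obstacle is the genus. Prescribing jets and principal parts together costs the excess `p * r`
-- inside `Λ`, which enters the comparison of products with pairs as a factor p^(2 p r). The gain
-- from the vanishing orders is only a constant of order M per pair of residue rings. It can pay for
-- the genus with M independent of `p` only if the number of rings is at least of order p r log p.
-- For odd `p` the modulus has degree σ = (p - 1)², so σ r / 2 rings suffice, and this is what the
-- tower is chosen for. Every ring of the tower is a predicate on the Laurent series. Finite places
-- are filtrations by lower bounds for orders, possibly for several points at once, and independence
-- of the powers of a coordinate is read off from pole orders at infinity. The coordinates are
-- produced from the top of the tower downwards: seen from above, each lower coordinate comes from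
-- the convergent root of an Artin-Schreier equation, whereas a step upwards would enlarge the field
-- of series.

private
  module ℕS = Data.Nat.Solver.+-*-Solver
  module ℤS = Data.Integer.Solver.+-*-Solver

-- Explicit finite types and counting by injections.

record Finite (A : Set) (n : ℕ) : Set where
  field
    encode : A → Fin n
    decode : Fin n → A
    encode-decode : ∀ i → encode (decode i) ≡ i
    decode-encode : ∀ a → decode (encode a) ≡ a

  decode-injective : ∀ {i j} → decode i ≡ decode j → i ≡ j
  decode-injective {i} {j} e = ≡.trans (≡.sym (encode-decode i)) (≡.trans (≡.cong encode e) (encode-decode j))

  encode-injective : ∀ {a b} → encode a ≡ encode b → a ≡ b
  encode-injective {a} {b} e = ≡.trans (≡.sym (decode-encode a)) (≡.trans (≡.cong decode e) (decode-encode b))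

finite-Fin : ∀ n → Finite (Fin n) n
finite-Fin n = record { encode = λ i → i ; decode = λ i → i ; encode-decode = λ _ → ≡.refl ; decode-encode = λ _ → ≡.refl }

finite-⊤ : Finite ⊤ 1
finite-⊤ = record { encode = λ _ → Fin.zero ; decode = λ _ → tt ; encode-decode = λ { Fin.zero → ≡.refl } ; decode-encode = λ _ → ≡.refl }

finite-× : ∀ {A B m n} → Finite A m → Finite B n → Finite (A × B) (m ℕ.* n)
finite-× {m = m} {n} FA FB = record
  { encode = λ { (a , b) → Fin.combine (A.encode a) (B.encode b) }
  ; decode = λ i → A.decode (proj₁ (Fin.remQuot n i)) , B.decode (proj₂ (Fin.remQuot {m} n i))
  ; encode-decode = λ i → ≡.trans (≡.cong₂ Fin.combine (A.encode-decode _) (B.encode-decode _)) (Finₚ.combine-remQuot {m} n i)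
  ; decode-encode = λ { (a , b) → ≡.cong₂ _,_
      (≡.trans (≡.cong (A.decode ∘ proj₁) (Finₚ.remQuot-combine (A.encode a) (B.encode b))) (A.decode-encode a))
      (≡.trans (≡.cong (B.decode ∘ proj₂) (Finₚ.remQuot-combine (A.encode a) (B.encode b))) (B.decode-encode b)) } }
  where
  module A = Finite FA
  module B = Finite FB

Tuple : Set → ℕ → Set
Tuple A zero = ⊤
Tuple A (suc k) = Tuple A k × A

finite-Tuple : ∀ {A m} k → Finite A m → Finite (Tuple A k) (m ℕ.^ k)
finite-Tuple zero F = finite-⊤
finite-Tuple {A} {m} (suc k) F = ≡.subst (Finite (Tuple A (suc k))) (ℕₚ.*-comm (m ℕ.^ k) m) (finite-× (finite-Tuple k F) F)

finite-≤ : ∀ {A B m n} → Finite A m → Finite B n → (f : A → B) → (∀ {a b} → f a ≡ f b → a ≡ b) → m ℕ.≤ n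
finite-≤ FA FB f inj = Finₚ.injective⇒≤ {f = B.encode ∘ f ∘ A.decode} (A.decode-injective ∘ inj ∘ B.encode-injective)
  where
  module A = Finite FA
  module B = Finite FB

finite-Σ : ∀ {k m} {B : Fin k → Set} → (∀ i → Finite (B i) m) → Finite (Σ (Fin k) B) (k ℕ.* m)
finite-Σ {k} {m} {B} F = record
  { encode = λ { (i , b) → Fin.combine i (Finite.encode (F i) b) }
  ; decode = λ j → let i , l = Fin.remQuot {k} m j in i , Finite.decode (F i) l
  ; encode-decode = λ j → let i , l = Fin.remQuot {k} m j in
      ≡.trans (≡.cong (Fin.combine i) (Finite.encode-decode (F i) l)) (Finₚ.combine-remQuot {k} m j)
  ; decode-encode = λ { (i , b) → ≡.trans (≡.cong (λ { (i , l) → i , Finite.decode (F i) l }) (Finₚ.remQuot-combine i (Finite.encode (F i) b)))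
      (≡.cong (i ,_) (Finite.decode-encode (F i) b)) } }

finite-cast : ∀ {A m n} → m ≡ n → Finite A m → Finite A n
finite-cast ≡.refl F = F

finite-Vec : ∀ {A m} k → Finite A m → Finite (Vec A k) (m ℕ.^ k)
finite-Vec zero F = record { encode = λ _ → Fin.zero ; decode = λ _ → [] ; encode-decode = λ { Fin.zero → ≡.refl } ; decode-encode = λ { [] → ≡.refl } }
finite-Vec {A} {m} (suc k) F = record
  { encode = λ { (a ∷ v) → P.encode (a , v) } ; decode = λ i → proj₁ (P.decode i) ∷ proj₂ (P.decode i)
  ; encode-decode = P.encode-decode
  ; decode-encode = λ { (a ∷ v) → ≡.cong (λ { (a , v) → a ∷ v }) (P.decode-encode (a , v)) } }
  where module P = Finite (finite-× F (finite-Vec k F))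

-- Binomial coefficients modulo a prime.

prime∤! : ∀ {p} → Prime p → ∀ {k} → k ℕ.< p → ¬ p ∣ (k ℕ.!)
prime∤! pp {zero} k<p p∣1 = contradiction (ℕ∣.∣⇒≤ p∣1) (ℕₚ.<⇒≱ (ℕ.nonTrivial⇒n>1 _ {{prime⇒nonTrivial pp}}))
prime∤! pp {suc k} k<p p∣ with euclidsLemma (suc k) (k ℕ.!) pp p∣
... | inj₁ p∣sk = contradiction (ℕ∣.∣⇒≤ p∣sk) (ℕₚ.<⇒≱ k<p)
... | inj₂ p∣k! = prime∤! pp (ℕₚ.<⇒≤ k<p) p∣k!

prime∣binomial : ∀ {p} → Prime p → ∀ {k} → 0 ℕ.< k → k ℕ.< p → p ∣ p C k
prime∣binomial {p} pp {k} 0<k k<p with euclidsLemma (p C k) (k ℕ.! ℕ.* (p ℕ.∸ k) ℕ.!) pp p∣C*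
  where
  instance
    nz : NonZero (k ℕ.! ℕ.* (p ℕ.∸ k) ℕ.!)
    nz = k ℕₚ.!* (p ℕ.∸ k) !≢0
  n∣n! : ∀ n → .{{NonZero n}} → n ∣ n ℕ.!
  n∣n! (suc n) = ℕ∣.m∣m*n (n ℕ.!)
  p∣C* : p ∣ (p C k) ℕ.* (k ℕ.! ℕ.* (p ℕ.∸ k) ℕ.!)
  p∣C* = ≡.subst (p ∣_)
    (≡.sym (≡.trans (≡.cong (ℕ._* (k ℕ.! ℕ.* (p ℕ.∸ k) ℕ.!)) (nCk≡n!/k![n-k]! (ℕₚ.<⇒≤ k<p)))
      (m/n*n≡m (k![n∸k]!∣n! (ℕₚ.<⇒≤ k<p)))))
    (n∣n! p {{prime⇒nonZero pp}})
... | inj₁ p∣C = p∣C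
... | inj₂ p∣f with euclidsLemma (k ℕ.!) ((p ℕ.∸ k) ℕ.!) pp p∣f
...   | inj₁ q = contradiction q (prime∤! pp k<p)
...   | inj₂ q = contradiction q (prime∤! pp (ℕₚ.∸-monoʳ-< 0<k (ℕₚ.<⇒≤ k<p)))

-- Ring calculus and Frobenius in characteristic `p`.

module RingKit (R : CommutativeRing 0ℓ 0ℓ) where
  open CommutativeRing R public
    using (Carrier; _≈_; _+_; _*_; -_; 0#; 1#; refl; sym; trans; reflexive; setoid;
      +-cong; +-congˡ; +-congʳ; *-cong; *-congˡ; *-congʳ; -‿cong; +-comm; +-assoc; *-comm; *-assoc;
      +-identityˡ; +-identityʳ; *-identityˡ; *-identityʳ; -‿inverseˡ; -‿inverseʳ; zeroˡ; zeroʳ; distribˡ; distribʳ)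
  open CommutativeRing R using (ring; semiring; commutativeSemiring; +-monoid)
  open Algebra.Properties.Ring ring public using (-‿distribˡ-*; -‿distribʳ-*; -0#≈0#; -‿involutive)
  open Algebra.Properties.CommutativeSemiring.Exp commutativeSemiring public
    using (_^_; ^-congˡ; ^-homo-*; ^-assocʳ; ^-distrib-*)
  open Relation.Binary.Reasoning.Setoid setoid public

  infixl 6 _-_
  _-_ : Carrier → Carrier → Carrier
  x - y = x + (- y)

  private
    module U = Algebra.Properties.Semiring.Mult semiring
    module T = Algebra.Properties.Semiring.Mult.TCOptimised semiring
    acr : AlmostCommutativeRing 0ℓ 0ℓ
    acr = fromCommutativeRing R
    open Algebra.Properties.Ring ring using (-‿+-comm)

  ι : ℕ → Carrier
  ι n = n T.× 1#

  ι-+ : ∀ m n → ι (m ℕ.+ n) ≈ ι m + ι n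
  ι-+ = T.×-homo-+ 1#

  ι-* : ∀ m n → ι (m ℕ.* n) ≈ ι m * ι n
  ι-* = T.×1-homo-*

  ι-suc : ∀ n → ι (suc n) ≈ 1# + ι n
  ι-suc n = T.1+× n 1#

  ×≈ι* : ∀ n x → n U.× x ≈ ι n * x
  ×≈ι* n x = begin
    n U.× x          ≈⟨ U.×-congʳ n (*-identityˡ x) ⟨
    n U.× (1# * x)   ≈⟨ U.×-assoc-* n 1# x ⟨
    (n U.× 1#) * x   ≈⟨ *-congʳ (T.×ᵤ≈× n 1#) ⟩
    ι n * x ∎

  ιℤ : ℤ → Carrier
  ιℤ (+ n) = ι n
  ιℤ -[1+ n ] = - ι (suc n)

  private
    cancel : ∀ a b c → (a + b) - (a + c) ≈ b - c
    cancel a b c = begin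
      (a + b) - (a + c)         ≈⟨ +-congˡ (-‿+-comm a c) ⟨
      (a + b) + (- a + - c)     ≈⟨ +-congʳ (+-comm a b) ⟩
      (b + a) + (- a + - c)     ≈⟨ +-assoc b a _ ⟩
      b + (a + (- a + - c))     ≈⟨ +-congˡ (+-assoc a (- a) (- c)) ⟨
      b + ((a + - a) + - c)     ≈⟨ +-congˡ (+-congʳ (-‿inverseʳ a)) ⟩
      b + (0# + - c)            ≈⟨ +-congˡ (+-identityˡ (- c)) ⟩
      b - c ∎

    ιℤ-⊖ : ∀ m n → ιℤ (m ⊖ n) ≈ ι m - ι n
    ιℤ-⊖ m zero = begin
      ιℤ (m ⊖ zero) ≡⟨ ≡.cong ιℤ (ℤₚ.⊖-≥ {m} {zero} ℕ.z≤n) ⟩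
      ι m ≈⟨ +-identityʳ _ ⟨
      ι m + 0# ≈⟨ +-congˡ -0#≈0# ⟨
      ι m - 0# ∎
    ιℤ-⊖ zero (suc n) = sym (+-identityˡ _)
    ιℤ-⊖ (suc m) (suc n) = begin
      ιℤ (suc m ⊖ suc n) ≡⟨ ≡.cong ιℤ (ℤₚ.[1+m]⊖[1+n]≡m⊖n m n) ⟩
      ιℤ (m ⊖ n) ≈⟨ ιℤ-⊖ m n ⟩
      ι m - ι n ≈⟨ cancel 1# (ι m) (ι n) ⟨
      (1# + ι m) - (1# + ι n) ≈⟨ +-cong (ι-suc m) (-‿cong (ι-suc n)) ⟨
      ι (suc m) - ι (suc n) ∎

  ιℤ-neg : ∀ i → ιℤ (ℤ.- i) ≈ - ιℤ i
  ιℤ-neg (+ zero) = sym -0#≈0#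
  ιℤ-neg (+ suc n) = refl
  ιℤ-neg -[1+ n ] = sym (-‿involutive _)

  ιℤ-+ : ∀ i j → ιℤ (i ℤ.+ j) ≈ ιℤ i + ιℤ j
  ιℤ-+ (+ m) (+ n) = ι-+ m n
  ιℤ-+ (+ m) -[1+ n ] = ιℤ-⊖ m (suc n)
  ιℤ-+ -[1+ m ] (+ n) = trans (ιℤ-⊖ n (suc m)) (+-comm _ _)
  ιℤ-+ -[1+ m ] -[1+ n ] = begin
    - ι (suc (suc (m ℕ.+ n))) ≡⟨ ≡.cong (λ k → - ι (suc k)) (≡.sym (ℕₚ.+-suc m n)) ⟩
    - ι (suc m ℕ.+ suc n) ≈⟨ -‿cong (ι-+ (suc m) (suc n)) ⟩
    - (ι (suc m) + ι (suc n)) ≈⟨ -‿+-comm _ _ ⟨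
    - ι (suc m) + - ι (suc n) ∎

  private
    ιℤ-+* : ∀ m j → ιℤ (+ m ℤ.* j) ≈ ι m * ιℤ j
    ιℤ-+* m (+ n) = begin
      ιℤ (+ m ℤ.* + n) ≡⟨ ≡.cong ιℤ (≡.sym (ℤₚ.pos-* m n)) ⟩
      ι (m ℕ.* n) ≈⟨ ι-* m n ⟩
      ι m * ι n ∎
    ιℤ-+* m -[1+ n ] = begin
      ιℤ (+ m ℤ.* (ℤ.- + suc n)) ≡⟨ ≡.cong ιℤ (≡.sym (ℤₚ.neg-distribʳ-* (+ m) (+ suc n))) ⟩
      ιℤ (ℤ.- (+ m ℤ.* + suc n)) ≈⟨ ιℤ-neg (+ m ℤ.* + suc n) ⟩
      - ιℤ (+ m ℤ.* + suc n) ≈⟨ -‿cong (ιℤ-+* m (+ suc n)) ⟩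
      - (ι m * ι (suc n)) ≈⟨ -‿distribʳ-* _ _ ⟩
      ι m * - ι (suc n) ∎

  ιℤ-* : ∀ i j → ιℤ (i ℤ.* j) ≈ ιℤ i * ιℤ j
  ιℤ-* (+ m) j = ιℤ-+* m j
  ιℤ-* -[1+ m ] j = begin
    ιℤ ((ℤ.- + suc m) ℤ.* j) ≡⟨ ≡.cong ιℤ (≡.sym (ℤₚ.neg-distribˡ-* (+ suc m) j)) ⟩
    ιℤ (ℤ.- (+ suc m ℤ.* j)) ≈⟨ ιℤ-neg (+ suc m ℤ.* j) ⟩
    - ιℤ (+ suc m ℤ.* j) ≈⟨ -‿cong (ιℤ-+* (suc m) j) ⟩
    - (ι (suc m) * ιℤ j) ≈⟨ -‿distribˡ-* _ _ ⟩
    - ι (suc m) * ιℤ j ∎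

  private
    ℤ⟶R : CommutativeRing.rawRing ℤₚ.+-*-commutativeRing -Raw-AlmostCommutative⟶ acr
    ℤ⟶R = record
      { ⟦_⟧ = ιℤ ; +-homo = ιℤ-+ ; *-homo = ιℤ-* ; -‿homo = ιℤ-neg ; 0-homo = refl ; 1-homo = refl }

    _coeff≟_ : ∀ i j → Maybe (ιℤ i ≈ ιℤ j)
    i coeff≟ j with i ℤ.≟ j
    ... | yes ≡.refl = just refl
    ... | no _ = nothing

  open Algebra.Solver.Ring _ acr ℤ⟶R _coeff≟_ public
    using (solve; _:=_; _:+_; _:*_; _:-_; :-_; _:^_; con; Polynomial)

  :1 :0 : ∀ {n} → Polynomial n
  :1 = con (+ 1)
  :0 = con (+ 0)

  1^ : ∀ n → 1# ^ n ≈ 1#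
  1^ zero = refl
  1^ (suc n) = trans (*-identityˡ _) (1^ n)

  0^ : ∀ n → 0 ℕ.< n → 0# ^ n ≈ 0#
  0^ (suc n) _ = zeroˡ _

  -≈0⇒≈ : ∀ {x y} → x - y ≈ 0# → x ≈ y
  -≈0⇒≈ {x} {y} e = begin
    x             ≈⟨ solve 2 (λ x y → x := (x :- y) :+ y) refl x y ⟩
    (x - y) + y   ≈⟨ +-congʳ e ⟩
    0# + y        ≈⟨ +-identityˡ y ⟩
    y ∎

  ≈⇒-≈0 : ∀ {x y} → x ≈ y → x - y ≈ 0#
  ≈⇒-≈0 {x} {y} e = trans (+-congʳ e) (-‿inverseʳ y)

  unit-cancelˡ : ∀ {u v x y} → u * v ≈ 1# → u * x ≈ u * y → x ≈ y
  unit-cancelˡ {u} {v} {x} {y} uv e = begin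
    x           ≈⟨ *-identityˡ x ⟨
    1# * x      ≈⟨ *-congʳ uv ⟨
    u * v * x   ≈⟨ solve 3 (λ u v x → u :* v :* x := v :* (u :* x)) refl u v x ⟩
    v * (u * x) ≈⟨ *-congˡ e ⟩
    v * (u * y) ≈⟨ solve 3 (λ u v x → v :* (u :* x) := u :* v :* x) refl u v y ⟩
    u * v * y   ≈⟨ *-congʳ uv ⟩
    1# * y      ≈⟨ *-identityˡ y ⟩
    y ∎

  unit-* : ∀ {u v u′ v′} → u * v ≈ 1# → u′ * v′ ≈ 1# → (u * u′) * (v * v′) ≈ 1#
  unit-* {u} {v} {u′} {v′} e e′ = begin
    (u * u′) * (v * v′) ≈⟨ solve 4 (λ u v u′ v′ → (u :* u′) :* (v :* v′) := (u :* v) :* (u′ :* v′)) refl u v u′ v′ ⟩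
    (u * v) * (u′ * v′) ≈⟨ *-cong e e′ ⟩
    1# * 1#             ≈⟨ *-identityˡ 1# ⟩
    1# ∎

  unit-^ : ∀ {u v} n → u * v ≈ 1# → u ^ n * v ^ n ≈ 1#
  unit-^ {u} {v} n e = trans (sym (^-distrib-* u v n)) (trans (^-congˡ n e) (1^ n))

  module Char {p : ℕ} (prime : Prime p) (char : ι p ≈ 0#) where
    private
      module Sum = Algebra.Properties.Monoid.Sum +-monoid
      module B = Algebra.Properties.CommutativeSemiring.Binomial commutativeSemiring

    ι-∣ : ∀ n → p ∣ n → ι n ≈ 0#
    ι-∣ _ (divides q ≡.refl) = trans (ι-* q p) (trans (*-congˡ char) (zeroʳ _))

    1<p : 1 ℕ.< p
    1<p = ℕ.nonTrivial⇒n>1 p {{prime⇒nonTrivial prime}}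

    frob-+ : ∀ x y → (x + y) ^ p ≈ x ^ p + y ^ p
    frob-+ x y = go p ≡.refl
      where
      zero-sum : ∀ {n} (f : Fin n → Carrier) → (∀ i → f i ≈ 0#) → Sum.sum f ≈ 0#
      zero-sum {n} f h = trans (Sum.sum-cong-≋ h) (Sum.sum-replicate-zero n)
      go : ∀ n → n ≡ p → (x + y) ^ n ≈ x ^ n + y ^ n
      go zero e = contradiction e (ℕₚ.<⇒≢ (ℕₚ.<-trans (ℕ.s≤s ℕ.z≤n) 1<p))
      go (suc n) ≡.refl = begin
        (x + y) ^ suc n
          ≈⟨ B.theorem (suc n) x y ⟩
        first + Sum.sum rest
          ≈⟨ +-congˡ (Sum.sum-init-last rest) ⟩
        first + (Sum.sum (λ i → rest (inject₁ i)) + rest (fromℕ n))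
          ≈⟨ +-cong (trans (U.×-homo-1 _) (*-identityˡ _)) (+-cong (zero-sum _ middle) last≈) ⟩
        y ^ suc n + (0# + x ^ suc n)
          ≈⟨ solve 2 (λ a b → b :+ (:0 :+ a) := a :+ b) refl (x ^ suc n) (y ^ suc n) ⟩
        x ^ suc n + y ^ suc n ∎
        where
        t = B.binomialTerm x y (suc n)
        first = t Fin.zero
        rest = λ i → t (Fin.suc i)
        middle : ∀ i → rest (inject₁ i) ≈ 0#
        middle i = trans (×≈ι* (suc n C suc (toℕ (inject₁ i))) (B.binomial x y (suc n) (Fin.suc (inject₁ i)))) (trans (*-congʳ (ι-∣ (suc n C suc (toℕ (inject₁ i))) (prime∣binomial prime (ℕ.s≤s ℕ.z≤n)
          (ℕ.s≤s (≡.subst (ℕ._< n) (≡.sym (Finₚ.toℕ-inject₁ i)) (Finₚ.toℕ<n i)))))) (zeroˡ _))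
        last≈ : rest (fromℕ n) ≈ x ^ suc n
        last≈ = begin
          (suc n C suc (toℕ (fromℕ n))) U.× (x ^ suc (toℕ (fromℕ n)) * y ^ (n ℕ.∸ toℕ (fromℕ n)))
            ≡⟨ ≡.cong (λ k → (suc n C suc k) U.× (x ^ suc k * y ^ (n ℕ.∸ k))) (Finₚ.toℕ-fromℕ n) ⟩
          (suc n C suc n) U.× (x ^ suc n * y ^ (n ℕ.∸ n))
            ≡⟨ ≡.cong₂ (λ k l → k U.× (x ^ suc n * y ^ l)) (nCn≡1 (suc n)) (ℕₚ.n∸n≡0 n) ⟩
          1 U.× (x ^ suc n * 1#)
            ≈⟨ trans (U.×-homo-1 _) (*-identityʳ _) ⟩
          x ^ suc n ∎

    frob-0 : 0# ^ p ≈ 0#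
    frob-0 = 0^ p (ℕₚ.<-trans (ℕ.s≤s ℕ.z≤n) 1<p)

    frob-neg : ∀ x → (- x) ^ p ≈ - (x ^ p)
    frob-neg x = begin
      (- x) ^ p                       ≈⟨ solve 2 (λ a b → a := (a :+ b) :- b) refl ((- x) ^ p) (x ^ p) ⟩
      ((- x) ^ p + x ^ p) - x ^ p     ≈⟨ +-congʳ (frob-+ (- x) x) ⟨
      (- x + x) ^ p - x ^ p           ≈⟨ +-congʳ (trans (^-congˡ p (-‿inverseˡ x)) frob-0) ⟩
      0# - x ^ p                      ≈⟨ +-identityˡ _ ⟩
      - (x ^ p) ∎

    frob-- : ∀ x y → (x - y) ^ p ≈ x ^ p - y ^ p
    frob-- x y = trans (frob-+ x (- y)) (+-congˡ (frob-neg y))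

    frob-ι : ∀ n → ι n ^ p ≈ ι n
    frob-ι zero = frob-0
    frob-ι (suc n) = begin
      ι (suc n) ^ p      ≈⟨ ^-congˡ p (ι-suc n) ⟩
      (1# + ι n) ^ p     ≈⟨ frob-+ 1# (ι n) ⟩
      1# ^ p + ι n ^ p   ≈⟨ +-cong (1^ p) (frob-ι n) ⟩
      1# + ι n           ≈⟨ ι-suc n ⟨
      ι (suc n) ∎

    -- On elements with x^(p²) = x this is the trace down to the elements fixed by Frobenius, which
    -- is why it governs the completely split fibres.
    φ : Carrier → Carrier
    φ x = x ^ p + x

-- Complete valued rings of characteristic p and the descending Artin-Schreier chain

private
  suc*≥suc : ∀ q j → 1 ℕ.< q → suc (suc j) ℕ.≤ q ℕ.* suc j
  suc*≥suc q j 1<q = ℕₚ.≤-trans (ℕ.s≤s (ℕ.s≤s (ℕₚ.m≤m+n j (j ℕ.+ 0))))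
    (ℕₚ.≤-trans (ℕₚ.≤-reflexive (≡.sym (≡.cong suc (ℕₚ.+-suc j (j ℕ.+ 0))))) (ℕₚ.*-monoˡ-≤ (suc j) 1<q))

i≤∣i∣ : ∀ i → i ℤ.≤ + ℤ.∣ i ∣
i≤∣i∣ (+ n) = ℤₚ.≤-refl
i≤∣i∣ -[1+ n ] = ℤ.-≤+

i-∣i+k∣≤-k : ∀ i k → i ℤ.- + ℤ.∣ i ℤ.+ + k ∣ ℤ.≤ ℤ.- (+ k)
i-∣i+k∣≤-k i k = ℤₚ.≤-trans (ℤₚ.+-monoʳ-≤ i (ℤₚ.neg-mono-≤ (i≤∣i∣ (i ℤ.+ + k))))
  (ℤₚ.≤-reflexive (ℤS.solve 2 (λ i k → i ℤS.:+ ℤS.:- (i ℤS.:+ k) ℤS.:= ℤS.:- k) ≡.refl i (+ k)))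

module Filtrations (R : CommutativeRing 0ℓ 0ℓ) where
  open RingKit R

  record Filtration : Set₁ where
    field
      O    : ℤ → Carrier → Set
      resp : ∀ {i a b} → a ≈ b → O i a → O i b
      zer  : ∀ {i} → O i 0#
      add  : ∀ {i a b} → O i a → O i b → O i (a + b)
      neg  : ∀ {i a} → O i a → O i (- a)
      mono : ∀ {i j a} → i ℤ.≤ j → O j a → O i a
      mul  : ∀ {i j a b} → O i a → O j b → O (i ℤ.+ j) (a * b)
      one  : O (+ 0) 1#

    at : ∀ {i j a} → i ≡ j → O i a → O j a
    at ≡.refl x = x

    sub : ∀ {i a b} → O i a → O i b → O i (a - b)
    sub x y = add x (neg y)

    mul₀ : ∀ {i a b} → O (+ 0) a → O i b → O i (a * b)
    mul₀ {i} x y = at (ℤₚ.+-identityˡ i) (mul x y)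

    mul₀ʳ : ∀ {i a b} → O i a → O (+ 0) b → O i (a * b)
    mul₀ʳ {i} x y = at (ℤₚ.+-identityʳ i) (mul x y)

    pow : ∀ {k a} n → O (+ k) a → O (+ (n ℕ.* k)) (a ^ n)
    pow zero x = one
    pow (suc n) x = mul x (pow n x)

    powℤ : ∀ {i a} n → O i a → O (+ n ℤ.* i) (a ^ n)
    powℤ {i} zero x = at (≡.sym (ℤₚ.*-zeroˡ i)) one
    powℤ {i} (suc n) x = at (≡.sym (ℤₚ.suc-* (+ n) i)) (mul x (powℤ n x))

    pow₀ : ∀ {a} n → O (+ 0) a → O (+ 0) (a ^ n)
    pow₀ n x = at (≡.cong +_ (ℕₚ.*-zeroʳ n)) (pow n x)

    pow₁ : ∀ {a} n → 0 ℕ.< n → O (+ 1) a → O (+ 1) (a ^ n)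
    pow₁ (suc n) _ x = mono (ℤ.+≤+ (ℕ.s≤s ℕ.z≤n)) (pow (suc n) x)

    1⇒0 : ∀ {a} → O (+ 1) a → O (+ 0) a
    1⇒0 = mono (ℤ.+≤+ ℕ.z≤n)

    constant : ∀ n → O (+ 0) (ι n)
    constant zero = zer
    constant (suc n) = resp (sym (ι-suc n)) (add one (constant n))

    -- a ≈ b - aε improves any bound on the order of a by one, as long as it is worse than that of b.
    boot : ∀ {i a b ε} k → O (ℤ.- (+ k)) a → O i b → O (+ 1) ε → a ≈ b - a * ε → O i a
    boot {i} {a} {b} {ε} k a∈ b∈ ε∈ e = go ℤ.∣ i ℤ.+ + k ∣ (mono (i-∣i+k∣≤-k i k) a∈)
      where
      go : ∀ n → O (i ℤ.- + n) a → O i a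
      go zero x = at (ℤₚ.+-identityʳ i) x
      go (suc n) x = go n (resp (sym e) (sub (mono (ℤₚ.i-j≤i i (+ n)) b∈)
        (at (ℤS.solve 2 (λ i n → i ℤS.:- (ℤS.con (+ 1) ℤS.:+ n) ℤS.:+ ℤS.con (+ 1) ℤS.:= i ℤS.:- n) ≡.refl i (+ n))
          (mul x ε∈))))

open Filtrations using (Filtration)

-- What the construction uses of F_p((t)): O i stands for the series of order at least i.
record ValuedRing : Set₁ where
  field
    ring : CommutativeRing 0ℓ 0ℓ
  open RingKit ring
  field
    p          : ℕ
    prime      : Prime p
    char       : ι p ≈ 0#
    filtration : Filtration ring
  open Filtration filtration
  field
    exhaustive : ∀ a → ∃ λ k → O (ℤ.- (+ k)) a
    separated  : ∀ {a} → (∀ k → O (+ k) a) → a ≈ 0#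
    complete   : ∀ (z : ℕ → Carrier) → (∀ k → O (+ 0) (z k)) → (∀ k → O (+ k) (z (suc k) - z k)) →
                 ∃ λ l → ∀ k → O (+ k) (l - z k)
    1∉         : ¬ O (+ 1) 1#
    t t⁻       : Carrier
    tt⁻        : t * t⁻ ≈ 1#
    t∈         : O (+ 1) t
    t⁻∈        : O -[1+ 0 ] t⁻
    coef       : ℤ → Carrier → Fin p
    coef-cong  : ∀ {i a b} → a ≈ b → coef i a ≡ coef i b
    coef-≡     : ∀ {i a b} → O i (a - b) → coef i a ≡ coef i b → O (ℤ.suc i) (a - b)

module Chain (V : ValuedRing) where
  open ValuedRing V
  open RingKit ring
  open Char prime char
  open Filtration filtration

  -- The truncated geometric series converge to a `b` with b = 1 - ε b, and the right side of this
  -- equation is the inverse of 1 + ε.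
  inverse₁ : ∀ {ε} → O (+ 1) ε → ∃ λ ε′ → O (+ 1) ε′ × (1# + ε) * (1# + ε′) ≈ 1#
  inverse₁ {ε} ε∈ = - (ε * b) , neg (mul₀ʳ ε∈ b∈) , eq
    where
    z : ℕ → Carrier
    z zero = 0#
    z (suc k) = 1# - ε * z k
    z∈ : ∀ k → O (+ 0) (z k)
    z∈ zero = zer
    z∈ (suc k) = sub one (1⇒0 (mul₀ʳ ε∈ (z∈ k)))
    step : ∀ k → O (+ k) (z (suc k) - z k)
    step zero = sub (z∈ 1) (z∈ 0)
    step (suc k) = resp (solve 3 (λ ε a b → ε :* (b :- a) := (:1 :- ε :* a) :- (:1 :- ε :* b)) refl ε (z (suc k)) (z k))
      (mul ε∈ (resp (solve 2 (λ a b → :- (a :- b) := b :- a) refl (z (suc k)) (z k)) (neg (step k))))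
    lim = complete z z∈ step
    b = proj₁ lim
    b∈ : O (+ 0) b
    b∈ = resp (solve 2 (λ a b → (a :- b) :+ b := a) refl b (z 0)) (add (proj₂ lim 0) (z∈ 0))
    fix : b ≈ 1# - ε * b
    fix = -≈0⇒≈ (separated λ k → resp
      (solve 3 (λ b ε z → (b :- (:1 :- ε :* z)) :+ ε :* (b :- z) := b :- (:1 :- ε :* b)) refl b ε (z k))
      (add (mono (ℤ.+≤+ (ℕₚ.n≤1+n k)) (proj₂ lim (suc k)))
        (mul₀ (1⇒0 ε∈) (proj₂ lim k))))
    eq : (1# + ε) * (1# - ε * b) ≈ 1#
    eq = begin
      (1# + ε) * (1# - ε * b) ≈⟨ *-congˡ fix ⟨
      (1# + ε) * b            ≈⟨ solve 2 (λ ε b → (:1 :+ ε) :* b := b :+ ε :* b) refl ε b ⟩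
      b + ε * b               ≈⟨ +-congʳ fix ⟩
      (1# - ε * b) + ε * b    ≈⟨ solve 2 (λ ε b → (:1 :- ε :* b) :+ ε :* b := :1) refl ε b ⟩
      1# ∎

  -- A fixed point of z ↦ s - z^p. Frobenius is additive, so it multiplies the order of a difference
  -- by `p`, and the iteration contracts on elements of positive order.
  ArtinSchreier : ∀ {s} → O (+ 1) s → ∃ λ z → O (+ 1) z × φ z ≈ s
  ArtinSchreier {s} s∈ = l , l∈ , -≈0⇒≈ (separated λ k → resp
      (trans (+-congʳ (frob-- l (z k)))
        (solve 4 (λ lp zp l s → ((lp :- zp) :+ (l :- (s :- zp))) := (lp :+ l) :- s) refl (l ^ p) (z k ^ p) l s))
      (add (mono (ℤ.+≤+ (ℕₚ.m≤n*m k p)) (pow p (proj₂ lim k)))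
        (mono (ℤ.+≤+ (ℕₚ.n≤1+n k)) (proj₂ lim (suc k)))))
    where
    0<p = ℕₚ.<-trans (ℕ.s≤s ℕ.z≤n) 1<p
    instance
      p≢0 : NonZero p
      p≢0 = ℕ.>-nonZero 0<p
    z : ℕ → Carrier
    z zero = 0#
    z (suc k) = s - z k ^ p
    z∈ : ∀ k → O (+ 1) (z k)
    z∈ zero = zer
    z∈ (suc k) = sub s∈ (pow₁ p 0<p (z∈ k))
    step : ∀ k → O (+ suc k) (z (suc k) - z k)
    step zero = sub (z∈ 1) (z∈ 0)
    step (suc k) = resp (trans (-‿cong (frob-- (z (suc k)) (z k)))
        (solve 3 (λ s a b → :- (a :- b) := (s :- a) :- (s :- b)) refl s (z (suc k) ^ p) (z k ^ p)))
      (neg (mono (ℤ.+≤+ (suc*≥suc p k 1<p)) (pow p (step k))))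
    lim = complete z (λ k → 1⇒0 (z∈ k)) (λ k → mono (ℤ.+≤+ (ℕₚ.n≤1+n k)) (step k))
    l = proj₁ lim
    l∈ : O (+ 1) l
    l∈ = resp (solve 2 (λ a b → (a :- b) :+ b := a) refl l (z 1)) (add (proj₂ lim 1) (z∈ 1))

  -- The leading coefficient is kept equal to one because `inverse₁` inverts only elements 1 + ε
  -- with ε of positive order.
  record Monic (k : ℕ) : Set where
    field
      z z⁻ : Carrier
      zz⁻  : z * z⁻ ≈ 1#
      ε ε⁻ : Carrier
      ε∈   : O (+ 1) ε
      ε⁻∈  : O (+ 1) ε⁻
      z≈   : z ≈ t ^ k * (1# + ε)
      z⁻≈  : z⁻ ≈ t⁻ ^ k * (1# + ε⁻)

    z∈ : O (+ k) z
    z∈ = resp (sym z≈) (mul₀ʳ (at (≡.cong +_ (ℕₚ.*-identityʳ k)) (pow k t∈)) (add one (1⇒0 ε∈)))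

    z⁻∈ : O (ℤ.- (+ k)) z⁻
    z⁻∈ = resp (sym z⁻≈) (mul₀ʳ (at eq (powℤ k t⁻∈)) (add one (1⇒0 ε⁻∈)))
      where eq : + k ℤ.* -[1+ 0 ] ≡ ℤ.- (+ k)
            eq = ≡.trans (ℤₚ.*-comm (+ k) -[1+ 0 ]) (ℤₚ.-1*i≡-i (+ k))

  monic : ∀ {a ε} k → O (+ 1) ε → a ≈ t ^ k * (1# + ε) → Monic k
  monic {a} {ε} k ε∈ a≈ = record
    { z = a ; z⁻ = t⁻ ^ k * (1# + ε⁻)
    ; zz⁻ = trans (*-congʳ a≈) (unit-* (unit-^ k tt⁻) e)
    ; ε∈ = ε∈ ; ε⁻∈ = ε⁻∈ ; z≈ = a≈ ; z⁻≈ = refl }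
    where
    i = inverse₁ ε∈
    ε⁻ = proj₁ i
    ε⁻∈ = proj₁ (proj₂ i)
    e = proj₂ (proj₂ i)

  private
    p-1 = ℕ.pred p
    p≡ : suc p-1 ≡ p
    p≡ = ℕₚ.suc-pred p {{ℕ.>-nonZero (ℕₚ.<-trans (ℕ.s≤s ℕ.z≤n) 1<p)}}
    0<p-1 : 0 ℕ.< p-1
    0<p-1 = ℕ.s≤s⁻¹ (≡.subst (1 ℕ.<_) (≡.sym p≡) 1<p)

  x^p : ∀ x → x ^ p ≈ x * x ^ p-1
  x^p x = reflexive (≡.cong (x ^_) (≡.sym p≡))

  φ-factor : ∀ x → φ x ≈ x * (1# + x ^ p-1)
  φ-factor x = trans (+-congʳ (x^p x)) (solve 2 (λ x y → x :* y :+ x := x :* (:1 :+ y)) refl x (x ^ p-1))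

  -- With z = 1 / y the equation of the tower reads φ(1 / x) = 1 / φ(y). The right side is z^p / (1
  -- + z^(p-1)), of positive order, so 1 / x is found by the Artin-Schreier iteration. It agrees
  -- with z^p to leading order, hence pole orders are multiplied by `p` on the way down.
  descend : ∀ {k} → 0 ℕ.< k → (m : Monic k) → Σ (Monic (k ℕ.* p)) λ m′ → φ (Monic.z m′) * φ (Monic.z⁻ m) ≈ 1#
  descend {k} 0<k m = monic (k ℕ.* p) ε″∈ z′≈ , trans (*-congʳ φz′) s-inv
    where
    open Monic m
    z∈₁ : O (+ 1) z
    z∈₁ = mono (ℤ.+≤+ 0<k) z∈
    i = inverse₁ (pow₁ p-1 0<p-1 z∈₁)
    η = proj₁ i
    η∈ = proj₁ (proj₂ i)
    s = z ^ p * (1# + η)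
    s∈ : O (+ 1) s
    s∈ = mul₀ʳ (pow₁ p (ℕₚ.<-trans (ℕ.s≤s ℕ.z≤n) 1<p) z∈₁) (add one (1⇒0 η∈))
    s-inv : s * φ z⁻ ≈ 1#
    s-inv = begin
      (z ^ p * (1# + η)) * (z⁻ ^ p + z⁻)
        ≈⟨ solve 5 (λ zp η z⁻p z⁻ z → (zp :* (:1 :+ η)) :* (z⁻p :+ z⁻) := (:1 :+ η) :* (zp :* z⁻p :+ zp :* z⁻)) refl (z ^ p) η (z⁻ ^ p) z⁻ z ⟩
      (1# + η) * (z ^ p * z⁻ ^ p + z ^ p * z⁻)
        ≈⟨ *-congˡ (+-cong (unit-^ p zz⁻) (trans (*-congʳ (x^p z)) (trans (solve 3 (λ z w z⁻ → (z :* w) :* z⁻ := (z :* z⁻) :* w) refl z (z ^ p-1) z⁻)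
             (trans (*-congʳ zz⁻) (*-identityˡ _))))) ⟩
      (1# + η) * (1# + z ^ p-1)
        ≈⟨ trans (*-comm _ _) (proj₂ (proj₂ i)) ⟩
      1# ∎
    as = ArtinSchreier s∈
    z′ = proj₁ as
    φz′ = proj₂ (proj₂ as)
    j = inverse₁ (pow₁ p-1 0<p-1 (proj₁ (proj₂ as)))
    η′ = proj₁ j
    ε″ = ((ε ^ p + η + ε ^ p * η) + η′) + (ε ^ p + η + ε ^ p * η) * η′
    ε^p∈ : O (+ 1) (ε ^ p)
    ε^p∈ = pow₁ p (ℕₚ.<-trans (ℕ.s≤s ℕ.z≤n) 1<p) ε∈
    u∈ : O (+ 1) (ε ^ p + η + ε ^ p * η)
    u∈ = add (add ε^p∈ η∈) (mul₀ʳ ε^p∈ (1⇒0 η∈))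
    ε″∈ : O (+ 1) ε″
    ε″∈ = add (add u∈ (proj₁ (proj₂ j))) (mul₀ʳ u∈ (1⇒0 (proj₁ (proj₂ j))))
    z′≈ : z′ ≈ t ^ (k ℕ.* p) * (1# + ε″)
    z′≈ = begin
      z′ ≈⟨ *-identityʳ z′ ⟨
      z′ * 1# ≈⟨ *-congˡ (proj₂ (proj₂ j)) ⟨
      z′ * ((1# + z′ ^ p-1) * (1# + η′)) ≈⟨ *-assoc _ _ _ ⟨
      (z′ * (1# + z′ ^ p-1)) * (1# + η′) ≈⟨ *-congʳ (φ-factor z′) ⟨
      φ z′ * (1# + η′) ≈⟨ *-congʳ φz′ ⟩
      (z ^ p * (1# + η)) * (1# + η′) ≈⟨ *-congʳ (*-congʳ (trans (^-congˡ p z≈) (^-distrib-* (t ^ k) (1# + ε) p))) ⟩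
      (((t ^ k) ^ p * (1# + ε) ^ p) * (1# + η)) * (1# + η′)
        ≈⟨ *-congʳ (*-congʳ (*-cong (^-assocʳ t k p) (trans (frob-+ 1# ε) (+-congʳ (1^ p))))) ⟩
      ((t ^ (k ℕ.* p) * (1# + ε ^ p)) * (1# + η)) * (1# + η′)
        ≈⟨ solve 4 (λ T e η η′ → ((T :* (:1 :+ e)) :* (:1 :+ η)) :* (:1 :+ η′) := T :* (:1 :+ (((e :+ η :+ e :* η) :+ η′) :+ (e :+ η :+ e :* η) :* η′))) refl (t ^ (k ℕ.* p)) (ε ^ p) η η′ ⟩
      t ^ (k ℕ.* p) * (1# + ε″) ∎

-- Polynomials over subrings

module Polynomials (ring : CommutativeRing 0ℓ 0ℓ) where
  open RingKit ring

  -- f = Σ_{k < m} a_k y^k, with the k-th coefficient in Co k.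
  data Poly (Co : ℕ → Carrier → Set) (y : Carrier) : ℕ → Carrier → Set where
    nil  : ∀ {f} → f ≈ 0# → Poly Co y zero f
    snoc : ∀ {m g a f} → Poly Co y m g → Co m a → f ≈ g + a * y ^ m → Poly Co y (suc m) f

  record Group (Co : ℕ → Carrier → Set) : Set where
    field
      Cresp : ∀ {k a b} → a ≈ b → Co k a → Co k b
      Czer  : ∀ {k} → Co k 0#
      Cadd  : ∀ {k a b} → Co k a → Co k b → Co k (a + b)
      Cneg  : ∀ {k a} → Co k a → Co k (- a)

  record Subring (R : Carrier → Set) : Set where
    field
      Rresp : ∀ {a b} → a ≈ b → R a → R b
      R0    : R 0#
      R1    : R 1#
      Radd  : ∀ {a b} → R a → R b → R (a + b)
      Rneg  : ∀ {a} → R a → R (- a)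
      Rmul  : ∀ {a b} → R a → R b → R (a * b)

    Rsub : ∀ {a b} → R a → R b → R (a - b)
    Rsub x y = Radd x (Rneg y)

    Rpow : ∀ {a} n → R a → R (a ^ n)
    Rpow zero _ = R1
    Rpow (suc n) x = Rmul x (Rpow n x)

    Rι : ∀ n → R (ι n)
    Rι zero = R0
    Rι (suc n) = Rresp (sym (ι-suc n)) (Radd R1 (Rι n))

    Rgroup : Group (λ _ → R)
    Rgroup = record { Cresp = Rresp ; Czer = R0 ; Cadd = Radd ; Cneg = Rneg }

  module PolyGroup {Co : ℕ → Carrier → Set} (G : Group Co) {y : Carrier} where
    open Group G

    presp : ∀ {m f g} → f ≈ g → Poly Co y m f → Poly Co y m g
    presp e (nil h) = nil (trans (sym e) h)
    presp e (snoc d c h) = snoc d c (trans (sym e) h)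

    pzero : ∀ m → Poly Co y m 0#
    pzero zero = nil refl
    pzero (suc m) = snoc (pzero m) Czer (solve 1 (λ z → :0 := :0 :+ :0 :* z) refl (y ^ m))

    padd : ∀ {m f g} → Poly Co y m f → Poly Co y m g → Poly Co y m (f + g)
    padd (nil e) (nil e′) = nil (trans (+-cong e e′) (+-identityˡ 0#))
    padd {suc m} (snoc {g = g} {a} d c e) (snoc {g = g′} {a′} d′ c′ e′) = snoc (padd d d′) (Cadd c c′)
      (trans (+-cong e e′) (solve 5 (λ g a g′ a′ z → (g :+ a :* z) :+ (g′ :+ a′ :* z) := (g :+ g′) :+ (a :+ a′) :* z) refl g a g′ a′ (y ^ m)))

    pneg : ∀ {m f} → Poly Co y m f → Poly Co y m (- f)
    pneg (nil e) = nil (trans (-‿cong e) -0#≈0#)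
    pneg {suc m} (snoc {g = g} {a} d c e) = snoc (pneg d) (Cneg c)
      (trans (-‿cong e) (solve 3 (λ g a z → :- (g :+ a :* z) := (:- g) :+ (:- a) :* z) refl g a (y ^ m)))

    psub : ∀ {m f g} → Poly Co y m f → Poly Co y m g → Poly Co y m (f - g)
    psub d d′ = padd d (pneg d′)

    psuc : ∀ {m f} → Poly Co y m f → Poly Co y (suc m) f
    psuc {m} {f} d = snoc d Czer (solve 2 (λ f z → f := f :+ :0 :* z) refl f (y ^ m))

    p≤ : ∀ {m n f} → m ℕ.≤ n → Poly Co y m f → Poly Co y n f
    p≤ le d = go (ℕₚ.≤⇒≤′ le) d
      where
      go : ∀ {m n f} → m ℕ.≤′ n → Poly Co y m f → Poly Co y n f
      go ℕ.≤′-refl d = d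
      go (ℕ.≤′-step le) d = psuc (go le d)

    monomial : ∀ k {a} → Co k a → Poly Co y (suc k) (a * y ^ k)
    monomial k {a} c = snoc (pzero k) c (sym (+-identityˡ _))

  pmap : ∀ {Co Co′ : ℕ → Carrier → Set} {y m f} → (∀ {k a} → k ℕ.< m → Co k a → Co′ k a) → Poly Co y m f → Poly Co′ y m f
  pmap h (nil e) = nil e
  pmap h (snoc d c e) = snoc (pmap (λ lt → h (ℕₚ.m<n⇒m<1+n lt)) d) (h (ℕₚ.n<1+n _) c) e

  pscale : ∀ {Co Co′ : ℕ → Carrier → Set} {y m f} b → (∀ {k a} → Co k a → Co′ k (b * a)) → Poly Co y m f → Poly Co′ y m (b * f)
  pscale b h (nil e) = nil (trans (*-congˡ e) (zeroʳ b))
  pscale {y = y} {m = suc m} b h (snoc {g = g} {a} d c e) = snoc (pscale b h d) (h c)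
    (trans (*-congˡ e) (solve 4 (λ b g a z → b :* (g :+ a :* z) := b :* g :+ (b :* a) :* z) refl b g a (y ^ m)))

  pshift : ∀ {Co Co′ : ℕ → Carrier → Set} {y m f} → Group Co′ → (∀ {k a} → Co k a → Co′ (suc k) a) → Poly Co y m f → Poly Co′ y (suc m) (f * y)
  pshift G h (nil e) = snoc (nil refl) (Group.Czer G) (trans (*-congʳ e) (solve 1 (λ y → :0 :* y := :0 :+ :0 :* :1) refl _))
  pshift {y = y} {m = suc m} G h (snoc {g = g} {a} d c e) = snoc (pshift G h d) (h c)
    (trans (*-congʳ e) (solve 4 (λ g a z y → (g :+ a :* z) :* y := g :* y :+ a :* (y :* z)) refl g a (y ^ m) y))

  module Adjoin {R : Carrier → Set} (S : Subring R) (y : Carrier) where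
    open Subring S
    Deg : ℕ → Carrier → Set
    Deg = Poly (λ _ → R) y
    open PolyGroup Rgroup {y} public

    Dconst : ∀ {m a} → R a → Deg (suc m) a
    Dconst {m} {a} r = p≤ (ℕ.s≤s ℕ.z≤n) (presp (*-identityʳ a) (monomial 0 r))

    Dscale : ∀ {m f b} → R b → Deg m f → Deg m (b * f)
    Dscale {b = b} r = pscale b (Rmul r)

    Dshift : ∀ {m f} → Deg m f → Deg (suc m) (f * y)
    Dshift = pshift Rgroup (λ r → r)

    DR : ∀ {R′ : Carrier → Set} → Subring R′ → (∀ {a} → R a → R′ a) → R′ y → ∀ {m f} → Deg m f → R′ f
    DR S′ inc ry (nil e) = Subring.Rresp S′ (sym e) (Subring.R0 S′)
    DR S′ inc ry {suc m} (snoc d c e) = Subring.Rresp S′ (sym e)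
      (Subring.Radd S′ (DR S′ inc ry d) (Subring.Rmul S′ (inc c) (Subring.Rpow S′ m ry)))

  -- A change of variable by an element of R affects only lower coefficients, so degree bounds and
  -- leading coefficients survive. Local coordinates at different places are compared with the
  -- global y in this way.
  module Rebase {R : Carrier → Set} (S : Subring R) (y T : Carrier) (y-T∈ : R (y - T)) where
    open Subring S
    private module A = Adjoin S T

    power : ∀ m → A.Deg m (y ^ m - T ^ m)
    power zero = nil (-‿inverseʳ 1#)
    power (suc m) = A.presp
        (solve 4 (λ y T a b → ((a :- b) :* T :+ (y :- T) :* (a :- b)) :+ (y :- T) :* b := y :* a :- T :* b) refl y T (y ^ m) (T ^ m))
        (A.padd (A.padd (A.Dshift (power m)) (A.psuc (A.Dscale y-T∈ (power m)))) (A.monomial m y-T∈))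

    rebase : ∀ {m f} → Poly (λ _ → R) y m f → A.Deg m f
    rebase (nil e) = nil e
    rebase {suc m} (snoc {g = g} {a} d r e) = A.presp
      (sym (trans e (solve 4 (λ g a z w → g :+ a :* z := (g :+ a :* (z :- w)) :+ a :* w) refl g a (y ^ m) (T ^ m))))
      (A.padd (A.psuc (A.padd (rebase d) (A.Dscale r (power m)))) (A.monomial m r))

  -- The relation is φ(y) = u; it folds the top coefficient back, so that degrees below `p` are
  -- closed under products. Independence of the powers of y over R comes separately, from their
  -- orders at infinity.
  module AdjoinRing {R : Carrier → Set} (S : Subring R) (y : Carrier) (p : ℕ) (1<p : 1 ℕ.< p)
    {u : Carrier} (u∈ : R u) (y^p : y ^ p ≈ u - y) where
    open Subring S
    open Adjoin S y

    R′ : Carrier → Set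
    R′ = Deg p

    inR′ : ∀ {a} → R a → R′ a
    inR′ r = p≤ (ℕₚ.<⇒≤ 1<p) (Dconst {0} r)

    y∈ : R′ y
    y∈ = p≤ 1<p (presp (trans (*-identityˡ _) (*-identityʳ y)) (monomial 1 R1))

    ay∈ : ∀ {a} → R a → R′ (a * y)
    ay∈ r = p≤ 1<p (presp (*-congˡ (*-identityʳ y)) (monomial 1 r))

    mulY : ∀ {f} → R′ f → R′ (f * y)
    mulY = go p ≡.refl
      where
      go : ∀ m → m ≡ p → ∀ {f} → Deg m f → Deg m (f * y)
      go zero e d = contradiction (≡.subst (1 ℕ.<_) (≡.sym e) 1<p) λ ()
      go (suc m) ≡.refl (snoc {g = g} {a} d r e) = presp
        (sym (trans (*-congʳ e) (trans (solve 4 (λ g a z y → (g :+ a :* z) :* y := g :* y :+ a :* (y :* z)) refl g a (y ^ m) y)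
          (+-congˡ (trans (*-congˡ y^p) (solve 3 (λ a u y → a :* (u :- y) := a :* u :- a :* y) refl a u y))))))
        (padd (Dshift d) (psub (inR′ (Rmul r u∈)) (ay∈ r)))

    mulY^ : ∀ {f} k → R′ f → R′ (f * y ^ k)
    mulY^ zero d = presp (sym (*-identityʳ _)) d
    mulY^ {f} (suc k) d = presp (*-assoc f y (y ^ k)) (mulY^ k (mulY d))

    mulR′ : ∀ {m f g} → R′ f → Deg m g → R′ (f * g)
    mulR′ d (nil e) = presp (sym (trans (*-congˡ e) (zeroʳ _))) (pzero p)
    mulR′ {suc m} {f} d (snoc {g = g} {a} d′ r e) = presp
      (sym (trans (*-congˡ e) (solve 4 (λ f g a z → f :* (g :+ a :* z) := f :* g :+ a :* (f :* z)) refl f g a (y ^ m))))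
      (padd (mulR′ d d′) (Dscale r (mulY^ m d)))

    subring : Subring R′
    subring = record { Rresp = presp ; R0 = pzero p ; R1 = inR′ R1 ; Radd = padd ; Rneg = pneg ; Rmul = mulR′ }

-- Pole orders at infinity along one extension step.

module AtInfinity (V : ValuedRing) where
  open ValuedRing V
  open RingKit ring
  open Char prime char
  open Filtration filtration
  open Polynomials ring

  -- Orders at infinity of nonzero elements of R are multiples of P.
  Rounds : (Carrier → Set) → ℕ → Set
  Rounds R P = ∀ {a i} → R a → ¬ (+ P ℤ∣.∣ i) → O i a → O (ℤ.suc i) a

  -- Coefficients have orders divisible by p P′ and y^k contributes -k P′. For k < p the monomials
  -- thus have orders in different classes modulo p P′ and their leading terms cannot cancel: a
  -- bound on the sum bounds every monomial. This takes the place of an irreducibility argument.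
  module NoCancellation {R : Carrier → Set} (S : Subring R) (P′ : ℕ) .{{_ : NonZero P′}} (rounds : Rounds R (p ℕ.* P′))
    (y y⁻ : Carrier) (yy⁻ : y * y⁻ ≈ 1#) (y∈ : O (ℤ.- + P′) y) (y⁻∈ : O (+ P′) y⁻) where
    open Subring S
    open Adjoin S y

    toCoeff : ∀ {i a} k → O i (a * y ^ k) → O (i ℤ.+ + k ℤ.* + P′) a
    toCoeff {i} {a} k o = resp
      (trans (*-assoc a _ _) (trans (*-congˡ (unit-^ k yy⁻)) (*-identityʳ a)))
      (mul o (powℤ k y⁻∈))

    fromCoeff : ∀ {i a} k → O (i ℤ.+ + k ℤ.* + P′) a → O i (a * y ^ k)
    fromCoeff {i} k o = at (ℤS.solve 3 (λ i k P → i ℤS.:+ k ℤS.:* P ℤS.:+ k ℤS.:* (ℤS.:- P) ℤS.:= i) ≡.refl i (+ k) (+ P′))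
      (mul o (powℤ k y∈))

    Bounded : ℤ → ∀ {m f} → Deg m f → Set
    Bounded i (nil _) = ⊤
    Bounded i (snoc {m} {a = a} d _ _) = Bounded i d × O i (a * y ^ m)

    bounded⇒∈ : ∀ {i m f} (d : Deg m f) → Bounded i d → O i f
    bounded⇒∈ (nil e) _ = resp (sym e) zer
    bounded⇒∈ (snoc d _ e) (b , o) = resp (sym e) (add (bounded⇒∈ d b) o)

    bounded-mono : ∀ {i j m f} → i ℤ.≤ j → (d : Deg m f) → Bounded j d → Bounded i d
    bounded-mono le (nil _) _ = tt
    bounded-mono le (snoc d _ _) (b , o) = bounded-mono le d b , mono le o

    -- The monomials a y^k of exact order i are those with i + k P′ divisible by p P′; at most one k < p qualifies.
    Critical : ℤ → ℕ → Set
    Critical i k = + (p ℕ.* P′) ℤ∣.∣ i ℤ.+ + k ℤ.* + P′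

    critical-unique : ∀ i k l → k ℕ.< l → l ℕ.< p → Critical i k → ¬ Critical i l
    critical-unique i k l k<l l<p ck cl with ℕₚ.m≤n⇒∃[o]m+o≡n (ℕₚ.<⇒≤ k<l)
    ... | zero , ≡.refl = ℕₚ.<-irrefl (≡.sym (ℕₚ.+-identityʳ k)) k<l
    ... | suc d , ≡.refl = ℕₚ.<⇒≱ l<p (ℕₚ.≤-trans (ℕ∣.∣⇒≤ p∣d) (ℕₚ.m≤n+m (suc d) k))
      where
      diff : (i ℤ.+ + (k ℕ.+ suc d) ℤ.* + P′) ℤ.- (i ℤ.+ + k ℤ.* + P′) ≡ + (suc d ℕ.* P′)
      diff = ≡.trans (ℤS.solve 4 (λ i k d P → (i ℤS.:+ (k ℤS.:+ d) ℤS.:* P) ℤS.:- (i ℤS.:+ k ℤS.:* P) ℤS.:= d ℤS.:* P) ≡.refl i (+ k) (+ suc d) (+ P′))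
        (≡.sym (ℤₚ.pos-* (suc d) P′))
      p∣d : p ℕ∣.∣ suc d
      p∣d = ℕ∣.*-cancelʳ-∣ P′ (ℤ∣.∣⇒∣ᵤ (≡.subst (+ (p ℕ.* P′) ℤ∣.∣_) diff (ℤ∣.∣m∣n⇒∣m-n cl ck)))

    improve-coeff : ∀ i k {a} → R a → ¬ Critical i k → O i (a * y ^ k) → O (ℤ.suc i) (a * y ^ k)
    improve-coeff i k r nc o = fromCoeff k (at (≡.sym (ℤₚ.+-assoc (+ 1) i (+ k ℤ.* + P′))) (rounds r nc (toCoeff k o)))

    improve-all : ∀ {i m f} (d : Deg m f) → (∀ {k} → k ℕ.< m → ¬ Critical i k) → Bounded i d → Bounded (ℤ.suc i) d
    improve-all (nil _) _ _ = tt
    improve-all {i} (snoc {m} d r _) nc (b , o) = improve-all d (λ lt → nc (ℕₚ.m<n⇒m<1+n lt)) b , improve-coeff i m r (nc (ℕₚ.n<1+n _)) o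

    improve : ∀ {i m f} (d : Deg m f) → m ℕ.≤ p → Bounded i d → O (ℤ.suc i) f → Bounded (ℤ.suc i) d
    improve (nil _) _ _ _ = tt
    -- At most one monomial can have exact order i. If it is not the top one, the top improves by
    -- rounding and is split off; if it is, all lower ones improve and the top is what they leave of
    -- f.
    improve {i} (snoc {m} {g} {a} d r e) le (b , o) f∈ with + (p ℕ.* P′) ℤ∣.∣? (i ℤ.+ + m ℤ.* + P′)
    ... | no nc = improve d (ℕₚ.<⇒≤ le) b (resp (trans (+-congʳ e) (solve 2 (λ g t → (g :+ t) :- t := g) refl g (a * y ^ m))) (sub f∈ o′)) , o′
      where o′ = improve-coeff i m r nc o
    ... | yes c = b′ , resp (trans (+-congʳ e) (solve 2 (λ g t → (g :+ t) :- g := t) refl g (a * y ^ m))) (sub f∈ (bounded⇒∈ d b′))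
      where b′ = improve-all d (λ {k} lt ck → critical-unique i k m lt le ck c) b

    somewhere : ∀ {m f} (d : Deg m f) → ∃ λ K → Bounded (ℤ.- + K) d
    somewhere (nil _) = 0 , tt
    somewhere (snoc {m} {a = a} d r e) with somewhere d | exhaustive (a * y ^ m)
    ... | K , b | L , o = K ℕ.+ L , bounded-mono (ℤₚ.neg-mono-≤ (ℤ.+≤+ (ℕₚ.m≤m+n K L))) d b , mono (ℤₚ.neg-mono-≤ (ℤ.+≤+ (ℕₚ.m≤n+m L K))) o

    noCancellation : ∀ {i m f} (d : Deg m f) → m ℕ.≤ p → O i f → Bounded i d
    noCancellation {i} d le f∈ = go ℤ.∣ i ℤ.+ + K ∣ (bounded-mono (i-∣i+k∣≤-k i K) d b)
      where
      K = proj₁ (somewhere d)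
      b = proj₂ (somewhere d)
      go : ∀ n → Bounded (i ℤ.- + n) d → Bounded i d
      go zero h = ≡.subst (λ j → Bounded j d) (ℤₚ.+-identityʳ i) h
      go (suc n) h = go n (≡.subst (λ j → Bounded j d) eq (improve d le h (at (≡.sym eq) (mono (ℤₚ.i-j≤i i (+ n)) f∈))))
        where
        eq : ℤ.suc (i ℤ.- + suc n) ≡ i ℤ.- + n
        eq = ℤS.solve 2 (λ i n → ℤS.con (+ 1) ℤS.:+ (i ℤS.:- (ℤS.con (+ 1) ℤS.:+ n)) ℤS.:= i ℤS.:- n) ≡.refl i (+ n)

    -- Zero lies in every `O k`. Undoing the factor y^m, so does the leading coefficient, which
    -- vanishes by separation.
    top≈0 : ∀ {m g a} → Deg m g → R a → m ℕ.< p → g + a * y ^ m ≈ 0# → a ≈ 0#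
    top≈0 {m} {g} {a} d r lt e = separated λ k → at (ℤS.solve 2 (λ k q → (k ℤS.:- q) ℤS.:+ q ℤS.:= k) ≡.refl (+ k) (+ m ℤ.* + P′))
      (toCoeff m (proj₂ (noCancellation {i = + k ℤ.- + m ℤ.* + P′} (snoc d r refl) lt (resp (sym e) zer))))

    -- At an order that P′ does not divide no monomial is critical, so all improve at once. This
    -- hands the rounding hypothesis to the next level.
    rounds′ : Rounds (Deg p) P′
    rounds′ {a} {i} d nd a∈ = bounded⇒∈ d (improve-all d (λ {k} _ c → nd (nd′ k c)) (noCancellation d ℕₚ.≤-refl a∈))
      where
      nd′ : ∀ k → Critical i k → + P′ ℤ∣.∣ i
      nd′ k c = ≡.subst (+ P′ ℤ∣.∣_) (ℤS.solve 2 (λ i q → (i ℤS.:+ q) ℤS.:- q ℤS.:= i) ≡.refl i (+ k ℤ.* + P′))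
        (ℤ∣.∣m∣n⇒∣m-n (ℤ∣.∣-trans (ℤ∣.divides (+ p) (ℤₚ.pos-* p P′)) c) (ℤ∣.divides (+ k) ≡.refl))

-- Places as filtrations

≤-shift : ∀ {a b a′ b′} c → a ℤ.≤ b → a′ ≡ a ℤ.+ c → b ℤ.+ c ≡ b′ → a′ ℤ.≤ b′
≤-shift c le ≡.refl ≡.refl = ℤₚ.+-monoˡ-≤ c le

≤-by : ∀ {a b} d → a ℤ.+ + d ≡ b → a ℤ.≤ b
≤-by {a} d ≡.refl = ℤₚ.i≤i+j a (+ d)

module Places (V : ValuedRing) where
  open ValuedRing V using (ring; p; prime; char)
  open RingKit ring
  open Char prime char
  open Polynomials ring

  -- A finite place: a filtration of R by pole order, with φ₀ vanishing to order m.
  record Place (R : Carrier → Set) (φ₀ : Carrier) : Set₁ where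
    field
      Fl  : Filtration ring
    open Filtration Fl public
    field
      O⇒R : ∀ {i a} → O i a → R a
      exh : ∀ {a} → R a → ∃ λ k → O (ℤ.- + k) a
      m   : ℤ
      φ∈  : O m φ₀

    -- Multiplication by φ₀ carries a target into `O 1`, so approximation within targets becomes
    -- regularity. The extra 1 pays for the poles of T^k in totally ramified steps.
    Target : Carrier → Set
    Target = O (+ 1 ℤ.- m)

    boot′ : ∀ {i a b ε} → R a → O i b → O (+ 1) ε → a ≈ b - a * ε → O i a
    boot′ r = boot (proj₁ (exh r)) (proj₂ (exh r))

  -- T = y - w satisfies T^p + T = s with a pole of order at most ε. Old orders are multiplied by e
  -- and T is given order -ε: (1 , 0) is an unramified step and (p , 1) a totally ramified one. The
  -- inequality e ε ≤ ε p makes T^p = s - T compatible with the filtration, and ε k < e leaves room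
  -- for the targets.
  module PlaceStep {R : Carrier → Set} (S : Subring R) {φ₀ y u : Carrier} (u∈R : R u) (φy : φ y ≈ u)
    (Q : Place R φ₀) (w : Carrier) (w∈R : R w) (e ε : ℕ)
    (0<e : 0 ℕ.< e) (eε≤εp : e ℕ.* ε ℕ.≤ ε ℕ.* p) (εk<e : ∀ {k} → k ℕ.< p → ε ℕ.* k ℕ.< e)
    (s∈ : Place.O Q (ℤ.- + ε) (u - φ w)) where
    open Place Q
    open Subring S

    T s : Carrier
    T = y - w
    s = u - φ w

    y^p : y ^ p ≈ u - y
    y^p = trans (solve 2 (λ a y → a := (a :+ y) :- y) refl (y ^ p) y) (+-congʳ φy)

    T^p : T ^ p ≈ s - T
    T^p = begin
      (y - w) ^ p ≈⟨ frob-- y w ⟩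
      y ^ p - w ^ p ≈⟨ +-congʳ y^p ⟩
      (u - y) - w ^ p ≈⟨ solve 4 (λ u y a w → (u :- y) :- a := (u :- (a :+ w)) :- (y :- w)) refl u y (w ^ p) w ⟩
      s - T ∎

    y-T∈ : R (y - T)
    y-T∈ = Rresp (solve 2 (λ y w → w := y :- (y :- w)) refl y w) w∈R

    T-y∈ : R (T - y)
    T-y∈ = Rresp (solve 2 (λ y w → :- w := (y :- w) :- y) refl y w) (Rneg w∈R)

    module toT = Rebase S y T y-T∈
    module toY = Rebase S T y T-y∈
    open AdjoinRing S y p 1<p u∈R y^p using (R′; inR′; y∈) renaming (subring to S′)

    E₀ E₁ : ℤ
    E₀ = + ε
    E₁ = + e

    private
      0≤E₀* : ∀ k → + 0 ℤ.≤ E₀ ℤ.* + k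
      0≤E₀* k = ≡.subst (+ 0 ℤ.≤_) (ℤₚ.pos-* ε k) (ℤ.+≤+ ℕ.z≤n)

      ≤E₁* : ∀ n → + n ℤ.≤ E₁ ℤ.* + n
      ≤E₁* n = ≡.subst (+ n ℤ.≤_) (ℤₚ.pos-* e n) (ℤ.+≤+ (ℕₚ.m≤n*m n e {{ℕ.>-nonZero 0<e}}))

    -- The coefficient of T^k in an element of order i: T has order -ε when orders are multiplied by e.
    record Co (i : ℤ) (k : ℕ) (b : Carrier) : Set where
      constructor co
      field
        l  : ℤ
        o  : O l b
        le : i ℤ.+ E₀ ℤ.* + k ℤ.≤ E₁ ℤ.* l

    group : ∀ {i} → Group (Co i)
    group {i} = record
      { Cresp = λ { eq (co l o le) → co l (resp eq o) le }
      ; Czer = λ {k} → co (+ ℤ.∣ i ℤ.+ E₀ ℤ.* + k ∣) zer (ℤₚ.≤-trans (i≤∣i∣ _) (≤E₁* _))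
      ; Cadd = λ { (co l o le) (co l′ o′ le′) → both (ℤₚ.≤-total l l′) o o′ le le′ }
      ; Cneg = λ { (co l o le) → co l (neg o) le } }
      where
      both : ∀ {k l l′ a b} → l ℤ.≤ l′ ⊎ l′ ℤ.≤ l → O l a → O l′ b → i ℤ.+ E₀ ℤ.* + k ℤ.≤ E₁ ℤ.* l → i ℤ.+ E₀ ℤ.* + k ℤ.≤ E₁ ℤ.* l′ → Co i k (a + b)
      both {l = l} (inj₁ q) o o′ le le′ = co l (add o (mono q o′)) le
      both {l′ = l′} (inj₂ q) o o′ le le′ = co l′ (add (mono q o) o′) le′

    Span : ℤ → ℕ → Carrier → Set
    Span i = Poly (Co i) T

    private module PG {i} = PolyGroup (group {i}) {T}

    Co-mono : ∀ {i j k b} → i ℤ.≤ j → Co j k b → Co i k b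
    Co-mono {k = k} le (co l o h) = co l o (ℤₚ.≤-trans (ℤₚ.+-monoˡ-≤ (E₀ ℤ.* + k) le) h)

    span-mono : ∀ {i j m f} → i ℤ.≤ j → Span j m f → Span i m f
    span-mono le = pmap (λ {k} _ → Co-mono {k = k} le)

    Co⇒R : ∀ {i k b} → Co i k b → R b
    Co⇒R (co _ o _) = O⇒R o

    span⇒R′ : ∀ {i f} → Span i p f → R′ f
    span⇒R′ d = toY.rebase (pmap (λ {k} _ → Co⇒R {k = k}) d)

    O⊂ : ∀ {i l b} → i ℤ.≤ E₁ ℤ.* l → O l b → Span i p b
    O⊂ {i} {l} le o = PG.p≤ (ℕₚ.<⇒≤ 1<p) (PG.presp (*-identityʳ _) (PG.monomial 0
      (co l o (ℤₚ.≤-trans (ℤₚ.≤-reflexive (ℤS.solve 2 (λ i q → i ℤS.:+ q ℤS.:* ℤS.con (+ 0) ℤS.:= i) ≡.refl i E₀)) le))))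

    OT : ∀ {i l b} → i ℤ.+ E₀ ℤ.≤ E₁ ℤ.* l → O l b → Span i p (b * T)
    OT {i} {l} le o = PG.p≤ 1<p (PG.presp (*-congˡ (*-identityʳ T)) (PG.monomial 1
      (co l o (ℤₚ.≤-trans (ℤₚ.≤-reflexive (ℤS.solve 2 (λ i q → i ℤS.:+ q ℤS.:* ℤS.con (+ 1) ℤS.:= i ℤS.:+ q) ≡.refl i E₀)) le))))

    mulT : ∀ {i f} → Span i p f → Span (i ℤ.- E₀) p (f * T)
    mulT {i} = go p ≡.refl
      where
      shiftCo : ∀ {k a} → Co i k a → Co (i ℤ.- E₀) (suc k) a
      shiftCo {k} (co l o le) = co l o (ℤₚ.≤-trans (ℤₚ.≤-reflexive
        (ℤS.solve 3 (λ i q k → (i ℤS.:- q) ℤS.:+ q ℤS.:* (ℤS.con (+ 1) ℤS.:+ k) ℤS.:= i ℤS.:+ q ℤS.:* k) ≡.refl i E₀ (+ k))) le)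
      go : ∀ n → n ≡ p → ∀ {f} → Span i n f → Span (i ℤ.- E₀) n (f * T)
      go zero eq d = contradiction (≡.subst (1 ℕ.<_) (≡.sym eq) 1<p) λ ()
      go (suc n) ≡.refl (snoc {g = g} {b} d (co l o le) eq) = PG.presp
        (sym (trans (*-congʳ eq) (trans (solve 4 (λ g a z y → (g :+ a :* z) :* y := g :* y :+ a :* (y :* z)) refl g b (T ^ n) T)
          (+-congˡ (trans (*-congˡ T^p) (solve 3 (λ a u y → a :* (u :- y) := a :* u :- a :* y) refl b s T))))))
        (PG.padd (pshift group shiftCo d) (PG.psub (O⊂ le₁ (mul o s∈)) (OT le₂ o)))
        where
        le₀ : i ℤ.- E₀ ℤ.≤ E₁ ℤ.* l ℤ.- E₀ ℤ.* + suc n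
        le₀ = ≤-shift (ℤ.- (E₀ ℤ.* + suc n)) le
          (ℤS.solve 3 (λ i q k → i ℤS.:- q ℤS.:= (i ℤS.:+ q ℤS.:* k) ℤS.:+ ℤS.:- (q ℤS.:* (ℤS.con (+ 1) ℤS.:+ k))) ≡.refl i E₀ (+ n)) ≡.refl
        le₁ : i ℤ.- E₀ ℤ.≤ E₁ ℤ.* (l ℤ.+ ℤ.- E₀)
        le₁ = ℤₚ.≤-trans le₀ (≡.subst (E₁ ℤ.* l ℤ.- E₀ ℤ.* + suc n ℤ.≤_)
          (ℤS.solve 3 (λ e l q → e ℤS.:* l ℤS.:- e ℤS.:* q ℤS.:= e ℤS.:* (l ℤS.:+ ℤS.:- q)) ≡.refl E₁ l E₀)
          (ℤₚ.+-monoʳ-≤ (E₁ ℤ.* l) (ℤₚ.neg-mono-≤ (≡.subst₂ ℤ._≤_ (ℤₚ.pos-* e ε) (ℤₚ.pos-* ε (suc n)) (ℤ.+≤+ eε≤εp)))))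
        le₂ : (i ℤ.- E₀) ℤ.+ E₀ ℤ.≤ E₁ ℤ.* l
        le₂ = ℤₚ.≤-trans (≤-shift i (0≤E₀* n) (ℤS.solve 2 (λ i q → (i ℤS.:- q) ℤS.:+ q ℤS.:= ℤS.con (+ 0) ℤS.:+ i) ≡.refl i E₀) (ℤₚ.+-comm _ i)) le

    mulT^ : ∀ {i f} k → Span i p f → Span (i ℤ.- E₀ ℤ.* + k) p (f * T ^ k)
    mulT^ {i} zero d = PG.presp (sym (*-identityʳ _)) (≡.subst (λ j → Span j p _)
      (ℤS.solve 2 (λ i q → i ℤS.:= i ℤS.:- q ℤS.:* ℤS.con (+ 0)) ≡.refl i E₀) d)
    mulT^ {i} {f} (suc k) d = PG.presp (*-assoc f T (T ^ k)) (≡.subst (λ j → Span j p _)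
      (ℤS.solve 3 (λ i q k → (i ℤS.:- q) ℤS.:- q ℤS.:* k ℤS.:= i ℤS.:- q ℤS.:* (ℤS.con (+ 1) ℤS.:+ k)) ≡.refl i E₀ (+ k)) (mulT^ k (mulT d)))

    scale : ∀ {i l b m f} → O l b → Span i m f → Span (i ℤ.+ E₁ ℤ.* l) m (b * f)
    scale {i} {l} {b} o = pscale b λ { {k} (co l′ o′ le) → co (l ℤ.+ l′) (mul o o′)
      (≤-shift (E₁ ℤ.* l) le (ℤS.solve 3 (λ i x y → (i ℤS.:+ x) ℤS.:+ y ℤS.:= (i ℤS.:+ y) ℤS.:+ x) ≡.refl i (E₁ ℤ.* l) (E₀ ℤ.* + k))
        (ℤS.solve 3 (λ e l l′ → e ℤS.:* l′ ℤS.:+ e ℤS.:* l ℤS.:= e ℤS.:* (l ℤS.:+ l′)) ≡.refl E₁ l l′)) }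

    spanMul : ∀ {i j m f g} → Span i p f → Span j m g → Span (i ℤ.+ j) p (f * g)
    spanMul d (nil eq) = PG.presp (sym (trans (*-congˡ eq) (zeroʳ _))) (PG.pzero p)
    spanMul {i} {j} {suc k} {f} d (snoc {g = g} {b} d′ (co l o le) eq) = PG.presp
      (sym (trans (*-congˡ eq) (solve 4 (λ f g a z → f :* (g :+ a :* z) := f :* g :+ a :* (f :* z)) refl f g b (T ^ k))))
      (PG.padd (spanMul d d′) (span-mono
        (≤-shift (i ℤ.- E₀ ℤ.* + k) le
          (ℤS.solve 3 (λ i j x → i ℤS.:+ j ℤS.:= (j ℤS.:+ x) ℤS.:+ (i ℤS.:- x)) ≡.refl i j (E₀ ℤ.* + k)) (ℤₚ.+-comm _ (i ℤ.- E₀ ℤ.* + k)))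
        (scale o (mulT^ k d))))

    filtration′ : Filtration ring
    filtration′ = record
      { O = λ i → Span i p ; resp = PG.presp ; zer = PG.pzero p ; add = PG.padd ; neg = PG.pneg
      ; mono = span-mono ; mul = spanMul
      ; one = O⊂ (ℤₚ.≤-reflexive (≡.sym (ℤₚ.*-zeroʳ E₁))) one }

    O⊂′ : ∀ {i b} → O i b → Span (E₁ ℤ.* i) p b
    O⊂′ = O⊂ ℤₚ.≤-refl

    span-exh : ∀ {m f} → Poly (λ _ → R) T m f → ∃ λ K → Span (ℤ.- + K) m f
    span-exh (nil eq) = 0 , nil eq
    span-exh {suc m} (snoc {a = a} d r eq) with span-exh d | exh r
    ... | K , d′ | L , o = K ℕ.+ (e ℕ.* L ℕ.+ ε ℕ.* m) ,
      snoc (span-mono (ℤₚ.neg-mono-≤ (ℤ.+≤+ (ℕₚ.m≤m+n K _))) d′)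
        (co (ℤ.- + L) o (ℤₚ.≤-trans (ℤₚ.+-monoˡ-≤ (E₀ ℤ.* + m) (ℤₚ.neg-mono-≤ (ℤ.+≤+ (ℕₚ.m≤n+m _ K))))
          (ℤₚ.≤-reflexive (≡.trans (≡.cong (λ z → ℤ.- z ℤ.+ E₀ ℤ.* + m) (≡.cong₂ ℤ._+_ (ℤₚ.pos-* e L) (ℤₚ.pos-* ε m)))
            (ℤS.solve 3 (λ e L x → ℤS.:- (e ℤS.:* L ℤS.:+ x) ℤS.:+ x ℤS.:= e ℤS.:* ℤS.:- L) ≡.refl E₁ (+ L) (E₀ ℤ.* + m)))))) eq

    place′ : Place R′ φ₀
    place′ = record
      { Fl = filtration′ ; O⇒R = span⇒R′ ; exh = λ r → span-exh (toT.rebase r)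
      ; m = E₁ ℤ.* m ; φ∈ = O⊂′ φ∈ }

    -- The order 1 - m of b becomes e - e m, and T^k takes away ε k < e, so at least 1 - e m
    -- remains.
    target : ∀ {k b} → k ℕ.< p → Target b → Place.Target place′ (b * T ^ k)
    target {k} lt o = PG.p≤ lt (PG.monomial k (co (+ 1 ℤ.- m) o
      (≤-shift (ℤ.- (E₁ ℤ.* m)) (≡.subst (ℤ._≤ E₁) (≡.cong (λ z → + 1 ℤ.+ z) (ℤₚ.pos-* ε k)) (ℤ.+≤+ (εk<e lt)))
        (ℤS.solve 2 (λ x y → (ℤS.con (+ 1) ℤS.:- x) ℤS.:+ y ℤS.:= (ℤS.con (+ 1) ℤS.:+ y) ℤS.:+ ℤS.:- x) ≡.refl (E₁ ℤ.* m) (E₀ ℤ.* + k))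
        (ℤS.solve 2 (λ e m → e ℤS.:+ ℤS.:- (e ℤS.:* m) ℤS.:= e ℤS.:* (ℤS.con (+ 1) ℤS.:- m)) ≡.refl E₁ m))))

    T∈ : Span (ℤ.- E₀) p T
    T∈ = PG.presp (*-identityˡ T) (OT {l = + 0} (ℤₚ.≤-reflexive (≡.trans (ℤₚ.+-inverseˡ E₀) (≡.sym (ℤₚ.*-zeroʳ E₁)))) one)

    coefficient₀ : ∀ {k b} → Co (+ 0) k b → O (+ 0) b
    coefficient₀ {k} (co l o le) = mono (0≤l l (ℤₚ.≤-trans (ℤₚ.≤-trans (0≤E₀* k) (ℤₚ.≤-reflexive (≡.sym (ℤₚ.+-identityˡ _)))) le)) o
      where
      0≤l : ∀ l → + 0 ℤ.≤ E₁ ℤ.* l → + 0 ℤ.≤ l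
      0≤l l h = ℤₚ.*-cancelˡ-≤-pos (+ 0) l E₁ {{ℤ.positive (ℤ.+<+ 0<e)}} (ℤₚ.≤-trans (ℤₚ.≤-reflexive (ℤₚ.*-zeroʳ E₁)) h)

-- Splitting a place by localisation

module Localisation (V : ValuedRing) where
  open ValuedRing V using (ring; p; prime; char)
  open RingKit ring
  open Char prime char
  open Polynomials ring
  open Places V

  module _ {R : Carrier → Set} (S : Subring R) {φ₀ : Carrier} (Q : Place R φ₀) where
    open Place Q
    open Subring S

    -- The part of a semilocal filtration belonging to the places where g is a unit.
    localise : ∀ g → O (+ 0) g → Place R φ₀
    localise g g∈ = record
      { Fl = record
        { O = L
        ; resp = λ { e (r , n , o) → Rresp e r , n , resp (*-congˡ e) o }
        ; zer = R0 , 0 , resp (sym (zeroʳ _)) zer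
        ; add = λ { (r , n , o) (r′ , n′ , o′) → Radd r r′ , n ℕ.+ n′ , resp (sym (distribˡ _ _ _)) (add
            (more′ n′ n o)
            (more n n′ o′)) }
        ; neg = λ { (r , n , o) → Rneg r , n , resp (-‿distribʳ-* _ _) (neg o) }
        ; mono = λ { le (r , n , o) → r , n , mono le o }
        ; mul = λ { {a = a} {b} (r , n , o) (r′ , n′ , o′) → Rmul r r′ , n ℕ.+ n′ , resp
            (trans (solve 4 (λ x y a b → (x :* a) :* (y :* b) := (x :* y) :* (a :* b)) refl (g ^ n) (g ^ n′) a b) (*-congʳ (sym (^-homo-* g n n′))))
            (mul o o′) }
        ; one = R1 , 0 , resp (sym (*-identityʳ _)) one }
      ; O⇒R = proj₁
      ; exh = λ r → let k , o = exh r in k , loc o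
      ; m = m ; φ∈ = loc φ∈ }
      where
      L : ℤ → Carrier → Set
      L i f = R f × ∃ λ n → O i (g ^ n * f)
      loc : ∀ {i f} → O i f → L i f
      loc o = O⇒R o , 0 , resp (sym (*-identityˡ _)) o
      more : ∀ k n {i f} → O i (g ^ n * f) → O i (g ^ (k ℕ.+ n) * f)
      more k n o = resp (trans (sym (*-assoc _ _ _)) (*-congʳ (sym (^-homo-* g k n)))) (mul₀ (pow₀ k g∈) o)
      more′ : ∀ k n {i f} → O i (g ^ n * f) → O i (g ^ (n ℕ.+ k) * f)
      more′ k n {i} {f} o = ≡.subst (λ j → O i (g ^ j * f)) (ℕₚ.+-comm k n) (more k n o)

    localise-∈ : ∀ {g} (g∈ : O (+ 0) g) {i f} → O i f → Place.O (localise g g∈) i f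
    localise-∈ g∈ o = O⇒R o , 0 , resp (sym (*-identityˡ _)) o

    -- At each point of the semilocal place exactly one of s and y is a unit. In the applications s
    -- is y^(p-1) + 1 and s y is φ(y): `QZ` is the point y = 0, and `QB` collects the points with
    -- y^(p-1) = -1, which are never separated from one another.
    module Split (s y : Carrier) (s∈ : O (+ 0) s) (y∈ : O (+ 0) y) (a : Carrier) (a∈ : O (+ 0) a)
      (comaximal : s + a * y ≈ 1#) (sy∈ : O (+ 1) (s * y)) where

      QZ QB : Place R φ₀
      QZ = localise s s∈
      QB = localise y y∈
      private
        module Z = Place QZ
        module B = Place QB

      y∈Z : Z.O (+ 1) y
      y∈Z = O⇒R y∈ , 1 , resp (*-congʳ (sym (*-identityʳ s))) sy∈

      s∈B : B.O (+ 1) s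
      s∈B = O⇒R s∈ , 1 , resp (trans (*-comm s y) (*-congʳ (sym (*-identityʳ y)))) sy∈

      bezout₁ : ∀ k → Σ Carrier λ α → Σ Carrier λ β → O (+ 0) α × O (+ 0) β × α * s ^ k + β * y ≈ 1#
      bezout₁ zero = 1# , 0# , one , zer , solve 1 (λ z → :1 :* :1 :+ :0 :* z := :1) refl y
      bezout₁ (suc k) with bezout₁ k
      ... | α , β , α∈ , β∈ , e = α , (α * s ^ k) * a + β * s + β * (a * y) , α∈ ,
        add (add (mul₀ (mul₀ α∈ (pow₀ k s∈)) a∈) (mul₀ β∈ s∈)) (mul₀ β∈ (mul₀ a∈ y∈)) ,
        trans (solve 6 (λ α β s x a y → α :* (s :* x) :+ ((α :* x) :* a :+ β :* s :+ β :* (a :* y)) :* y := (α :* x :+ β :* y) :* (s :+ a :* y)) refl α β s (s ^ k) a y)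
          (trans (*-cong e comaximal) (*-identityˡ _))

      bezout : ∀ k l → Σ Carrier λ α → Σ Carrier λ β → O (+ 0) α × O (+ 0) β × α * s ^ k + β * y ^ l ≈ 1#
      bezout k zero = 0# , 1# , zer , one , solve 1 (λ z → :0 :* z :+ :1 :* :1 := :1) refl (s ^ k)
      bezout k (suc l) with bezout k l | bezout₁ k
      ... | α , β , α∈ , β∈ , e | α′ , β′ , α′∈ , β′∈ , e′ =
        (α * α′) * s ^ k + (α * β′) * y + (β * y ^ l) * α′ , β * β′ ,
        add (add (mul₀ (mul₀ α∈ α′∈) (pow₀ k s∈)) (mul₀ (mul₀ α∈ β′∈) y∈)) (mul₀ (mul₀ β∈ (pow₀ l y∈)) α′∈) ,
        mul₀ β∈ β′∈ ,
        trans (solve 7 (λ α β α′ β′ x y z → ((α :* α′) :* x :+ (α :* β′) :* y :+ (β :* z) :* α′) :* x :+ (β :* β′) :* (y :* z)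
            := (α :* x :+ β :* z) :* (α′ :* x :+ β′ :* y)) refl α β α′ β′ (s ^ k) y (y ^ l))
          (trans (*-cong e e′) (*-identityˡ _))

      intersect : ∀ {i f} → Z.O i f → B.O i f → O i f
      intersect (r , k , o) (_ , l , o′) with bezout k l
      ... | α , β , α∈ , β∈ , e = resp
        (trans (solve 5 (λ α β x y f → α :* (x :* f) :+ β :* (y :* f) := (α :* x :+ β :* y) :* f) refl α β (s ^ k) (y ^ l) _) (trans (*-congʳ e) (*-identityˡ _)))
        (add (mul₀ α∈ o) (mul₀ β∈ o′))

      separate : ∀ i {hZ hB} → R hZ → R hB → Σ Carrier λ h → R h × Z.O i (h - hZ) × B.O i (h - hB)
      separate i {hZ} {hB} rZ rB with exh (Rsub rB rZ)
      -- The exponent has to outweigh the pole order L of the difference of the two prescriptions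
      -- and still leave order i.
      ... | L , o with bezout ℤ.∣ i ℤ.+ + L ∣ ℤ.∣ i ℤ.+ + L ∣
      ... | α , β , α∈ , β∈ , e = α * s ^ K * hZ + β * y ^ K * hB ,
        Radd (Rmul (Rmul (O⇒R α∈) (Rpow K (O⇒R s∈))) rZ) (Rmul (Rmul (O⇒R β∈) (Rpow K (O⇒R y∈))) rB) ,
        Z.resp (sym eqZ) (Z.mono le (Z.mul (Z.mul₀ (localise-∈ s∈ β∈) (Z.at (≡.cong +_ (ℕₚ.*-identityʳ K)) (Z.pow K y∈Z))) (localise-∈ s∈ o))) ,
        B.resp (sym eqB) (B.mono le (B.mul (B.mul₀ (localise-∈ y∈ α∈) (B.at (≡.cong +_ (ℕₚ.*-identityʳ K)) (B.pow K s∈B))) (localise-∈ y∈ (resp (solve 2 (λ a b → :- (b :- a) := a :- b) refl hZ hB) (neg o))))) 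
        where
        K = ℤ.∣ i ℤ.+ + L ∣
        le : i ℤ.≤ + K ℤ.+ ℤ.- + L
        le = ≤-shift (+ K) (i-∣i+k∣≤-k i L) (ℤS.solve 2 (λ i k → i ℤS.:= (i ℤS.:- k) ℤS.:+ k) ≡.refl i (+ K)) (ℤₚ.+-comm (ℤ.- + L) (+ K))
        eqZ : α * s ^ K * hZ + β * y ^ K * hB - hZ ≈ β * y ^ K * (hB - hZ)
        eqZ = begin
          α * s ^ K * hZ + β * y ^ K * hB - hZ
            ≈⟨ +-congˡ (-‿cong (trans (sym (*-identityˡ hZ)) (*-congʳ (sym e)))) ⟩
          α * s ^ K * hZ + β * y ^ K * hB - (α * s ^ K + β * y ^ K) * hZ
            ≈⟨ solve 6 (λ α x β y z b → α :* x :* z :+ β :* y :* b :- (α :* x :+ β :* y) :* z := β :* y :* (b :- z)) refl α (s ^ K) β (y ^ K) hZ hB ⟩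
          β * y ^ K * (hB - hZ) ∎
        eqB : α * s ^ K * hZ + β * y ^ K * hB - hB ≈ α * s ^ K * (hZ - hB)
        eqB = begin
          α * s ^ K * hZ + β * y ^ K * hB - hB
            ≈⟨ +-congˡ (-‿cong (trans (sym (*-identityˡ hB)) (*-congʳ (sym e)))) ⟩
          α * s ^ K * hZ + β * y ^ K * hB - (α * s ^ K + β * y ^ K) * hB
            ≈⟨ solve 6 (λ α x β y z b → α :* x :* z :+ β :* y :* b :- (α :* x :+ β :* y) :* b := α :* x :* (z :- b)) refl α (s ^ K) β (y ^ K) hZ hB ⟩
          α * s ^ K * (hZ - hB) ∎

-- Behaviour of the finite places along the tower

module States (V : ValuedRing) where
  open ValuedRing V using (ring; p; prime; char)
  open RingKit ring
  open Char prime char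
  open Polynomials ring
  open Places V
  open Localisation V

  p-1 p-2 : ℕ
  p-1 = ℕ.pred p
  p-2 = ℕ.pred p-1

  p≡ : suc p-1 ≡ p
  p≡ = ℕₚ.suc-pred p {{ℕ.>-nonZero (ℕₚ.<-trans (ℕ.s≤s ℕ.z≤n) 1<p)}}

  0<p-1 : 0 ℕ.< p-1
  0<p-1 = ℕ.s≤s⁻¹ (≡.subst (1 ℕ.<_) (≡.sym p≡) 1<p)

  p-1≡ : suc p-2 ≡ p-1
  p-1≡ = ℕₚ.suc-pred p-1 {{ℕ.>-nonZero 0<p-1}}

  x^p : ∀ x → x ^ p ≈ x * x ^ p-1
  x^p x = reflexive (≡.cong (x ^_) (≡.sym p≡))

  x^p-1 : ∀ x → x ^ p-1 ≈ x * x ^ p-2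
  x^p-1 x = reflexive (≡.cong (x ^_) (≡.sym p-1≡))

  φ-factor : ∀ x → φ x ≈ x * (1# + x ^ p-1)
  φ-factor x = trans (+-congʳ (x^p x)) (solve 2 (λ x y → x :* y :+ x := x :* (:1 :+ y)) refl x (x ^ p-1))

  φ-0 : φ 0# ≈ 0#
  φ-0 = trans (+-congʳ frob-0) (+-identityˡ 0#)

  module _ {R : Carrier → Set} {φ₀ : Carrier} (Q : Place R φ₀) where
    open Place Q

    Small : Carrier → Set
    Small z = Σ Carrier λ z⁻ → z * z⁻ ≈ 1# × O (+ 1) z⁻ × R z

    -- Successive reciprocals z, z′, … of the coordinates below a zero, with z ≈ φ(z′) up to regular terms.
    data PoleChain : Carrier → List Carrier → Set where
      end  : ∀ {z} → Small z → O -[1+ 0 ] z → PoleChain z []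
      link : ∀ {z z′ zs} → Small z → O (+ 0) (z - φ z′) → PoleChain z′ zs → PoleChain z (z′ ∷ zs)

    small : ∀ {z zs} → PoleChain z zs → Small z
    small (end s _) = s
    small (link s _ _) = s

    -- How the next step y^p + y = u behaves: unramified with u integral, totally ramified, or unramified after
    -- subtracting c z from y, where z is the reciprocal of the coordinate mirrored at the point where the pole arose.
    data State (u u⁻ : Carrier) : Set where
      int  : O (+ 0) u → O (+ 0) u⁻ → State u u⁻
      ram  : O -[1+ 0 ] u → O (+ 1) u⁻ → State u u⁻
      fold : ∀ {c c⁻ z zs} → c * c⁻ ≈ 1# → O (+ 0) c → O (+ 0) c⁻ → PoleChain z zs →
             O (+ 0) (u - φ (c * z)) → O (+ 0) ((c - c ^ p) * z ^ p) → State u u⁻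

    record Zero (x x⁻ : Carrier) : Set where
      field
        x∈    : O (+ 1) x
        zs    : List Carrier
        chain : PoleChain x⁻ zs

  transport : ∀ {R R′ : Carrier → Set} {φ₀ φ₀′} {Q : Place R φ₀} {Q′ : Place R′ φ₀′} → (∀ {a} → R a → R′ a) →
    (∀ {a} → Place.O Q (+ 1) a → Place.O Q′ (+ 1) a) → (∀ {a} → Place.O Q (+ 0) a → Place.O Q′ (+ 0) a) →
    (∀ {a} → Place.O Q -[1+ 0 ] a → Place.O Q′ -[1+ 0 ] a) → ∀ {z zs} → PoleChain Q z zs → PoleChain Q′ z zs
  transport r o1 o0 o-1 (end (z⁻ , e , o , rz) o′) = end (z⁻ , e , o1 o , r rz) (o-1 o′)
  transport r o1 o0 o-1 (link (z⁻ , e , o , rz) o′ c) = link (z⁻ , e , o1 o , r rz) (o0 o′) (transport r o1 o0 o-1 c)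

  module Step {R : Carrier → Set} (S : Subring R) {φ₀ u u⁻ y y⁻ : Carrier} (u∈ : R u) (u⁻∈ : R u⁻) (uu⁻ : u * u⁻ ≈ 1#)
    (φy : φ y ≈ u) (yy⁻ : y * y⁻ ≈ 1#) where
    open Subring S

    y^p≈ : y ^ p ≈ u - y
    y^p≈ = trans (solve 2 (λ a y → a := (a :+ y) :- y) refl (y ^ p) y) (+-congʳ φy)

    open AdjoinRing S y p 1<p u∈ y^p≈ using (R′; inR′; y∈) renaming (subring to S′) public
    module S′ = Subring S′

    -- As φ(y) = u, this is y^(p+1) / φ(y), the right-hand side of the next equation of the tower.
    u′ u′⁻ : Carrier
    u′ = y ^ suc p * u⁻
    u′⁻ = φ y⁻

    y⁻≈ : y⁻ ≈ (y ^ p-1 + 1#) * u⁻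
    y⁻≈ = unit-cancelˡ yy⁻ (begin
      y * y⁻ ≈⟨ yy⁻ ⟩
      1# ≈⟨ uu⁻ ⟨
      u * u⁻ ≈⟨ *-congʳ φy ⟨
      (y ^ p + y) * u⁻ ≈⟨ *-congʳ (φ-factor y) ⟩
      (y * (1# + y ^ p-1)) * u⁻ ≈⟨ solve 3 (λ y a u → (y :* (:1 :+ a)) :* u := y :* ((a :+ :1) :* u)) refl y (y ^ p-1) u⁻ ⟩
      y * ((y ^ p-1 + 1#) * u⁻) ∎)

    y⁻∈ : R′ y⁻
    y⁻∈ = S′.Rresp (sym y⁻≈) (S′.Rmul (S′.Radd (S′.Rpow p-1 y∈) S′.R1) (inR′ u⁻∈))

    u′∈ : R′ u′
    u′∈ = S′.Rmul (S′.Rpow (suc p) y∈) (inR′ u⁻∈)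

    u′⁻∈ : R′ u′⁻
    u′⁻∈ = S′.Radd (S′.Rpow p y⁻∈) y⁻∈

    u′u′⁻ : u′ * u′⁻ ≈ 1#
    u′u′⁻ = begin
      ((y * y ^ p) * u⁻) * (y⁻ ^ p + y⁻)
        ≈⟨ solve 5 (λ y yp u z zp → ((y :* yp) :* u) :* (zp :+ z) := (y :* (yp :* zp) :+ yp :* (y :* z)) :* u) refl y (y ^ p) u⁻ y⁻ (y⁻ ^ p) ⟩
      (y * (y ^ p * y⁻ ^ p) + y ^ p * (y * y⁻)) * u⁻
        ≈⟨ *-congʳ (trans (+-cong (trans (*-congˡ (unit-^ p yy⁻)) (*-identityʳ y)) (trans (*-congˡ yy⁻) (*-identityʳ _))) (+-comm _ _)) ⟩
      φ y * u⁻ ≈⟨ *-congʳ φy ⟩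
      u * u⁻ ≈⟨ uu⁻ ⟩
      1# ∎

    -- What one step provides for the global arguments: a local coordinate T, with approximation targets
    -- and integrality both read off coefficientwise.
    record Stepped (Q : Place R φ₀) : Set₁ where
      field
        Q′     : Place R′ φ₀
        T      : Carrier
        y-T∈   : R (y - T)
        target : ∀ {k b} → k ℕ.< p → Place.Target Q b → Place.Target Q′ (b * T ^ k)
        coeffs : ∀ {f} → Place.O Q′ (+ 0) f → Poly (λ _ → Place.O Q (+ 0)) T p f

    module _ (Q : Place R φ₀) where
      open Place Q

      unramified : ∀ w → R w → O (+ 0) (u - φ w) → Stepped Q
      unramified w w∈ s∈ = record
        { Q′ = place′ ; T = T ; y-T∈ = y-T∈ ; target = target ; coeffs = pmap (λ {k} _ → coefficient₀ {k}) }
        where open PlaceStep S u∈ φy Q w w∈ 1 0 (ℕ.s≤s ℕ.z≤n) ℕ.z≤n (λ _ → ℕ.s≤s ℕ.z≤n) s∈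

      module Unramified {w : Carrier} (w∈ : R w) (s∈ : O (+ 0) (u - φ w)) where
        open PlaceStep S u∈ φy Q w w∈ 1 0 (ℕ.s≤s ℕ.z≤n) ℕ.z≤n (λ _ → ℕ.s≤s ℕ.z≤n) s∈ public using (T; T∈; O⊂′; place′)
        open Place place′ public using () renaming (O to O′)

        up : ∀ {i b} → O i b → O′ i b
        up {i} o = Place.at place′ (ℤₚ.*-identityˡ i) (O⊂′ o)

      u-φ0 : ∀ {i} → O i u → O i (u - φ 0#)
      u-φ0 = resp (sym (trans (+-congˡ (trans (-‿cong φ-0) -0#≈0#)) (+-identityʳ u)))

      y-0 : y - 0# ≈ y
      y-0 = trans (+-congˡ -0#≈0#) (+-identityʳ y)

    module After (Q′ : Place R′ φ₀) where
      open Place Q′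

      -- If y has a pole then u′ = y^{p+1} / φ(y) agrees with y up to a regular term.
      u′-y : O (+ 1) y⁻ → O (+ 0) (u′ - y)
      u′-y o = resp (sym eq) (neg (mul₀ a∈ (pow₀ p-2 (1⇒0 o))))
        where
        a = u′ * y⁻
        a≈ : a ≈ 1# - a * y⁻ ^ p-1
        a≈ = begin
          a ≈⟨ solve 2 (λ a z → a := a :* (:1 :+ z) :- a :* z) refl a (y⁻ ^ p-1) ⟩
          a * (1# + y⁻ ^ p-1) - a * y⁻ ^ p-1
            ≈⟨ +-congʳ (trans (*-assoc _ _ _) (trans (*-congˡ (sym (φ-factor y⁻))) u′u′⁻)) ⟩
          1# - a * y⁻ ^ p-1 ∎
        a∈ : O (+ 0) a
        a∈ = boot′ (S′.Rmul u′∈ y⁻∈) one (pow₁ p-1 0<p-1 o) a≈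
        eq : u′ - y ≈ - (a * y⁻ ^ p-2)
        eq = begin
          u′ - y ≈⟨ +-congˡ (-‿cong (trans (sym (*-identityʳ y)) (*-congˡ (sym u′u′⁻)))) ⟩
          u′ - y * (u′ * φ y⁻) ≈⟨ +-congˡ (-‿cong (*-congˡ (*-congˡ (φ-factor y⁻)))) ⟩
          u′ - y * (u′ * (y⁻ * (1# + y⁻ ^ p-1)))
            ≈⟨ solve 4 (λ u y z q → u :- y :* (u :* (z :* (:1 :+ q))) := u :- (y :* z) :* (u :+ u :* q)) refl u′ y y⁻ (y⁻ ^ p-1) ⟩
          u′ - (y * y⁻) * (u′ + u′ * y⁻ ^ p-1) ≈⟨ +-congˡ (-‿cong (trans (*-congʳ yy⁻) (*-identityˡ _))) ⟩
          u′ - (u′ + u′ * y⁻ ^ p-1) ≈⟨ +-congˡ (-‿cong (+-congˡ (*-congˡ (x^p-1 y⁻)))) ⟩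
          u′ - (u′ + u′ * (y⁻ * y⁻ ^ p-2)) ≈⟨ solve 3 (λ u z q → u :- (u :+ u :* (z :* q)) := :- ((u :* z) :* q)) refl u′ y⁻ (y⁻ ^ p-2) ⟩
          - (a * y⁻ ^ p-2) ∎

      ramState : O -[1+ 0 ] y → O (+ 1) y⁻ → State Q′ u′ u′⁻
      ramState o o⁻ = ram
        (resp (solve 2 (λ u y → (u :- y) :+ y := u) refl u′ y) (add (mono ℤ.-≤+ (u′-y o⁻)) o))
        (add (pow₁ p (ℕₚ.<-trans (ℕ.s≤s ℕ.z≤n) 1<p) o⁻) o⁻)

    -- Integral data stay integral and unramified. A simple pole of u ramifies totally and
    -- reproduces itself in u′. In the folded state y agrees with c z up to a regular term, so the
    -- step is unramified and the chain loses a link, until its end leaves a simple pole.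
    step : (Q : Place R φ₀) → State Q u u⁻ → Σ (Stepped Q) λ st → State (Stepped.Q′ st) u′ u′⁻
    step Q (int o o⁻) = unramified Q 0# R0 s∈ , int
        (mul₀ (pow₀ (suc p) y∈′) (up o⁻)) (add (pow₀ p y⁻∈′) y⁻∈′)
      where
      s∈ = u-φ0 Q o
      open Unramified Q R0 s∈
      open Place place′ using (mul₀; pow₀; add; resp; one)
      y∈′ : O′ (+ 0) y
      y∈′ = resp (y-0 Q) T∈
      y⁻∈′ : O′ (+ 0) y⁻
      y⁻∈′ = resp (sym y⁻≈) (mul₀ (add (pow₀ p-1 y∈′) one) (up o⁻))
    step Q (ram o o⁻) =
      record { Q′ = place′ ; T = T ; y-T∈ = y-T∈ ; target = target ; coeffs = pmap (λ {k} _ → coefficient₀ {k}) } ,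
      -- 1 / y = (y^(p-1) + 1) / u has order p - (p - 1) = 1 after rescaling.
      After.ramState place′ y∈′ (resp (sym y⁻≈) (resp (*-comm _ _) (at eq (mul (O⊂′ o⁻)
        (add (powℤ p-1 y∈′) (mono (ℤₚ.≤-trans (ℤₚ.≤-reflexive (≡.trans (ℤₚ.*-comm (+ p-1) -[1+ 0 ]) (ℤₚ.-1*i≡-i (+ p-1)))) (ℤₚ.neg-mono-≤ (ℤ.+≤+ {0} ℕ.z≤n))) one))))))
      where
      open PlaceStep S u∈ φy Q 0# R0 p 1 (ℕₚ.<-trans (ℕ.s≤s ℕ.z≤n) 1<p)
        (ℕₚ.≤-reflexive (≡.trans (ℕₚ.*-identityʳ p) (≡.sym (ℕₚ.*-identityˡ p)))) (λ lt → ≡.subst (ℕ._< p) (≡.sym (ℕₚ.*-identityˡ _)) lt) (u-φ0 Q o)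
      open Place place′ using (mul; powℤ; add; resp; one; mono; at)
      y∈′ : Place.O place′ -[1+ 0 ] y
      y∈′ = resp (y-0 Q) T∈
      eq : + p ℤ.* + 1 ℤ.+ + p-1 ℤ.* -[1+ 0 ] ≡ + 1
      eq = ≡.trans (≡.cong (λ q → + q ℤ.* + 1 ℤ.+ + p-1 ℤ.* -[1+ 0 ]) (≡.sym p≡))
        (ℤS.solve 1 (λ k → (ℤS.con (+ 1) ℤS.:+ k) ℤS.:* ℤS.con (+ 1) ℤS.:+ k ℤS.:* ℤS.con -[1+ 0 ] ℤS.:= ℤS.con (+ 1)) ≡.refl (+ p-1))
    step Q (fold {c} {c⁻} {z} {zs} cc⁻ c∈ c⁻∈ chain s∈ κ∈) = unramified Q (c * z) w∈ s∈ , next chain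
      where
      module Q = Place Q
      sm = small Q chain
      z⁻ = proj₁ sm
      zz⁻ = proj₁ (proj₂ sm)
      z⁻∈ = proj₁ (proj₂ (proj₂ sm))
      w∈ : R (c * z)
      w∈ = Rmul (Q.O⇒R c∈) (proj₂ (proj₂ (proj₂ sm)))
      open Unramified Q w∈ s∈
      open Place place′ using (mul₀; mul₀ʳ; add; sub; resp; mono; boot′)
      open After place′
      ε = T * (z⁻ * c⁻)
      zc∈ : O′ (+ 1) (z⁻ * c⁻)
      zc∈ = up (Q.mul₀ʳ z⁻∈ c⁻∈)
      y⁻∈′ : O′ (+ 1) y⁻
      y⁻∈′ = boot′ y⁻∈ zc∈ (mul₀ T∈ zc∈) (begin
        y⁻ ≈⟨ solve 3 (λ y⁻ zc t → y⁻ := y⁻ :* (:1 :+ t) :- y⁻ :* t) refl y⁻ (z⁻ * c⁻) ε ⟩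
        y⁻ * (1# + ε) - y⁻ * ε ≈⟨ +-congʳ (*-congˡ (+-congʳ (trans (sym (*-identityˡ 1#)) (*-cong (sym cc⁻) (sym zz⁻))))) ⟩
        y⁻ * ((c * c⁻) * (z * z⁻) + (y - c * z) * (z⁻ * c⁻)) - y⁻ * ε
          ≈⟨ +-congʳ (solve 6 (λ y⁻ c c⁻ z z⁻ y → y⁻ :* ((c :* c⁻) :* (z :* z⁻) :+ (y :- c :* z) :* (z⁻ :* c⁻)) := (y :* y⁻) :* (z⁻ :* c⁻)) refl y⁻ c c⁻ z z⁻ y) ⟩
        (y * y⁻) * (z⁻ * c⁻) - y⁻ * ε ≈⟨ +-congʳ (trans (*-congʳ yy⁻) (*-identityˡ _)) ⟩
        z⁻ * c⁻ - y⁻ * ε ∎)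
      next : PoleChain Q z zs → State place′ u′ u′⁻
      next (end _ z∈) = ramState (resp (solve 2 (λ y w → (y :- w) :+ w := y) refl y (c * z))
        (add (mono ℤ.-≤+ T∈) (mul₀ (up c∈) (up z∈)))) y⁻∈′
      -- Up to regular terms u′, y, c z and c φ(z′) agree, and c φ(z′) differs from φ(c z′) by (c -
      -- c^p) z′^p, regular by `a∈`. So the next coordinate of the chain takes over the role of z.
      next (link {z′ = z′} _ d∈ ch) = fold cc⁻ (up c∈) (up c⁻∈)
          (transport {Q = Q} {Q′ = place′} inR′ up up up ch)
          (resp eq (add (add (add (u′-y y⁻∈′) T∈) (up (Q.mul₀ c∈ d∈))) (up a∈))) (up a∈)
        where
        sm′ = small Q ch
        z′⁻ = proj₁ sm′
        z′z′⁻ = proj₁ (proj₂ sm′)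
        a = (c - c ^ p) * z′ ^ p
        d = z - φ z′
        κ = c - c ^ p
        back : ∀ {x x⁻} → x * x⁻ ≈ 1# → κ * x ≈ (κ * x ^ p) * x⁻ ^ p-1
        back {x} {x⁻} xx⁻ = begin
          κ * x ≈⟨ trans (*-congˡ (trans (sym (*-identityʳ x)) (*-congˡ (sym (unit-^ p-1 xx⁻))))) (solve 4 (λ k x a b → k :* (x :* (a :* b)) := (k :* (x :* a)) :* b) refl κ x (x ^ p-1) (x⁻ ^ p-1)) ⟩
          (κ * (x * x ^ p-1)) * x⁻ ^ p-1 ≈⟨ *-congʳ (*-congˡ (x^p x)) ⟨
          (κ * x ^ p) * x⁻ ^ p-1 ∎
        -- Multiply z = φ(z′) + d by κ: then a = κ z - κ d - κ z′. The first two terms are regular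
        -- and κ z′ is a times a positive power of 1 / z′, so bootstrapping applies.
        a∈ : Q.O (+ 0) a
        a∈ = Q.boot′ (Rmul κR (Rpow p (proj₂ (proj₂ (proj₂ sm′)))))
          (Q.sub (Q.resp (sym (back zz⁻)) (Q.mul₀ʳ κ∈ (Q.pow₀ p-1 (Q.1⇒0 z⁻∈)))) (Q.mul₀ (Q.sub c∈ (Q.pow₀ p c∈)) d∈))
          (Q.pow₁ p-1 0<p-1 (proj₁ (proj₂ (proj₂ sm′)))) (begin
            a ≈⟨ solve 4 (λ k z q x → k :* q := (k :* z :- k :* (z :- (q :+ x))) :- k :* x) refl κ z (z′ ^ p) z′ ⟩
            (κ * z - κ * d) - κ * z′ ≈⟨ +-congˡ (-‿cong (back z′z′⁻)) ⟩
            (κ * z - κ * d) - a * z′⁻ ^ p-1 ∎)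
          where κR = Rsub (Q.O⇒R c∈) (Rpow p (Q.O⇒R c∈))
        eq : (((u′ - y) + T) + c * d) + a ≈ u′ - φ (c * z′)
        eq = trans
          (solve 7 (λ u y c z z′ q cp → (((u :- y) :+ (y :- c :* z)) :+ c :* (z :- (q :+ z′))) :+ (c :- cp) :* q := u :- (cp :* q :+ c :* z′)) refl u′ y c z z′ (z′ ^ p) (c ^ p))
          (+-congˡ (-‿cong (+-congʳ (sym (^-distrib-* c z′ p)))))

-- The prime field inside the valued ring.

module Constants (V : ValuedRing) where
  open ValuedRing V
  open RingKit ring
  open Char prime char
  open Filtration filtration
  open Polynomials ring

  ι-inverse : ∀ n → ¬ p ℕ∣.∣ n → ∃ λ m → ι n * ι m ≈ 1#
  ι-inverse n p∤n with coprime-Bézout cop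
    where
    cop : Coprime p n
    cop {d} (d∣p , d∣n) with prime⇒irreducible prime d∣p
    ... | inj₁ d≡1 = d≡1
    ... | inj₂ ≡.refl = contradiction d∣n p∤n
  ... | Bézout.+- a b eq = b ℕ.* p-1 , (begin
      ι n * ι (b ℕ.* p-1) ≈⟨ *-congˡ (ι-* b p-1) ⟩
      ι n * (ι b * ι p-1) ≈⟨ solve 3 (λ n b q → n :* (b :* q) := (:1 :+ q) :* (n :* b) :- n :* b) refl (ι n) (ι b) (ι p-1) ⟩
      (1# + ι p-1) * (ι n * ι b) - ι n * ι b ≈⟨ +-cong (trans (*-congʳ (trans (sym (ι-suc p-1)) (trans (reflexive (≡.cong ι p≡)) char))) (zeroˡ _)) (-‿cong (trans (*-comm _ _) (sym (ι-* b n)))) ⟩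
      0# - ι (b ℕ.* n) ≈⟨ solve 1 (λ z → :0 :- z := :1 :- (:1 :+ z)) refl (ι (b ℕ.* n)) ⟩
      1# - (1# + ι (b ℕ.* n)) ≈⟨ +-congˡ (-‿cong (trans (sym (ι-suc (b ℕ.* n))) (trans (reflexive (≡.cong ι eq)) (ι-∣ (a ℕ.* p) (ℕ∣.n∣m*n a))))) ⟩
      1# - 0# ≈⟨ solve 0 (:1 :- :0 := :1) refl ⟩
      1# ∎)
    where
    p-1 = ℕ.pred p
    p≡ : suc p-1 ≡ p
    p≡ = ℕₚ.suc-pred p {{ℕ.>-nonZero (ℕₚ.<-trans (ℕ.s≤s ℕ.z≤n) 1<p)}}
  ... | Bézout.-+ a b eq = b , (begin
      ι n * ι b ≈⟨ trans (*-comm _ _) (sym (ι-* b n)) ⟩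
      ι (b ℕ.* n) ≡⟨ ≡.cong ι (≡.sym eq) ⟩
      ι (1 ℕ.+ a ℕ.* p) ≈⟨ trans (ι-suc (a ℕ.* p)) (+-congˡ (ι-∣ (a ℕ.* p) (ℕ∣.n∣m*n a))) ⟩
      1# + 0# ≈⟨ +-identityʳ 1# ⟩
      1# ∎)

  ι∈⇒∣ : ∀ n → O (+ 1) (ι n) → p ℕ∣.∣ n
  ι∈⇒∣ n o with p ℕ∣.∣? n
  ... | yes d = d
  ... | no nd = contradiction (resp (proj₂ (ι-inverse n nd)) (mul₀ʳ o (constant (proj₁ (ι-inverse n nd))))) 1∉

  Constant : Carrier → Set
  Constant c = ∃ λ n → c ≈ ι n

  constants : Subring Constant
  constants = record
    { Rresp = λ { e (n , h) → n , trans (sym e) h }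
    ; R0 = 0 , refl
    ; R1 = 1 , refl
    ; Radd = λ { (m , h) (n , h′) → m ℕ.+ n , trans (+-cong h h′) (sym (ι-+ m n)) }
    ; Rneg = λ { {a} (n , h) → ℕ.pred p ℕ.* n , trans (-‿cong h) (sym (begin
        ι (ℕ.pred p ℕ.* n) ≈⟨ ι-* (ℕ.pred p) n ⟩
        ι (ℕ.pred p) * ι n ≈⟨ solve 2 (λ q n → q :* n := (:1 :+ q) :* n :- n) refl (ι (ℕ.pred p)) (ι n) ⟩
        (1# + ι (ℕ.pred p)) * ι n - ι n ≈⟨ +-congʳ (trans (*-congʳ (trans (sym (ι-suc (ℕ.pred p))) (trans (reflexive (≡.cong ι (ℕₚ.suc-pred p {{ℕ.>-nonZero (ℕₚ.<-trans (ℕ.s≤s ℕ.z≤n) 1<p)}}))) char))) (zeroˡ _)) ⟩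
        0# - ι n ≈⟨ +-identityˡ _ ⟩
        - ι n ∎)) }
    ; Rmul = λ { (m , h) (n , h′) → m ℕ.* n , trans (*-cong h h′) (sym (ι-* m n)) } }

  constant∈⇒≈0 : ∀ {c} → Constant c → O (+ 1) c → c ≈ 0#
  constant∈⇒≈0 (n , e) o = trans e (ι-∣ n (ι∈⇒∣ n (resp e o)))

  digit : Fin.Fin p → Carrier
  digit i = ι (Fin.toℕ i)

  ι-injective : ∀ a b → a ℕ.≤ b → b ℕ.< p → ι a ≈ ι b → a ≡ b
  ι-injective a b le lt e with ℕₚ.m≤n⇒∃[o]m+o≡n le
  ... | zero , ≡.refl = ≡.sym (ℕₚ.+-identityʳ a)
  ... | suc d , ≡.refl = contradiction (ℕ∣.∣⇒≤ (ι∈⇒∣ (suc d) (resp (begin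
          0# ≈⟨ -‿inverseʳ (ι a) ⟨
          ι a - ι a ≈⟨ +-congʳ (trans e (ι-+ a (suc d))) ⟩
          ι a + ι (suc d) - ι a ≈⟨ solve 2 (λ a d → a :+ d :- a := d) refl (ι a) (ι (suc d)) ⟩
          ι (suc d) ∎) zer))) (ℕₚ.<⇒≱ (ℕₚ.≤-<-trans (ℕₚ.m≤n+m (suc d) a) lt))

  digit-injective : ∀ {i j} → digit i ≈ digit j → i ≡ j
  digit-injective {i} {j} e with ℕₚ.≤-total (Fin.toℕ i) (Fin.toℕ j)
  ... | inj₁ le = Finₚ.toℕ-injective (ι-injective _ _ le (Finₚ.toℕ<n j) e)
  ... | inj₂ le = ≡.sym (Finₚ.toℕ-injective (ι-injective _ _ le (Finₚ.toℕ<n i) (sym e)))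

-- Polynomials over the prime field and division by monic ones.

module PolynomialRing (V : ValuedRing) where
  open ValuedRing V
  open RingKit ring
  open Char prime char
  open Polynomials ring
  open Constants V

  module _ (x : Carrier) where
    open Adjoin constants x

    Dcast : ∀ {m n f} → m ≡ n → Deg m f → Deg n f
    Dcast ≡.refl d = d

    Deg-shift : ∀ {m f} k → Deg m f → Deg (m ℕ.+ k) (f * x ^ k)
    Deg-shift {m} {f} zero d = Dcast (≡.sym (ℕₚ.+-identityʳ m)) (presp (sym (*-identityʳ f)) d)
    Deg-shift {m} {f} (suc k) d = Dcast (≡.sym (ℕₚ.+-suc m k))
      (presp (trans (*-assoc f _ x) (*-congˡ (*-comm _ x))) (Dshift (Deg-shift k d)))

    Deg-mul : ∀ {m n f g} → Deg m f → Deg n g → Deg (m ℕ.+ n) (f * g)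
    Deg-mul {m} d (nil e) = presp (sym (trans (*-congˡ e) (zeroʳ _))) (pzero (m ℕ.+ 0))
    Deg-mul {m} {suc n} {f} d (snoc {g = g} {c} h cc e) = Dcast (≡.sym (ℕₚ.+-suc m n)) (presp
      (sym (trans (*-congˡ e) (solve 4 (λ f g a z → f :* (g :+ a :* z) := f :* g :+ a :* (f :* z)) refl f g c (x ^ n))))
      (psuc (padd (Deg-mul d h) (Dscale cc (Deg-shift n d)))))

    Pol : Carrier → Set
    Pol f = ∃ λ m → Deg m f

    pol : Subring Pol
    pol = record
      { Rresp = λ { e (m , d) → m , presp e d } ; R0 = 0 , pzero 0 ; R1 = 1 , Dconst (Subring.R1 constants)
      ; Radd = λ { (m , d) (n , d′) → m ℕ.+ n , padd (p≤ (ℕₚ.m≤m+n m n) d) (p≤ (ℕₚ.m≤n+m n m) d′) }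
      ; Rneg = λ { (m , d) → m , pneg d }
      ; Rmul = λ { (_ , d) (_ , d′) → _ , Deg-mul d d′ } }

    x∈Pol : Pol x
    x∈Pol = 2 , presp (trans (*-identityˡ _) (*-identityʳ x)) (monomial 1 (Subring.R1 constants))

    Deg-x^ : ∀ k → Deg (suc k) (x ^ k)
    Deg-x^ k = presp (*-identityˡ _) (monomial k (Subring.R1 constants))

    MonicPol : ℕ → Carrier → Set
    MonicPol d M = Deg d (M - x ^ d)

    monic⇒Deg : ∀ {d M} → MonicPol d M → Deg (suc d) M
    monic⇒Deg {d} {M} h = presp (solve 2 (λ m z → (m :- z) :+ z := m) refl M (x ^ d)) (padd (psuc h) (Deg-x^ d))

    module Division {d : ℕ} {M : Carrier} (monicM : MonicPol d M) where

      private
        module P = Subring pol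

      divMod-x^ : ∀ m → Σ Carrier λ q → Σ Carrier λ r → Pol q × Deg d r × x ^ m ≈ q * M + r
      divStep : ∀ {f} → Deg (suc d) f → Σ Carrier λ q → Σ Carrier λ r → Pol q × Deg d r × f ≈ q * M + r
      divStep (snoc {g = g} {c} h cc e) = c , g - c * (M - x ^ d) , (1 , Dconst cc) , psub h (Dscale cc monicM) ,
        trans e (solve 4 (λ g c z m → g :+ c :* z := c :* m :+ (g :- c :* (m :- z))) refl g c (x ^ d) M)
      divMod-x^ zero with divStep (p≤ (ℕ.s≤s ℕ.z≤n) (Deg-x^ 0))
      ... | r = r
      divMod-x^ (suc m) with divMod-x^ m
      ... | q , r , q∈ , r∈ , e with divStep (Dshift r∈)
      ... | q′ , r′ , q′∈ , r′∈ , e′ = x * q + q′ , r′ , P.Radd (P.Rmul x∈Pol q∈) q′∈ , r′∈ ,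
        trans (*-congˡ e) (trans (solve 4 (λ x q m r → x :* (q :* m :+ r) := (x :* q) :* m :+ r :* x) refl x q M r)
          (trans (+-congˡ e′) (solve 4 (λ a m b c → a :* m :+ (b :* m :+ c) := (a :+ b) :* m :+ c) refl (x * q) M q′ r′)))

      divMod : ∀ {m f} → Deg m f → Σ Carrier λ q → Σ Carrier λ r → Pol q × Deg d r × f ≈ q * M + r
      divMod (nil e) = 0# , 0# , (0 , pzero 0) , pzero d , trans e (solve 1 (λ m → :0 := :0 :* m :+ :0) refl M)
      divMod {suc m} (snoc {g = g} {c} h cc e) with divMod h | divMod-x^ m
      ... | q , r , q∈ , r∈ , e₁ | q′ , r′ , q′∈ , r′∈ , e₂ = q + c * q′ , r + c * r′ ,
        P.Radd q∈ (P.Rmul (1 , Dconst cc) q′∈) , padd r∈ (Dscale cc r′∈) ,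
        trans e (trans (+-cong e₁ (*-congˡ e₂)) (solve 6 (λ q m r c q′ r′ → (q :* m :+ r) :+ c :* (q′ :* m :+ r′) := (q :+ c :* q′) :* m :+ (r :+ c :* r′)) refl q M r c q′ r′))

    monic-mul : ∀ {d e M M′} → MonicPol d M → MonicPol e M′ → MonicPol (d ℕ.+ e) (M * M′)
    monic-mul {d} {e} {M} {M′} h h′ = presp
      (trans (solve 4 (λ m a n b → (m :- a) :* (n :- b) :+ (m :- a) :* b :+ (n :- b) :* a := m :* n :- a :* b) refl M (x ^ d) M′ (x ^ e))
        (+-congˡ (-‿cong (sym (^-homo-* x d e)))))
      (padd (padd (Deg-mul h h′) (Deg-shift e h)) (Dcast (ℕₚ.+-comm e d) (Deg-shift d h′)))

    monic-pow : ∀ {d M} k → MonicPol d M → MonicPol (k ℕ.* d) (M ^ k)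
    monic-pow zero h = nil (-‿inverseʳ 1#)
    monic-pow (suc k) h = monic-mul h (monic-pow k h)

-- Levels of the tower

module Tower (V : ValuedRing) where
  open ValuedRing V using (ring; p; prime; char; filtration; exhaustive; separated)
  open RingKit ring
  open Char prime char
  open Polynomials ring
  open Places V
  open Localisation V
  open States V
  open AtInfinity V
  module ∞ = Filtration filtration

  -- Simultaneous approximation: H¹ = 0 for the divisor given by the targets.
  Approx : (Carrier → Set) → {𝕀 : Set} → (𝕀 → Carrier → Set) → Set
  Approx R {𝕀} tgt = (h : 𝕀 → Carrier) → (∀ i → R (h i)) → Σ Carrier λ a → R a × (∀ i → tgt i (a - h i))

  data Ix (I : Set) : Set where
    pl        : I → Ix I
    zz gg inf : Ix I

  evalTuple : ∀ {A : Set} → (A → Carrier) → Carrier → ∀ m → Tuple A m → Carrier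
  evalTuple f y zero _ = 0#
  evalTuple f y (suc m) (t , a) = evalTuple f y m t + f a * y ^ m

  -- The congruences x^(p²) = x for generators and u^p = u modulo Π express that the roots of Π
  -- split completely. `Code` with `elem-inj` bounds the size of R / Π from below, which later
  -- yields many residue rings. `generate` is induction over R, independent of how R was built.
  record Reduction (R₀ : Carrier → Set) (Π⁻ : Carrier) (R : Carrier → Set) (u : Carrier) : Set₁ where
    field
      R₀⊂R     : ∀ {f} → R₀ f → R f
      gens     : List Carrier
      gens∈    : All R gens
      generate : ∀ {R″ : Carrier → Set} → Subring R″ → (∀ {f} → R₀ f → R″ f) → All R″ gens → ∀ {f} → R f → R″ f
      dec      : ∀ {f} → R f → Dec (R (Π⁻ * f))
      Code     : Set
      size     : ℕ
      finite   : Finite Code size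
      elem     : Code → Carrier
      elem∈    : ∀ c → R (elem c)
      elem-inj : ∀ {c d} → R (Π⁻ * (elem c - elem d)) → c ≡ d
      gensFrob : All (λ x → R (Π⁻ * ((x ^ p) ^ p - x))) gens
      uFrob    : R (Π⁻ * (u ^ p - u))

  -- Norm over trace is again fixed by Frobenius: the defect of y^(p+1) / u is a combination of the
  -- defect of y under the square of Frobenius and that of u under Frobenius.
  frobenius-defect : ∀ {u u⁻} z y → u * u⁻ ≈ 1# →
    ((y ^ p * u⁻ ^ p) * (z * ((y ^ p) ^ p - y))) + - ((y ^ suc p * (u⁻ * u⁻ ^ p)) * (z * (u ^ p - u))) ≈ z * ((y ^ suc p * u⁻) ^ p - y ^ suc p * u⁻)
  frobenius-defect {u} {u⁻} z y uu⁻ = begin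
      ((a * b) * (z * (a ^ p - y))) + - (((y * a) * (u⁻ * b)) * (z * (u ^ p - u)))
        ≈⟨ solve 7 (λ a b z A y q d → ((a :* b) :* (z :* (A :- y))) :+ (:- (((y :* a) :* q) :* (z :* d))) := z :* ((a :* b) :* (A :- y) :- (y :* a) :* (q :* d))) refl a b z (a ^ p) y (u⁻ * b) (u ^ p - u) ⟩
      z * ((a * b) * (a ^ p - y) - (y * a) * ((u⁻ * b) * (u ^ p - u)))
        ≈⟨ *-congˡ (+-congˡ (-‿cong (*-congˡ (sym inv)))) ⟩
      z * ((a * b) * (a ^ p - y) - (y * a) * (u⁻ - b))
        ≈⟨ *-congˡ (solve 5 (λ a b A y u⁻ → (a :* b) :* (A :- y) :- (y :* a) :* (u⁻ :- b) := (a :* A) :* b :- (y :* a) :* u⁻) refl a b (a ^ p) y u⁻) ⟩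
      z * ((a * a ^ p) * b - (y * a) * u⁻)
        ≈⟨ *-congˡ (+-congʳ (trans (*-congʳ (sym (^-distrib-* y a p))) (sym (^-distrib-* (y * a) u⁻ p)))) ⟩
      z * ((y ^ suc p * u⁻) ^ p - y ^ suc p * u⁻) ∎
    where
    a = y ^ p
    b = u⁻ ^ p
    inv : u⁻ - b ≈ (u⁻ * b) * (u ^ p - u)
    inv = begin
      u⁻ - b ≈⟨ +-cong (trans (sym (*-identityʳ u⁻)) (*-congˡ (sym (unit-^ p uu⁻)))) (-‿cong (trans (sym (*-identityʳ b)) (*-congˡ (sym uu⁻)))) ⟩
      u⁻ * (u ^ p * b) - b * (u * u⁻) ≈⟨ solve 4 (λ u⁻ b v u → u⁻ :* (v :* b) :- b :* (u :* u⁻) := (u⁻ :* b) :* (v :- u)) refl u⁻ b (u ^ p) u ⟩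
      (u⁻ * b) * (u ^ p - u) ∎

  module _ (φ₀ M⁻ : Carrier) (K₀ : ℤ) where

    -- The bound P - K₀ at infinity is the one that survives a step: multiplication by y^k with k <
    -- p takes order p P′ - K₀ to at least P′ - K₀.
    targets : ∀ {R : Carrier → Set} {I : Set} → (I → Place R φ₀) → Place R φ₀ → ℕ → Ix I → Carrier → Set
    targets Q Z P (pl i) a = Place.Target (Q i) a
    targets Q Z P zz a = Place.Target Z a
    targets {R} Q Z P gg a = R (M⁻ * a)
    targets Q Z P inf a = ∞.O (+ P ℤ.- K₀) a

    -- `Zp` is the place where all coordinates so far vanish. It is the one cut in two at the next
    -- step, into a new such place and a place that enters `I` in the folded state. `approx` and
    -- `regular⇒0` stand for the vanishing of H¹ and H⁰ of suitable divisors.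
    record Stage {R : Carrier → Set} (S : Subring R) (x x⁻ u u⁻ : Carrier) (P : ℕ) : Set₁ where
      field
        xx⁻    : x * x⁻ ≈ 1#
        u∈     : R u
        u⁻∈    : R u⁻
        uu⁻    : u * u⁻ ≈ 1#
        u⁻≈    : u⁻ ≈ φ x⁻
        rounds : Rounds R P
        I      : Set
        place  : I → Place R φ₀
        state  : ∀ i → State (place i) u u⁻
        Zp     : Place R φ₀
        zeroAt : Zero Zp x x⁻
        approx : Approx R (targets place Zp P)
        regular⇒0 : ∀ {f} → R f → (∀ i → Place.O (place i) (+ 0) f) → Place.O Zp (+ 0) f → ∞.O (+ 1) f → f ≈ 0#

    splitApprox : ∀ {R : Carrier → Set} (S : Subring R) {I} (Q : I → Place R φ₀) (Z QZ QB : Place R φ₀) (P : ℕ) →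
      (∀ {a} → Place.Target Z a → Place.Target QZ a) → (∀ {a} → Place.Target Z a → Place.Target QB a) →
      (∀ {hZ hB} → R hZ → R hB → Σ Carrier λ h → R h × Place.Target QZ (h - hZ) × Place.Target QB (h - hB)) →
      Approx R (targets Q Z P) → Approx R (targets (maybe′ Q QB) QZ P)
    splitApprox {R} S {I} Q Z QZ QB P ZZ ZB separate ap h r = a , ra , near
      where
      sep = separate (r zz) (r (pl nothing))
      h′ : Ix I → Carrier
      h′ (pl i) = h (pl (just i))
      h′ zz = proj₁ sep
      h′ gg = h gg
      h′ inf = h inf
      r′ : ∀ i → R (h′ i)
      r′ (pl i) = r (pl (just i))
      r′ zz = proj₁ (proj₂ sep)
      r′ gg = r gg
      r′ inf = r inf
      res = ap h′ r′
      a = proj₁ res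
      ra = proj₁ (proj₂ res)
      chain : ∀ b c → (a - b) + (b - c) ≈ a - c
      chain b c = solve 3 (λ a b c → (a :- b) :+ (b :- c) := a :- c) refl a b c
      near : ∀ i → targets (maybe′ Q QB) QZ P i (a - h i)
      near (pl (just i)) = proj₂ (proj₂ res) (pl i)
      near (pl nothing) = Place.resp QB (chain _ _) (Place.add QB (ZB (proj₂ (proj₂ res) zz)) (proj₂ (proj₂ (proj₂ sep))))
      near zz = Place.resp QZ (chain _ _) (Place.add QZ (ZZ (proj₂ (proj₂ res) zz)) (proj₁ (proj₂ (proj₂ sep))))
      near gg = proj₂ (proj₂ res) gg
      near inf = proj₂ (proj₂ res) inf

    module NextStage {R : Carrier → Set} {S : Subring R} {x x⁻ u u⁻ : Carrier} {P : ℕ} (L : Stage S x x⁻ u u⁻ P)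
      {y y⁻ : Carrier} (yy⁻ : y * y⁻ ≈ 1#) (φy : φ y ≈ u)
      (P′ : ℕ) .{{_ : NonZero P′}} (P≡ : P ≡ p ℕ.* P′) (y∈∞ : ∞.O (ℤ.- + P′) y) (y⁻∈∞ : ∞.O (+ P′) y⁻) where

      open Stage L
      open Step S {φ₀ = φ₀} u∈ u⁻∈ uu⁻ φy yy⁻
      open Subring S
      open NoCancellation S P′ (≡.subst (Rounds R) P≡ rounds) y y⁻ yy⁻ y∈∞ y⁻∈∞
      open Adjoin S y

      unsnoc : ∀ {Co : ℕ → Carrier → Set} {y m f} → Poly Co y (suc m) f →
        Σ Carrier λ a → Σ Carrier λ g → Co m a × Poly Co y m g × f ≈ g + a * y ^ m
      unsnoc (snoc d c e) = _ , _ , c , d , e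

      module Coordinate (T : Carrier) (y-T∈ : R (y - T)) where
        T-y∈ : R (T - y)
        T-y∈ = Rresp (solve 2 (λ y t → :- (y :- t) := t :- y) refl y T) (Rneg y-T∈)
        module toT = Rebase S y T y-T∈
        module toY = Rebase S T y T-y∈

        dropTop : ∀ {Co : Carrier → Set} → (∀ {a} → Co a → R a) → Group (λ _ → Co) → ∀ {k f} → k ℕ.< p → Poly (λ _ → Co) T (suc k) f → Deg k f → Poly (λ _ → Co) T k f
        dropTop inc G {k} {f} lt (snoc {g = g} {b} d c e) h = PolyGroup.presp G (sym (trans e (trans (+-congˡ (trans (*-congʳ b≈0) (zeroˡ _))) (+-identityʳ g)))) d
          where
          rest : Deg k (g + b * (T ^ k - y ^ k) - f)
          rest = psub (padd (toY.rebase (pmap (λ _ → inc) d)) (Dscale (inc c) (toY.power k))) h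
          b≈0 : b ≈ 0#
          b≈0 = top≈0 rest (inc c) lt (trans (solve 5 (λ g b t y f → (g :+ b :* (t :- y) :- f) :+ b :* y := (g :+ b :* t) :- f) refl g b (T ^ k) (y ^ k) f) (≈⇒-≈0 (sym e)))

        -- By independence of the powers of y the coefficients of T^k with k > m vanish. Then the
        -- coefficients of T^m and y^m agree, since T and y differ by an element of R. This is how
        -- local information reaches a global leading coefficient.
        leading : ∀ {Co : Carrier → Set} → (∀ {a} → Co a → R a) → Group (λ _ → Co) → ∀ {m f g a} → m ℕ.< p →
          Poly (λ _ → Co) T p f → Deg m g → R a → f ≈ g + a * y ^ m → Co a
        leading {Co} inc G {m} {f} {g} {a} lt d dg ra e = Group.Cresp G {m} b≈a cb
          where
          df : Deg (suc m) f
          df = snoc dg ra e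
          descend : ∀ k → suc m ℕ.≤′ k → k ℕ.≤ p → Poly (λ _ → Co) T k f → Poly (λ _ → Co) T (suc m) f
          descend _ ℕ.≤′-refl _ q = q
          descend (suc k) (ℕ.≤′-step le) k<p q = descend k le (ℕₚ.<⇒≤ k<p) (dropTop inc G k<p q (p≤ (ℕₚ.≤′⇒≤ le) df))
          un = unsnoc (descend p (ℕₚ.≤⇒≤′ lt) ℕₚ.≤-refl d)
          b = proj₁ un
          g′ = proj₁ (proj₂ un)
          cb = proj₁ (proj₂ (proj₂ un))
          b≈a : b ≈ a
          b≈a = -≈0⇒≈ (top≈0
            (psub (padd (toY.rebase (pmap (λ _ → inc) (proj₁ (proj₂ (proj₂ (proj₂ un)))))) (Dscale (inc cb) (toY.power m))) dg)
            (Rsub (inc cb) ra) lt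
            (trans (solve 6 (λ g′ b t y g a → (g′ :+ b :* (t :- y) :- g) :+ (b :- a) :* y := (g′ :+ b :* t) :- (g :+ a :* y)) refl g′ b (T ^ m) (y ^ m) g a)
              (≈⇒-≈0 (trans (sym (proj₂ (proj₂ (proj₂ (proj₂ un))))) e))))

      -- Induction on the degree. One α in R approximates the leading coefficients in all local
      -- coordinates simultaneously; α y^m is expanded in each T i and its lower terms are moved
      -- into the remaining problem.
      approxStep : ∀ {𝕀} (tgt tgt′ : 𝕀 → Carrier → Set) (T : 𝕀 → Carrier) → (∀ i → R (y - T i)) →
        (∀ i {a b} → a ≈ b → tgt′ i a → tgt′ i b) → (∀ i → tgt′ i 0#) → (∀ i {a b} → tgt′ i a → tgt′ i b → tgt′ i (a + b)) →
        (∀ i {k b} → k ℕ.< p → tgt i b → tgt′ i (b * T i ^ k)) → Approx R tgt → Approx R′ tgt′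
      approxStep {𝕀} tgt tgt′ T y-T∈ resp′ zer′ add′ mulT ap = go p ℕₚ.≤-refl
        where
        go : ∀ m → m ℕ.≤ p → (h : 𝕀 → Carrier) → (∀ i → Deg m (h i)) → Σ Carrier λ a → Deg m a × (∀ i → tgt′ i (a - h i))
        go zero le h d = 0# , pzero 0 , λ i → resp′ i (sym (trans (+-identityˡ _) (trans (-‿cong (nil≈ (d i))) -0#≈0#))) (zer′ i)
          where
          nil≈ : ∀ {f} → Deg zero f → f ≈ 0#
          nil≈ (nil e) = e
        go (suc m) le h d = a′ + α * y ^ m , snoc (proj₁ (proj₂ rec)) α∈ refl , near
          where
          module C i = Coordinate (T i) (y-T∈ i)
          un = λ i → unsnoc (C.toT.rebase i (d i))
          b = λ i → proj₁ (un i)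
          g = λ i → proj₁ (proj₂ (un i))
          ra = ap b (λ i → proj₁ (proj₂ (proj₂ (un i))))
          α = proj₁ ra
          α∈ = proj₁ (proj₂ ra)
          rec = go m (ℕₚ.<⇒≤ le) (λ i → g i + α * (T i ^ m - y ^ m))
            (λ i → padd (C.toY.rebase i (proj₁ (proj₂ (proj₂ (proj₂ (un i)))))) (Dscale α∈ (C.toY.power i m)))
          a′ = proj₁ rec
          near : ∀ i → tgt′ i ((a′ + α * y ^ m) - h i)
          near i = resp′ i
            (trans (solve 6 (λ a′ α y g t b → (a′ :- (g :+ α :* (t :- y))) :+ (α :- b) :* t := (a′ :+ α :* y) :- (g :+ b :* t)) refl a′ α (y ^ m) (g i) (T i ^ m) (b i))
              (+-congˡ (-‿cong (sym (proj₂ (proj₂ (proj₂ (proj₂ (un i)))))))))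
            (add′ i (proj₂ (proj₂ rec) i) (mulT i le (proj₂ (proj₂ ra) i)))

      stepped : ∀ i → Σ (Stepped (place i)) λ st → State (Stepped.Q′ st) u′ u′⁻
      stepped i = step (place i) (state i)

      module Q i = Stepped (proj₁ (stepped i))

      module ZP = Place Zp
      open Zero zeroAt renaming (x∈ to xZ; chain to chainZ)

      private
        0<p = ℕₚ.<-trans (ℕ.s≤s ℕ.z≤n) 1<p

      x⁻R : R x⁻
      x⁻R = proj₂ (proj₂ (proj₂ (small Zp chainZ)))

      -- Rewriting u φ(1 / x) = 1 as u / x^p = 1 - (u / x^p) x^(p-1) allows bootstrapping: u
      -- vanishes at least like x^p.
      uz^p∈ : ZP.O (+ 0) (u * x⁻ ^ p)
      uz^p∈ = ZP.boot′ (Rmul u∈ (Rpow p x⁻R)) ZP.one (ZP.pow₁ p-1 0<p-1 xZ) (begin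
        u * x⁻ ^ p ≈⟨ solve 3 (λ u z q → u :* z := u :* (z :+ q) :- u :* q) refl u (x⁻ ^ p) x⁻ ⟩
        u * φ x⁻ - u * x⁻ ≈⟨ +-cong (trans (*-congˡ (sym u⁻≈)) uu⁻) (-‿cong (begin
          u * x⁻ ≈⟨ *-congˡ (trans (sym (*-identityʳ x⁻)) (*-congˡ (sym (unit-^ p-1 xx⁻)))) ⟩
          u * (x⁻ * (x ^ p-1 * x⁻ ^ p-1)) ≈⟨ solve 4 (λ u z a b → u :* (z :* (a :* b)) := (u :* (z :* b)) :* a) refl u x⁻ (x ^ p-1) (x⁻ ^ p-1) ⟩
          (u * (x⁻ * x⁻ ^ p-1)) * x ^ p-1 ≈⟨ *-congʳ (*-congˡ (sym (x^p x⁻))) ⟩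
          (u * x⁻ ^ p) * x ^ p-1 ∎)) ⟩
        1# - (u * x⁻ ^ p) * x ^ p-1 ∎)

      u∈Z : ZP.O (+ 1) u
      u∈Z = ZP.resp (trans (*-assoc u _ _) (trans (*-congˡ (trans (*-comm _ _) (unit-^ p xx⁻))) (*-identityʳ u))) (ZP.mul₀ uz^p∈ (ZP.pow₁ p 0<p xZ))

      -- Since u has a zero, y is integral here and y (y^(p-1) + 1) = u vanishes. The fat place is
      -- afterwards cut into y = 0 and y^(p-1) = -1.
      fat : Stepped Zp
      fat = unramified Zp 0# R0 (u-φ0 Zp (ZP.1⇒0 u∈Z))
      module F = Stepped fat
      module FP = Place F.Q′
      open Unramified Zp R0 (u-φ0 Zp (ZP.1⇒0 u∈Z)) using (up; T∈)

      s : Carrier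
      s = y ^ p-1 + 1#

      yF : FP.O (+ 0) y
      yF = FP.resp (y-0 Zp) T∈

      sy∈ : FP.O (+ 1) (s * y)
      sy∈ = FP.resp (sym (trans (*-comm _ _) (trans (*-congˡ (+-comm _ _)) (trans (sym (φ-factor y)) φy)))) (up u∈Z)

      open Split S′ F.Q′ s y (FP.add (FP.pow₀ p-1 yF) FP.one) yF (- (y ^ p-2)) (FP.neg (FP.pow₀ p-2 yF))
        (trans (+-congʳ (+-congʳ (x^p-1 y))) (solve 2 (λ y q → (y :* q :+ :1) :+ (:- q) :* y := :1) refl y (y ^ p-2))) sy∈

      toZ : ∀ {i f} → FP.O i f → Place.O QZ i f
      toZ = localise-∈ S′ F.Q′ (FP.add (FP.pow₀ p-1 yF) FP.one)
      toB : ∀ {i f} → FP.O i f → Place.O QB i f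
      toB = localise-∈ S′ F.Q′ yF

      zero′ : Zero QZ y y⁻
      zero′ = record { x∈ = y∈Z ; zs = x⁻ ∷ zs ; chain = link (y , trans (*-comm _ _) yy⁻ , y∈Z , y⁻∈)
          (S′.Rsub y⁻∈ (S′.Rresp u⁻≈ (inR′ u⁻∈)) , 1 , FP.resp (begin
            y ^ p-2 ≈⟨ trans (sym (*-identityʳ _)) (*-congˡ (sym yy⁻)) ⟩
            y ^ p-2 * (y * y⁻) ≈⟨ solve 3 (λ q y z → q :* (y :* z) := (y :* q) :* z) refl (y ^ p-2) y y⁻ ⟩
            (y * y ^ p-2) * y⁻ ≈⟨ *-cong (sym (x^p-1 y)) y⁻≈ ⟩
            y ^ p-1 * (s * u⁻) ≈⟨ solve 2 (λ q u → q :* ((q :+ :1) :* u) := ((q :+ :1) :* :1) :* ((q :+ :1) :* u :- u)) refl (y ^ p-1) u⁻ ⟩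
            (s * 1#) * (s * u⁻ - u⁻) ≈⟨ *-congˡ (+-cong (sym y⁻≈) (-‿cong u⁻≈)) ⟩
            s ^ 1 * (y⁻ - φ x⁻) ∎) (FP.pow₀ p-2 yF))
          (transport {Q = Zp} {Q′ = QZ} inR′ (λ o → toZ (up o)) (λ o → toZ (up o)) (λ o → toZ (up o)) chainZ) }

      -- Here a pole is born, with 1 / x as its mirror. For c = y^(p+1) the difference of u′ = c φ(1
      -- / x) and φ(c / x) is (c - c^p) / x^p. Now c - c^p is a regular multiple of u, and u / x^p
      -- is regular.
      stateB : State QB u′ u′⁻
      stateB = fold {c = y ^ suc p} {c⁻ = y⁻ ^ suc p} (unit-^ (suc p) yy⁻) (toB (FP.pow₀ (suc p) yF)) (Place.pow₀ QB (suc p) y⁻B)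
          (transport {Q = Zp} {Q′ = QB} inR′ (λ o → toB (up o)) (λ o → toB (up o)) (λ o → toB (up o)) chainZ)
          (Place.resp QB eq κ∈) κ∈
        where
        c = y ^ suc p
        y⁻B : Place.O QB (+ 0) y⁻
        y⁻B = y⁻∈ , 1 , FP.resp (sym (trans (*-congʳ (*-identityʳ y)) yy⁻)) FP.one
        c^p : c ^ p ≈ (u - y) * (u ^ p - (u - y))
        c^p = begin
          (y * y ^ p) ^ p ≈⟨ ^-distrib-* y (y ^ p) p ⟩
          y ^ p * (y ^ p) ^ p ≈⟨ *-cong y^p≈ (trans (^-congˡ p y^p≈) (frob-- u y)) ⟩
          (u - y) * (u ^ p - y ^ p) ≈⟨ *-congˡ (+-congˡ (-‿cong y^p≈)) ⟩
          (u - y) * (u ^ p - (u - y)) ∎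
        κ≈ : c - c ^ p ≈ ((u - y) * (1# - u ^ p-1)) * u
        κ≈ = begin
          y * y ^ p - c ^ p ≈⟨ +-cong (*-congˡ y^p≈) (-‿cong (trans c^p (*-congˡ (+-congʳ (x^p u))))) ⟩
          y * (u - y) - (u - y) * (u * u ^ p-1 - (u - y)) ≈⟨ solve 3 (λ y u q → y :* (u :- y) :- (u :- y) :* (u :* q :- (u :- y)) := ((u :- y) :* (:1 :- q)) :* u) refl y u (u ^ p-1) ⟩
          ((u - y) * (1# - u ^ p-1)) * u ∎
        κ∈ : Place.O QB (+ 0) ((c - c ^ p) * x⁻ ^ p)
        κ∈ = toB (FP.resp (sym (trans (*-congʳ κ≈) (*-assoc _ u _)))
          (FP.mul₀ (FP.mul₀ (FP.sub (FP.1⇒0 (up u∈Z)) yF) (FP.sub FP.one (FP.pow₀ p-1 (FP.1⇒0 (up u∈Z))))) (up uz^p∈)))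
        eq : (c - c ^ p) * x⁻ ^ p ≈ u′ - φ (c * x⁻)
        eq = begin
          (c - c ^ p) * x⁻ ^ p ≈⟨ solve 4 (λ c d z q → (c :- d) :* z := c :* (z :+ q) :- (d :* z :+ c :* q)) refl c (c ^ p) (x⁻ ^ p) x⁻ ⟩
          c * φ x⁻ - (c ^ p * x⁻ ^ p + c * x⁻) ≈⟨ +-cong (*-congˡ (sym u⁻≈)) (-‿cong (+-congʳ (sym (^-distrib-* c x⁻ p)))) ⟩
          u′ - φ (c * x⁻) ∎

      place⁺ : Maybe I → Place R′ φ₀
      place⁺ = maybe′ Q.Q′ QB

      state⁺ : ∀ i → State (place⁺ i) u′ u′⁻
      state⁺ (just i) = proj₂ (stepped i)
      state⁺ nothing = stateB

      approx⁺ : Approx R′ (targets place⁺ QZ P′)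
      approx⁺ = splitApprox S′ Q.Q′ F.Q′ QZ QB P′ toZ toB (separate _)
          (approxStep (targets place Zp P) (targets Q.Q′ F.Q′ P′) T y-T∈ resp′ zer′ add′ mulT approx)
        where
        T : Ix I → Carrier
        T (pl i) = Q.T i
        T zz = F.T
        T gg = y
        T inf = y
        y-y∈ : R (y - y)
        y-y∈ = Rresp (sym (-‿inverseʳ y)) R0
        y-T∈ : ∀ i → R (y - T i)
        y-T∈ (pl i) = Q.y-T∈ i
        y-T∈ zz = F.y-T∈
        y-T∈ gg = y-y∈
        y-T∈ inf = y-y∈
        tgt′ = targets Q.Q′ F.Q′ P′
        resp′ : ∀ i {a b} → a ≈ b → tgt′ i a → tgt′ i b
        resp′ (pl i) = Place.resp (Q.Q′ i)
        resp′ zz = FP.resp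
        resp′ gg e = S′.Rresp (*-congˡ e)
        resp′ inf = ∞.resp
        zer′ : ∀ i → tgt′ i 0#
        zer′ (pl i) = Place.zer (Q.Q′ i)
        zer′ zz = FP.zer
        zer′ gg = S′.Rresp (sym (zeroʳ M⁻)) S′.R0
        zer′ inf = ∞.zer
        add′ : ∀ i {a b} → tgt′ i a → tgt′ i b → tgt′ i (a + b)
        add′ (pl i) = Place.add (Q.Q′ i)
        add′ zz = FP.add
        add′ gg a b = S′.Rresp (sym (distribˡ _ _ _)) (S′.Radd a b)
        add′ inf = ∞.add
        mulT : ∀ i {k b} → k ℕ.< p → targets place Zp P i b → tgt′ i (b * T i ^ k)
        mulT (pl i) = Q.target i
        mulT zz = F.target
        mulT gg {k} lt r = S′.Rresp (*-assoc _ _ _) (S′.Rmul (inR′ r) (S′.Rpow k y∈))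
        mulT inf {k} lt o = ∞.mono
            (ℤₚ.≤-trans (ℤₚ.≤-reflexive (≡.sym (ℤₚ.+-identityˡ _))) (ℤₚ.+-monoˡ-≤ (+ P′ ℤ.- K₀) 0≤))
            (∞.at (≡.trans (≡.cong (λ q → (q ℤ.- K₀) ℤ.+ + k ℤ.* ℤ.- + P′) (≡.trans (≡.cong +_ P≡) (ℤₚ.pos-* p P′)))
               (ℤS.solve 4 (λ p k P K → (p ℤS.:* P ℤS.:- K) ℤS.:+ k ℤS.:* ℤS.:- P ℤS.:= (p ℤS.:- (ℤS.con (+ 1) ℤS.:+ k)) ℤS.:* P ℤS.:+ (P ℤS.:- K)) ≡.refl (+ p) (+ k) (+ P′) K₀))
              (∞.mul o (∞.powℤ k y∈∞)))
          where
          0≤ : + 0 ℤ.≤ (+ p ℤ.- (+ 1 ℤ.+ + k)) ℤ.* + P′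
          0≤ with ℕₚ.m≤n⇒∃[o]m+o≡n lt
          ... | d , q = ≡.subst (+ 0 ℤ.≤_) (≡.trans (ℤₚ.pos-* d P′) (≡.cong (ℤ._* + P′) (≡.trans
            (ℤS.solve 2 (λ k d → d ℤS.:= ((ℤS.con (+ 1) ℤS.:+ k) ℤS.:+ d) ℤS.:- (ℤS.con (+ 1) ℤS.:+ k)) ≡.refl (+ k) (+ d))
            (≡.cong (λ z → + z ℤ.- (+ 1 ℤ.+ + k)) q)))) (ℤ.+≤+ {0} ℕ.z≤n)

      -- The leading coefficient in y is integral at every old place by `leading`, after `intersect`
      -- has rejoined the two halves, and has a zero at infinity by `noCancellation`. It vanishes by
      -- the previous level, and the degree drops.
      regular⇒0′ : ∀ {f} → R′ f → (∀ i → Place.O (place⁺ i) (+ 0) f) → Place.O QZ (+ 0) f → ∞.O (+ 1) f → f ≈ 0#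
      regular⇒0′ {f} r o oZ o∞ = go p ℕₚ.≤-refl r refl
        where
        cQ : ∀ i → Poly (λ _ → Place.O (place i) (+ 0)) (Q.T i) p f
        cQ i = Q.coeffs i (o (just i))
        cZ : Poly (λ _ → ZP.O (+ 0)) F.T p f
        cZ = F.coeffs (intersect oZ (o nothing))
        G : (A : Place R φ₀) → Group (λ _ → Place.O A (+ 0))
        G A = record { Cresp = Place.resp A ; Czer = Place.zer A ; Cadd = Place.add A ; Cneg = Place.neg A }
        go : ∀ m → m ℕ.≤ p → ∀ {f′} → Deg m f′ → f ≈ f′ → f ≈ 0#
        go zero le (nil e) e′ = trans e′ e
        go (suc m) le (snoc {g = g} {a} d ra e) e′ = go m (ℕₚ.<⇒≤ le) d
          (trans e′ (trans e (trans (+-congˡ (trans (*-congʳ a≈0) (zeroˡ _))) (+-identityʳ g))))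
          where
          a≈0 : a ≈ 0#
          a≈0 = regular⇒0 ra
            (λ i → Coordinate.leading (Q.T i) (Q.y-T∈ i) (Place.O⇒R (place i)) (G (place i)) le (cQ i) d ra (trans e′ e))
            (Coordinate.leading F.T F.y-T∈ ZP.O⇒R (G Zp) le cZ d ra (trans e′ e))
            (∞.mono (≤-by (m ℕ.* P′) (≡.cong (λ z → + 1 ℤ.+ z) (ℤₚ.pos-* m P′)))
              (toCoeff m (proj₂ (noCancellation (snoc d ra refl) le (∞.resp (trans e′ e) o∞)))))

      nextStage : Stage S′ y y⁻ u′ u′⁻ P′
      nextStage = record
        { xx⁻ = yy⁻ ; u∈ = u′∈ ; u⁻∈ = u′⁻∈ ; uu⁻ = u′u′⁻ ; u⁻≈ = refl ; rounds = rounds′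
        ; I = Maybe I ; place = place⁺ ; state = state⁺ ; Zp = QZ ; zeroAt = zero′
        ; approx = approx⁺ ; regular⇒0 = regular⇒0′ }

      module NextReduction {R₀ : Carrier → Set} {Π Π⁻ : Carrier} (ΠΠ⁻ : Π * Π⁻ ≈ 1#) (Π∈ : R₀ Π) (red : Reduction R₀ Π⁻ R u) where
        open Reduction red

        ΠR : Carrier → Set
        ΠR a = R (Π⁻ * a)

        private
          cancelΠ : ∀ a → Π⁻ * (Π * a) ≈ a
          cancelΠ a = trans (solve 3 (λ x y a → y :* (x :* a) := (x :* y) :* a) refl Π Π⁻ a) (trans (*-congʳ ΠΠ⁻) (*-identityˡ a))
          cancelΠ′ : ∀ a → Π * (Π⁻ * a) ≈ a
          cancelΠ′ a = trans (sym (*-assoc _ _ a)) (trans (*-congʳ ΠΠ⁻) (*-identityˡ a))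

        ΠR⇒R : ∀ {a} → ΠR a → R a
        ΠR⇒R {a} r = Rresp (cancelΠ′ a) (Rmul (R₀⊂R Π∈) r)

        ΠG : Group (λ _ → ΠR)
        ΠG = record { Cresp = λ e → Rresp (*-congˡ e) ; Czer = Rresp (sym (zeroʳ _)) R0
          ; Cadd = λ a b → Rresp (sym (distribˡ _ _ _)) (Radd a b) ; Cneg = λ a → Rresp (-‿distribʳ-* _ _) (Rneg a) }

        -- `leading` for T = y and coefficients divisible by Π: the powers of y stay independent
        -- modulo Π, so the size of the residue ring is raised to the power `p`.
        leadingΠ : ∀ {m f g a} → m ℕ.< p → R′ (Π⁻ * f) → Deg m g → R a → f ≈ g + a * y ^ m → ΠR a
        leadingΠ {f = f} lt r = Coordinate.leading y (Rresp (sym (-‿inverseʳ y)) R0) ΠR⇒R ΠG lt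
          (PolyGroup.presp ΠG (cancelΠ′ f) (pscale Π (λ {k} {a} ra → Rresp (sym (cancelΠ a)) ra) r))

        ΠR⇒R′ : ∀ {a} k → ΠR a → R′ (Π⁻ * (a * y ^ k))
        ΠR⇒R′ k r = S′.Rresp (*-assoc _ _ _) (S′.Rmul (inR′ r) (S′.Rpow k y∈))

        dropΠ : ∀ {m f g a} → m ℕ.< p → R′ (Π⁻ * f) → Deg m g → R a → f ≈ g + a * y ^ m → R′ (Π⁻ * g)
        dropΠ {m} {f} {g} {a} lt r d ra e = S′.Rresp
          (trans (+-congʳ (*-congˡ e)) (solve 3 (λ z g t → z :* (g :+ t) :- z :* t := z :* g) refl Π⁻ g (a * y ^ m)))
          (S′.Rsub r (ΠR⇒R′ m (leadingΠ lt r d ra e)))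

        dec′ : ∀ {m f} → m ℕ.≤ p → Deg m f → Dec (R′ (Π⁻ * f))
        dec′ le (nil e) = yes (S′.Rresp (sym (trans (*-congˡ e) (zeroʳ _))) S′.R0)
        dec′ {suc m} le (snoc {g = g} {a} d ra e) with dec ra | dec′ (ℕₚ.<⇒≤ le) d
        ... | no na | _ = no λ r → na (leadingΠ le r d ra e)
        ... | yes _ | no ng = no λ r → ng (dropΠ le r d ra e)
        ... | yes ya | yes yg = yes (S′.Rresp (trans (sym (distribˡ _ _ _)) (*-congˡ (sym e))) (S′.Radd yg (ΠR⇒R′ m ya)))

        Code′ : Set
        Code′ = Tuple Code p

        evalDeg : ∀ m (t : Tuple Code m) → Deg m (evalTuple elem y m t)
        evalDeg zero t = nil refl
        evalDeg (suc m) (t , c) = snoc (evalDeg m t) (elem∈ c) refl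

        evalInj : ∀ m → m ℕ.≤ p → (t t′ : Tuple Code m) → R′ (Π⁻ * (evalTuple elem y m t - evalTuple elem y m t′)) → t ≡ t′
        evalInj zero le _ _ r = ≡.refl
        evalInj (suc m) le (t , c) (t′ , c′) r = ≡.cong₂ _,_
            (evalInj m (ℕₚ.<⇒≤ le) t t′ (dropΠ le r d ra e)) (elem-inj (leadingΠ le r d ra e))
          where
          d = psub (evalDeg m t) (evalDeg m t′)
          ra = Rsub (elem∈ c) (elem∈ c′)
          e = solve 5 (λ g a g′ a′ z → (g :+ a :* z) :- (g′ :+ a′ :* z) := (g :- g′) :+ (a :- a′) :* z) refl
            (evalTuple elem y m t) (elem c) (evalTuple elem y m t′) (elem c′) (y ^ m)

        yFrob : R′ (Π⁻ * ((y ^ p) ^ p - y))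
        yFrob = S′.Rresp (*-congˡ (begin
          u ^ p - u ≈⟨ +-congˡ (-‿cong (sym φy)) ⟩
          u ^ p - (y ^ p + y) ≈⟨ solve 3 (λ u q y → u :- (q :+ y) := (u :- q) :- y) refl (u ^ p) (y ^ p) y ⟩
          (u ^ p - y ^ p) - y ≈⟨ +-congʳ (trans (^-congˡ p y^p≈) (frob-- u y)) ⟨
          (y ^ p) ^ p - y ∎)) (inR′ uFrob)

        u′Frob : R′ (Π⁻ * (u′ ^ p - u′))
        u′Frob = S′.Rresp (frobenius-defect Π⁻ y uu⁻) (S′.Radd
            (S′.Rmul (S′.Rmul (S′.Rpow p y∈) (inR′ (Rpow p u⁻∈))) yFrob)
            (S′.Rneg (S′.Rmul (S′.Rmul (S′.Rpow (suc p) y∈) (inR′ (Rmul u⁻∈ (Rpow p u⁻∈)))) (inR′ uFrob))))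

        nextReduction : Reduction R₀ Π⁻ R′ u′
        nextReduction = record
          { R₀⊂R = λ r → inR′ (R₀⊂R r)
          ; gens = y ∷ gens
          ; gens∈ = y∈ ∷ All.map inR′ gens∈
          ; generate = λ { S″ inc (y″ ∷ gs) d → DR S″ (generate S″ inc gs) y″ d }
          ; dec = dec′ ℕₚ.≤-refl
          ; Code = Code′ ; size = size ℕ.^ p ; finite = finite-Tuple p finite
          ; elem = evalTuple elem y p ; elem∈ = evalDeg p ; elem-inj = evalInj p ℕₚ.≤-refl _ _
          ; gensFrob = yFrob ∷ All.map inR′ gensFrob
          ; uFrob = u′Frob }

-- The bottom level

module UnitPowers (R : CommutativeRing 0ℓ 0ℓ) (a a⁻ : CommutativeRing.Carrier R)
  (aa⁻ : CommutativeRing._≈_ R (CommutativeRing._*_ R a a⁻) (CommutativeRing.1# R)) where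
  open RingKit R

  ψ : ℤ → Carrier
  ψ (+ n) = a ^ n
  ψ -[1+ n ] = a⁻ ^ suc n

  private
    ψ-⊖ : ∀ m n → ψ (m ⊖ n) ≈ a ^ m * a⁻ ^ n
    ψ-⊖ m zero = trans (reflexive (≡.cong ψ (ℤₚ.⊖-≥ {m} {zero} ℕ.z≤n))) (sym (*-identityʳ _))
    ψ-⊖ zero (suc n) = sym (*-identityˡ _)
    ψ-⊖ (suc m) (suc n) = begin
      ψ (suc m ⊖ suc n) ≡⟨ ≡.cong ψ (ℤₚ.[1+m]⊖[1+n]≡m⊖n m n) ⟩
      ψ (m ⊖ n) ≈⟨ ψ-⊖ m n ⟩
      a ^ m * a⁻ ^ n ≈⟨ *-identityˡ _ ⟨
      1# * (a ^ m * a⁻ ^ n) ≈⟨ *-congʳ aa⁻ ⟨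
      (a * a⁻) * (a ^ m * a⁻ ^ n) ≈⟨ solve 4 (λ a b c d → (a :* b) :* (c :* d) := (a :* c) :* (b :* d)) refl a a⁻ (a ^ m) (a⁻ ^ n) ⟩
      a ^ suc m * a⁻ ^ suc n ∎

  ψ-+ : ∀ i j → ψ (i ℤ.+ j) ≈ ψ i * ψ j
  ψ-+ (+ m) (+ n) = ^-homo-* a m n
  ψ-+ (+ m) -[1+ n ] = ψ-⊖ m (suc n)
  ψ-+ -[1+ m ] (+ n) = trans (ψ-⊖ n (suc m)) (*-comm _ _)
  ψ-+ -[1+ m ] -[1+ n ] = trans (reflexive (≡.cong (λ k → a⁻ ^ suc k) (≡.sym (ℕₚ.+-suc m n)))) (^-homo-* a⁻ (suc m) (suc n))

module AffineLine (V : ValuedRing) where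
  open ValuedRing V
  open RingKit ring
  open Char prime char
  open Filtration filtration
  open PolynomialRing V

  -- The affine line with the zeros of φ₀ = φ(x) inverted.  M is a power of the modulus whose roots split in the tower.
  module BaseStage (x x⁻ : Carrier) (xx⁻ : x * x⁻ ≈ 1#)
    (P : ℕ) (0<P : 0 ℕ.< P) (x∈∞ : O (ℤ.- + P) x) (x⁻∈∞ : O (+ P) x⁻)
    (φ₀⁻ : Carrier) (φ₀φ₀⁻ : φ x * φ₀⁻ ≈ 1#) (φ₀⁻∈∞ : O (+ (p ℕ.* P)) φ₀⁻)
    (D : ℕ) (M M⁻ : Carrier) (MM⁻ : M * M⁻ ≈ 1#) (monicM : MonicPol x D M)
    (φ̃ ρ : Carrier) (φ̃∈ : Pol x φ̃) (ρ∈ : Pol x ρ) (φφ̃ : φ x * φ̃ ≈ 1# + M * ρ) where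
    open Polynomials ring
    open Constants V
    open Places V
    open Localisation V
    open States V
    open AtInfinity V
    open Tower V
    private
      module C = Subring constants
      module Pl = Subring (pol x)
    open Adjoin constants x

    φ₀ : Carrier
    φ₀ = φ x

    K₀ : ℤ
    K₀ = + (D ℕ.* P)

    x∈ : Pol x x
    x∈ = x∈Pol x

    φ₀∈ : Pol x φ₀
    φ₀∈ = Pl.Radd (Pl.Rpow p x∈) x∈

    R₀ : Carrier → Set
    R₀ f = ∃ λ k → Pol x (φ₀ ^ k * f)

    pol⇒R₀ : ∀ {f} → Pol x f → R₀ f
    pol⇒R₀ h = 0 , Pl.Rresp (sym (*-identityˡ _)) h

    φ₀⁻∈ : R₀ φ₀⁻
    φ₀⁻∈ = 1 , Pl.Rresp (sym (trans (*-congʳ (*-identityʳ _)) φ₀φ₀⁻)) Pl.R1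

    S₀ : Subring R₀
    S₀ = record
      { Rresp = λ { e (k , h) → k , Pl.Rresp (*-congˡ e) h }
      ; R0 = pol⇒R₀ Pl.R0 ; R1 = pol⇒R₀ Pl.R1
      ; Radd = λ { {a} {b} (k , h) (l , h′) → k ℕ.+ l , Pl.Rresp
          (trans (solve 4 (λ u v a b → v :* (u :* a) :+ u :* (v :* b) := (u :* v) :* (a :+ b)) refl (φ₀ ^ k) (φ₀ ^ l) a b) (*-congʳ (sym (^-homo-* φ₀ k l))))
          (Pl.Radd (Pl.Rmul (Pl.Rpow l φ₀∈) h) (Pl.Rmul (Pl.Rpow k φ₀∈) h′)) }
      ; Rneg = λ { (k , h) → k , Pl.Rresp (-‿distribʳ-* _ _) (Pl.Rneg h) }
      ; Rmul = λ { {a} {b} (k , h) (l , h′) → k ℕ.+ l , Pl.Rresp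
          (trans (solve 4 (λ u v a b → (u :* a) :* (v :* b) := (u :* v) :* (a :* b)) refl (φ₀ ^ k) (φ₀ ^ l) a b) (*-congʳ (sym (^-homo-* φ₀ k l))))
          (Pl.Rmul h h′) } }
    private module S₀ = Subring S₀

    deg∈∞ : ∀ {m f} → Deg m f → O (+ P ℤ.- + m ℤ.* + P) f
    deg∈∞ (nil e) = resp (sym e) zer
    deg∈∞ {suc m} (snoc {g = g} {c} d (n , h) e) = resp (sym e) (add
      (mono (≤-by P (ℤS.solve 2 (λ m P → (P ℤS.:- (ℤS.con (+ 1) ℤS.:+ m) ℤS.:* P) ℤS.:+ P ℤS.:= P ℤS.:- m ℤS.:* P) ≡.refl (+ m) (+ P))) (deg∈∞ d))
      (at (ℤS.solve 2 (λ m P → m ℤS.:* ℤS.:- P ℤS.:= P ℤS.:- (ℤS.con (+ 1) ℤS.:+ m) ℤS.:* P) ≡.refl (+ m) (+ P))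
        (mul₀ (resp (sym h) (constant n)) (powℤ m x∈∞))))

    top≈0 : ∀ {m g c f i} → Deg m g → Constant c → f ≈ g + c * x ^ m → O i f → + 1 ℤ.- + m ℤ.* + P ℤ.≤ i → c ≈ 0#
    top≈0 {m} {g} {c} {f} {i} d cc e f∈ le = constant∈⇒≈0 cc (resp
      (trans (*-assoc c _ _) (trans (*-congˡ (unit-^ m xx⁻)) (*-identityʳ c)))
      (at (ℤS.solve 2 (λ m P → (ℤS.con (+ 1) ℤS.:- m ℤS.:* P) ℤS.:+ m ℤS.:* P ℤS.:= ℤS.con (+ 1)) ≡.refl (+ m) (+ P))
        (mul cx∈ (powℤ m x⁻∈∞))))
      where
      cx∈ : O (+ 1 ℤ.- + m ℤ.* + P) (c * x ^ m)
      cx∈ = resp (trans (+-congʳ e) (solve 2 (λ g t → (g :+ t) :- g := t) refl g (c * x ^ m)))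
        (sub (mono le f∈) (mono (ℤₚ.+-monoˡ-≤ (ℤ.- (+ m ℤ.* + P)) (ℤ.+≤+ 0<P)) (deg∈∞ d)))

    roundsPol : ∀ {m f i} → Deg m f → ¬ (+ P ℤ∣.∣ i) → O i f → O (ℤ.suc i) f
    roundsPol (nil e) nd f∈ = resp (sym e) zer
    roundsPol {suc m} {f} {i} (snoc {g = g} {c} d cc e) nd f∈ with ℤₚ.<-cmp i (ℤ.- (+ m ℤ.* + P))
    ... | tri< lt _ _ = mono (ℤₚ.i<j⇒suc[i]≤j lt) (at
          (ℤS.solve 2 (λ m P → P ℤS.:- (ℤS.con (+ 1) ℤS.:+ m) ℤS.:* P ℤS.:= ℤS.:- (m ℤS.:* P)) ≡.refl (+ m) (+ P)) (deg∈∞ (snoc d cc e)))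
    ... | tri≈ _ i≡ _ = ⊥-elim (nd (ℤ∣.divides (ℤ.- + m) (≡.trans i≡ (ℤₚ.neg-distribˡ-* (+ m) (+ P)))))
    ... | tri> _ _ gt = resp (sym f≈g) (roundsPol d nd (resp f≈g f∈))
      where
      c≈0 : c ≈ 0#
      c≈0 = top≈0 d cc e f∈ (ℤₚ.i<j⇒suc[i]≤j gt)
      f≈g : f ≈ g
      f≈g = trans e (trans (+-congˡ (trans (*-congʳ c≈0) (zeroˡ _))) (+-identityʳ g))

    φ₀∈∞ : O (ℤ.- + (p ℕ.* P)) φ₀
    φ₀∈∞ = add (at (≡.trans (≡.sym (ℤₚ.neg-distribʳ-* (+ p) (+ P))) (≡.cong ℤ.-_ (≡.sym (ℤₚ.pos-* p P)))) (powℤ p x∈∞))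
      (mono (ℤₚ.neg-mono-≤ (ℤ.+≤+ (ℕₚ.m≤n*m P p {{ℕ.>-nonZero (ℕₚ.<-trans (ℕ.s≤s ℕ.z≤n) 1<p)}}))) x∈∞)

    rounds₀ : Rounds R₀ P
    rounds₀ {f} {i} (k , _ , d) nd f∈ = resp
        (trans (solve 3 (λ a b f → b :* (a :* f) := (a :* b) :* f) refl (φ₀ ^ k) (φ₀⁻ ^ k) f) (trans (*-congʳ (unit-^ k φ₀φ₀⁻)) (*-identityˡ f)))
        (at (≡.trans (≡.cong (λ q → + k ℤ.* q ℤ.+ ℤ.suc (+ k ℤ.* (ℤ.- q) ℤ.+ i)) (ℤₚ.pos-* p P))
            (ℤS.solve 3 (λ k q i → k ℤS.:* q ℤS.:+ (ℤS.con (+ 1) ℤS.:+ (k ℤS.:* ℤS.:- q ℤS.:+ i)) ℤS.:= ℤS.con (+ 1) ℤS.:+ i) ≡.refl (+ k) (+ p ℤ.* + P) i))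
          (mul (powℤ k φ₀⁻∈∞) (roundsPol d nd′ (mul (powℤ k φ₀∈∞) f∈))))
      where
      nd′ : ¬ (+ P ℤ∣.∣ + k ℤ.* (ℤ.- + (p ℕ.* P)) ℤ.+ i)
      nd′ h = nd (≡.subst (+ P ℤ∣.∣_) (ℤS.solve 2 (λ a i → (a ℤS.:+ i) ℤS.:- a ℤS.:= i) ≡.refl (+ k ℤ.* (ℤ.- + (p ℕ.* P))) i)
        (ℤ∣.∣m∣n⇒∣m-n h (ℤ∣.∣n⇒∣m*n (+ k) (ℤ∣.∣m⇒∣-m (ℤ∣.divides (+ p) (ℤₚ.pos-* p P))))))

    -- The divisor of zeros of φ₀, as one semilocal place.

    open UnitPowers ring φ₀ φ₀⁻ φ₀φ₀⁻

    private
      ψ-cancel : ∀ i f → ψ i * (ψ (ℤ.- i) * f) ≈ f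
      ψ-cancel i f = trans (sym (*-assoc _ _ f)) (trans (*-congʳ (trans (sym (ψ-+ i (ℤ.- i))) (reflexive (≡.cong ψ (ℤₚ.+-inverseʳ i))))) (*-identityˡ f))

      ψ≥0 : ∀ {i} → + 0 ℤ.≤ i → Pol x (ψ i)
      ψ≥0 {+ n} _ = Pl.Rpow n φ₀∈

    fatPlace : Place R₀ φ₀
    fatPlace = record
      { Fl = record
        { O = λ i f → Pol x (ψ (ℤ.- i) * f)
        ; resp = λ e → Pl.Rresp (*-congˡ e)
        ; zer = Pl.Rresp (sym (zeroʳ _)) Pl.R0
        ; add = λ a b → Pl.Rresp (sym (distribˡ _ _ _)) (Pl.Radd a b)
        ; neg = λ a → Pl.Rresp (-‿distribʳ-* _ _) (Pl.Rneg a)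
        ; mono = λ {i} {j} {a} le h → Pl.Rresp
            (trans (sym (*-assoc _ _ a)) (*-congʳ (trans (sym (ψ-+ (j ℤ.- i) (ℤ.- j))) (reflexive (≡.cong ψ (ℤS.solve 2 (λ i j → (j ℤS.:- i) ℤS.:+ ℤS.:- j ℤS.:= ℤS.:- i) ≡.refl i j))))))
            (Pl.Rmul (ψ≥0 (ℤₚ.i≤j⇒0≤j-i le)) h)
        ; mul = λ {i} {j} {a} {b} h h′ → Pl.Rresp
            (trans (solve 4 (λ u v a b → (u :* a) :* (v :* b) := (u :* v) :* (a :* b)) refl (ψ (ℤ.- i)) (ψ (ℤ.- j)) a b)
              (*-congʳ (trans (sym (ψ-+ (ℤ.- i) (ℤ.- j))) (reflexive (≡.cong ψ (≡.sym (ℤₚ.neg-distrib-+ i j)))))))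
            (Pl.Rmul h h′)
        ; one = Pl.Rresp (sym (*-identityˡ _)) Pl.R1 }
      ; O⇒R = λ {i} {a} h → ℤ.∣ i ∣ , Pl.Rresp (*-congˡ (ψ-cancel i a)) (Pl.Rresp (*-assoc _ _ _)
          (Pl.Rmul (Pl.Rresp (ψ-+ (+ ℤ.∣ i ∣) i) (ψ≥0 (0≤∣i∣+i i))) h))
      ; exh = λ { {a} (k , h) → k , Pl.Rresp (*-congʳ (reflexive (≡.cong ψ (≡.sym (ℤₚ.neg-involutive (+ k)))))) h }
      ; m = + 1
      ; φ∈ = Pl.Rresp (sym (trans (*-congʳ (*-identityʳ _)) (trans (*-comm _ _) φ₀φ₀⁻))) Pl.R1 }
      where
      0≤∣i∣+i : ∀ i → + 0 ℤ.≤ + ℤ.∣ i ∣ ℤ.+ i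
      0≤∣i∣+i (+ n) = ℤ.+≤+ ℕ.z≤n
      0≤∣i∣+i -[1+ n ] = ℤₚ.≤-reflexive (≡.sym (ℤₚ.+-inverseʳ (+ suc n)))

    private
      module F = Place fatPlace

    pol⇒F : ∀ {f} → Pol x f → F.O (+ 0) f
    pol⇒F = Pl.Rresp (sym (*-identityˡ _))

    s : Carrier
    s = x ^ p-1 + 1#

    s∈ : Pol x s
    s∈ = Pl.Radd (Pl.Rpow p-1 x∈) Pl.R1

    sx : s * x ≈ φ₀
    sx = trans (*-comm _ _) (trans (*-congˡ (+-comm _ _)) (sym (φ-factor x)))

    open Split S₀ fatPlace s x (pol⇒F s∈) (pol⇒F x∈) (- (x ^ p-2)) (pol⇒F (Pl.Rneg (Pl.Rpow p-2 x∈)))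
      (trans (+-congʳ (+-congʳ (x^p-1 x))) (solve 2 (λ y q → (y :* q :+ :1) :+ (:- q) :* y := :1) refl x (x ^ p-2)))
      (F.resp {+ 1} (sym sx) F.φ∈)

    toZ : ∀ {i f} → F.O i f → Place.O QZ i f
    toZ {i} = localise-∈ S₀ fatPlace (pol⇒F s∈) {i}
    toB : ∀ {i f} → F.O i f → Place.O QB i f
    toB {i} = localise-∈ S₀ fatPlace (pol⇒F x∈) {i}

    u u⁻ : Carrier
    u = x ^ suc p * φ₀⁻
    u⁻ = φ x⁻

    x⁻≈ : x⁻ ≈ s * φ₀⁻
    x⁻≈ = unit-cancelˡ xx⁻ (trans xx⁻ (trans (sym φ₀φ₀⁻) (trans (*-congʳ (sym sx)) (solve 3 (λ s x f → (s :* x) :* f := x :* (s :* f)) refl s x φ₀⁻))))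

    x⁻∈ : R₀ x⁻
    x⁻∈ = S₀.Rresp (sym x⁻≈) (S₀.Rmul (pol⇒R₀ s∈) φ₀⁻∈)

    private
      x^suc-p*φx⁻ : x ^ suc p * u⁻ ≈ φ₀
      x^suc-p*φx⁻ = begin
        (x * x ^ p) * (x⁻ ^ p + x⁻) ≈⟨ solve 4 (λ x a b z → (x :* a) :* (b :+ z) := x :* (a :* b) :+ a :* (x :* z)) refl x (x ^ p) (x⁻ ^ p) x⁻ ⟩
        x * (x ^ p * x⁻ ^ p) + x ^ p * (x * x⁻) ≈⟨ +-cong (trans (*-congˡ (unit-^ p xx⁻)) (*-identityʳ x)) (trans (*-congˡ xx⁻) (*-identityʳ _)) ⟩
        x + x ^ p ≈⟨ +-comm _ _ ⟩
        φ₀ ∎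

    uu⁻ : u * u⁻ ≈ 1#
    uu⁻ = trans (solve 3 (λ a b c → (a :* b) :* c := (a :* c) :* b) refl (x ^ suc p) φ₀⁻ u⁻) (trans (*-congʳ x^suc-p*φx⁻) φ₀φ₀⁻)

    x⁻∈₋₁ : F.O -[1+ 0 ] x⁻
    x⁻∈₋₁ = Pl.Rresp (begin
      s ≈⟨ trans (sym (*-identityʳ s)) (*-congˡ (sym xx⁻)) ⟩
      s * (x * x⁻) ≈⟨ *-assoc _ _ _ ⟨
      (s * x) * x⁻ ≈⟨ *-congʳ (trans sx (sym (*-identityʳ φ₀))) ⟩
      (φ₀ * 1#) * x⁻ ∎) s∈

    zero₀ : Zero QZ x x⁻
    zero₀ = record { x∈ = y∈Z ; zs = [] ; chain = end (x , trans (*-comm _ _) xx⁻ , y∈Z , x⁻∈) (toZ { -[1+ 0 ] } x⁻∈₋₁) }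

    -- Where x^(p-1) = -1 the first right-hand side x^(p+1) / φ₀ has a simple pole, so these points
    -- ramify from the start.
    state₀ : State QB u u⁻
    state₀ = ram
      (toB { -[1+ 0 ] } (Pl.Rresp (sym (trans (*-congʳ (*-identityʳ φ₀)) (trans (solve 3 (λ f a g → f :* (a :* g) := a :* (f :* g)) refl φ₀ (x ^ suc p) φ₀⁻) (trans (*-congˡ φ₀φ₀⁻) (*-identityʳ _))))) (Pl.Rpow (suc p) x∈)))
      (S₀.Radd (S₀.Rpow p x⁻∈) x⁻∈ , suc p , F.resp {+ 1} (sym x^suc-p*φx⁻) F.φ∈)

    module Dv = Division x monicM

    unitPower : ∀ k → Σ Carrier λ σ → Pol x σ × φ₀ ^ k * φ̃ ^ k ≈ 1# + M * σ
    unitPower zero = 0# , Pl.R0 , solve 1 (λ m → :1 :* :1 := :1 :+ m :* :0) refl M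
    unitPower (suc k) with unitPower k
    ... | σ , σ∈ , e = ρ + σ + M * (ρ * σ) , Pl.Radd (Pl.Radd ρ∈ σ∈) (Pl.Rmul (suc D , monic⇒Deg x monicM) (Pl.Rmul ρ∈ σ∈)) , (begin
      (φ₀ * φ₀ ^ k) * (φ̃ * φ̃ ^ k) ≈⟨ solve 4 (λ a b c d → (a :* b) :* (c :* d) := (a :* c) :* (b :* d)) refl φ₀ (φ₀ ^ k) φ̃ (φ̃ ^ k) ⟩
      (φ₀ * φ̃) * (φ₀ ^ k * φ̃ ^ k) ≈⟨ *-cong φφ̃ e ⟩
      (1# + M * ρ) * (1# + M * σ) ≈⟨ solve 3 (λ m r s → (:1 :+ m :* r) :* (:1 :+ m :* s) := :1 :+ m :* (r :+ s :+ m :* (r :* s))) refl M ρ σ ⟩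
      1# + M * (ρ + σ + M * (ρ * σ)) ∎)

    -- 1/φ₀ is congruent to φ̃ modulo M, so every element of R₀ has a polynomial representative of degree < D.
    remainder : ∀ {f} → R₀ f → Σ Carrier λ b → Deg D b × R₀ (M⁻ * (b - f))
    remainder {f} (k , m , d) = r , r∈ , S₀.Rresp eq
        (S₀.Rsub (S₀.Rmul (0 , Pl.Rresp (sym (*-identityˡ _)) (proj₁ (proj₂ (unitPower k)))) (k , m , d)) (pol⇒R₀ q∈))
      where
      σ = proj₁ (unitPower k)
      dm = Dv.divMod (proj₂ (Pl.Rmul (Pl.Rpow k φ̃∈) (m , d)))
      q = proj₁ dm
      r = proj₁ (proj₂ dm)
      q∈ = proj₁ (proj₂ (proj₂ dm))
      r∈ = proj₁ (proj₂ (proj₂ (proj₂ dm)))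
      e₁ : φ̃ ^ k * (φ₀ ^ k * f) ≈ q * M + r
      e₁ = proj₂ (proj₂ (proj₂ (proj₂ dm)))
      eq : σ * f - q ≈ M⁻ * (r - f)
      eq = begin
        σ * f - q ≈⟨ *-identityˡ _ ⟨
        1# * (σ * f - q) ≈⟨ *-congʳ (trans (sym MM⁻) (*-comm M M⁻)) ⟩
        (M⁻ * M) * (σ * f - q) ≈⟨ solve 5 (λ m⁻ m s f q → (m⁻ :* m) :* (s :* f :- q) := m⁻ :* ((:1 :+ m :* s) :* f :- q :* m :- f)) refl M⁻ M σ f q ⟩
        M⁻ * ((1# + M * σ) * f - q * M - f) ≈⟨ *-congˡ (+-congʳ (+-congʳ (*-congʳ (proj₂ (proj₂ (unitPower k)))))) ⟨
        M⁻ * ((φ₀ ^ k * φ̃ ^ k) * f - q * M - f) ≈⟨ *-congˡ (+-congʳ (+-congʳ (trans (solve 3 (λ a b f → (a :* b) :* f := b :* (a :* f)) refl (φ₀ ^ k) (φ̃ ^ k) f) e₁))) ⟩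
        M⁻ * ((q * M + r) - q * M - f) ≈⟨ *-congˡ (solve 4 (λ q m r f → (q :* m :+ r) :- q :* m :- f := r :- f) refl q M r f) ⟩
        M⁻ * (r - f) ∎

    φ₀-monic : MonicPol x p φ₀
    φ₀-monic = presp (solve 2 (λ a b → a := (b :+ a) :- b) refl x (x ^ p)) (p≤ 1<p (presp (trans (*-identityˡ _) (*-identityʳ x)) (monomial 1 C.R1)))

    -- The remainder modulo φ₀^k has degree below k p, so divided by φ₀^k it keeps order at least P
    -- at infinity.
    integralPart : ∀ {f} → R₀ f → Σ Carrier λ q → Pol x q × O (+ P) (q - f)
    integralPart {f} (k , m , d) = q , q∈ , resp eq (neg (mono le (mul (powℤ k φ₀⁻∈∞) (deg∈∞ r∈))))
      where
      dm = Division.divMod x (monic-pow x k φ₀-monic) d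
      q = proj₁ dm
      r = proj₁ (proj₂ dm)
      q∈ = proj₁ (proj₂ (proj₂ dm))
      r∈ = proj₁ (proj₂ (proj₂ (proj₂ dm)))
      e : φ₀ ^ k * f ≈ q * φ₀ ^ k + r
      e = proj₂ (proj₂ (proj₂ (proj₂ dm)))
      le : + P ℤ.≤ + k ℤ.* + (p ℕ.* P) ℤ.+ (+ P ℤ.- + (k ℕ.* p) ℤ.* + P)
      le = ℤₚ.≤-reflexive (≡.sym (≡.trans (≡.cong₂ (λ a b → + k ℤ.* a ℤ.+ (+ P ℤ.- b ℤ.* + P)) (ℤₚ.pos-* p P) (ℤₚ.pos-* k p))
        (ℤS.solve 3 (λ k p P → k ℤS.:* (p ℤS.:* P) ℤS.:+ (P ℤS.:- (k ℤS.:* p) ℤS.:* P) ℤS.:= P) ≡.refl (+ k) (+ p) (+ P))))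
      eq : - (φ₀⁻ ^ k * r) ≈ q - f
      eq = begin
        - (φ₀⁻ ^ k * r) ≈⟨ solve 4 (λ b r q a → :- (b :* r) := q :* (a :* b) :- b :* (q :* a :+ r)) refl (φ₀⁻ ^ k) r q (φ₀ ^ k) ⟩
        q * (φ₀ ^ k * φ₀⁻ ^ k) - φ₀⁻ ^ k * (q * φ₀ ^ k + r) ≈⟨ +-cong (trans (*-congˡ (unit-^ k φ₀φ₀⁻)) (*-identityʳ q)) (-‿cong (*-congˡ (sym e))) ⟩
        q - φ₀⁻ ^ k * (φ₀ ^ k * f) ≈⟨ +-congˡ (-‿cong (trans (solve 3 (λ a b f → b :* (a :* f) := (a :* b) :* f) refl (φ₀ ^ k) (φ₀⁻ ^ k) f) (trans (*-congʳ (unit-^ k φ₀φ₀⁻)) (*-identityˡ f)))) ⟩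
        q - f ∎

    -- Three corrections that do not interfere: `h zz` has the right polar part at the zeros of φ₀,
    -- which polynomials preserve; q corrects infinity; b, of degree below D, corrects the class
    -- modulo M and has order at least P - D P at infinity, whence the value of `K₀`.
    approxFat : Approx R₀ (targets φ₀ M⁻ K₀ {I = ⊥} ⊥-elim fatPlace P)
    approxFat h h∈ = a , S₀.Radd (S₀.Radd (h∈ zz) (pol⇒R₀ q∈)) (pol⇒R₀ (D , b∈)) , near
      where
      ip = integralPart (S₀.Rsub (h∈ inf) (h∈ zz))
      q = proj₁ ip
      q∈ = proj₁ (proj₂ ip)
      rm = remainder (S₀.Rsub (h∈ gg) (S₀.Radd (h∈ zz) (pol⇒R₀ q∈)))
      b = proj₁ rm
      b∈ = proj₁ (proj₂ rm)
      a = h zz + q + b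
      near : ∀ i → targets φ₀ M⁻ K₀ {I = ⊥} ⊥-elim fatPlace P i (a - h i)
      near (pl ())
      near zz = Pl.Rresp (trans (sym (*-identityˡ _)) (*-congˡ (solve 3 (λ h q b → q :+ b := (h :+ q :+ b) :- h) refl (h zz) q b))) (Pl.Radd q∈ (D , b∈))
      near gg = S₀.Rresp (*-congˡ (solve 4 (λ h q b g → b :- (g :- (h :+ q)) := (h :+ q :+ b) :- g) refl (h zz) q b (h gg))) (proj₂ (proj₂ rm))
      near inf = resp (solve 4 (λ h q b g → (q :- (g :- h)) :+ b := (h :+ q :+ b) :- g) refl (h zz) q b (h inf))
        (add (mono (ℤₚ.i-j≤i (+ P) K₀) (proj₂ (proj₂ ip))) (at (≡.cong (λ k → + P ℤ.- k) (≡.sym (ℤₚ.pos-* D P))) (deg∈∞ b∈)))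

    approx₀ : Approx R₀ (targets φ₀ M⁻ K₀ (maybe′ ⊥-elim QB) QZ P)
    approx₀ = splitApprox φ₀ M⁻ K₀ S₀ {⊥} ⊥-elim fatPlace QZ QB P (toZ {+ 0}) (toB {+ 0}) (separate (+ 0)) approxFat

    regularPolynomial≈0 : ∀ {m f} → Deg m f → O (+ 1) f → f ≈ 0#
    regularPolynomial≈0 (nil e) _ = e
    regularPolynomial≈0 {suc m} {f} (snoc {g = g} {c} d cc e) o = trans f≈g (regularPolynomial≈0 d (resp f≈g o))
      where
      f≈g : f ≈ g
      f≈g = trans e (trans (+-congˡ (trans (*-congʳ (top≈0 d cc e o
        (≡.subst (λ z → + 1 ℤ.- z ℤ.≤ + 1) (ℤₚ.pos-* m P) (ℤₚ.i-j≤i (+ 1) (+ (m ℕ.* P)))))) (zeroˡ _))) (+-identityʳ g))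

    regular⇒0₀ : ∀ {f} → R₀ f → (∀ i → Place.O (maybe′ ⊥-elim QB i) (+ 0) f) → Place.O QZ (+ 0) f → O (+ 1) f → f ≈ 0#
    regular⇒0₀ {f} _ oB oZ o∞ = regularPolynomial≈0 (proj₂ (Pl.Rresp (*-identityˡ f) (intersect {+ 0} oZ (oB nothing)))) o∞

    stage₀ : Stage φ₀ M⁻ K₀ S₀ x x⁻ u u⁻ P
    stage₀ = record
      { xx⁻ = xx⁻ ; u∈ = S₀.Rmul (pol⇒R₀ (Pl.Rpow (suc p) x∈)) φ₀⁻∈ ; u⁻∈ = S₀.Radd (S₀.Rpow p x⁻∈) x⁻∈
      ; uu⁻ = uu⁻ ; u⁻≈ = refl ; rounds = rounds₀
      ; I = Maybe ⊥ ; place = maybe′ ⊥-elim QB ; state = λ { nothing → state₀ }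
      ; Zp = QZ ; zeroAt = zero₀ ; approx = approx₀ ; regular⇒0 = regular⇒0₀ }

    module BaseReduction (Π Π⁻ : Carrier) (ΠΠ⁻ : Π * Π⁻ ≈ 1#) (σ : ℕ) (monicΠ : MonicPol x σ Π) (Π⁻∈∞ : O (+ (σ ℕ.* P)) Π⁻)
      (Π′ : Carrier) (Π′∈ : Pol x Π′) (M≈ : M ≈ Π * Π′) (g : Carrier) (g∈ : Pol x g) (φ₀-frob : φ₀ ^ p - φ₀ ≈ Π * g) where

      private
        Π∈ : Pol x Π
        Π∈ = suc σ , monic⇒Deg x monicΠ
        cancelΠ : ∀ a → Π⁻ * (Π * a) ≈ a
        cancelΠ a = trans (solve 3 (λ x y a → y :* (x :* a) := (x :* y) :* a) refl Π Π⁻ a) (trans (*-congʳ ΠΠ⁻) (*-identityˡ a))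
        cancelΠ′ : ∀ a → Π * (Π⁻ * a) ≈ a
        cancelΠ′ a = trans (sym (*-assoc _ _ a)) (trans (*-congʳ ΠΠ⁻) (*-identityˡ a))

      -- As φ₀ is invertible modulo Π, the quotient r / Π is a polynomial and not merely an element
      -- of R₀. By its degree it has a zero at infinity, so it is zero.
      remainder-unique : ∀ {r} → Deg σ r → R₀ (Π⁻ * r) → r ≈ 0#
      remainder-unique {r} d (l , h) = trans (sym (cancelΠ′ r)) (trans (*-congˡ w≈0) (zeroʳ Π))
        where
        w = Π⁻ * r
        up = unitPower l
        w∈ : Pol x w
        w∈ = Pl.Rresp (begin
            φ̃ ^ l * (φ₀ ^ l * w) - proj₁ up * (Π′ * r) ≈⟨ +-cong (solve 3 (λ a b w → b :* (a :* w) := (a :* b) :* w) refl (φ₀ ^ l) (φ̃ ^ l) w) (-‿cong (*-congˡ (*-congˡ (sym (cancelΠ′ r))))) ⟩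
            (φ₀ ^ l * φ̃ ^ l) * w - proj₁ up * (Π′ * (Π * w)) ≈⟨ +-congʳ (*-congʳ (trans (proj₂ (proj₂ up)) (+-congˡ (*-congʳ M≈)))) ⟩
            (1# + Π * Π′ * proj₁ up) * w - proj₁ up * (Π′ * (Π * w)) ≈⟨ solve 4 (λ a b s w → (:1 :+ a :* b :* s) :* w :- s :* (b :* (a :* w)) := w) refl Π Π′ (proj₁ up) w ⟩
            w ∎)
          (Pl.Rsub (Pl.Rmul (Pl.Rpow l φ̃∈) h) (Pl.Rmul (proj₁ (proj₂ up)) (Pl.Rmul Π′∈ (σ , d))))
        w≈0 : w ≈ 0#
        w≈0 = regularPolynomial≈0 (proj₂ w∈) (mono (ℤ.+≤+ 0<P)
          (at (≡.trans (≡.cong (λ z → z ℤ.+ (+ P ℤ.- + σ ℤ.* + P)) (ℤₚ.pos-* σ P)) (ℤS.solve 2 (λ s P → s ℤS.:+ (P ℤS.:- s) ℤS.:= P) ≡.refl (+ σ ℤ.* + P) (+ P)))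
            (mul Π⁻∈∞ (deg∈∞ d))))

      zero? : ∀ {m f} → Deg m f → Dec (f ≈ 0#)
      zero? (nil e) = yes e
      zero? {suc m} {f} (snoc {g = h} {c} d (n , e′) e) with p ℕ∣.∣? n
      ... | no nd = no λ f≈0 → nd (ι∈⇒∣ n (resp (sym (trans (sym e′) (top≈0 d (n , e′) e
              (resp (sym f≈0) (zer {+ 1 ℤ.- + m ℤ.* + P})) ℤₚ.≤-refl))) zer))
      ... | yes pd with zero? d
      ...   | yes h≈0 = yes (trans e (trans (+-cong h≈0 (trans (*-congʳ (trans e′ (ι-∣ n pd))) (zeroˡ _))) (+-identityˡ 0#)))
      ...   | no nh = no λ f≈0 → nh (trans (sym (trans e (trans (+-congˡ (trans (*-congʳ (trans e′ (ι-∣ n pd))) (zeroˡ _))) (+-identityʳ h)))) f≈0)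

      dec₀ : ∀ {f} → R₀ f → Dec (R₀ (Π⁻ * f))
      dec₀ {f} (k , m , d) with Division.divMod x monicΠ d
      ... | q , r , q∈ , r∈ , e with zero? r∈
      ...   | yes r≈0 = yes (S₀.Rresp (begin
                φ₀⁻ ^ k * q ≈⟨ *-congˡ (cancelΠ q) ⟨
                φ₀⁻ ^ k * (Π⁻ * (Π * q)) ≈⟨ *-congˡ (*-congˡ (trans (*-comm Π q) (sym (trans e (trans (+-congˡ r≈0) (+-identityʳ _)))))) ⟩
                φ₀⁻ ^ k * (Π⁻ * (φ₀ ^ k * f)) ≈⟨ solve 4 (λ a b z f → b :* (z :* (a :* f)) := (a :* b) :* (z :* f)) refl (φ₀ ^ k) (φ₀⁻ ^ k) Π⁻ f ⟩
                (φ₀ ^ k * φ₀⁻ ^ k) * (Π⁻ * f) ≈⟨ trans (*-congʳ (unit-^ k φ₀φ₀⁻)) (*-identityˡ _) ⟩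
                Π⁻ * f ∎) (S₀.Rmul (S₀.Rpow k φ₀⁻∈) (pol⇒R₀ q∈)))
      ...   | no nr = no λ h → nr (remainder-unique r∈ (S₀.Rresp (begin
                φ₀ ^ k * (Π⁻ * f) - q ≈⟨ +-cong (solve 3 (λ a z f → a :* (z :* f) := z :* (a :* f)) refl (φ₀ ^ k) Π⁻ f) (-‿cong (sym (cancelΠ q))) ⟩
                Π⁻ * (φ₀ ^ k * f) - Π⁻ * (Π * q) ≈⟨ +-congʳ (*-congˡ e) ⟩
                Π⁻ * (q * Π + r) - Π⁻ * (Π * q) ≈⟨ solve 4 (λ z q a r → z :* (q :* a :+ r) :- z :* (a :* q) := z :* r) refl Π⁻ q Π r ⟩
                Π⁻ * r ∎) (S₀.Rsub (S₀.Rmul (pol⇒R₀ (Pl.Rpow k φ₀∈)) h) (pol⇒R₀ q∈))))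

      evalDeg : ∀ m t → Deg m (evalTuple digit x m t)
      evalDeg zero t = nil refl
      evalDeg (suc m) (t , c) = snoc (evalDeg m t) (Fin.toℕ c , refl) refl

      evalInj : ∀ m t t′ → evalTuple digit x m t - evalTuple digit x m t′ ≈ 0# → t ≡ t′
      evalInj zero _ _ _ = ≡.refl
      evalInj (suc m) (t , c) (t′ , c′) e = ≡.cong₂ _,_
          (evalInj m t t′ (trans (solve 2 (λ f z → f := f :+ :0 :* z) refl _ (x ^ m)) (trans (+-congˡ (*-congʳ (sym c≈0))) (trans (sym split) e))))
          (digit-injective (-≈0⇒≈ c≈0))
        where
        split = solve 5 (λ g a g′ a′ z → (g :+ a :* z) :- (g′ :+ a′ :* z) := (g :- g′) :+ (a :- a′) :* z) refl
          (evalTuple digit x m t) (digit c) (evalTuple digit x m t′) (digit c′) (x ^ m)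
        c≈0 : digit c - digit c′ ≈ 0#
        c≈0 = top≈0 (psub (evalDeg m t) (evalDeg m t′)) (C.Rsub (Fin.toℕ c , refl) (Fin.toℕ c′ , refl)) split
          (resp (sym e) (zer {+ 1 ℤ.- + m ℤ.* + P})) ℤₚ.≤-refl

      xFrob : (x ^ p) ^ p - x ≈ Π * g
      xFrob = begin
        (x ^ p) ^ p - x ≈⟨ solve 3 (λ a b x → a :- x := (a :+ b) :- (b :+ x)) refl ((x ^ p) ^ p) (x ^ p) x ⟩
        ((x ^ p) ^ p + x ^ p) - φ₀ ≈⟨ +-congʳ (frob-+ (x ^ p) x) ⟨
        φ₀ ^ p - φ₀ ≈⟨ φ₀-frob ⟩
        Π * g ∎

      reduction₀ : Reduction R₀ Π⁻ R₀ u
      reduction₀ = record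
        { R₀⊂R = λ r → r ; gens = x ∷ [] ; gens∈ = pol⇒R₀ x∈ ∷ [] ; generate = λ _ inc _ r → inc r
        ; dec = dec₀ ; Code = Tuple (Fin p) σ ; size = p ℕ.^ σ ; finite = finite-Tuple σ (finite-Fin p)
        ; elem = evalTuple digit x σ ; elem∈ = λ t → pol⇒R₀ (σ , evalDeg σ t)
        ; elem-inj = λ {t} {t′} r → evalInj σ t t′ (remainder-unique (psub (evalDeg σ t) (evalDeg σ t′)) r)
        ; gensFrob = xFrob∈ ∷ []
        ; uFrob = S₀.Rresp (frobenius-defect Π⁻ x φ₀φ₀⁻) (S₀.Radd
            (S₀.Rmul (S₀.Rmul (pol⇒R₀ (Pl.Rpow p x∈)) (S₀.Rpow p φ₀⁻∈)) xFrob∈)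
            (S₀.Rneg (S₀.Rmul (S₀.Rmul (pol⇒R₀ (Pl.Rpow (suc p) x∈)) (S₀.Rmul φ₀⁻∈ (S₀.Rpow p φ₀⁻∈)))
              (S₀.Rresp (sym (trans (*-congˡ φ₀-frob) (cancelΠ g))) (pol⇒R₀ g∈))))) }
        where
        xFrob∈ : R₀ (Π⁻ * ((x ^ p) ^ p - x))
        xFrob∈ = S₀.Rresp (sym (trans (*-congˡ xFrob) (cancelΠ g))) (pol⇒R₀ g∈)

-- A ring of functions on a curve with many points: regular functions Reg with at most a pole at infinity,
-- and the modulus Π cutting out the completely split fibres.
record Curve (V : ValuedRing) : Set₁ where
  open ValuedRing V
  open RingKit ring
  open Char prime char
  open Filtration filtration
  open Polynomials ring
  field
    σ r J Λ : ℕ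
    Λ≡      : Λ ≡ (J ℕ.* σ ℕ.+ p) ℕ.* r
    R       : Carrier → Set
    S       : Subring R
    x₀ φ₀⁻ Π Π⁻ : Carrier
    φ₀φ₀⁻   : φ x₀ * φ₀⁻ ≈ 1#
    ΠΠ⁻     : Π * Π⁻ ≈ 1#
    x₀∈     : R x₀
    φ₀⁻∈    : R φ₀⁻
    Π∈      : R Π
    h       : Carrier
    h∈      : R h
    φ-root  : φ x₀ ^ ℕ.pred p ≈ 1# + Π * h
    δ⁻ ρ    : Carrier
    δ⁻∈     : R δ⁻
    ρ∈      : R ρ
    δδ⁻     : (x₀ - x₀ ^ p) * δ⁻ ≈ 1# + Π * ρ
    gens    : List Carrier
    gens∈   : All R gens
    generate : ∀ {R″ : Carrier → Set} → Subring R″ → R″ x₀ → R″ φ₀⁻ → All R″ gens → ∀ {f} → R f → R″ f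
    gensFrob : All (λ x → R (Π⁻ * ((x ^ p) ^ p - x))) gens
    dec      : ∀ {f} → R f → Dec (R (Π⁻ * f))
    Code     : Set
    finite   : Finite Code (p ℕ.^ (σ ℕ.* r))
    elem     : Code → Carrier
    elem∈    : ∀ c → R (elem c)
    elem-inj : ∀ {c d} → R (Π⁻ * (elem c - elem d)) → c ≡ d
    X X⁻     : Carrier
    XX⁻      : X * X⁻ ≈ 1#
    X∈       : O -[1+ 0 ] X
    X⁻∈      : O (+ 1) X⁻
    X∈R      : R X
    Reg      : Carrier → Set
    Reg⇒R    : ∀ {f} → Reg f → R f
    Reg-resp : ∀ {f g} → f ≈ g → Reg f → Reg g
    Reg-add  : ∀ {f g} → Reg f → Reg g → Reg (f + g)
    Reg-neg  : ∀ {f} → Reg f → Reg (- f)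
    Reg-mul  : ∀ {f g} → Reg f → Reg g → Reg (f * g)
    regular⇒0 : ∀ {f} → Reg f → O (+ 1) f → f ≈ 0#
    approximate : ∀ {hG H} → R hG → R H → Σ Carrier λ f → Reg f × R (Π⁻ ^ J * (f - hG)) × O (+ 1 ℤ.- + Λ) (f - H)

-- The tower assembled into a curve.

module Assembly (V : ValuedRing) where
  open ValuedRing V
  open RingKit ring
  open Char prime char
  open Filtration filtration
  open Polynomials ring
  open Places V
  open Chain V using (Monic; monic; descend; inverse₁)
  open PolynomialRing V
  open Tower V

  degree : ℕ → ℕ
  degree zero = 1
  degree (suc j) = degree j ℕ.* p

  0<degree : ∀ j → 0 ℕ.< degree j
  0<degree zero = ℕ.s≤s ℕ.z≤n
  0<degree (suc j) = ℕₚ.*-mono-< (0<degree j) (ℕₚ.<-trans (ℕ.s≤s ℕ.z≤n) 1<p)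

  <degree : ∀ s → s ℕ.< degree s
  <degree zero = ℕ.s≤s ℕ.z≤n
  <degree (suc s) = ℕₚ.≤-trans (ℕₚ.≤-trans (ℕ.s≤s (<degree s)) (ℕₚ.≤-reflexive (≡.sym (ℕₚ.+-comm (degree s) 1))))
    (ℕₚ.≤-trans (ℕₚ.+-monoʳ-≤ (degree s) (ℕₚ.≤-trans (ℕ.s≤s ℕ.z≤n) (<degree s)))
      (ℕₚ.≤-trans (ℕₚ.≤-reflexive (≡.sym (≡.trans (ℕₚ.*-comm (degree s) 2) (≡.cong (degree s ℕ.+_) (ℕₚ.+-identityʳ _))))) (ℕₚ.*-monoʳ-≤ (degree s) 1<p)))

  chain : ∀ j → Monic (degree j)
  chain zero = monic {ε = 0#} 1 zer (solve 1 (λ t → t := (t :* :1) :* (:1 :+ :0)) refl t)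
  chain (suc j) = proj₁ (descend (0<degree j) (chain j))

  -- The coordinate of the tower with a pole of order degree j at infinity.
  X X⁻ : ℕ → Carrier
  X j = Monic.z⁻ (chain j)
  X⁻ j = Monic.z (chain j)

  XX⁻ : ∀ j → X j * X⁻ j ≈ 1#
  XX⁻ j = trans (*-comm _ _) (Monic.zz⁻ (chain j))

  X∈ : ∀ j → O (ℤ.- + degree j) (X j)
  X∈ j = Monic.z⁻∈ (chain j)

  X⁻∈ : ∀ j → O (+ degree j) (X⁻ j)
  X⁻∈ j = Monic.z∈ (chain j)

  recurrence : ∀ j → φ (X⁻ (suc j)) * φ (X j) ≈ 1#
  recurrence j = proj₂ (descend (0<degree j) (chain j))

  monic-inverse : ∀ j {d M} → MonicPol (X j) d M → Σ Carrier λ M⁻ → M * M⁻ ≈ 1# × O (+ (d ℕ.* degree j)) M⁻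
  monic-inverse j {d} {M} h = X⁻ j ^ d * (1# + ε′) , inv , mul₀ʳ
      (at (≡.sym (ℤₚ.pos-* d (degree j))) (powℤ d (X⁻∈ j))) (add one (1⇒0 (proj₁ (proj₂ i))))
    where
    ε = X⁻ j ^ d * (M - X j ^ d)
    deg∈ : ∀ {m f} → Adjoin.Deg (Constants.constants V) (X j) m f → O (+ degree j ℤ.- + m ℤ.* + degree j) f
    deg∈ (nil e) = resp (sym e) zer
    deg∈ {suc m} (snoc {g = g} {c} q (n , h) e) = resp (sym e) (add
      (mono (≤-by (degree j) (ℤS.solve 2 (λ m P → (P ℤS.:- (ℤS.con (+ 1) ℤS.:+ m) ℤS.:* P) ℤS.:+ P ℤS.:= P ℤS.:- m ℤS.:* P) ≡.refl (+ m) (+ degree j))) (deg∈ q))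
      (at (ℤS.solve 2 (λ m P → m ℤS.:* ℤS.:- P ℤS.:= P ℤS.:- (ℤS.con (+ 1) ℤS.:+ m) ℤS.:* P) ≡.refl (+ m) (+ degree j))
        (mul₀ (resp (sym h) (constant n)) (powℤ m (X∈ j)))))
    ε∈ : O (+ 1) ε
    ε∈ = mono (ℤ.+≤+ (0<degree j)) (at (ℤS.solve 2 (λ q P → q ℤS.:+ (P ℤS.:- q) ℤS.:= P) ≡.refl (+ d ℤ.* + degree j) (+ degree j))
      (mul (powℤ d (X⁻∈ j)) (deg∈ h)))
    i = inverse₁ ε∈
    ε′ = proj₁ i
    inv : M * (X⁻ j ^ d * (1# + ε′)) ≈ 1#
    inv = begin
      M * (X⁻ j ^ d * (1# + ε′)) ≈⟨ solve 4 (λ m a z e → m :* (a :* e) := (a :* z :+ a :* (m :- z)) :* e) refl M (X⁻ j ^ d) (X j ^ d) (1# + ε′) ⟩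
      (X⁻ j ^ d * X j ^ d + ε) * (1# + ε′) ≈⟨ *-congʳ (+-congʳ (unit-^ d (trans (*-comm _ _) (XX⁻ j)))) ⟩
      (1# + ε) * (1# + ε′) ≈⟨ proj₂ (proj₂ i) ⟩
      1# ∎

  φ-monic : ∀ x → MonicPol x p (φ x)
  φ-monic x = A.presp (solve 2 (λ a b → a := (b :+ a) :- b) refl x (x ^ p)) (A.p≤ 1<p (A.presp (trans (*-identityˡ _) (*-identityʳ x)) (A.monomial 1 (Subring.R1 (Constants.constants V)))))
    where module A = Adjoin (Constants.constants V) x

  -- A polynomial Π of degree σ in x all of whose roots α satisfy φ(α)^{p-1} = 1 and α^p ≠ α.
  record Modulus (x : Carrier) (σ : ℕ) : Set where
    field
      Π     : Carrier
      monicΠ : MonicPol x σ Π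
      h     : Carrier
      h∈    : Pol x h
      φ-root : φ x ^ ℕ.pred p ≈ 1# + Π * h
      δ⁻ ρ  : Carrier
      δ⁻∈   : Pol x δ⁻
      ρ∈    : Pol x ρ
      δδ⁻   : (x - x ^ p) * δ⁻ ≈ 1# + Π * ρ

  module _ (N : ℕ) {σ : ℕ} (modulus : Modulus (X N) σ) (J : ℕ) where
    open Modulus modulus

    x₀ φ₀ : Carrier
    x₀ = X N
    φ₀ = φ x₀

    private
      module Pl = Subring (pol x₀)
      0<p = ℕₚ.<-trans (ℕ.s≤s ℕ.z≤n) 1<p

    φ₀⁻ : Carrier
    φ₀⁻ = proj₁ (monic-inverse N (φ-monic x₀))
    φ₀φ₀⁻ : φ₀ * φ₀⁻ ≈ 1#
    φ₀φ₀⁻ = proj₁ (proj₂ (monic-inverse N (φ-monic x₀)))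
    Π⁻ : Carrier
    Π⁻ = proj₁ (monic-inverse N monicΠ)
    ΠΠ⁻ : Π * Π⁻ ≈ 1#
    ΠΠ⁻ = proj₁ (proj₂ (monic-inverse N monicΠ))
    M M⁻ : Carrier
    M = Π ^ suc J
    M⁻ = Π⁻ ^ suc J
    D : ℕ
    D = suc J ℕ.* σ

    φ₀∈ : Pol x₀ φ₀
    φ₀∈ = Pl.Radd (Pl.Rpow p (x∈Pol x₀)) (x∈Pol x₀)

    Π∈ : Pol x₀ Π
    Π∈ = suc σ , monic⇒Deg x₀ monicΠ

    private
      p-1 = ℕ.pred p
      p≡ : suc p-1 ≡ p
      p≡ = ℕₚ.suc-pred p {{ℕ.>-nonZero 0<p}}

    frob^ : ∀ s a → (1# + a) ^ degree s ≈ 1# + a ^ degree s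
    frob^ zero a = solve 1 (λ a → (:1 :+ a) :* :1 := :1 :+ a :* :1) refl a
    frob^ (suc s) a = begin
      (1# + a) ^ (degree s ℕ.* p) ≈⟨ ^-assocʳ (1# + a) (degree s) p ⟨
      ((1# + a) ^ degree s) ^ p ≈⟨ ^-congˡ p (frob^ s a) ⟩
      (1# + a ^ degree s) ^ p ≈⟨ trans (frob-+ 1# (a ^ degree s)) (+-cong (1^ p) (^-assocʳ a (degree s) p)) ⟩
      1# + a ^ (degree s ℕ.* p) ∎

    -- φ₀^{(p-1) p^s} = (1 + Π h)^{p^s} = 1 + (Π h)^{p^s}.
    q : ℕ
    q = degree (suc J)
    e : ℕ
    e = q ℕ.∸ suc J
    q≡ : suc J ℕ.+ e ≡ q
    q≡ = ℕₚ.m+[n∸m]≡n (ℕₚ.<⇒≤ (<degree (suc J)))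
    k : ℕ
    k = ℕ.pred (p-1 ℕ.* q)
    k≡ : suc k ≡ p-1 ℕ.* q
    k≡ = ℕₚ.suc-pred (p-1 ℕ.* q) {{ℕ.>-nonZero (ℕₚ.*-mono-< (ℕ.s≤s⁻¹ (≡.subst (1 ℕ.<_) (≡.sym p≡) 1<p)) (ℕₚ.≤-trans (ℕ.s≤s ℕ.z≤n) (<degree (suc J))))}}

    φ̃ ρ̃ : Carrier
    φ̃ = φ₀ ^ k
    ρ̃ = Π ^ e * h ^ q

    φφ̃ : φ₀ * φ̃ ≈ 1# + M * ρ̃
    φφ̃ = begin
      φ₀ ^ suc k ≡⟨ ≡.cong (φ₀ ^_) k≡ ⟩
      φ₀ ^ (p-1 ℕ.* q) ≈⟨ ^-assocʳ φ₀ p-1 q ⟨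
      (φ₀ ^ p-1) ^ q ≈⟨ ^-congˡ q φ-root ⟩
      (1# + Π * h) ^ q ≈⟨ frob^ (suc J) (Π * h) ⟩
      1# + (Π * h) ^ q ≈⟨ +-congˡ (^-distrib-* Π h q) ⟩
      1# + Π ^ q * h ^ q ≈⟨ +-congˡ (*-congʳ (trans (reflexive (≡.cong (Π ^_) (≡.sym q≡))) (^-homo-* Π (suc J) e))) ⟩
      1# + (Π ^ suc J * Π ^ e) * h ^ q ≈⟨ +-congˡ (*-assoc _ _ _) ⟩
      1# + M * ρ̃ ∎

    φ₀-frob : φ₀ ^ p - φ₀ ≈ Π * (φ₀ * h)
    φ₀-frob = begin
      φ₀ ^ p - φ₀ ≈⟨ +-congʳ (trans (reflexive (≡.cong (φ₀ ^_) (≡.sym p≡))) (*-congˡ φ-root)) ⟩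
      φ₀ * (1# + Π * h) - φ₀ ≈⟨ solve 3 (λ f a h → f :* (:1 :+ a :* h) :- f := a :* (f :* h)) refl φ₀ Π h ⟩
      Π * (φ₀ * h) ∎

    private
      0<r = 0<degree N

    module B = AffineLine.BaseStage V x₀ (X⁻ N) (XX⁻ N) (degree N) 0<r (X∈ N) (X⁻∈ N) φ₀⁻ φ₀φ₀⁻ (proj₂ (proj₂ (monic-inverse N (φ-monic x₀))))
      D M M⁻ (unit-^ (suc J) ΠΠ⁻) (monic-pow x₀ (suc J) monicΠ) φ̃ ρ̃ (Pl.Rpow k φ₀∈) (Pl.Rmul (Pl.Rpow e Π∈) (Pl.Rpow q h∈)) φφ̃
    module BR = B.BaseReduction Π Π⁻ ΠΠ⁻ σ monicΠ (proj₂ (proj₂ (monic-inverse N monicΠ))) (Π ^ J) (Pl.Rpow J Π∈) refl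
      (φ₀ * h) (Pl.Rmul φ₀∈ h∈) φ₀-frob

    record At (j : ℕ) : Set₁ where
      field
        R       : Carrier → Set
        S       : Subring R
        u u⁻    : Carrier
        stage   : Stage φ₀ M⁻ B.K₀ S (X j) (X⁻ j) u u⁻ (degree j)
        red     : Reduction B.R₀ Π⁻ R u
        X∈R     : R (X j)
        height  : ℕ
        height≡ : height ℕ.+ j ≡ N
        size≡   : Reduction.size red ≡ p ℕ.^ (σ ℕ.* degree height)

    -- The bottom coordinate is `X N`, so climbing lowers the index, and the pole order at infinity
    -- falls from p^(j+1) to p^j.
    climb : ∀ n j → n ℕ.+ j ≡ N → At j
    climb zero j ≡.refl = record { R = B.R₀ ; S = B.S₀ ; u = B.u ; u⁻ = B.u⁻ ; stage = B.stage₀ ; red = BR.reduction₀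
      ; X∈R = B.pol⇒R₀ (x∈Pol x₀) ; height = 0 ; height≡ = ≡.refl ; size≡ = ≡.cong (p ℕ.^_) (≡.sym (ℕₚ.*-identityʳ σ)) }
    climb (suc n) j eq = record
        { R = _ ; S = _ ; u = _ ; u⁻ = _ ; stage = nextStage ; red = nextReduction
        ; X∈R = All.head (Reduction.gens∈ nextReduction)
        ; height = suc height ; height≡ = ≡.trans (≡.sym (ℕₚ.+-suc height j)) height≡
        ; size≡ = ≡.trans (≡.cong (ℕ._^ p) size≡) (≡.trans (ℕₚ.^-*-assoc p (σ ℕ.* degree height) p) (≡.cong (p ℕ.^_) (ℕₚ.*-assoc σ (degree height) p))) }
      where

      open At (climb n (suc j) (≡.trans (ℕₚ.+-suc n j) eq))
      φy : φ (X j) ≈ u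
      φy = unit-cancelˡ (trans (*-comm _ _) (Stage.uu⁻ stage)) (begin
        u⁻ * φ (X j) ≈⟨ *-congʳ (Stage.u⁻≈ stage) ⟩
        φ (X⁻ (suc j)) * φ (X j) ≈⟨ recurrence j ⟩
        1# ≈⟨ trans (*-comm _ _) (Stage.uu⁻ stage) ⟨
        u⁻ * u ∎)
      open NextStage φ₀ M⁻ B.K₀ stage (XX⁻ j) φy (degree j) {{ℕ.>-nonZero (0<degree j)}} (ℕₚ.*-comm (degree j) p) (X∈ j) (X⁻∈ j)
      open NextReduction ΠΠ⁻ (B.pol⇒R₀ Π∈) red

    -- `D * degree N` is the order at infinity spent on the congruence modulo M, and `p * degree N`
    -- the pole order of φ₀, by which approximations are multiplied.
    Λ : ℕ
    Λ = (D ℕ.+ p) ℕ.* degree N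

    curve : Curve V
    curve = record
      { σ = σ ; r = degree N ; J = suc J ; Λ = Λ ; Λ≡ = ≡.refl
      ; R = R ; S = S ; x₀ = x₀ ; φ₀⁻ = φ₀⁻ ; Π = Π ; Π⁻ = Π⁻ ; φ₀φ₀⁻ = φ₀φ₀⁻ ; ΠΠ⁻ = ΠΠ⁻
      ; x₀∈ = inc (B.pol⇒R₀ (x∈Pol x₀)) ; φ₀⁻∈ = inc B.φ₀⁻∈ ; Π∈ = inc (B.pol⇒R₀ Π∈)
      ; h = h ; h∈ = inc (B.pol⇒R₀ h∈) ; φ-root = φ-root ; δ⁻ = δ⁻ ; δ⁻∈ = inc (B.pol⇒R₀ δ⁻∈)
      ; ρ = ρ ; ρ∈ = inc (B.pol⇒R₀ ρ∈) ; δδ⁻ = δδ⁻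
      ; gens = gens ; gens∈ = gens∈
      ; generate = λ S″ x″ f″ gs → generate S″ (λ { (k , d) → base S″ x″ f″ k d }) gs
      ; gensFrob = gensFrob ; dec = dec ; Code = Code ; finite = ≡.subst (Finite Code) size finite
      ; elem = elem ; elem∈ = elem∈ ; elem-inj = elem-inj
      ; X = X 0 ; X∈ = X∈ 0 ; X⁻ = X⁻ 0 ; X⁻∈ = X⁻∈ 0 ; XX⁻ = XX⁻ 0 ; X∈R = X∈R
      ; Reg = Reg
      ; Reg⇒R = proj₁
      ; Reg-resp = λ { e (a , b , c) → Subring.Rresp S e a , (λ i → Place.resp (place i) e (b i)) , Place.resp Zp e c }
      ; Reg-add = λ { (a , b , c) (a′ , b′ , c′) → Subring.Radd S a a′ , (λ i → Place.add (place i) (b i) (b′ i)) , Place.add Zp c c′ }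
      ; Reg-neg = λ { (a , b , c) → Subring.Rneg S a , (λ i → Place.neg (place i) (b i)) , Place.neg Zp c }
      ; Reg-mul = λ { (a , b , c) (a′ , b′ , c′) → Subring.Rmul S a a′ , (λ i → Place.mul (place i) (b i) (b′ i)) , Place.mul Zp c c′ }
      ; regular⇒0 = λ { (a , b , c) o → regular⇒0 a b c o }
      ; approximate = approximate }
      where
      open At (climb N 0 (ℕₚ.+-identityʳ N))
      open Stage stage
      open Reduction red renaming (size to codeSize)
      size : codeSize ≡ p ℕ.^ (σ ℕ.* degree N)
      size = ≡.trans size≡ (≡.cong (λ j → p ℕ.^ (σ ℕ.* degree j)) (≡.trans (≡.sym (ℕₚ.+-identityʳ height)) height≡))
      inc : ∀ {f} → B.R₀ f → R f
      inc = R₀⊂R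
      base : ∀ {R″} → Subring R″ → R″ x₀ → R″ φ₀⁻ → ∀ k {f} → Pol x₀ (φ₀ ^ k * f) → R″ f
      base {R″} S″ x″ f″ k {f} (_ , d) = Subring.Rresp S″
        (trans (solve 3 (λ a b f → b :* (a :* f) := (a :* b) :* f) refl (φ₀ ^ k) (φ₀⁻ ^ k) f) (trans (*-congʳ (unit-^ k φ₀φ₀⁻)) (*-identityˡ f)))
        (Subring.Rmul S″ (Subring.Rpow S″ k f″)
          (Adjoin.DR (Constants.constants V) x₀ S″ (λ { (n , e) → Subring.Rresp S″ (sym e) (Subring.Rι S″ n) }) x″ d))
      Reg : Carrier → Set
      Reg f = R f × (∀ i → Place.O (place i) (+ 0) f) × Place.O Zp (+ 0) f
      φ₀R = inc (B.pol⇒R₀ φ₀∈)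
      regular : ∀ (Q : Place R φ₀) {a} → Place.Target Q (a - 0#) → Place.O Q (+ 0) (φ₀ * a)
      regular Q {a} o = Q.mono (ℤ.+≤+ ℕ.z≤n) (Q.at (ℤS.solve 1 (λ m → m ℤS.:+ (ℤS.con (+ 1) ℤS.:- m) ℤS.:= ℤS.con (+ 1)) ≡.refl Q.m)
          (Q.mul Q.φ∈ (Q.resp (trans (+-congˡ -0#≈0#) (+-identityʳ a)) o)))
        where module Q = Place Q
      -- The data divided by φ₀ are approximated and the result is multiplied by φ₀. At the finite
      -- places zero is approximated, and there the targets turn into regularity.
      approximate : ∀ {hG H} → R hG → R H → Σ Carrier λ f → Reg f × R (Π⁻ ^ suc J * (f - hG)) × O (+ 1 ℤ.- + Λ) (f - H)
      approximate {hG} {H} rG rH = φ₀ * a , (Subring.Rmul S φ₀R (proj₁ (proj₂ ap)) , (λ i → regular (place i) (near (pl i))) , regular Zp (near zz)) ,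
          Subring.Rresp S (trans (solve 3 (λ f m d → f :* (m :* d) := m :* (f :* d)) refl φ₀ M⁻ (a - φ₀⁻ * hG)) (*-congˡ (clear hG))) (Subring.Rmul S φ₀R (near gg)) ,
          resp (clear H) (at eq (mul B.φ₀∈∞ (near inf)))
        where
        hs : Ix I → Carrier
        hs (pl _) = 0#
        hs zz = 0#
        hs gg = φ₀⁻ * hG
        hs inf = φ₀⁻ * H
        hs∈ : ∀ i → R (hs i)
        hs∈ (pl _) = Subring.R0 S
        hs∈ zz = Subring.R0 S
        hs∈ gg = Subring.Rmul S (inc B.φ₀⁻∈) rG
        hs∈ inf = Subring.Rmul S (inc B.φ₀⁻∈) rH
        ap = approx hs hs∈
        a = proj₁ ap
        near = proj₂ (proj₂ ap)
        clear : ∀ b → φ₀ * (a - φ₀⁻ * b) ≈ φ₀ * a - b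
        clear b = trans (solve 4 (λ f a g b → f :* (a :- g :* b) := f :* a :- (f :* g) :* b) refl φ₀ a φ₀⁻ b) (+-congˡ (-‿cong (trans (*-congʳ φ₀φ₀⁻) (*-identityˡ b))))
        eq : ℤ.- + (p ℕ.* degree N) ℤ.+ (+ 1 ℤ.- B.K₀) ≡ + 1 ℤ.- + Λ
        eq = ≡.trans (ℤS.solve 2 (λ a b → ℤS.:- a ℤS.:+ (ℤS.con (+ 1) ℤS.:- b) ℤS.:= ℤS.con (+ 1) ℤS.:- (b ℤS.:+ a)) ≡.refl (+ (p ℕ.* degree N)) (+ (D ℕ.* degree N)))
          (≡.cong (λ z → + 1 ℤ.- + z) (≡.sym (ℕₚ.*-distribʳ-+ (degree N) D p)))

-- Idempotents of the residue ring of the modulus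

-- X^p - X = ∏ (X - c) over F_p, by splitting off the roots 0, 1, 2, … one at a time.
module FermatProduct (V : ValuedRing) where
  open ValuedRing V
  open RingKit ring
  open Char prime char
  open Constants V

  eval : List Carrier → Carrier → Carrier
  eval [] x = 0#
  eval (a ∷ f) x = a + x * eval f x

  data MonicList : List Carrier → ℕ → Set where
    lead : ∀ {a} → a ≈ 1# → MonicList (a ∷ []) 0
    more : ∀ {a b f n} → MonicList (b ∷ f) n → MonicList (a ∷ b ∷ f) (suc n)

  quotient : Carrier → List Carrier → List Carrier
  quotient c [] = []
  quotient c (a ∷ []) = []
  quotient c (a ∷ b ∷ f) = eval (b ∷ f) c ∷ quotient c (b ∷ f)

  divide : ∀ f g c → eval f g ≈ eval f c + (g - c) * eval (quotient c f) g
  divide [] g c = solve 2 (λ g c → :0 := :0 :+ (g :- c) :* :0) refl g c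
  divide (a ∷ []) g c = solve 3 (λ a g c → a :+ g :* :0 := (a :+ c :* :0) :+ (g :- c) :* :0) refl a g c
  divide (a ∷ b ∷ f) g c = trans (+-congˡ (*-congˡ (divide (b ∷ f) g c)))
    (solve 5 (λ a g c v q → a :+ g :* (v :+ (g :- c) :* q) := (a :+ c :* v) :+ (g :- c) :* (v :+ g :* q)) refl a g c (eval (b ∷ f) c) (eval (quotient c (b ∷ f)) g))

  quotient-monic : ∀ {f n} c → MonicList f (suc n) → MonicList (quotient c f) n
  quotient-monic c (more (lead {a} e)) = lead (trans (+-congˡ (zeroʳ c)) (trans (+-identityʳ a) e))
  quotient-monic c (more m@(more _)) = more (quotient-monic c m)

  product : ℕ → ℕ → Carrier → Carrier
  product k zero g = 1#
  product k (suc n) g = (g - ι k) * product (suc k) n g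

  -- A later root i stays a root of the quotient because i - k is a unit, which k + n ≤ p
  -- guarantees.
  factor : ∀ {f n} k → MonicList f n → k ℕ.+ n ℕ.≤ p → (∀ i → k ℕ.≤ i → i ℕ.< k ℕ.+ n → eval f (ι i) ≈ 0#) → ∀ g → eval f g ≈ product k n g
  factor k (lead {a} e) le roots g = trans (+-congˡ (zeroʳ g)) (trans (+-identityʳ a) e)
  factor {f} {suc n} k m@(more _) le roots g = begin
      eval f g ≈⟨ divide f g (ι k) ⟩
      eval f (ι k) + (g - ι k) * eval q g ≈⟨ +-congʳ (roots k ℕₚ.≤-refl (ℕₚ.m<m+n k (ℕ.s≤s ℕ.z≤n))) ⟩
      0# + (g - ι k) * eval q g ≈⟨ +-identityˡ _ ⟩
      (g - ι k) * eval q g ≈⟨ *-congˡ (factor (suc k) (quotient-monic (ι k) m) (≡.subst (ℕ._≤ p) (ℕₚ.+-suc k n) le) roots′ g) ⟩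
      (g - ι k) * product (suc k) n g ∎
    where
    q = quotient (ι k) f
    roots′ : ∀ i → suc k ℕ.≤ i → i ℕ.< suc k ℕ.+ n → eval q (ι i) ≈ 0#
    roots′ i lt i< with ℕₚ.m≤n⇒∃[o]m+o≡n lt
    ... | d , ≡.refl = unit-cancelˡ (proj₂ inv) (begin
        ι (suc d) * eval q (ι i) ≈⟨ *-congʳ (trans (solve 2 (λ k d → d := (k :+ d) :- k) refl (ι k) (ι (suc d)))
            (+-congʳ (trans (sym (ι-+ k (suc d))) (reflexive (≡.cong ι (ℕₚ.+-suc k d)))))) ⟩
        (ι i - ι k) * eval q (ι i) ≈⟨ solve 2 (λ z w → w := (z :+ w) :- z) refl (eval f (ι k)) _ ⟩
        (eval f (ι k) + (ι i - ι k) * eval q (ι i)) - eval f (ι k) ≈⟨ +-cong (trans (sym (divide f (ι i) (ι k))) (roots i (ℕₚ.<⇒≤ lt) (≡.subst (i ℕ.<_) (≡.sym (ℕₚ.+-suc k n)) i<)))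
            (-‿cong (roots k ℕₚ.≤-refl (ℕₚ.m<m+n k (ℕ.s≤s ℕ.z≤n)))) ⟩
        0# - 0# ≈⟨ solve 1 (λ z → :0 :- :0 := z :* :0) refl (ι (suc d)) ⟩
        ι (suc d) * 0# ∎)
      where
      d<p : suc d ℕ.< p
      d<p = ℕₚ.≤-<-trans (ℕₚ.m≤n+m (suc d) k) (ℕₚ.<-≤-trans (≡.subst (ℕ._< suc k ℕ.+ n) (≡.sym (ℕₚ.+-suc k d)) i<)
        (≡.subst (ℕ._≤ p) (ℕₚ.+-suc k n) le))
      inv = ι-inverse (suc d) (λ dv → ℕₚ.<⇒≱ d<p (ℕ∣.∣⇒≤ dv))

  private
    powerList : ℕ → List Carrier
    powerList zero = 1# ∷ []
    powerList (suc m) = 0# ∷ powerList m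

    powerList-monic : ∀ m → MonicList (powerList m) m
    powerList-monic zero = lead refl
    powerList-monic (suc zero) = more (lead refl)
    powerList-monic (suc (suc m)) = more (powerList-monic (suc m))

    eval-powerList : ∀ m x → eval (powerList m) x ≈ x ^ m
    eval-powerList zero x = trans (+-congˡ (zeroʳ x)) (+-identityʳ _)
    eval-powerList (suc m) x = trans (+-identityˡ _) (*-congˡ (eval-powerList m x))

    -- The coefficient list of X^{m+1} - 1, for m ≥ 0.
    cyc : ℕ → List Carrier
    cyc m = (- 1#) ∷ powerList m

    cyc-monic : ∀ m → MonicList (cyc m) (suc m)
    cyc-monic zero = more (lead refl)
    cyc-monic (suc m) = more (powerList-monic (suc m))

  fermat-product : ∀ g → product 0 p g ≈ g ^ p - g
  fermat-product = go p ≡.refl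
    where
    go : ∀ n → n ≡ p → ∀ g → product 0 n g ≈ g ^ n - g
    go zero e = ⊥-elim (ℕₚ.<⇒≢ (ℕₚ.<-trans (ℕ.s≤s ℕ.z≤n) 1<p) e)
    go (suc zero) e = ⊥-elim (ℕₚ.<⇒≢ 1<p e)
    go (suc (suc m)) ≡.refl g = trans (sym (factor 0 (more (cyc-monic m)) ℕₚ.≤-refl (λ i _ _ → trans (ev (ι i)) (≈⇒-≈0 (frob-ι i))) g)) (ev g)
      where
      ev : ∀ g → eval (0# ∷ cyc m) g ≈ g ^ suc (suc m) - g
      ev g = trans (+-congˡ (*-congˡ (+-congˡ (*-congˡ (eval-powerList m g)))))
        (solve 2 (λ g z → :0 :+ g :* (:- :1 :+ g :* z) := g :* (g :* z) :- g) refl g (g ^ m))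

module Pieces (V : ValuedRing) (𝒞 : Curve V) where
  open ValuedRing V
  open RingKit ring
  open Char prime char
  open Filtration filtration
  open Polynomials ring
  open Constants V
  open FermatProduct V
  open States V using (p-1; p-2; p≡; 0<p-1; p-1≡; x^p; x^p-1)
  open Curve 𝒞 renaming (h to h₀; h∈ to h₀∈)
  open Subring S

  I : Carrier → Set
  I a = R (Π⁻ * a)

  Iresp : ∀ {a b} → a ≈ b → I a → I b
  Iresp e = Rresp (*-congˡ e)

  I0 : I 0#
  I0 = Rresp (sym (zeroʳ _)) R0

  Iadd : ∀ {a b} → I a → I b → I (a + b)
  Iadd a b = Rresp (sym (distribˡ _ _ _)) (Radd a b)

  Ineg : ∀ {a} → I a → I (- a)
  Ineg a = Rresp (-‿distribʳ-* _ _) (Rneg a)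

  Isub : ∀ {a b} → I a → I b → I (a - b)
  Isub a b = Iadd a (Ineg b)

  Imul : ∀ {a b} → R a → I b → I (a * b)
  Imul {a} {b} ra ib = Rresp (solve 3 (λ z a b → a :* (z :* b) := z :* (a :* b)) refl Π⁻ a b) (Rmul ra ib)

  Imulʳ : ∀ {a b} → I a → R b → I (a * b)
  Imulʳ ia rb = Iresp (*-comm _ _) (Imul rb ia)

  IΠ : ∀ {a} → R a → I (Π * a)
  IΠ {a} r = Rresp (sym (trans (solve 3 (λ x y a → y :* (x :* a) := (x :* y) :* a) refl Π Π⁻ a) (trans (*-congʳ ΠΠ⁻) (*-identityˡ a)))) r

  Ifrob : ∀ {a} → I a → I (a ^ p)
  Ifrob {a} i = Iresp (sym (x^p a)) (Imulʳ i (Rpow p-1 (Rresp (trans (sym (*-assoc _ _ a)) (trans (*-congʳ ΠΠ⁻) (*-identityˡ a))) (Rmul Π∈ i))))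

  Fixed : Carrier → Set
  Fixed g = R g × I (g ^ p - g)

  Idempotent : Carrier → Set
  Idempotent a = R a × I (a * a - a)

  complement : ∀ {a} → Idempotent a → Idempotent (1# - a)
  complement {a} (r , i) = Rsub R1 r , Iresp (solve 1 (λ a → a :* a :- a := (:1 :- a) :* (:1 :- a) :- (:1 :- a)) refl a) i

  idem-* : ∀ {a b} → Idempotent a → Idempotent b → Idempotent (a * b)
  idem-* {a} {b} (r , i) (r′ , i′) = Rmul r r′ , Iresp
    (solve 2 (λ a b → (b :* b) :* (a :* a :- a) :+ a :* (b :* b :- b) := (a :* b) :* (a :* b) :- a :* b) refl a b)
    (Iadd (Imul (Rmul r′ r′) i) (Imul r i′))

  Decided : Carrier → Carrier → Set
  Decided ε a = I (ε * a) ⊎ I (ε * (1# - a))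

  record Piece (as : List Carrier) (ε : Carrier) : Set where
    field
      idem    : Idempotent ε
      nonzero : ¬ I ε
      decided : All (Decided ε) as
    ε∈ = proj₁ idem

  Orthogonal : Carrier → Carrier → Set
  Orthogonal a b = I (a * b)

  -- A decomposition of R / Π. Completeness is stated as a test for divisibility by Π on the pieces,
  -- which is the form used for counting.
  record Family (as : List Carrier) : Set where
    field
      pieces : List Carrier
      piece  : All (Piece as) pieces
      orth   : AllPairs Orthogonal pieces
      cover  : ∀ {f} → R f → All (λ ε → I (ε * f)) pieces → I f

  trivialFamily : Family []
  trivialFamily with dec (Rresp refl R1)
  ... | yes i = record { pieces = [] ; piece = [] ; orth = [] ; cover = λ r _ → Iresp (*-identityˡ _) (Imulʳ i r) }
  ... | no ni = record { pieces = 1# ∷ [] ; orth = [] ∷ []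
      ; piece = record { idem = R1 , Iresp (solve 0 (:0 := :1 :* :1 :- :1) refl) I0 ; nonzero = ni ; decided = [] } ∷ []
      ; cover = λ { r (i ∷ []) → Iresp (*-identityˡ _) i } }

  module _ {as : List Carrier} {a : Carrier} (idem-a : Idempotent a) where

    private
      ra = proj₁ idem-a
      1-a∈ = proj₁ (complement idem-a)

    -- The decision drops a half that vanishes modulo Π, so that all pieces stay nonzero.
    keep : ∀ {ε} b → R b → Dec (I (ε * b)) → List Carrier
    keep {ε} b _ (yes _) = []
    keep {ε} b _ (no _) = ε * b ∷ []

    halves : ∀ ε → R ε → List Carrier
    halves ε r = keep {ε} a ra (dec (Rmul r ra)) ++ keep {ε} (1# - a) 1-a∈ (dec (Rmul r 1-a∈))

    refinePieces : ∀ es → All (Piece as) es → List Carrier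
    refinePieces [] [] = []
    refinePieces (ε ∷ es) (q ∷ qs) = halves ε (Piece.ε∈ q) ++ refinePieces es qs

    Multiple : Carrier → Carrier → Set
    Multiple ε e = ∃ λ b → R b × e ≈ ε * b

    keep-multiple : ∀ {ε} b rb d → All (Multiple ε) (keep {ε} b rb d)
    keep-multiple b rb (yes _) = []
    keep-multiple b rb (no _) = (b , rb , refl) ∷ []

    halves-multiple : ∀ ε r → All (Multiple ε) (halves ε r)
    halves-multiple ε r = Allₚ.++⁺ (keep-multiple a ra (dec (Rmul r ra))) (keep-multiple (1# - a) 1-a∈ (dec (Rmul r 1-a∈)))

    decided-multiple : ∀ {ε b c} → R b → Decided ε c → Decided (ε * b) c
    decided-multiple {ε} {b} {c} rb (inj₁ i) = inj₁ (Iresp (solve 3 (λ e b c → b :* (e :* c) := (e :* b) :* c) refl ε b c) (Imul rb i))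
    decided-multiple {ε} {b} {c} rb (inj₂ i) = inj₂ (Iresp (solve 3 (λ e b c → b :* (e :* c) := (e :* b) :* c) refl ε b (1# - c)) (Imul rb i))

    keep-piece : ∀ {ε b} → Piece as ε → (ib : Idempotent b) → Decided (ε * b) a → ∀ d → All (Piece (a ∷ as)) (keep {ε} b (proj₁ ib) d)
    keep-piece q ib da (yes _) = []
    keep-piece q ib da (no ni) = record { idem = idem-* (Piece.idem q) ib ; nonzero = ni
      ; decided = da ∷ All.map (decided-multiple (proj₁ ib)) (Piece.decided q) } ∷ []

    halves-piece : ∀ {ε} (q : Piece as ε) → All (Piece (a ∷ as)) (halves ε (Piece.ε∈ q))
    halves-piece {ε} q = Allₚ.++⁺
      (keep-piece q idem-a (inj₂ (Iresp (solve 2 (λ e a → :- (e :* (a :* a :- a)) := (e :* a) :* (:1 :- a)) refl ε a) (Ineg (Imul (Piece.ε∈ q) (proj₂ idem-a))))) (dec (Rmul (Piece.ε∈ q) ra)))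
      (keep-piece q (complement idem-a) (inj₁ (Iresp (solve 2 (λ e a → :- (e :* (a :* a :- a)) := (e :* (:1 :- a)) :* a) refl ε a) (Ineg (Imul (Piece.ε∈ q) (proj₂ idem-a))))) (dec (Rmul (Piece.ε∈ q) 1-a∈)))

    refine-piece : ∀ es (qs : All (Piece as) es) → All (Piece (a ∷ as)) (refinePieces es qs)
    refine-piece [] [] = []
    refine-piece (ε ∷ es) (q ∷ qs) = Allₚ.++⁺ (halves-piece q) (refine-piece es qs)

    refine-orth-with : ∀ {ε} → R ε → ∀ es (qs : All (Piece as) es) → All (Orthogonal ε) es → All (Orthogonal ε) (refinePieces es qs)
    refine-orth-with r [] [] [] = []
    refine-orth-with {ε} r (e ∷ es) (q ∷ qs) (o ∷ os) = Allₚ.++⁺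
      (All.map (λ { {x} (b , rb , eq) → Iresp (trans (solve 3 (λ b e f → b :* (e :* f) := e :* (f :* b)) refl b ε e) (*-congˡ (sym eq))) (Imul rb o) }) (halves-multiple e (Piece.ε∈ q)))
      (refine-orth-with r es qs os)

    halves-orth : ∀ ε r → AllPairs Orthogonal (halves ε r)
    halves-orth ε r with dec (Rmul r ra) | dec (Rmul r 1-a∈)
    ... | yes _ | yes _ = []
    ... | yes _ | no _ = [] ∷ []
    ... | no _ | yes _ = [] ∷ []
    ... | no _ | no _ = (Iresp (solve 2 (λ e a → :- ((e :* e) :* (a :* a :- a)) := (e :* a) :* (e :* (:1 :- a))) refl ε a) (Ineg (Imul (Rmul r r) (proj₂ idem-a))) ∷ []) ∷ [] ∷ []

    refine-orth : ∀ es (qs : All (Piece as) es) → AllPairs Orthogonal es → AllPairs Orthogonal (refinePieces es qs)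
    refine-orth [] [] [] = []
    refine-orth (ε ∷ es) (q ∷ qs) (o ∷ os) = AllPairsₚ.++⁺ (halves-orth ε (Piece.ε∈ q)) (refine-orth es qs os)
      (All.map (λ { {x} (b , rb , eq) → All.map (λ {y} i → Iresp (trans (solve 3 (λ b e f → b :* (e :* f) := (e :* b) :* f) refl b ε y) (*-congʳ (sym eq))) (Imul rb i))
          (refine-orth-with (Piece.ε∈ q) es qs o) }) (halves-multiple ε (Piece.ε∈ q)))

    keep-cover : ∀ {ε f} b rb d → R f → All (λ e → I (e * f)) (keep {ε} b rb d) → I ((ε * b) * f)
    keep-cover b rb (yes i) rf _ = Imulʳ i rf
    keep-cover b rb (no _) rf (i ∷ []) = i

    halves-cover : ∀ {ε f} r → R f → All (λ e → I (e * f)) (halves ε r) → I (ε * f)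
    halves-cover {ε} {f} r rf all = Iresp (solve 3 (λ e a f → (e :* a) :* f :+ (e :* (:1 :- a)) :* f := e :* f) refl ε a f)
      (Iadd (keep-cover a ra (dec (Rmul r ra)) rf (Allₚ.++⁻ˡ (keep {ε} a ra (dec (Rmul r ra))) all))
        (keep-cover (1# - a) 1-a∈ (dec (Rmul r 1-a∈)) rf (Allₚ.++⁻ʳ (keep {ε} a ra (dec (Rmul r ra))) all)))

    refine-cover : ∀ {f} es (qs : All (Piece as) es) → R f → All (λ e → I (e * f)) (refinePieces es qs) → All (λ e → I (e * f)) es
    refine-cover [] [] rf _ = []
    refine-cover (ε ∷ es) (q ∷ qs) rf all = halves-cover (Piece.ε∈ q) rf (Allₚ.++⁻ˡ (halves ε (Piece.ε∈ q)) all)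
      ∷ refine-cover es qs rf (Allₚ.++⁻ʳ (halves ε (Piece.ε∈ q)) all)

    refine : Family as → Family (a ∷ as)
    refine F = record { pieces = refinePieces pieces piece ; piece = refine-piece pieces piece ; orth = refine-orth pieces piece orth
        ; cover = λ r all → cover r (refine-cover pieces piece r all) }
      where open Family F

  refineAll : ∀ {as} → All Idempotent as → Family as
  refineAll [] = trivialFamily
  refineAll (i ∷ is) = refine i (refineAll is)

  shiftFixed : ∀ {g} k → Fixed g → Fixed (g - ι k)
  shiftFixed {g} k (r , i) = Rsub r (Rι k) , Iresp (begin
    g ^ p - g ≈⟨ solve 3 (λ a b c → a :- b := (a :- c) :- (b :- c)) refl (g ^ p) g (ι k) ⟩
    (g ^ p - ι k) - (g - ι k) ≈⟨ +-congʳ (+-congˡ (-‿cong (sym (frob-ι k)))) ⟩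
    (g ^ p - ι k ^ p) - (g - ι k) ≈⟨ +-congʳ (sym (frob-- g (ι k))) ⟩
    (g - ι k) ^ p - (g - ι k) ∎) i

  -- For p-fixed g and a constant c the element (g - c)^{p-1} is idempotent: the indicator of g ≠ c.
  indicator : ∀ {g} k → Fixed g → Idempotent ((g - ι k) ^ p-1)
  indicator {g} k (r , i) = Rpow p-1 rh , Iresp (begin
      h ^ p-2 * (h ^ p - h) ≈⟨ *-congˡ (+-congʳ (x^p h)) ⟩
      h ^ p-2 * (h * h ^ p-1 - h) ≈⟨ solve 3 (λ h a b → b :* (h :* a :- h) := (h :* b) :* a :- h :* b) refl h (h ^ p-1) (h ^ p-2) ⟩
      (h * h ^ p-2) * h ^ p-1 - h * h ^ p-2 ≈⟨ +-cong (*-congʳ (sym (x^p-1 h))) (-‿cong (sym (x^p-1 h))) ⟩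
      h ^ p-1 * h ^ p-1 - h ^ p-1 ∎) (Imul (Rpow p-2 rh) fixh)
    where
    h = g - ι k
    rh = proj₁ (shiftFixed k (r , i))
    fixh = proj₂ (shiftFixed k (r , i))

  indicators : Carrier → ℕ → ℕ → List Carrier
  indicators g k zero = []
  indicators g k (suc n) = (g - ι k) ^ p-1 ∷ indicators g (suc k) n

  indicators-idem : ∀ {g} → Fixed g → ∀ k n → All Idempotent (indicators g k n)
  indicators-idem fx k zero = []
  indicators-idem fx k (suc n) = indicator k fx ∷ indicators-idem fx (suc k) n

  -- Each (g - c)^(p-1) is 0 or 1 on ε. If all were 1, so would be their product (g^p - g)^(p-1),
  -- which is 0. Hence one of them vanishes, and g = c on ε because g - c equals its p-th power
  -- modulo Π.
  constantOn : ∀ {g ε} → Fixed g → Idempotent ε → ¬ I ε → All (Decided ε) (indicators g 0 p) → ∃ λ c → I (ε * (g - ι c))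
  constantOn {g} {ε} fx (rε , iε) ne ds with search 0 p ds
    where
    search : ∀ k n → All (Decided ε) (indicators g k n) → (∃ λ c → I (ε * (g - ι c))) ⊎ I (ε * (1# - product k n g ^ p-1))
    search k zero [] = inj₂ (Iresp (sym (trans (*-congˡ (trans (+-congˡ (-‿cong (1^ p-1))) (-‿inverseʳ 1#))) (zeroʳ ε))) I0)
    search k (suc n) (inj₁ i ∷ ds) = inj₁ (k , Iresp (begin
        h * (ε * h ^ p-1) - ε * (h ^ p - h) ≈⟨ +-congˡ (-‿cong (*-congˡ (+-congʳ (x^p h)))) ⟩
        h * (ε * h ^ p-1) - ε * (h * h ^ p-1 - h) ≈⟨ solve 3 (λ e h a → h :* (e :* a) :- e :* (h :* a :- h) := e :* h) refl ε h (h ^ p-1) ⟩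
        ε * h ∎) (Isub (Imul rh i) (Imul rε fixh)))
      where
      h = g - ι k
      rh = proj₁ (shiftFixed k fx)
      fixh = proj₂ (shiftFixed k fx)
    search k (suc n) (inj₂ i ∷ ds) with search (suc k) n ds
    ... | inj₁ found = inj₁ found
    ... | inj₂ j = inj₂ (Iresp (begin
        ε * (1# - a) + a * (ε * (1# - b)) ≈⟨ solve 3 (λ e a b → e :* (:1 :- a) :+ a :* (e :* (:1 :- b)) := e :* (:1 :- a :* b)) refl ε a b ⟩
        ε * (1# - a * b) ≈⟨ *-congˡ (+-congˡ (-‿cong (sym (^-distrib-* (g - ι k) (product (suc k) n g) p-1)))) ⟩
        ε * (1# - product k (suc n) g ^ p-1) ∎) (Iadd i (Imul (Rpow p-1 (Rsub (proj₁ fx) (Rι k))) j)))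
      where
      a = (g - ι k) ^ p-1
      b = product (suc k) n g ^ p-1
  ... | inj₁ found = found
  ... | inj₂ j = contradiction (Iresp (begin
      ε * (1# - product 0 p g ^ p-1) + ε * (g ^ p - g) ^ p-1 ≈⟨ +-congʳ (*-congˡ (+-congˡ (-‿cong (^-congˡ p-1 (fermat-product g))))) ⟩
      ε * (1# - (g ^ p - g) ^ p-1) + ε * (g ^ p - g) ^ p-1 ≈⟨ solve 2 (λ e a → e :* (:1 :- a) :+ e :* a := e) refl ε ((g ^ p - g) ^ p-1) ⟩
      ε ∎) (Iadd j (Imul rε (Iresp (sym (x^p-1 _)) (Imulʳ (proj₂ fx) (Rpow p-2 (Rsub (Rpow p (proj₁ fx)) (proj₁ fx)))))))) ne

  valuesOf : List Carrier → List Carrier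
  valuesOf [] = []
  valuesOf (g ∷ gs) = indicators g 0 p ++ valuesOf gs

  valuesOf-idem : ∀ {gs} → All Fixed gs → All Idempotent (valuesOf gs)
  valuesOf-idem [] = []
  valuesOf-idem (fx ∷ fxs) = Allₚ.++⁺ (indicators-idem fx 0 p) (valuesOf-idem fxs)

  constants-on : ∀ {gs ε} → All Fixed gs → Piece (valuesOf gs) ε → All (λ g → ∃ λ c → I (ε * (g - ι c))) gs
  constants-on fxs q = go fxs (Piece.decided q)
    where
    go : ∀ {gs} → All Fixed gs → All (Decided _) (valuesOf gs) → All (λ g → ∃ λ c → I (_ * (g - ι c))) gs
    go [] _ = []
    go {g ∷ gs} (fx ∷ fxs) ds = constantOn fx (Piece.idem q) (Piece.nonzero q) (Allₚ.++⁻ˡ (indicators g 0 p) ds) ∷ go fxs (Allₚ.++⁻ʳ (indicators g 0 p) ds)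

-- Residue rings of rank two over the prime field.

module ResidueRings (V : ValuedRing) (𝒞 : Curve V) where
  open ValuedRing V
  open RingKit ring
  open Char prime char
  open Filtration filtration
  open Polynomials ring
  open Constants V
  open States V using (p-1; p-2; p≡; 0<p-1; p-1≡; x^p; x^p-1)
  open Curve 𝒞
  open Subring S
  open Pieces V 𝒞

  private
    module C = Subring constants
    φ₀ nm δ : Carrier
    φ₀ = φ x₀
    nm = x₀ * x₀ ^ p
    δ = x₀ - x₀ ^ p

    φ₀∈ : R φ₀
    φ₀∈ = Radd (Rpow p x₀∈) x₀∈

    δ∈ : R δ
    δ∈ = Rsub x₀∈ (Rpow p x₀∈)

    fixed-φ₀ : Fixed φ₀
    fixed-φ₀ = φ₀∈ , Iresp (sym (begin
      φ₀ ^ p - φ₀ ≈⟨ +-congʳ (trans (x^p φ₀) (*-congˡ φ-root)) ⟩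
      φ₀ * (1# + Π * h) - φ₀ ≈⟨ solve 3 (λ f a h → f :* (:1 :+ a :* h) :- f := a :* (f :* h)) refl φ₀ Π h ⟩
      Π * (φ₀ * h) ∎)) (IΠ (Rmul φ₀∈ h∈))

    frob-x₀ : I ((x₀ ^ p) ^ p - x₀)
    frob-x₀ = Iresp (sym (begin
      (x₀ ^ p) ^ p - x₀ ≈⟨ solve 3 (λ a b x → a :- x := (a :+ b) :- (b :+ x)) refl ((x₀ ^ p) ^ p) (x₀ ^ p) x₀ ⟩
      ((x₀ ^ p) ^ p + x₀ ^ p) - φ₀ ≈⟨ +-congʳ (frob-+ (x₀ ^ p) x₀) ⟨
      φ₀ ^ p - φ₀ ∎)) (proj₂ fixed-φ₀)

    fixed-nm : Fixed nm
    fixed-nm = Rmul x₀∈ (Rpow p x₀∈) , Iresp (begin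
      x₀ ^ p * ((x₀ ^ p) ^ p - x₀) ≈⟨ solve 3 (λ a b x → a :* (b :- x) := a :* b :- x :* a) refl (x₀ ^ p) ((x₀ ^ p) ^ p) x₀ ⟩
      x₀ ^ p * (x₀ ^ p) ^ p - nm ≈⟨ +-congʳ (sym (^-distrib-* x₀ (x₀ ^ p) p)) ⟩
      nm ^ p - nm ∎) (Imul (Rpow p x₀∈) frob-x₀)

    δ^p+δ : I (δ ^ p + δ)
    δ^p+δ = Iresp (begin
      - ((x₀ ^ p) ^ p - x₀) ≈⟨ solve 3 (λ a b x → :- (b :- x) := (a :- b) :+ (x :- a)) refl (x₀ ^ p) ((x₀ ^ p) ^ p) x₀ ⟩
      (x₀ ^ p - (x₀ ^ p) ^ p) + δ ≈⟨ +-congʳ (sym (frob-- x₀ (x₀ ^ p))) ⟩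
      δ ^ p + δ ∎) (Ineg frob-x₀)

    unit-δ : I (δ * δ⁻ - 1#)
    unit-δ = Iresp (sym (trans (+-congʳ δδ⁻) (solve 1 (λ a → (:1 :+ a) :- :1 := a) refl (Π * ρ)))) (IΠ ρ∈)

    δ⁻^p+δ⁻ : I (δ⁻ ^ p + δ⁻)
    δ⁻^p+δ⁻ = Iresp (begin
        ((δ⁻ * e) * (δ ^ p + δ) - e * (δ * δ⁻ - 1#)) - δ⁻ * ((δ * δ⁻ - 1#) ^ p)
          ≈⟨ +-congˡ (-‿cong (*-congˡ (trans (frob-- (δ * δ⁻) 1#) (+-cong (^-distrib-* δ δ⁻ p) (-‿cong (1^ p)))))) ⟩
        ((δ⁻ * e) * (δ ^ p + δ) - e * (δ * δ⁻ - 1#)) - δ⁻ * (δ ^ p * e - 1#)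
          ≈⟨ solve 4 (λ z e d dp → ((z :* e) :* (dp :+ d) :- e :* (d :* z :- :1)) :- z :* (dp :* e :- :1) := e :+ z) refl δ⁻ e δ (δ ^ p) ⟩
        e + δ⁻ ∎)
      (Isub (Isub (Imul (Rmul δ⁻∈ e∈) δ^p+δ) (Imul e∈ unit-δ)) (Imul δ⁻∈ (Ifrob unit-δ)))
      where
      e = δ⁻ ^ p
      e∈ = Rpow p δ⁻∈

    -- Solving x = a + b x₀ and its conjugate x^p = a + b x₀^p gives these formulas. Numerator and
    -- denominator of b both change sign under Frobenius modulo Π, so b is fixed, and then a is.
    module Coordinates {x : Carrier} (x∈ : R x) (frob-x : I ((x ^ p) ^ p - x)) where
      a b : Carrier
      b = (x - x ^ p) * δ⁻
      a = x - b * x₀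

      b∈ : R b
      b∈ = Rmul (Rsub x∈ (Rpow p x∈)) δ⁻∈

      fixed-b : Fixed b
      fixed-b = b∈ , Iresp (begin
          - (δ⁻ ^ p * ((x ^ p) ^ p - x)) - (x - x ^ p) * (δ⁻ ^ p + δ⁻)
            ≈⟨ solve 5 (λ e xpp x xp z → :- (e :* (xpp :- x)) :- (x :- xp) :* (e :+ z) := (xp :- xpp) :* e :- (x :- xp) :* z) refl (δ⁻ ^ p) ((x ^ p) ^ p) x (x ^ p) δ⁻ ⟩
          (x ^ p - (x ^ p) ^ p) * δ⁻ ^ p - b ≈⟨ +-congʳ (*-congʳ (sym (frob-- x (x ^ p)))) ⟩
          (x - x ^ p) ^ p * δ⁻ ^ p - b ≈⟨ +-congʳ (sym (^-distrib-* (x - x ^ p) δ⁻ p)) ⟩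
          b ^ p - b ∎)
        (Isub (Ineg (Imul (Rpow p δ⁻∈) frob-x)) (Imul (Rsub x∈ (Rpow p x∈)) δ⁻^p+δ⁻))

      fixed-a : Fixed a
      fixed-a = Rsub x∈ (Rmul b∈ x₀∈) , Iresp (begin
          (x - x ^ p) * (δ * δ⁻ - 1#) - x₀ ^ p * (b ^ p - b)
            ≈⟨ solve 6 (λ x xp y yp z bp → (x :- xp) :* ((y :- yp) :* z :- :1) :- yp :* (bp :- (x :- xp) :* z) := (xp :- bp :* yp) :- (x :- ((x :- xp) :* z) :* y)) refl x (x ^ p) x₀ (x₀ ^ p) δ⁻ (b ^ p) ⟩
          (x ^ p - b ^ p * x₀ ^ p) - a ≈⟨ +-congʳ (trans (+-congˡ (-‿cong (sym (^-distrib-* b x₀ p)))) (sym (frob-- x (b * x₀)))) ⟩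
          a ^ p - a ∎)
        (Isub (Imul (Rsub x∈ (Rpow p x∈)) unit-δ) (Imul (Rpow p x₀∈) (proj₂ fixed-b)))

    coordinates : ∀ {gs} → All R gs → All (λ x → I ((x ^ p) ^ p - x)) gs → List Carrier
    coordinates [] [] = []
    coordinates (r ∷ rs) (f ∷ fs) = Coordinates.a r f ∷ Coordinates.b r f ∷ coordinates rs fs

    coordinates-fixed : ∀ {gs} (rs : All R gs) (fs : All _ gs) → All Fixed (coordinates rs fs)
    coordinates-fixed [] [] = []
    coordinates-fixed (r ∷ rs) (f ∷ fs) = Coordinates.fixed-a r f ∷ Coordinates.fixed-b r f ∷ coordinates-fixed rs fs

    fixeds : List Carrier
    fixeds = φ₀ ∷ nm ∷ coordinates gens∈ gensFrob

    fixeds-fixed : All Fixed fixeds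
    fixeds-fixed = fixed-φ₀ ∷ fixed-nm ∷ coordinates-fixed gens∈ gensFrob

  pair : Fin p × Fin p → Carrier
  pair (i , j) = digit i + digit j * x₀

  toDigit : ∀ {c} → Constant c → ∃ λ i → c ≈ digit i
  toDigit {c} (n , e) = Fin.fromℕ< (DM.m%n<n n p) , (begin
      c ≈⟨ e ⟩
      ι n ≡⟨ ≡.cong ι (DM.m≡m%n+[m/n]*n n p) ⟩
      ι (n DM.% p ℕ.+ n DM./ p ℕ.* p) ≈⟨ ι-+ (n DM.% p) (n DM./ p ℕ.* p) ⟩
      ι (n DM.% p) + ι (n DM./ p ℕ.* p) ≈⟨ +-congˡ (ι-∣ (n DM./ p ℕ.* p) (ℕ∣.n∣m*n (n DM./ p))) ⟩
      ι (n DM.% p) + 0# ≈⟨ +-identityʳ _ ⟩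
      ι (n DM.% p) ≡⟨ ≡.cong ι (≡.sym (Finₚ.toℕ-fromℕ< (DM.m%n<n n p))) ⟩
      digit (Fin.fromℕ< (DM.m%n<n n p)) ∎)
    where
    instance
      p≢0 : NonZero p
      p≢0 = ℕ.>-nonZero (ℕₚ.<-trans (ℕ.s≤s ℕ.z≤n) 1<p)

  -- A primitive idempotent modulo Π, with residue ring F_p ⊕ F_p x₀.
  record Residue (ε : Carrier) : Set where
    field
      ε∈          : R ε
      idempotent  : I (ε * ε - ε)
      represent   : ∀ {f} → R f → ∃ λ c → I (ε * (f - pair c))
      independent : ∀ {c d} → I (ε * (pair c - pair d)) → c ≡ d

  -- On ε the trace and norm of x₀ and the coordinates of all generators are constants. The relation
  -- x₀² = τ x₀ - ν makes the combinations of 1 and x₀ a subring, and `generate` shows that it is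
  -- everything.
  module Linear {ε : Carrier} (idem : Idempotent ε) (nonzero : ¬ I ε) (t n : ℕ)
    (τ-on : I (ε * (φ₀ - ι t))) (ν-on : I (ε * (nm - ι n)))
    (gens-on : All (λ g → ∃ λ c → I (ε * (g - ι c))) (coordinates gens∈ gensFrob)) where
    rε : R ε
    rε = proj₁ idem
    τ ν : Carrier
    τ = ι t
    ν = ι n

    Lin : Carrier → Set
    Lin f = R f × Σ Carrier λ c → Σ Carrier λ d → Constant c × Constant d × I (ε * (f - (c + d * x₀)))

    constantι : ∀ n → Constant (ι n)
    constantι n = n , refl

    Lmul : ∀ {f g} → Lin f → Lin g → Lin (f * g)
    Lmul {f} {g} (rf , c , d , cc , cd , i) (rg , c′ , d′ , cc′ , cd′ , i′) = Rmul rf rg ,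
      c * c′ - (d * d′) * ν , c * d′ + d * c′ + (d * d′) * τ ,
      C.Rsub (C.Rmul cc cc′) (C.Rmul (C.Rmul cd cd′) (constantι n)) , C.Radd (C.Radd (C.Rmul cc cd′) (C.Rmul cd cc′)) (C.Rmul (C.Rmul cd cd′) (constantι t)) ,
      Iresp
        (trans (+-congˡ (*-congˡ (+-congʳ (solve 4 (λ x e xp t → x :* (e :* ((xp :+ x) :- t)) := e :* (x :* (xp :+ x) :- x :* t)) refl x₀ ε (x₀ ^ p) τ))))
          (E.lemma))
        (Iadd (Iadd (Imul rg i) (Imul (Radd (constR cc) (Rmul (constR cd) x₀∈)) i′)) (Imul (Rmul (constR cd) (constR cd′)) (Isub (Imul x₀∈ τ-on) ν-on)))
      where
      constR : ∀ {c} → Constant c → R c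
      constR (k , e) = Rresp (sym e) (Rι k)
      module E where
        lemma : (g * (ε * (f - (c + d * x₀))) + (c + d * x₀) * (ε * (g - (c′ + d′ * x₀)))) + (d * d′) * (ε * (x₀ * (x₀ ^ p + x₀) - x₀ * τ) - ε * (nm - ν))
          ≈ ε * (f * g - ((c * c′ - (d * d′) * ν) + (c * d′ + d * c′ + (d * d′) * τ) * x₀))
        lemma = begin
          (g * (ε * (f - (c + d * x₀))) + (c + d * x₀) * (ε * (g - (c′ + d′ * x₀)))) + (d * d′) * (ε * (x₀ * (x₀ ^ p + x₀) - x₀ * τ) - ε * (nm - ν))
            ≈⟨ +-congˡ (*-congˡ (solve 5 (λ e x xp t n → e :* (x :* (xp :+ x) :- x :* t) :- e :* (x :* xp :- n) := e :* (x :* x :- x :* t :+ n)) refl ε x₀ (x₀ ^ p) τ ν)) ⟩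
          (g * (ε * (f - (c + d * x₀))) + (c + d * x₀) * (ε * (g - (c′ + d′ * x₀)))) + (d * d′) * (ε * (x₀ * x₀ - x₀ * τ + ν))
            ≈⟨ +-cong (solve 5 (λ e f g a b → g :* (e :* (f :- a)) :+ a :* (e :* (g :- b)) := e :* (f :* g :- a :* b)) refl ε f g (c + d * x₀) (c′ + d′ * x₀))
                 (solve 3 (λ e k m → k :* (e :* m) := e :* (k :* m)) refl ε (d * d′) (x₀ * x₀ - x₀ * τ + ν)) ⟩
          ε * (f * g - (c + d * x₀) * (c′ + d′ * x₀)) + ε * ((d * d′) * (x₀ * x₀ - x₀ * τ + ν))
            ≈⟨ distribˡ ε _ _ ⟨
          ε * ((f * g - (c + d * x₀) * (c′ + d′ * x₀)) + (d * d′) * (x₀ * x₀ - x₀ * τ + ν))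
            ≈⟨ *-congˡ (solve 8 (λ F c d c′ d′ x t n → (F :- (c :+ d :* x) :* (c′ :+ d′ :* x)) :+ (d :* d′) :* (x :* x :- x :* t :+ n)
                 := F :- ((c :* c′ :- (d :* d′) :* n) :+ (c :* d′ :+ d :* c′ :+ (d :* d′) :* t) :* x)) refl (f * g) c d c′ d′ x₀ τ ν) ⟩
          ε * (f * g - ((c * c′ - (d * d′) * ν) + (c * d′ + d * c′ + (d * d′) * τ) * x₀)) ∎

    lin : Subring Lin
    lin = record
      { Rresp = λ { e (r , c , d , cc , cd , i) → Rresp e r , c , d , cc , cd , Iresp (*-congˡ (+-congʳ e)) i }
      ; R0 = R0 , 0# , 0# , C.R0 , C.R0 , Iresp (solve 2 (λ e x → :0 := e :* (:0 :- (:0 :+ :0 :* x))) refl ε x₀) I0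
      ; R1 = R1 , 1# , 0# , C.R1 , C.R0 , Iresp (solve 2 (λ e x → :0 := e :* (:1 :- (:1 :+ :0 :* x))) refl ε x₀) I0
      ; Radd = λ { {f} {g} (r , c , d , cc , cd , i) (r′ , c′ , d′ , cc′ , cd′ , i′) → Radd r r′ , c + c′ , d + d′ , C.Radd cc cc′ , C.Radd cd cd′ ,
          Iresp (solve 8 (λ e f g c d c′ d′ x → e :* (f :- (c :+ d :* x)) :+ e :* (g :- (c′ :+ d′ :* x)) := e :* ((f :+ g) :- ((c :+ c′) :+ (d :+ d′) :* x))) refl ε f g c d c′ d′ x₀) (Iadd i i′) }
      ; Rneg = λ { {f} (r , c , d , cc , cd , i) → Rneg r , - c , - d , C.Rneg cc , C.Rneg cd ,
          Iresp (solve 5 (λ e f c d x → :- (e :* (f :- (c :+ d :* x))) := e :* ((:- f) :- ((:- c) :+ (:- d) :* x))) refl ε f c d x₀) (Ineg i) }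
      ; Rmul = Lmul }
    module L = Subring lin

    lin-x₀ : Lin x₀
    lin-x₀ = x₀∈ , 0# , 1# , C.R0 , C.R1 , Iresp (solve 2 (λ e x → :0 := e :* (x :- (:0 :+ :1 :* x))) refl ε x₀) I0

    lin-φ₀ : Lin φ₀
    lin-φ₀ = φ₀∈ , τ , 0# , constantι t , C.R0 , Iresp (*-congˡ (+-congˡ (-‿cong (solve 2 (λ t x → t := t :+ :0 :* x) refl τ x₀)))) τ-on

    lin-φ₀⁻ : Lin φ₀⁻
    -- Since φ₀^(p-1) is 1 modulo Π, the inverse of φ₀ is congruent to φ₀^(p-2).
    lin-φ₀⁻ with L.Rpow p-2 lin-φ₀
    ... | r , c , d , cc , cd , i = φ₀⁻∈ , c , d , cc , cd , Iresp (solve 4 (λ e a f c → e :* (a :- c) :- e :* (a :- f) := e :* (f :- c)) refl ε (φ₀ ^ p-2) φ₀⁻ (c + d * x₀)) (Isub i (Imul rε inv))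
      where
      inv : I (φ₀ ^ p-2 - φ₀⁻)
      inv = Iresp (sym (begin
        φ₀ ^ p-2 - φ₀⁻ ≈⟨ +-congʳ (trans (sym (*-identityˡ _)) (*-congʳ (sym φ₀φ₀⁻))) ⟩
        (φ₀ * φ₀⁻) * φ₀ ^ p-2 - φ₀⁻ ≈⟨ +-congʳ (trans (solve 3 (λ f g a → (f :* g) :* a := g :* (f :* a)) refl φ₀ φ₀⁻ (φ₀ ^ p-2)) (*-congˡ (trans (sym (x^p-1 φ₀)) φ-root))) ⟩
        φ₀⁻ * (1# + Π * h) - φ₀⁻ ≈⟨ solve 3 (λ g a h → g :* (:1 :+ a :* h) :- g := a :* (g :* h)) refl φ₀⁻ Π h ⟩
        Π * (φ₀⁻ * h) ∎)) (IΠ (Rmul φ₀⁻∈ h∈))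

    lin-gens : ∀ {gs} (rs : All R gs) (fs : All _ gs) → All (λ g → ∃ λ c → I (ε * (g - ι c))) (coordinates rs fs) → All Lin gs
    lin-gens [] [] [] = []
    lin-gens {x ∷ _} (r ∷ rs) (f ∷ fs) ((α , iα) ∷ (β , iβ) ∷ cs) =
      (r , ι α , ι β , constantι α , constantι β , Iresp
        (solve 6 (λ e x b y s t → e :* ((x :- b :* y) :- s) :+ y :* (e :* (b :- t)) := e :* (x :- (s :+ t :* y))) refl ε x (Coordinates.b r f) x₀ (ι α) (ι β))
        (Iadd iα (Imul x₀∈ iβ))) ∷ lin-gens rs fs cs

    toPair : ∀ {f c d} → (∃ λ i → c ≈ digit i) → (∃ λ j → d ≈ digit j) → I (ε * (f - (c + d * x₀))) → ∃ λ k → I (ε * (f - pair k))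
    toPair (i , e) (j , e′) h = (i , j) , Iresp (*-congˡ (+-congˡ (-‿cong (+-cong e (*-congʳ e′))))) h

    lin⇒pair : ∀ {f} → Lin f → ∃ λ k → I (ε * (f - pair k))
    lin⇒pair (_ , c , d , cc , cd , h) = toPair (toDigit cc) (toDigit cd) h

    represent : ∀ {f} → R f → ∃ λ k → I (ε * (f - pair k))
    represent rf = lin⇒pair (generate lin lin-x₀ lin-φ₀⁻ (lin-gens gens∈ gensFrob gens-on) rf)

    unit-on⇒⊥ : ∀ {c c′} → R c′ → c * c′ ≈ 1# → ¬ I (ε * c)
    unit-on⇒⊥ {c} {c′} r e i = nonzero (Iresp (trans (*-assoc ε c c′) (trans (*-congˡ e) (*-identityʳ ε))) (Imulʳ i r))

    idem-pow : ∀ n → I (ε ^ suc n - ε)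
    idem-pow zero = Iresp (solve 1 (λ e → :0 := e :* :1 :- e) refl ε) I0
    idem-pow (suc n) = Iresp (solve 2 (λ e a → e :* (a :- e) :+ (e :* e :- e) := e :* a :- e) refl ε (ε ^ suc n))
      (Iadd (Imul rε (idem-pow n)) (proj₂ idem))

    -- If x₀ were a constant on ε, then x₀^p would be the same constant, and δ = x₀ - x₀^p, a unit
    -- modulo Π, would vanish on ε.
    x₀-not-constant : ∀ n → ¬ I (ε * (x₀ - ι n))
    x₀-not-constant n i = nonzero (Iresp (begin
        εδ * δ⁻ - Π * (ε * ρ) ≈⟨ solve 5 (λ e d z a r → (e :* d) :* z :- a :* (e :* r) := e :* (d :* z :- a :* r)) refl ε δ δ⁻ Π ρ ⟩
        ε * (δ * δ⁻ - Π * ρ) ≈⟨ *-congˡ (trans (+-congʳ δδ⁻) (solve 1 (λ a → (:1 :+ a) :- a := :1) refl (Π * ρ))) ⟩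
        ε * 1# ≈⟨ *-identityʳ ε ⟩
        ε ∎) (Isub (Imulʳ on-δ δ⁻∈) (IΠ (Rmul rε ρ∈))))
      where
      εδ = ε * δ
      on-δ : I εδ
      on-δ = Iresp (begin
          ((ε * (x₀ - ι n)) * ε ^ p-1 - (ε * (x₀ - ι n)) ^ p) - (ε ^ p - ε) * δ
            ≈⟨ +-cong (+-congˡ (-‿cong (trans (^-distrib-* ε (x₀ - ι n) p) (*-cong (x^p ε) (trans (frob-- x₀ (ι n)) (+-congˡ (-‿cong (frob-ι n)))))))) (-‿cong (*-congʳ (+-congʳ (x^p ε)))) ⟩
          ((ε * (x₀ - ι n)) * ε ^ p-1 - (ε * ε ^ p-1) * (x₀ ^ p - ι n)) - (ε * ε ^ p-1 - ε) * δ
            ≈⟨ solve 5 (λ e a x c y → ((e :* (x :- c)) :* a :- (e :* a) :* (y :- c)) :- (e :* a :- e) :* (x :- y) := e :* (x :- y)) refl ε (ε ^ p-1) x₀ (ι n) (x₀ ^ p) ⟩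
          εδ ∎)
        (Isub (Isub (Imulʳ i (Rpow p-1 rε)) (Ifrob i)) (Imulʳ (Iresp (+-congʳ (sym (x^p ε))) (idem-pow p-1)) δ∈))

    digit∈ : ∀ i → Constant (digit i)
    digit∈ i = Fin.toℕ i , refl

    unit-of : ∀ {c} → Constant c → ¬ c ≈ 0# → Σ Carrier λ v → Constant v × c * v ≈ 1#
    unit-of (n , e) ne = let m , e′ = ι-inverse n (λ d → ne (trans e (ι-∣ n d))) in ι m , (m , refl) , trans (*-congʳ e) e′

    constR : ∀ {c} → Constant c → R c
    constR (n , e) = Rresp (sym e) (Rι n)

    constant-on : ∀ {c} → Constant c → I (ε * c) → ¬ ¬ c ≈ 0#
    constant-on cc h ne = let v , cv , uv = unit-of cc ne in unit-on⇒⊥ (constR cv) uv h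

    not-proportional : ∀ {a b} → Constant a → Constant b → I (ε * (a + b * x₀)) → ¬ ¬ b ≈ 0#
    not-proportional {a} {b} ca cb h ne = absurd (unit-of cb ne)
      where
      absurd : ¬ Σ Carrier λ v → Constant v × b * v ≈ 1#
      absurd (v , cv , uv) = absurd′ (C.Rneg (C.Rmul ca cv))
        where
        absurd′ : ¬ Constant (- (a * v))
        absurd′ (k , e) = x₀-not-constant k (Iresp (begin
          (ε * (a + b * x₀)) * v ≈⟨ solve 5 (λ e a b x v → (e :* (a :+ b :* x)) :* v := e :* ((b :* v) :* x :- (:- (a :* v)))) refl ε a b x₀ v ⟩
          ε * ((b * v) * x₀ - (- (a * v))) ≈⟨ *-congˡ (+-cong (trans (*-congʳ uv) (*-identityˡ x₀)) (-‿cong e)) ⟩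
          ε * (x₀ - ι k) ∎) (Imulʳ h (constR cv)))

    independent : ∀ {c d} → I (ε * (pair c - pair d)) → c ≡ d
    independent {i , j} {k , l} h = go (i Fin.≟ k) (j Fin.≟ l)
      where
      diff : Fin p → Fin p → Carrier
      diff i k = digit i - digit k
      diff∈ : ∀ i k → Constant (diff i k)
      diff∈ i k = C.Rsub (digit∈ i) (digit∈ k)
      split : I (ε * (diff i k + diff j l * x₀))
      split = Iresp (*-congˡ (solve 5 (λ a b c d x → (a :+ b :* x) :- (c :+ d :* x) := (a :- c) :+ (b :- d) :* x) refl (digit i) (digit j) (digit k) (digit l) x₀)) h
      go : Dec (i ≡ k) → Dec (j ≡ l) → (i , j) ≡ (k , l)
      go _ (no ne) = contradiction (λ e → ne (digit-injective (-≈0⇒≈ e))) (not-proportional (diff∈ i k) (diff∈ j l) split)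
      go (no ne) (yes e) = contradiction (λ e′ → ne (digit-injective (-≈0⇒≈ e′))) (constant-on (diff∈ i k)
        (Iresp (*-congˡ (trans (+-congˡ (trans (*-congʳ (≈⇒-≈0 (reflexive (≡.cong digit e)))) (zeroˡ x₀))) (+-identityʳ _))) split))
      go (yes ≡.refl) (yes ≡.refl) = ≡.refl

  constants⇒residue : ∀ {ε} → Idempotent ε → ¬ I ε → All (λ g → ∃ λ c → I (ε * (g - ι c))) fixeds → Residue ε
  constants⇒residue {ε} id ne ((t , τ-on) ∷ (n , ν-on) ∷ gens-on) = record
      { ε∈ = proj₁ id ; idempotent = proj₂ id ; represent = represent ; independent = λ {c} {d} → independent {c} {d} }
    where open Linear id ne t n τ-on ν-on gens-on using (represent; independent)

  piece⇒residue : ∀ {ε} → Piece (valuesOf fixeds) ε → Residue ε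
  piece⇒residue q = constants⇒residue (Piece.idem q) (Piece.nonzero q) (constants-on fixeds-fixed q)

  key : ∀ {es} → All Residue es → ∀ {f} → R f → Tuple (Fin p × Fin p) (length es)
  key [] _ = tt
  key (q ∷ qs) rf = key qs rf , proj₁ (Residue.represent q rf)

  key-separates : ∀ {es} (qs : All Residue es) {f g} (rf : R f) (rg : R g) → key qs rf ≡ key qs rg → All (λ ε → I (ε * (f - g))) es
  key-separates [] _ _ _ = []
  key-separates {ε ∷ _} (q ∷ qs) {f} {g} rf rg e = same (≡.cong proj₂ e) (proj₂ (Residue.represent q rf)) (proj₂ (Residue.represent q rg)) ∷ key-separates qs rf rg (≡.cong proj₁ e)
    where
    same : ∀ {c d} → c ≡ d → I (ε * (f - pair c)) → I (ε * (g - pair d)) → I (ε * (f - g))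
    same {c} ≡.refl i j = Iresp (solve 4 (λ e f g c → e :* (f :- c) :- e :* (g :- c) := e :* (f :- g)) refl ε f g (pair c)) (Isub i j)

  -- Distinct classes modulo Π differ on some piece, where at most p² values are possible. So there
  -- are at least σ r / 2 pieces.
  count : ∀ {es} (qs : All Residue es) → (∀ {f} → R f → All (λ ε → I (ε * f)) es → I f) → p ℕ.^ (σ ℕ.* r) ℕ.≤ (p ℕ.* p) ℕ.^ length es
  count {es} qs cover = finite-≤ finite (finite-Tuple (length es) (finite-× (finite-Fin p) (finite-Fin p))) (λ c → key qs (elem∈ c))
    (λ {c} {d} e → elem-inj (cover (Rsub (elem∈ c) (elem∈ d)) (key-separates qs (elem∈ c) (elem∈ d) e)))

  record Residues : Set where
    field
      es      : List Carrier
      residue : All Residue es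
      orth    : AllPairs Orthogonal es
      enough  : p ℕ.^ (σ ℕ.* r) ℕ.≤ (p ℕ.* p) ℕ.^ length es

  family⇒residues : Family (valuesOf fixeds) → Residues
  family⇒residues F = record { es = pieces ; residue = qs ; orth = orth ; enough = count qs cover }
    where
    open Family F
    qs : All Residue pieces
    qs = All.map piece⇒residue piece

  residues : Residues
  residues = family⇒residues (refineAll (valuesOf-idem fixeds-fixed))

-- Patterns of vanishing orders

module Rows {Q : Set} {q′ : ℕ} (finiteQ : Finite Q (suc q′)) (0Q : Q) where
  private module Q = Finite finiteQ

  q : ℕ
  q = suc q′

  nz : Fin q′ → Q
  nz i = Q.decode (Fin.punchIn (Q.encode 0Q) i)

  nz≢0 : ∀ i → ¬ nz i ≡ 0Q
  nz≢0 i e = Finₚ.punchInᵢ≢i (Q.encode 0Q) i (≡.trans (≡.sym (Q.encode-decode _)) (≡.cong Q.encode e))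

  nz-injective : ∀ {i j} → nz i ≡ nz j → i ≡ j
  nz-injective e = Finₚ.punchIn-injective (Q.encode 0Q) _ _ (Q.decode-injective e)

  -- Vectors of length m whose first nonzero entry is at position e. That the order is exact keeps
  -- the patterns for different i disjoint.
  Row : ℕ → ℕ → Set
  Row zero    _       = ⊥
  Row (suc m) zero    = Fin q′ × Vec Q m
  Row (suc m) (suc e) = Row m e

  toVec : ∀ m e → Row m e → Vec Q m
  toVec (suc m) zero (i , v) = nz i ∷ v
  toVec (suc m) (suc e) r = 0Q ∷ toVec m e r

  finite-Row : ∀ m e → e ℕ.< m → Finite (Row m e) (q′ ℕ.* q ℕ.^ (m ℕ.∸ suc e))
  finite-Row (suc m) zero _ = finite-× (finite-Fin q′) (finite-Vec m finiteQ)
  finite-Row (suc m) (suc e) (ℕ.s≤s lt) = finite-Row m e lt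

  toVec-injective : ∀ m e e′ (r : Row m e) (r′ : Row m e′) → toVec m e r ≡ toVec m e′ r′ → Σ (e ≡ e′) λ q → ≡.subst (Row m) q r ≡ r′
  toVec-injective (suc m) zero zero (i , v) (j , w) eq with nz-injective (≡.cong Vec.head eq) | ≡.cong Vec.tail eq
  ... | ≡.refl | ≡.refl = ≡.refl , ≡.refl
  toVec-injective (suc m) zero (suc e′) (i , v) r′ eq = ⊥-elim (nz≢0 i (≡.cong Vec.head eq))
  toVec-injective (suc m) (suc e) zero r (j , w) eq = ⊥-elim (nz≢0 j (≡.sym (≡.cong Vec.head eq)))
  toVec-injective (suc m) (suc e) (suc e′) r r′ eq with toVec-injective m e e′ r r′ (≡.cong Vec.tail eq)
  ... | ≡.refl , ≡.refl = ≡.refl , ≡.refl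

  toVec-injective₁ : ∀ m e {r r′ : Row m e} → toVec m e r ≡ toVec m e r′ → r ≡ r′
  toVec-injective₁ m e {r} {r′} eq with toVec-injective m e e r r′ eq
  ... | p , eq′ rewrite ℕₚ.≡-irrelevant p ≡.refl = eq′

  module Patterns (M J : ℕ) (M<J : M ℕ.< J) where

    PairRow : Fin (suc M) → Set
    PairRow a = Row J (Fin.toℕ a) × Row J (M ℕ.∸ Fin.toℕ a)

    Pat : ℕ → Set
    Pat zero = ⊤
    Pat (suc zero) = Row J 0
    Pat (suc (suc n)) = Pat n × Σ (Fin (suc M)) PairRow

    -- `double` counts the jets of a pair for one choice of orders. It is the same for all choices
    -- because the two orders add up to M.
    single double : ℕ
    single = q′ ℕ.* q ℕ.^ (J ℕ.∸ 1)
    double = (q′ ℕ.* q′) ℕ.* q ℕ.^ ((J ℕ.∸ 1) ℕ.+ (J ℕ.∸ suc M))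

    patSize : ℕ → ℕ
    patSize zero = 1
    patSize (suc zero) = single
    patSize (suc (suc n)) = patSize n ℕ.* (suc M ℕ.* double)

    private
      exponent : ∀ {a} → a ℕ.≤ M → (J ℕ.∸ suc a) ℕ.+ (J ℕ.∸ suc (M ℕ.∸ a)) ≡ (J ℕ.∸ 1) ℕ.+ (J ℕ.∸ suc M)
      exponent {a} a≤M with ℕₚ.m≤n⇒∃[o]m+o≡n a≤M | ℕₚ.m≤n⇒∃[o]m+o≡n M<J
      ... | b , ≡.refl | c , ≡.refl = ≡.trans
        (≡.cong₂ ℕ._+_
          (≡.trans (≡.cong (ℕ._∸ suc a) (≡.cong suc (ℕₚ.+-assoc a b c))) (ℕₚ.m+n∸m≡n a (b ℕ.+ c)))
          (≡.trans (≡.cong₂ (λ x y → x ℕ.∸ y) (≡.trans (≡.cong (ℕ._+ c) (ℕₚ.+-comm a b)) (ℕₚ.+-assoc b a c)) (ℕₚ.m+n∸m≡n a b)) (ℕₚ.m+n∸m≡n b (a ℕ.+ c))))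
        (≡.trans (ℕS.solve 3 (λ a b c → (b ℕS.:+ c) ℕS.:+ (a ℕS.:+ c) ℕS.:= (a ℕS.:+ b ℕS.:+ c) ℕS.:+ c) ≡.refl a b c)
          (≡.cong ((a ℕ.+ b ℕ.+ c) ℕ.+_) (≡.sym (ℕₚ.m+n∸m≡n (a ℕ.+ b) c))))

    finite-Pair : ∀ a → Finite (PairRow a) double
    finite-Pair a = finite-cast
      (≡.trans (ℕS.solve 3 (λ x u v → (x ℕS.:* u) ℕS.:* (x ℕS.:* v) ℕS.:= (x ℕS.:* x) ℕS.:* (u ℕS.:* v)) ≡.refl q′ (q ℕ.^ (J ℕ.∸ suc (Fin.toℕ a))) (q ℕ.^ (J ℕ.∸ suc (M ℕ.∸ Fin.toℕ a))))
        (≡.cong ((q′ ℕ.* q′) ℕ.*_) (≡.trans (≡.sym (ℕₚ.^-distribˡ-+-* q (J ℕ.∸ suc (Fin.toℕ a)) _)) (≡.cong (q ℕ.^_) (exponent a≤M)))))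
      (finite-× (finite-Row J (Fin.toℕ a) (ℕₚ.≤-<-trans a≤M M<J)) (finite-Row J (M ℕ.∸ Fin.toℕ a) (ℕₚ.≤-<-trans (ℕₚ.m∸n≤m M (Fin.toℕ a)) M<J)))
      where
      a≤M : Fin.toℕ a ℕ.≤ M
      a≤M = ℕ.s≤s⁻¹ (Finₚ.toℕ<n a)

    finite-Pat : ∀ n → Finite (Pat n) (patSize n)
    finite-Pat zero = finite-⊤
    finite-Pat (suc zero) = finite-Row J 0 (ℕₚ.≤-<-trans ℕ.z≤n M<J)
    finite-Pat (suc (suc n)) = finite-× (finite-Pat n) (finite-Σ finite-Pair)

    code : ∀ n → Pat n → Tuple (Fin (suc M)) ⌊ n /2⌋
    code zero _ = tt
    code (suc zero) _ = tt
    code (suc (suc n)) (x , a , _) = code n x , a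

    vecs : ∀ n → Pat n → Vec (Vec Q J) n
    vecs zero _ = []
    vecs (suc zero) r = toVec J 0 r ∷ []
    vecs (suc (suc n)) (x , a , r , r′) = toVec J (Fin.toℕ a) r ∷ toVec J (M ℕ.∸ Fin.toℕ a) r′ ∷ vecs n x

    vecs-injective : ∀ n {x y} → vecs n x ≡ vecs n y → x ≡ y
    vecs-injective zero _ = ≡.refl
    vecs-injective (suc zero) e = toVec-injective₁ J 0 (≡.cong Vec.head e)
    vecs-injective (suc (suc n)) {x , a , r , r′} {y , b , s , s′} e
      with Finₚ.toℕ-injective {i = a} {j = b} (proj₁ (toVec-injective J _ _ r s (≡.cong Vec.head e))) | vecs-injective n {x} {y} (≡.cong (λ v → Vec.tail (Vec.tail v)) e)
    ... | ≡.refl | ≡.refl = ≡.cong₂ (λ u v → x , a , u , v)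
      (toVec-injective₁ J (Fin.toℕ a) (≡.cong Vec.head e))
      (toVec-injective₁ J (M ℕ.∸ Fin.toℕ a) (≡.cong (λ v → Vec.head (Vec.tail v)) e))

    -- The complementary jets, below the orders (a , L - a). A pair has q^L of them whatever a is,
    -- so all vanishing classes are smaller by the same factor.
    Trunc : (L n : ℕ) → Tuple (Fin (suc L)) ⌊ n /2⌋ → Set
    Trunc L zero _ = ⊤
    Trunc L (suc zero) _ = ⊤
    Trunc L (suc (suc n)) (s , a) = Trunc L n s × (Vec Q (Fin.toℕ a) × Vec Q (L ℕ.∸ Fin.toℕ a))

    finite-Trunc : ∀ L n s → Finite (Trunc L n s) ((q ℕ.^ L) ℕ.^ ⌊ n /2⌋)
    finite-Trunc L zero _ = finite-⊤
    finite-Trunc L (suc zero) _ = finite-⊤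
    finite-Trunc L (suc (suc n)) (s , a) = finite-cast (≡.trans (≡.cong ((q ℕ.^ L) ℕ.^ ⌊ n /2⌋ ℕ.*_)
        (≡.trans (≡.sym (ℕₚ.^-distribˡ-+-* q (Fin.toℕ a) _)) (≡.cong (q ℕ.^_) (ℕₚ.m+[n∸m]≡n (ℕ.s≤s⁻¹ (Finₚ.toℕ<n a))))))
        (ℕₚ.*-comm ((q ℕ.^ L) ℕ.^ ⌊ n /2⌋) (q ℕ.^ L)))
      (finite-× (finite-Trunc L n s) (finite-× (finite-Vec (Fin.toℕ a) finiteQ) (finite-Vec (L ℕ.∸ Fin.toℕ a) finiteQ)))

-- Elements with prescribed jets

module Construction (V : ValuedRing) (𝒞 : Curve V) (ℛ : ResidueRings.Residues V 𝒞)
  (M : ℕ) (2M≤J : M ℕ.+ M ℕ.≤ Curve.J 𝒞) (M<J : M ℕ.< Curve.J 𝒞) where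
  open ValuedRing V
  open RingKit ring
  open Char prime char
  open Filtration filtration
  open Polynomials ring
  open Constants V
  open Tower V using (evalTuple)
  open Curve 𝒞
  open Subring S
  open Pieces V 𝒞
  open ResidueRings V 𝒞
  open Residues ℛ

  record I^ (k : ℕ) (a : Carrier) : Set where
    constructor multiple
    field quotient∈ : R (Π⁻ ^ k * a)
  open I^

  ^resp : ∀ {k a b} → a ≈ b → I^ k a → I^ k b
  ^resp e (multiple x) = multiple (Rresp (*-congˡ e) x)

  ^add : ∀ {k a b} → I^ k a → I^ k b → I^ k (a + b)
  ^add (multiple x) (multiple y) = multiple (Rresp (sym (distribˡ _ _ _)) (Radd x y))

  ^neg : ∀ {k a} → I^ k a → I^ k (- a)
  ^neg (multiple x) = multiple (Rresp (-‿distribʳ-* _ _) (Rneg x))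

  ^sub : ∀ {k a b} → I^ k a → I^ k b → I^ k (a - b)
  ^sub x y = ^add x (^neg y)

  ^zero : ∀ {k} → I^ k 0#
  ^zero = multiple (Rresp (sym (zeroʳ _)) R0)

  ^mul : ∀ {k a b} → R a → I^ k b → I^ k (a * b)
  ^mul {k} {a} {b} r (multiple x) = multiple (Rresp (solve 3 (λ z a b → a :* (z :* b) := z :* (a :* b)) refl (Π⁻ ^ k) a b) (Rmul r x))

  ^mulʳ : ∀ {k a b} → I^ k a → R b → I^ k (a * b)
  ^mulʳ x r = ^resp (*-comm _ _) (^mul r x)

  ^times : ∀ {k l a b} → I^ k a → I^ l b → I^ (k ℕ.+ l) (a * b)
  ^times {k} {l} {a} {b} (multiple x) (multiple y) = multiple (Rresp
    (trans (solve 4 (λ z w a b → (z :* a) :* (w :* b) := (z :* w) :* (a :* b)) refl (Π⁻ ^ k) (Π⁻ ^ l) a b) (*-congʳ (sym (^-homo-* Π⁻ k l)))) (Rmul x y))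

  ^of-R : ∀ {a} → R a → I^ 0 a
  ^of-R r = multiple (Rresp (sym (*-identityˡ _)) r)

  private
    cancel : ∀ k a → (Π⁻ * Π⁻ ^ k) * (Π * a) ≈ Π⁻ ^ k * a
    cancel k a = trans (solve 4 (λ q z w a → (z :* w) :* (q :* a) := (q :* z) :* (w :* a)) refl Π Π⁻ (Π⁻ ^ k) a) (trans (*-congʳ ΠΠ⁻) (*-identityˡ _))

  ^shift : ∀ {k a} → I^ k a → I^ (suc k) (Π * a)
  ^shift {k} {a} (multiple x) = multiple (Rresp (sym (cancel k a)) x)

  ^unshift : ∀ {k a} → I^ (suc k) (Π * a) → I^ k a
  ^unshift {k} {a} (multiple x) = multiple (Rresp (cancel k a) x)

  ^lower : ∀ {k a} → I^ (suc k) a → I^ k a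
  ^lower x = ^unshift (^mul Π∈ x)

  ^mono : ∀ {k l a} → k ℕ.≤ l → I^ l a → I^ k a
  ^mono le = go (ℕₚ.≤⇒≤′ le)
    where
    go : ∀ {k l a} → k ℕ.≤′ l → I^ l a → I^ k a
    go ℕ.≤′-refl x = x
    go (ℕ.≤′-step le) x = go le (^lower x)

  ^one⇒I : ∀ {a} → I^ 1 a → I a
  ^one⇒I (multiple x) = Rresp (*-congʳ (*-identityʳ Π⁻)) x

  -- Raising an idempotent modulo Π to a large power of p makes it idempotent modulo Π^J.

  p^ : ℕ → ℕ
  p^ zero = 1
  p^ (suc s) = p^ s ℕ.* p

  <p^ : ∀ s → s ℕ.< p^ s
  <p^ zero = ℕ.s≤s ℕ.z≤n
  <p^ (suc s) = ℕₚ.≤-trans (ℕₚ.≤-trans (ℕ.s≤s (<p^ s)) (ℕₚ.≤-reflexive (≡.sym (ℕₚ.+-comm (p^ s) 1))))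
    (ℕₚ.≤-trans (ℕₚ.+-monoʳ-≤ (p^ s) (ℕₚ.≤-trans (ℕ.s≤s ℕ.z≤n) (<p^ s)))
      (ℕₚ.≤-trans (ℕₚ.≤-reflexive (≡.sym (≡.trans (ℕₚ.*-comm (p^ s) 2) (≡.cong (p^ s ℕ.+_) (ℕₚ.+-identityʳ _))))) (ℕₚ.*-monoʳ-≤ (p^ s) 1<p)))

  E : ℕ
  E = p^ J

  frobs : ∀ s a b → (a - b) ^ p^ s ≈ a ^ p^ s - b ^ p^ s
  frobs zero a b = solve 2 (λ a b → (a :- b) :* :1 := a :* :1 :- b :* :1) refl a b
  frobs (suc s) a b = begin
    (a - b) ^ (p^ s ℕ.* p) ≈⟨ ^-assocʳ (a - b) (p^ s) p ⟨
    ((a - b) ^ p^ s) ^ p ≈⟨ ^-congˡ p (frobs s a b) ⟩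
    (a ^ p^ s - b ^ p^ s) ^ p ≈⟨ trans (frob-- _ _) (+-cong (^-assocʳ a (p^ s) p) (-‿cong (^-assocʳ b (p^ s) p))) ⟩
    a ^ (p^ s ℕ.* p) - b ^ (p^ s ℕ.* p) ∎

  ^lift : ∀ {a} → I a → I^ J (a ^ E)
  ^lift {a} i = ^mono {J} {E} (ℕₚ.<⇒≤ (<p^ J)) (multiple (Rresp (^-distrib-* Π⁻ a E) (Rpow E i)))

  record Hat (ε̂ : Carrier) : Set where
    field
      ∈R    : R ε̂
      idem  : I^ J (ε̂ * ε̂ - ε̂)
      indep : ∀ {c d} → I (ε̂ * (pair c - pair d)) → c ≡ d

  idem-pow : ∀ {ε} → R ε → I (ε * ε - ε) → ∀ n → I (ε ^ suc n - ε)
  idem-pow {ε} r i zero = Iresp (solve 1 (λ e → :0 := e :* :1 :- e) refl ε) I0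
  idem-pow {ε} r i (suc n) = Iresp (solve 2 (λ e a → e :* (a :- e) :+ (e :* e :- e) := e :* a :- e) refl ε (ε ^ suc n))
    (Iadd (Imul r (idem-pow r i n)) i)

  pair∈ : ∀ c → R (pair c)
  pair∈ (i , j) = Radd (Rι (Fin.toℕ i)) (Rmul (Rι (Fin.toℕ j)) x₀∈)

  -- By additivity of Frobenius, ε^E is idempotent up to (ε² - ε)^E, which is divisible by Π^J. It
  -- is congruent to ε modulo Π, so the residue ring is unchanged.
  hat : ∀ {ε} → Residue ε → Hat (ε ^ E)
  hat {ε} q = record
    { ∈R = Rpow E ε∈
    ; idem = ^resp (trans (frobs J (ε * ε) ε) (+-congʳ (^-distrib-* ε ε E))) (^lift idempotent)
    ; indep = λ {c} {d} i → independent (Iresp (solve 3 (λ a e d → a :* d :- (a :- e) :* d := e :* d) refl (ε ^ E) ε (pair c - pair d))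
        (Isub i (Imulʳ powE (Rsub (pair∈ c) (pair∈ d))))) }
    where
    open Residue q
    powE : I (ε ^ E - ε)
    powE = ≡.subst (λ k → I (ε ^ k - ε)) (ℕₚ.suc-pred E {{ℕ.>-nonZero (ℕₚ.≤-trans (ℕ.s≤s ℕ.z≤n) (<p^ J))}}) (idem-pow ε∈ idempotent (ℕ.pred E))

  hat-orth : ∀ {ε ε′} → I (ε * ε′) → I^ J (ε ^ E * ε′ ^ E)
  hat-orth {ε} {ε′} i = ^resp (^-distrib-* ε ε′ E) (^lift i)

  Q : Set
  Q = Fin p × Fin p

  -- A Π-adic expansion in Horner form; the digits `pair c` serve all residue rings alike.
  rv : ∀ {m} → Vec Q m → Carrier
  rv [] = 0#
  rv (c ∷ v) = pair c + Π * rv v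

  rv∈ : ∀ {m} (v : Vec Q m) → R (rv v)
  rv∈ [] = R0
  rv∈ (c ∷ v) = Radd (pair∈ c) (Rmul Π∈ (rv∈ v))

  rv-injective : ∀ {ε̂} → Hat ε̂ → ∀ {m} (v w : Vec Q m) → I^ m (ε̂ * (rv v - rv w)) → v ≡ w
  rv-injective H [] [] _ = ≡.refl
  rv-injective {ε̂} H {suc m} (c ∷ v) (d ∷ w) i = cons (Hat.indep H low)
    where
    low : I (ε̂ * (pair c - pair d))
    low = Iresp (solve 6 (λ e c q v d w → e :* ((c :+ q :* v) :- (d :+ q :* w)) :- q :* (e :* (v :- w)) := e :* (c :- d)) refl ε̂ (pair c) Π (rv v) (pair d) (rv w))
      (Isub (^one⇒I (^mono {1} {suc m} (ℕ.s≤s ℕ.z≤n) i)) (IΠ (Rmul (Hat.∈R H) (Rsub (rv∈ v) (rv∈ w)))))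
    cons : c ≡ d → (c ∷ v) ≡ (d ∷ w)
    cons ≡.refl = ≡.cong (c ∷_) (rv-injective H v w (^unshift {m} (^resp
      (solve 5 (λ e c q v w → e :* ((c :+ q :* v) :- (c :+ q :* w)) := q :* (e :* (v :- w))) refl ε̂ (pair c) Π (rv v) (rv w)) i)))

  private
    0<p : 0 ℕ.< p
    0<p = ℕₚ.<-trans (ℕ.s≤s ℕ.z≤n) 1<p

  0Q : Q
  0Q = Fin.fromℕ< 0<p , Fin.fromℕ< 0<p

  pair-0Q : pair 0Q ≈ 0#
  pair-0Q = trans (+-cong d0 (*-congʳ d0)) (solve 1 (λ x → :0 :+ :0 :* x := :0) refl x₀)
    where
    d0 : digit (Fin.fromℕ< 0<p) ≈ 0#
    d0 = reflexive (≡.cong ι (Finₚ.toℕ-fromℕ< 0<p))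

  q′ : ℕ
  q′ = ℕ.pred (p ℕ.* p)

  q′≡ : p ℕ.* p ≡ suc q′
  q′≡ = ≡.sym (ℕₚ.suc-pred (p ℕ.* p) {{ℕ.>-nonZero (ℕₚ.*-mono-< 0<p 0<p)}})

  finiteQ : Finite (Fin p × Fin p) (suc q′)
  finiteQ = finite-cast q′≡ (finite-× (finite-Fin p) (finite-Fin p))

  open Rows finiteQ 0Q public
  open Patterns M J M<J public

  rv-toVec : ∀ m e (r : Row m e) → I^ e (rv (toVec m e r))
  rv-toVec (suc m) zero r = ^of-R (rv∈ (toVec (suc m) zero r))
  rv-toVec (suc m) (suc e) r = ^resp (sym (trans (+-congʳ pair-0Q) (+-identityˡ _))) (^shift {e} (rv-toVec m e r))

  comb : ∀ es → All (λ _ → Σ Carrier R) es → Carrier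
  comb [] [] = 0#
  comb (ε ∷ es) ((b , _) ∷ bs) = ε ^ E * b + comb es bs

  comb∈ : ∀ {es} → All Residue es → ∀ bs → R (comb es bs)
  comb∈ [] [] = R0
  comb∈ (q ∷ qs) ((b , r) ∷ bs) = Radd (Rmul (Rpow E (Residue.ε∈ q)) r) (comb∈ qs bs)

  Picked : Carrier → ∀ es → All (λ _ → Σ Carrier R) es → Set
  Picked F [] [] = ⊤
  Picked F (ε ∷ es) ((b , _) ∷ bs) = I^ J (ε ^ E * F - ε ^ E * b) × Picked F es bs

  picked-resp : ∀ {F G} {es} → All Residue es → ∀ bs → I^ J (G - F) → Picked F es bs → Picked G es bs
  picked-resp [] [] _ _ = tt
  picked-resp {F} {G} {ε ∷ _} (q ∷ qs) ((b , _) ∷ bs) i (h , hs) =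
    ^resp (solve 4 (λ e f g b → (e :* f :- e :* b) :+ e :* (g :- f) := e :* g :- e :* b) refl (ε ^ E) F G b) (^add {J} h (^mul {J} (Rpow E (Residue.ε∈ q)) i)) , picked-resp qs bs i hs

  comb-orth : ∀ {ε} → R ε → ∀ es bs → All (Orthogonal ε) es → I^ J (ε ^ E * comb es bs)
  comb-orth r [] [] [] = ^resp (sym (zeroʳ _)) (^zero {J})
  comb-orth {ε} r (ε′ ∷ es) ((b , rb) ∷ bs) (o ∷ os) = ^resp
    (solve 4 (λ e f b c → (e :* f) :* b :+ e :* c := e :* (f :* b :+ c)) refl (ε ^ E) (ε′ ^ E) b (comb es bs))
    (^add {J} (^mulʳ {J} (hat-orth o) rb) (comb-orth r es bs os))

  -- The accumulator c is the part of the combination already passed; it has to be invisible at the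
  -- idempotents still to come.
  picked : ∀ c es bs → All Residue es → AllPairs Orthogonal es → All (λ ε → I^ J (ε ^ E * c)) es → Picked (c + comb es bs) es bs
  picked c [] [] _ _ _ = tt
  picked c (ε ∷ es) ((b , rb) ∷ bs) (q ∷ qs) (o ∷ os) (i ∷ is) =
    ^resp (solve 4 (λ e c b k → (e :* c :+ (e :* e :- e) :* b) :+ e :* k := e :* (c :+ (e :* b :+ k)) :- e :* b) refl (ε ^ E) c b (comb es bs))
      (^add {J} (^add {J} i (^mulʳ {J} (Hat.idem (hat q)) rb)) (comb-orth (Residue.ε∈ q) es bs o)) ,
    picked-resp qs bs (^resp (solve 3 (λ c x y → :0 := (c :+ (x :+ y)) :- ((c :+ x) :+ y)) refl c (ε ^ E * b) (comb es bs)) (^zero {J}))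
      (picked (c + ε ^ E * b) es bs qs os (further es o is))
    where
    further : ∀ es → All (Orthogonal ε) es → All (λ ε → I^ J (ε ^ E * c)) es → All (λ ε′ → I^ J (ε′ ^ E * (c + ε ^ E * b))) es
    further [] [] [] = []
    further (ε′ ∷ es) (o ∷ os) (i ∷ is) = ^resp (solve 4 (λ f c e b → f :* c :+ (e :* f) :* b := f :* (c :+ e :* b)) refl (ε′ ^ E) c (ε ^ E) b)
      (^add {J} i (^mulʳ {J} (hat-orth o) rb)) ∷ further es os is

  comb-picked : ∀ bs → Picked (comb es bs) es bs
  comb-picked bs = picked-resp residue bs (^resp (solve 1 (λ k → :0 := k :- (:0 :+ k)) refl (comb es bs)) (^zero {J}))
    (picked 0# es bs residue orth (All.map (λ _ → ^resp (sym (zeroʳ _)) (^zero {J})) residue))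

  Vanish : (L : ℕ) → ∀ es → Tuple (Fin (suc L)) ⌊ length es /2⌋ → Carrier → Set
  Vanish L [] _ F = ⊤
  Vanish L (_ ∷ []) _ F = ⊤
  Vanish L (ε ∷ ε′ ∷ es) (s , a) F = Vanish L es s F × I^ (Fin.toℕ a) (ε ^ E * F) × I^ (L ℕ.∸ Fin.toℕ a) (ε′ ^ E * F)

  vanish-sub : ∀ {L} es s {F G} → Vanish L es s F → Vanish L es s G → Vanish L es s (F - G)
  vanish-sub [] _ _ _ = tt
  vanish-sub (_ ∷ []) _ _ _ = tt
  vanish-sub {L} (ε ∷ ε′ ∷ es) (s , a) {F} {G} (v , i , j) (v′ , i′ , j′) = vanish-sub es s v v′ ,
      ^resp (eq ε) (^sub {Fin.toℕ a} i i′) , ^resp (eq ε′) (^sub {L ℕ.∸ Fin.toℕ a} j j′)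
    where
    eq : ∀ ε → ε ^ E * F - ε ^ E * G ≈ ε ^ E * (F - G)
    eq ε = solve 3 (λ e f g → e :* f :- e :* g := e :* (f :- g)) refl (ε ^ E) F G

  addFin : Fin (suc M) → Fin (suc M) → Fin (suc (M ℕ.+ M))
  addFin a b = Fin.fromℕ< {Fin.toℕ a ℕ.+ Fin.toℕ b} (ℕ.s≤s (ℕₚ.+-mono-≤ (ℕ.s≤s⁻¹ (Finₚ.toℕ<n a)) (ℕ.s≤s⁻¹ (Finₚ.toℕ<n b))))

  toℕ-addFin : ∀ a b → Fin.toℕ (addFin a b) ≡ Fin.toℕ a ℕ.+ Fin.toℕ b
  toℕ-addFin a b = Finₚ.toℕ-fromℕ< _

  addTuple : ∀ k → Tuple (Fin (suc M)) k → Tuple (Fin (suc M)) k → Tuple (Fin (suc (M ℕ.+ M))) k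
  addTuple zero _ _ = tt
  addTuple (suc k) (s , a) (t , b) = addTuple k s t , addFin a b

  -- The lifted idempotent equals its square only modulo Π^J. The orders reached by a product are at
  -- most 2M, and 2M ≤ J keeps them within this precision.
  vanish-mul : ∀ {es} → All Residue es → ∀ s t {F G} → R F → R G → Vanish M es s F → Vanish M es t G → Vanish (M ℕ.+ M) es (addTuple _ s t) (F * G)
  vanish-mul [] _ _ _ _ _ _ = tt
  vanish-mul (_ ∷ []) _ _ _ _ _ _ = tt
  vanish-mul {ε ∷ ε′ ∷ es} (q ∷ q′ ∷ qs) (s , a) (t , b) {F} {G} rF rG (v , i , j) (v′ , i′ , j′) = vanish-mul qs s t rF rG v v′ ,
      ≡.subst (λ k → I^ k (ε ^ E * (F * G))) (≡.sym (toℕ-addFin a b)) (mulAt q (Fin.toℕ a) (Fin.toℕ b) (ℕₚ.≤-trans (ℕₚ.+-mono-≤ a≤ b≤) 2M≤J) i i′) ,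
      ≡.subst (λ k → I^ k (ε′ ^ E * (F * G))) (≡.trans eq (≡.cong (M ℕ.+ M ℕ.∸_) (≡.sym (toℕ-addFin a b))))
        (mulAt q′ (M ℕ.∸ Fin.toℕ a) (M ℕ.∸ Fin.toℕ b) (ℕₚ.≤-trans (ℕₚ.+-mono-≤ (ℕₚ.m∸n≤m M (Fin.toℕ a)) (ℕₚ.m∸n≤m M (Fin.toℕ b))) 2M≤J) j j′)
    where
    a≤ = ℕ.s≤s⁻¹ (Finₚ.toℕ<n a)
    b≤ = ℕ.s≤s⁻¹ (Finₚ.toℕ<n b)
    eq : (M ℕ.∸ Fin.toℕ a) ℕ.+ (M ℕ.∸ Fin.toℕ b) ≡ M ℕ.+ M ℕ.∸ (Fin.toℕ a ℕ.+ Fin.toℕ b)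
    eq = ≡.sym (≡.trans (≡.sym (ℕₚ.∸-+-assoc (M ℕ.+ M) (Fin.toℕ a) (Fin.toℕ b)))
      (≡.trans (≡.cong (ℕ._∸ Fin.toℕ b) (ℕₚ.+-∸-comm M a≤)) (ℕₚ.+-∸-assoc (M ℕ.∸ Fin.toℕ a) b≤)))
    mulAt : ∀ {ε} → Residue ε → ∀ k l → k ℕ.+ l ℕ.≤ J → I^ k (ε ^ E * F) → I^ l (ε ^ E * G) → I^ (k ℕ.+ l) (ε ^ E * (F * G))
    mulAt {ε} q k l le x y = ^resp
      (solve 3 (λ e f g → (e :* f) :* (e :* g) :- (e :* e :- e) :* (f :* g) := e :* (f :* g)) refl (ε ^ E) F G)
      (^sub {k ℕ.+ l} (^times {k} {l} x y) (^mulʳ {k ℕ.+ l} (^mono {k ℕ.+ l} {J} le (Hat.idem (hat q))) (Rmul rF rG)))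

  patJets : ∀ (es : List Carrier) → Pat (length es) → All (λ _ → Σ Carrier R) es
  patJets [] _ = []
  patJets (_ ∷ []) r = (rv (toVec J 0 r) , rv∈ (toVec J 0 r)) ∷ []
  patJets (_ ∷ _ ∷ es) (x , a , r , r′) = (rv (toVec J (Fin.toℕ a) r) , rv∈ (toVec J (Fin.toℕ a) r)) ∷ (rv (toVec J (M ℕ.∸ Fin.toℕ a) r′) , rv∈ (toVec J (M ℕ.∸ Fin.toℕ a) r′)) ∷ patJets es x

  truncJets : ∀ L (es : List Carrier) s → Trunc L (length es) s → All (λ _ → Σ Carrier R) es
  truncJets L [] _ _ = []
  truncJets L (_ ∷ []) _ _ = (0# , R0) ∷ []
  truncJets L (_ ∷ _ ∷ es) (s , a) (t , v , w) = (rv v , rv∈ v) ∷ (rv w , rv∈ w) ∷ truncJets L es s t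

  private
    agree : ∀ {ε F b b′} k → k ℕ.≤ J → I^ J (ε ^ E * F - ε ^ E * b) → I^ J (ε ^ E * F - ε ^ E * b′) → I^ k (ε ^ E * (b - b′))
    agree {ε} {F} {b} {b′} k le i j = ^mono {k} {J} le (^resp (solve 4 (λ e f b b′ → (e :* f :- e :* b′) :- (e :* f :- e :* b) := e :* (b :- b′)) refl (ε ^ E) F b b′) (^sub {J} j i))

  pat-unique : ∀ {es} → All Residue es → ∀ (x y : Pat (length es)) {F} → Picked F es (patJets es x) → Picked F es (patJets es y) → vecs (length es) x ≡ vecs (length es) y
  pat-unique [] _ _ _ _ = ≡.refl
  pat-unique {ε ∷ []} (q ∷ []) x y {F} (i , _) (j , _) = ≡.cong (_∷ []) (rv-injective (hat q) (toVec J 0 x) (toVec J 0 y) (agree {ε} {F} J ℕₚ.≤-refl i j))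
  pat-unique {ε ∷ ε′ ∷ es} (q ∷ q′ ∷ qs) (x , a , r , r′) (y , b , s , s′) {F} (i , i′ , is) (j , j′ , js) =
    ≡.cong₂ _∷_ (rv-injective (hat q) (toVec J (Fin.toℕ a) r) (toVec J (Fin.toℕ b) s) (agree {ε} {F} J ℕₚ.≤-refl i j)) (≡.cong₂ _∷_ (rv-injective (hat q′) (toVec J (M ℕ.∸ Fin.toℕ a) r′) (toVec J (M ℕ.∸ Fin.toℕ b) s′) (agree {ε′} {F} J ℕₚ.≤-refl i′ j′)) (pat-unique qs x y is js))

  pat-vanish : ∀ {es} → All Residue es → ∀ (x : Pat (length es)) {F} → Picked F es (patJets es x) → Vanish M es (code (length es) x) F
  pat-vanish [] _ _ = tt
  pat-vanish (_ ∷ []) _ _ = tt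
  pat-vanish {ε ∷ ε′ ∷ es} (q ∷ q′ ∷ qs) (x , a , r , r′) {F} (i , i′ , is) = pat-vanish qs x is ,
      from q (Fin.toℕ a) (ℕₚ.≤-trans (ℕ.s≤s⁻¹ (Finₚ.toℕ<n a)) (ℕₚ.<⇒≤ M<J)) (rv-toVec J (Fin.toℕ a) r) i ,
      from q′ (M ℕ.∸ Fin.toℕ a) (ℕₚ.≤-trans (ℕₚ.m∸n≤m M (Fin.toℕ a)) (ℕₚ.<⇒≤ M<J)) (rv-toVec J (M ℕ.∸ Fin.toℕ a) r′) i′
    where
    from : ∀ {ε b} → Residue ε → ∀ k → k ℕ.≤ J → I^ k b → I^ J (ε ^ E * F - ε ^ E * b) → I^ k (ε ^ E * F)
    from {ε} {b} q k le ib i = ^resp (solve 2 (λ f b → (f :- b) :+ b := f) refl (ε ^ E * F) (ε ^ E * b))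
      (^add {k} (^mono {k} {J} le i) (^mul {k} (Rpow E (Residue.ε∈ q)) ib))

  -- At each ring of a pair F - G vanishes exactly to the length of the two truncated jets, so they
  -- agree digit by digit.
  trunc-unique : ∀ {L es} → L ℕ.≤ J → All Residue es → ∀ s (t t′ : Trunc L (length es) s) {F G} → Picked F es (truncJets L es s t) → Picked G es (truncJets L es s t′) →
    Vanish L es s (F - G) → t ≡ t′
  trunc-unique _ [] _ _ _ _ _ _ = ≡.refl
  trunc-unique _ (_ ∷ []) _ _ _ _ _ _ = ≡.refl
  trunc-unique {L} {ε ∷ ε′ ∷ es} le (q ∷ q′ ∷ qs) (s , a) (t , v , w) (t′ , v′ , w′) {F} {G} (i , i′ , is) (j , j′ , js) (vn , k , k′) =
      ≡.cong₂ _,_ (trunc-unique le qs s t t′ is js vn)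
        (≡.cong₂ _,_ (rv-injective (hat q) v v′ (at′ q (Fin.toℕ a) (ℕₚ.≤-trans (ℕ.s≤s⁻¹ (Finₚ.toℕ<n a)) le) i j k))
          (rv-injective (hat q′) w w′ (at′ q′ (L ℕ.∸ Fin.toℕ a) (ℕₚ.≤-trans (ℕₚ.m∸n≤m L (Fin.toℕ a)) le) i′ j′ k′)))
    where
    at′ : ∀ {ε b b′} → Residue ε → ∀ k → k ℕ.≤ J → I^ J (ε ^ E * F - ε ^ E * b) → I^ J (ε ^ E * G - ε ^ E * b′) → I^ k (ε ^ E * (F - G)) → I^ k (ε ^ E * (b - b′))
    at′ {ε} {b} {b′} q k le i j h = ^resp
      (solve 5 (λ e f g b b′ → (e :* (f :- g) :- (e :* f :- e :* b)) :+ (e :* g :- e :* b′) := e :* (b :- b′)) refl (ε ^ E) F G b b′)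
      (^add {k} (^sub {k} h (^mono {k} {J} le i)) (^mono {k} {J} le j))

-- Representatives of keys, counted class by class.

module Dedupe {X : Set} {k : ℕ} (key : X → Fin k) where

  Distinct : X → X → Set
  Distinct x y = ¬ key x ≡ key y

  insert : ∀ x ys → Dec (Any (λ y → key x ≡ key y) ys) → List X
  insert x ys (yes _) = ys
  insert x ys (no _) = x ∷ ys

  occurs? : ∀ x ys → Dec (Any (λ y → key x ≡ key y) ys)
  occurs? x = Any.any? (λ y → key x Fin.≟ key y)

  dedupe : List X → List X
  dedupe [] = []
  dedupe (x ∷ xs) = insert x (dedupe xs) (occurs? x (dedupe xs))

  dedupe-distinct : ∀ xs → AllPairs Distinct (dedupe xs)
  dedupe-distinct [] = []
  dedupe-distinct (x ∷ xs) = go (occurs? x (dedupe xs))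
    where
    go : ∀ d → AllPairs Distinct (insert x (dedupe xs) d)
    go (yes _) = dedupe-distinct xs
    go (no n) = Allₚ.¬Any⇒All¬ _ n ∷ dedupe-distinct xs

  dedupe-all : ∀ {P : X → Set} xs → All P xs → All P (dedupe xs)
  dedupe-all [] [] = []
  dedupe-all {P} (x ∷ xs) (px ∷ pxs) = go (occurs? x (dedupe xs))
    where
    go : ∀ d → All P (insert x (dedupe xs) d)
    go (yes _) = dedupe-all xs pxs
    go (no _) = px ∷ dedupe-all xs pxs

  dedupe-covers : ∀ {x} xs → x ∈ xs → Any (λ y → key x ≡ key y) (dedupe xs)
  dedupe-covers (x ∷ xs) (here ≡.refl) = go (occurs? x (dedupe xs))
    where
    go : ∀ d → Any (λ y → key x ≡ key y) (insert x (dedupe xs) d)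
    go (yes a) = a
    go (no _) = here ≡.refl
  dedupe-covers {z} (x ∷ xs) (there m) = go (occurs? x (dedupe xs))
    where
    go : ∀ d → Any (λ y → key z ≡ key y) (insert x (dedupe xs) d)
    go (yes _) = dedupe-covers xs m
    go (no _) = there (dedupe-covers xs m)

  -- Representatives are chosen inside each of the m classes and joined. The factor T stays on the
  -- left because the bound for one class is in effect the quotient B / T.
  classCover : ∀ {m} (cls : X → Fin m) T B →
    (∀ s ys → All (λ y → cls y ≡ s) ys → AllPairs Distinct ys → length ys ℕ.* T ℕ.≤ B) →
    ∀ xs → Σ (List X) λ S → (∀ {x} → x ∈ xs → Any (λ y → key x ≡ key y) S) × length S ℕ.* T ℕ.≤ m ℕ.* B
  classCover {m} cls T B bound xs = reps (allFin m) , (λ {x} x∈ → covers (allFin m) x∈ (∈ₚ.∈-allFin (cls x))) ,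
      ≡.subst (λ j → length (reps (allFin m)) ℕ.* T ℕ.≤ j ℕ.* B) (Listₚ.length-tabulate {n = m} (λ i → i)) (size (allFin m))
    where
    members : Fin m → List X
    members s = filter (λ x → cls x Fin.≟ s) xs
    fibre : Fin m → List X
    fibre s = dedupe (members s)
    reps : List (Fin m) → List X
    reps [] = []
    reps (s ∷ ss) = fibre s ++ reps ss
    size : ∀ ss → length (reps ss) ℕ.* T ℕ.≤ length ss ℕ.* B
    size [] = ℕ.z≤n
    size (s ∷ ss) = ℕₚ.≤-trans
      (ℕₚ.≤-reflexive (≡.trans (≡.cong (ℕ._* T) (Listₚ.length-++ (fibre s))) (ℕₚ.*-distribʳ-+ T (length (fibre s)) _)))
      (ℕₚ.+-mono-≤ (bound s (fibre s) (dedupe-all (members s) (Allₚ.all-filter (λ x → cls x Fin.≟ s) xs)) (dedupe-distinct (members s))) (size ss))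
    covers : ∀ ss {x} → x ∈ xs → cls x ∈ ss → Any (λ y → key x ≡ key y) (reps ss)
    covers (s ∷ ss) x∈ (here e) = Anyₚ.++⁺ˡ (dedupe-covers (members s) (∈ₚ.∈-filter⁺ (λ x → cls x Fin.≟ s) x∈ e))
    covers (s ∷ ss) x∈ (there c) = Anyₚ.++⁺ʳ (fibre s) (covers ss x∈ c)

lookup-distinct : ∀ {X : Set} {R : X → X → Set} → (∀ {x y} → R x y → R y x) → ∀ {xs} → AllPairs R xs → ∀ i j → ¬ i ≡ j → R (lookup xs i) (lookup xs j)
lookup-distinct s (r ∷ rs) Fin.zero Fin.zero ne = contradiction ≡.refl ne
lookup-distinct s (r ∷ rs) Fin.zero (Fin.suc j) ne = All.lookup r (∈ₚ.∈-lookup j)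
lookup-distinct s (r ∷ rs) (Fin.suc i) Fin.zero ne = s (All.lookup r (∈ₚ.∈-lookup i))
lookup-distinct s (r ∷ rs) (Fin.suc i) (Fin.suc j) ne = lookup-distinct s rs i j (λ e → ne (≡.cong Fin.suc e))

-- The set and covers of its sums and products.

module Elements (V : ValuedRing) (𝒞 : Curve V) (ℛ : ResidueRings.Residues V 𝒞)
  (M : ℕ) (2M≤J : M ℕ.+ M ℕ.≤ Curve.J 𝒞) (M<J : M ℕ.< Curve.J 𝒞) where
  open ValuedRing V
  open RingKit ring
  open Char prime char
  open Filtration filtration
  open Polynomials ring
  open Constants V
  open Tower V using (evalTuple)
  open Curve 𝒞
  open Subring S
  open ResidueRings V 𝒞
  open Residues ℛ
  open Construction V 𝒞 ℛ M 2M≤J M<J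

  keyFrom : ∀ m → ℤ → Carrier → Tuple (Fin p) m
  keyFrom zero i f = tt
  keyFrom (suc m) i f = keyFrom m i f , coef (i ℤ.+ + m) f

  keyFrom-cong : ∀ m i {f g} → f ≈ g → keyFrom m i f ≡ keyFrom m i g
  keyFrom-cong zero i e = ≡.refl
  keyFrom-cong (suc m) i e = ≡.cong₂ _,_ (keyFrom-cong m i e) (coef-cong e)

  keyFrom-separates : ∀ m i {f g} → O i (f - g) → keyFrom m i f ≡ keyFrom m i g → O (i ℤ.+ + m) (f - g)
  keyFrom-separates zero i o _ = at (≡.sym (ℤₚ.+-identityʳ i)) o
  keyFrom-separates (suc m) i {f} {g} o e = at (ℤS.solve 2 (λ i m → ℤS.con (+ 1) ℤS.:+ (i ℤS.:+ m) ℤS.:= i ℤS.:+ (ℤS.con (+ 1) ℤS.:+ m)) ≡.refl i (+ m))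
    (coef-≡ (keyFrom-separates m i o (≡.cong proj₁ e)) (≡.cong proj₂ e))

  module _ (K : ℕ) where
    key-code : Finite (Tuple (Fin p) (suc K)) (p ℕ.^ suc K)
    key-code = finite-Tuple (suc K) (finite-Fin p)

    keyAt : Carrier → Fin (p ℕ.^ suc K)
    keyAt f = Finite.encode key-code (keyFrom (suc K) (ℤ.- + K) f)

    keyAt-cong : ∀ {f g} → f ≈ g → keyAt f ≡ keyAt g
    keyAt-cong e = ≡.cong (Finite.encode key-code) (keyFrom-cong (suc K) (ℤ.- + K) e)

    Bounded : Carrier → Set
    Bounded f = Reg f × O (ℤ.- + K) f

    -- The key holds the coefficients of orders -K to 0. If they agree, the difference is regular
    -- with a zero at infinity, hence zero.
    keyAt-injective : ∀ {f g} → Bounded f → Bounded g → keyAt f ≡ keyAt g → f ≈ g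
    keyAt-injective (rf , of) (rg , og) e = -≈0⇒≈ (regular⇒0 (Reg-add rf (Reg-neg rg))
      (at (ℤS.solve 1 (λ k → ℤS.:- k ℤS.:+ (ℤS.con (+ 1) ℤS.:+ k) ℤS.:= ℤS.con (+ 1)) ≡.refl (+ K))
        (keyFrom-separates (suc K) (ℤ.- + K) (sub of og) (Finite.encode-injective key-code e))))

  K : ℕ
  K = Λ ℕ.+ Λ

  n : ℕ
  n = length es

  Index : Set
  Index = Tuple (Fin p) (suc Λ) × Pat n

  finite-Index : Finite Index (p ℕ.^ suc Λ ℕ.* patSize n)
  finite-Index = finite-× (finite-Tuple (suc Λ) (finite-Fin p)) (finite-Pat n)

  poly∈ : ∀ m c → O (+ 1 ℤ.- + m) (evalTuple digit X m c)
  poly∈ zero _ = zer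
  poly∈ (suc m) (c , i) = add (mono (≤-by 1 (ℤS.solve 1 (λ m → (ℤS.con (+ 1) ℤS.:- (ℤS.con (+ 1) ℤS.:+ m)) ℤS.:+ ℤS.con (+ 1) ℤS.:= ℤS.con (+ 1) ℤS.:- m) ≡.refl (+ m))) (poly∈ m c))
    (at (ℤS.solve 1 (λ m → m ℤS.:* ℤS.con -[1+ 0 ] ℤS.:= ℤS.con (+ 1) ℤS.:- (ℤS.con (+ 1) ℤS.:+ m)) ≡.refl (+ m)) (mul₀ (constant (Fin.toℕ i)) (powℤ m X∈)))

  polyR : ∀ m c → R (evalTuple digit X m c)
  polyR zero _ = R0
  polyR (suc m) (c , i) = Radd (polyR m c) (Rmul (Rι (Fin.toℕ i)) (Rpow m X∈R))

  poly-unique : ∀ m c d → O (+ 1) (evalTuple digit X m c - evalTuple digit X m d) → c ≡ d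
  poly-unique zero _ _ _ = ≡.refl
  poly-unique (suc m) (c , i) (d , j) o = finish (digit-injective (-≈0⇒≈ top≈0))
    where
    f = evalTuple digit X m c
    g = evalTuple digit X m d
    b = digit i - digit j
    rest : O (+ 1 ℤ.- + m) (b * X ^ m)
    rest = resp (solve 5 (λ f g a b x → ((f :+ a :* x) :- (g :+ b :* x)) :- (f :- g) := (a :- b) :* x) refl f g (digit i) (digit j) (X ^ m))
      (sub (mono (ℤₚ.i-j≤i (+ 1) (+ m)) o) (sub (poly∈ m c) (poly∈ m d)))
    top≈0 : b ≈ 0#
    top≈0 = constant∈⇒≈0 (Subring.Rsub constants {digit i} {digit j} (Fin.toℕ i , refl) (Fin.toℕ j , refl)) (resp
      (trans (*-assoc b _ _) (trans (*-congˡ (unit-^ m XX⁻)) (*-identityʳ b)))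
      (at (ℤS.solve 1 (λ m → (ℤS.con (+ 1) ℤS.:- m) ℤS.:+ m ℤS.:* ℤS.con (+ 1) ℤS.:= ℤS.con (+ 1)) ≡.refl (+ m)) (mul rest (powℤ m X⁻∈))))
    finish : i ≡ j → (c , i) ≡ (d , j)
    finish ≡.refl = ≡.cong (_, i) (poly-unique m c d (resp (solve 4 (λ f g a x → (f :+ a :* x) :- (g :+ a :* x) := f :- g) refl f g (digit i) (X ^ m)) o))

  -- Approximation determines series at infinity only below order 1 - Λ. The factor X^Λ puts the Λ +
  -- 1 digits at the orders -2Λ to -Λ, all below that threshold, so distinct digits give distinct
  -- functions.
  principal : Tuple (Fin p) (suc Λ) → Carrier
  principal c = evalTuple digit X (suc Λ) c * X ^ Λ

  X^Λ∈ : O (ℤ.- + Λ) (X ^ Λ)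
  X^Λ∈ = at (≡.trans (ℤₚ.*-comm (+ Λ) -[1+ 0 ]) (ℤₚ.-1*i≡-i (+ Λ))) (powℤ Λ X∈)

  principal∈ : ∀ c → O (ℤ.- + K) (principal c)
  principal∈ c = at (ℤS.solve 1 (λ l → (ℤS.con (+ 1) ℤS.:- (ℤS.con (+ 1) ℤS.:+ l)) ℤS.:+ ℤS.:- l ℤS.:= ℤS.:- (l ℤS.:+ l)) ≡.refl (+ Λ)) (mul (poly∈ (suc Λ) c) X^Λ∈)

  principalR : ∀ c → R (principal c)
  principalR c = Rmul (polyR (suc Λ) c) (Rpow Λ X∈R)

  lift : ∀ {G H} → R G → R H → Σ Carrier λ f → Reg f × R (Π⁻ ^ J * (f - G)) × O (+ 1 ℤ.- + Λ) (f - H)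
  lift = approximate

  private
    low≤ : ∀ k → Λ ℕ.≤ k → ℤ.- + k ℤ.≤ + 1 ℤ.- + Λ
    low≤ k le = ℤₚ.≤-trans (ℤₚ.neg-mono-≤ (ℤ.+≤+ le)) (≤-by 1 (ℤS.solve 1 (λ l → ℤS.:- l ℤS.:+ ℤS.con (+ 1) ℤS.:= ℤS.con (+ 1) ℤS.:- l) ≡.refl (+ Λ)))

  el : Index → Carrier
  el (c , x) = proj₁ (lift (comb∈ residue (patJets es x)) (principalR c))

  el-bounded : ∀ x → Bounded K (el x)
  el-bounded (c , x) = proj₁ (proj₂ l) , resp (solve 2 (λ f h → (f :- h) :+ h := f) refl _ (principal c))
      (add (mono (low≤ K (ℕₚ.m≤m+n Λ Λ)) (proj₂ (proj₂ (proj₂ l)))) (principal∈ c))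
    where l = lift (comb∈ residue (patJets es x)) (principalR c)

  el-picked : ∀ c x → Picked (el (c , x)) es (patJets es x)
  el-picked c x = picked-resp residue (patJets es x) (multiple (proj₁ (proj₂ (proj₂ l)))) (comb-picked (patJets es x))
    where l = lift (comb∈ residue (patJets es x)) (principalR c)

  el-vanish : ∀ c x → Vanish M es (code n x) (el (c , x))
  el-vanish c x = pat-vanish residue x (el-picked c x)

  el-injective : ∀ x y → el x ≈ el y → x ≡ y
  el-injective (c , x) (d , y) e = ≡.cong₂ _,_
      (poly-unique (suc Λ) c d (resp (begin
          (principal c - principal d) * X⁻ ^ Λ ≈⟨ solve 4 (λ f g x z → (f :* x :- g :* x) :* z := (f :- g) :* (x :* z)) refl (evalTuple digit X (suc Λ) c) (evalTuple digit X (suc Λ) d) (X ^ Λ) (X⁻ ^ Λ) ⟩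
          (evalTuple digit X (suc Λ) c - evalTuple digit X (suc Λ) d) * (X ^ Λ * X⁻ ^ Λ) ≈⟨ trans (*-congˡ (unit-^ Λ XX⁻)) (*-identityʳ _) ⟩
          evalTuple digit X (suc Λ) c - evalTuple digit X (suc Λ) d ∎)
        (at (ℤS.solve 1 (λ l → (ℤS.con (+ 1) ℤS.:- l) ℤS.:+ l ℤS.:* ℤS.con (+ 1) ℤS.:= ℤS.con (+ 1)) ≡.refl (+ Λ)) (mul same (powℤ Λ X⁻∈)))))
      (vecs-injective n (pat-unique residue x y (el-picked c x)
        (picked-resp residue (patJets es y) (^resp (sym (≈⇒-≈0 e)) ^zero) (el-picked d y))))
    where
    l = lift (comb∈ residue (patJets es x)) (principalR c)
    l′ = lift (comb∈ residue (patJets es y)) (principalR d)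
    same : O (+ 1 ℤ.- + Λ) (principal c - principal d)
    same = resp (solve 3 (λ g h k → (g :- k) :- (g :- h) := h :- k) refl (proj₁ l′) (principal c) (principal d))
      (sub (proj₂ (proj₂ (proj₂ l′))) (resp (+-congʳ e) (proj₂ (proj₂ (proj₂ l)))))

  allIndices : List Index
  allIndices = List.map (Finite.decode finite-Index) (allFin _)

  allPairs : List (Index × Index)
  allPairs = List.cartesianProduct allIndices allIndices

  index∈ : ∀ x → x ∈ allIndices
  index∈ x = ≡.subst (_∈ allIndices) (Finite.decode-encode finite-Index x) (∈ₚ.∈-map⁺ (Finite.decode finite-Index) (∈ₚ.∈-allFin (Finite.encode finite-Index x)))

  pair∈all : ∀ x y → (x , y) ∈ allPairs
  pair∈all x y = ∈ₚ.∈-cartesianProduct⁺ (index∈ x) (index∈ y)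

  distinct-keys : ∀ {X : Set} (g : X → Carrier) k ys → AllPairs (λ x y → ¬ keyAt k (g x) ≡ keyAt k (g y)) ys → ∀ {i j} → g (lookup ys i) ≈ g (lookup ys j) → i ≡ j
  distinct-keys g k ys d {i} {j} e = decide (i Fin.≟ j)
    where
    decide : Dec (i ≡ j) → i ≡ j
    decide (yes q) = q
    decide (no ne) = contradiction (keyAt-cong k e) (lookup-distinct (λ r q → r (≡.sym q)) d i j ne)

  sumCover : Σ (List Carrier) λ S → (∀ x y → Any (λ s → el x + el y ≈ s) S) × length S ℕ.≤ p ℕ.^ suc K
  sumCover = List.map add₂ (proj₁ cc) , (λ x y → Anyₚ.map⁺ (Any.map (λ {z} e → keyAt-injective K (b (x , y)) (b z) e) (proj₁ (proj₂ cc) (pair∈all x y)))) ,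
      ≡.subst (ℕ._≤ p ℕ.^ suc K) (≡.sym (Listₚ.length-map add₂ (proj₁ cc)))
        (≡.subst₂ ℕ._≤_ (ℕₚ.*-identityʳ _) (ℕₚ.*-identityˡ _) (proj₂ (proj₂ cc)))
    where
    add₂ : Index × Index → Carrier
    add₂ (x , y) = el x + el y
    b : ∀ z → Bounded K (add₂ z)
    b (x , y) = Reg-add (proj₁ (el-bounded x)) (proj₁ (el-bounded y)) , add (proj₂ (el-bounded x)) (proj₂ (el-bounded y))
    open Dedupe (λ z → keyAt K (add₂ z))
    cc = classCover {1} (λ _ → Fin.zero) 1 (p ℕ.^ suc K)
      (λ _ ys _ d → ≡.subst (ℕ._≤ p ℕ.^ suc K) (≡.sym (ℕₚ.*-identityʳ _)) (Finₚ.injective⇒≤ {f = λ i → keyAt K (add₂ (lookup ys i))}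
        (λ {i} {j} e → distinct-keys add₂ K ys d {i} {j} (keyAt-injective K (b (lookup ys i)) (b (lookup ys j)) e)))) allPairs

  2K : ℕ
  2K = K ℕ.+ K

  L : ℕ
  L = M ℕ.+ M

  truncSize : ℕ
  truncSize = (q ℕ.^ L) ℕ.^ ⌊ n /2⌋

  codes : Finite (Tuple (Fin (suc L)) ⌊ n /2⌋) (suc L ℕ.^ ⌊ n /2⌋)
  codes = finite-Tuple ⌊ n /2⌋ (finite-Fin (suc L))

  -- A set of functions with prescribed orders of vanishing can be translated by all jets below these orders.
  module Translate (s : Tuple (Fin (suc L)) ⌊ n /2⌋) {X : Set} (g : X → Carrier) (ys : List X)
    (b : ∀ z → Bounded 2K (g z)) (v : All (λ z → Vanish L es s (g z)) ys)
    (d : AllPairs (λ x y → ¬ keyAt 2K (g x) ≡ keyAt 2K (g y)) ys) where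

    jet : Trunc L n s → Carrier
    jet t = proj₁ (lift (comb∈ residue (truncJets L es s t)) R0)

    jet-bounded : ∀ t → Bounded 2K (jet t)
    jet-bounded t = proj₁ (proj₂ l) , mono (low≤ 2K (ℕₚ.≤-trans (ℕₚ.m≤m+n Λ Λ) (ℕₚ.m≤m+n K K)))
        (resp (trans (+-congˡ -0#≈0#) (+-identityʳ _)) (proj₂ (proj₂ (proj₂ l))))
      where l = lift (comb∈ residue (truncJets L es s t)) R0

    jet-picked : ∀ t → Picked (jet t) es (truncJets L es s t)
    jet-picked t = picked-resp residue (truncJets L es s t) (multiple (proj₁ (proj₂ (proj₂ l)))) (comb-picked (truncJets L es s t))
      where l = lift (comb∈ residue (truncJets L es s t)) R0

    translate : Fin (length ys) × Trunc L n s → Fin (p ℕ.^ suc 2K)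
    translate (i , t) = keyAt 2K (g (lookup ys i) + jet t)

    sum-bounded : ∀ i t → Bounded 2K (g (lookup ys i) + jet t)
    sum-bounded i t = Reg-add (proj₁ (b _)) (proj₁ (jet-bounded t)) , add (proj₂ (b _)) (proj₂ (jet-bounded t))

    -- If two translates coincide, the jets differ by a difference of two members of the class,
    -- which vanishes to the prescribed orders. The jets have no longer expansions than that, so
    -- they are equal, and then so are the members.
    translate-injective : ∀ {z w} → translate z ≡ translate w → z ≡ w
    translate-injective {i , t} {j , t′} e = finish t≡t′
      where
      f = g (lookup ys i)
      f′ = g (lookup ys j)
      eq : f + jet t ≈ f′ + jet t′
      eq = keyAt-injective 2K (sum-bounded i t) (sum-bounded j t′) e
      vdiff : Vanish L es s (f′ - f)
      vdiff = vanish-sub es s (All.lookup v (∈ₚ.∈-lookup {xs = ys} j)) (All.lookup v (∈ₚ.∈-lookup {xs = ys} i))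
      jets≈ : jet t - jet t′ ≈ f′ - f
      jets≈ = begin
        jet t - jet t′ ≈⟨ solve 3 (λ f a b → a :- b := (f :+ a) :- (f :+ b)) refl f (jet t) (jet t′) ⟩
        (f + jet t) - (f + jet t′) ≈⟨ +-congʳ eq ⟩
        (f′ + jet t′) - (f + jet t′) ≈⟨ solve 3 (λ f g b → (g :+ b) :- (f :+ b) := g :- f) refl f f′ (jet t′) ⟩
        f′ - f ∎
      vresp : ∀ (es : List Carrier) s {F G} → F ≈ G → Vanish L es s F → Vanish L es s G
      vresp [] _ _ _ = tt
      vresp (_ ∷ []) _ _ _ = tt
      vresp (_ ∷ _ ∷ es) (s , a) q (v , i , j) = vresp es s q v , ^resp (*-congˡ q) i , ^resp (*-congˡ q) j
      t≡t′ : t ≡ t′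
      t≡t′ = trunc-unique 2M≤J residue s t t′ (jet-picked t) (jet-picked t′) (vresp es s (sym jets≈) vdiff)
      finish : t ≡ t′ → (i , t) ≡ (j , t′)
      finish ≡.refl = ≡.cong (_, t) (distinct-keys g 2K ys d {i} {j} (begin
        f ≈⟨ solve 2 (λ f a → f := (f :+ a) :- a) refl f (jet t) ⟩
        (f + jet t) - jet t ≈⟨ +-congʳ eq ⟩
        (f′ + jet t) - jet t ≈⟨ solve 2 (λ f a → (f :+ a) :- a := f) refl f′ (jet t) ⟩
        f′ ∎))

    bound : length ys ℕ.* truncSize ℕ.≤ p ℕ.^ suc 2K
    bound = finite-≤ (finite-× (finite-Fin (length ys)) (finite-Trunc L n s)) (finite-Fin (p ℕ.^ suc 2K)) translate translate-injective

  productCover : Σ (List Carrier) λ S → (∀ x y → Any (λ s → el x * el y ≈ s) S) × length S ℕ.* truncSize ℕ.≤ suc L ℕ.^ ⌊ n /2⌋ ℕ.* p ℕ.^ suc 2K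
  productCover = List.map mul₂ (proj₁ cc) , (λ x y → Anyₚ.map⁺ (Any.map (λ {z} e → keyAt-injective 2K (b (x , y)) (b z) e) (proj₁ (proj₂ cc) (pair∈all x y)))) ,
      ≡.subst (λ j → j ℕ.* truncSize ℕ.≤ suc L ℕ.^ ⌊ n /2⌋ ℕ.* p ℕ.^ suc 2K) (≡.sym (Listₚ.length-map mul₂ (proj₁ cc))) (proj₂ (proj₂ cc))
    where
    mul₂ : Index × Index → Carrier
    mul₂ (x , y) = el x * el y
    b : ∀ z → Bounded 2K (mul₂ z)
    b (x , y) = Reg-mul (proj₁ (el-bounded x)) (proj₁ (el-bounded y)) ,
      at (ℤS.solve 1 (λ k → ℤS.:- k ℤS.:+ ℤS.:- k ℤS.:= ℤS.:- (k ℤS.:+ k)) ≡.refl (+ K)) (mul (proj₂ (el-bounded x)) (proj₂ (el-bounded y)))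
    classOf : Index × Index → Tuple (Fin (suc L)) ⌊ n /2⌋
    classOf ((_ , x) , (_ , y)) = addTuple ⌊ n /2⌋ (code n x) (code n y)
    vanish : ∀ z → Vanish L es (classOf z) (mul₂ z)
    vanish ((c , x) , (d , y)) = vanish-mul residue (code n x) (code n y) (Reg⇒R (proj₁ (el-bounded (c , x)))) (Reg⇒R (proj₁ (el-bounded (d , y)))) (el-vanish c x) (el-vanish d y)
    open Dedupe (λ z → keyAt 2K (mul₂ z))
    cc = classCover (λ z → Finite.encode codes (classOf z)) truncSize (p ℕ.^ suc 2K)
      (λ s ys inClass d → Translate.bound (Finite.decode codes s) mul₂ ys b
        (All.map (λ {z} e → ≡.subst (λ c → Vanish L es c (mul₂ z)) (≡.trans (≡.sym (Finite.decode-encode codes (classOf z))) (≡.cong (Finite.decode codes) e)) (vanish z)) inClass) d)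
      allPairs

-- Numerical estimates

module Counting where
  open import Data.Nat using (_+_; _*_; _∸_; _^_; _≤_; _<_; z≤n; s≤s)
  open import Data.Nat.Properties
  open ≡ using (refl; sym; trans; cong; cong₂; subst)

  open ≤-Reasoning

  ^-distrib-* : ∀ a b n → (a * b) ^ n ≡ a ^ n * b ^ n
  ^-distrib-* a b zero = refl
  ^-distrib-* a b (suc n) = trans (cong ((a * b) *_) (^-distrib-* a b n))
    (ℕS.solve 4 (λ a b x y → (a ℕS.:* b) ℕS.:* (x ℕS.:* y) ℕS.:= (a ℕS.:* x) ℕS.:* (b ℕS.:* y)) refl a b (a ^ n) (b ^ n))

  1≤^ : ∀ a n → 1 ≤ a → 1 ≤ a ^ n
  1≤^ a n h = subst (_≤ a ^ n) (^-zeroˡ n) (^-monoˡ-≤ n h)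

  module PatternCount {Q : Set} {q′ : ℕ} (finiteQ : Finite Q (suc q′)) (0Q : Q) (M J : ℕ) (M<J : M < J)
    (W : ℕ) (M≡ : suc M ≡ 64 * W) (1≤q′ : 1 ≤ q′) where
    open Rows finiteQ 0Q
    open Patterns M J M<J

    private
      1≤W : 1 ≤ W
      1≤W = go W M≡
        where
        go : ∀ W → suc M ≡ 64 * W → 1 ≤ W
        go (suc W) _ = s≤s z≤n
      1≤double : 1 ≤ double
      1≤double = *-mono-≤ {1} {_} {1} (*-mono-≤ {1} {_} {1} 1≤q′ 1≤q′) (1≤^ q ((J ∸ 1) + (J ∸ suc M)) (s≤s z≤n))

    2^≤patSize : ∀ n → 2 ^ ⌊ n /2⌋ ≤ patSize n
    2^≤patSize zero = ≤-refl
    2^≤patSize (suc zero) = *-mono-≤ {1} {_} {1} 1≤q′ (1≤^ q (J ∸ 1) (s≤s z≤n))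
    2^≤patSize (suc (suc n)) = begin
      2 * 2 ^ ⌊ n /2⌋ ≡⟨ *-comm 2 (2 ^ ⌊ n /2⌋) ⟩
      2 ^ ⌊ n /2⌋ * (2 * 1) ≤⟨ *-mono-≤ (2^≤patSize n) (*-mono-≤ (≤-trans (s≤s (s≤s z≤n)) (≤-trans (*-monoʳ-≤ 64 1≤W) (≤-reflexive (sym M≡)))) 1≤double) ⟩
      patSize n * (suc M * double) ∎

    L : ℕ
    L = M + M

    -- The gain demanded of each pair: 2M + 1 for the number of classes of products, 2 for the
    -- saving, and `W` for the genus.
    a : ℕ
    a = (2 * suc L) * W

    private
      q≤2q′ : q ≤ 2 * q′
      q≤2q′ = ≤-trans (+-monoˡ-≤ q′ 1≤q′) (≤-reflexive (cong (_+_ q′) (sym (+-identityʳ q′))))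

      e : ℕ
      e = (J ∸ 1) + (J ∸ suc M)

      exponents : 4 + ((e + e) + L) ≡ 4 * J
      exponents = subst (λ J → 4 + ((((J ∸ 1) + (J ∸ suc M)) + ((J ∸ 1) + (J ∸ suc M))) + L) ≡ 4 * J) (m+[n∸m]≡n M<J)
        (trans (cong (λ z → 4 + ((((M + c) + z) + ((M + c) + z)) + L)) (m+n∸m≡n M c))
          (ℕS.solve 2 (λ m c → ℕS.con 4 ℕS.:+ ((((m ℕS.:+ c) ℕS.:+ c) ℕS.:+ ((m ℕS.:+ c) ℕS.:+ c)) ℕS.:+ (m ℕS.:+ m)) ℕS.:= ℕS.con 4 ℕS.:* (ℕS.con 1 ℕS.:+ m ℕS.:+ c)) refl M c))
        where c = J ∸ suc M

      -- Origin of 64 = 4 * 2^4: 2 (2M + 1) ≤ 4 (M + 1), and the four nonzero leading digits cost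
      -- q^4 ≤ 2^4 q′^4. This leaves one factor M + 1 in the form 64 W.
      pair-bound : a * q ^ (4 * J) ≤ (suc M * double) * (suc M * double) * q ^ L
      pair-bound = begin
        a * q ^ (4 * J) ≡⟨ cong (λ z → a * q ^ z) (sym exponents) ⟩
        a * q ^ (4 + ((e + e) + L)) ≡⟨ cong (a *_) (trans (^-distribˡ-+-* q 4 ((e + e) + L)) (cong (q ^ 4 *_) (trans (^-distribˡ-+-* q (e + e) L) (cong (_* q ^ L) (^-distribˡ-+-* q e e))))) ⟩
        a * (q ^ 4 * ((q ^ e * q ^ e) * q ^ L)) ≤⟨ *-mono-≤ (*-monoˡ-≤ W 2sL≤) (*-monoˡ-≤ ((q ^ e * q ^ e) * q ^ L) (^-monoˡ-≤ 4 q≤2q′)) ⟩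
        ((4 * suc M) * W) * ((2 * q′) ^ 4 * ((q ^ e * q ^ e) * q ^ L))
          ≡⟨ ℕS.solve 5 (λ sm w q′ x y → ((ℕS.con 4 ℕS.:* sm) ℕS.:* w) ℕS.:* ((ℕS.con 2 ℕS.:* q′) ℕS.:* ((ℕS.con 2 ℕS.:* q′) ℕS.:* ((ℕS.con 2 ℕS.:* q′) ℕS.:* ((ℕS.con 2 ℕS.:* q′) ℕS.:* ℕS.con 1))) ℕS.:* ((x ℕS.:* x) ℕS.:* y))
               ℕS.:= (sm ℕS.:* ((q′ ℕS.:* q′) ℕS.:* x)) ℕS.:* ((ℕS.con 64 ℕS.:* w) ℕS.:* ((q′ ℕS.:* q′) ℕS.:* x)) ℕS.:* y) refl (suc M) W q′ (q ^ e) (q ^ L) ⟩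
        (suc M * ((q′ * q′) * q ^ e)) * ((64 * W) * ((q′ * q′) * q ^ e)) * q ^ L ≡⟨ cong (λ z → (suc M * double) * (z * double) * q ^ L) (sym M≡) ⟩
        (suc M * double) * (suc M * double) * q ^ L ∎
        where
        2sL≤ : 2 * suc L ≤ 4 * suc M
        2sL≤ = ≤-trans (*-monoʳ-≤ 2 (n≤1+n (suc L))) (≤-reflexive (ℕS.solve 1 (λ m → ℕS.con 2 ℕS.:* (ℕS.con 2 ℕS.:+ (m ℕS.:+ m)) ℕS.:= ℕS.con 4 ℕS.:* (ℕS.con 1 ℕS.:+ m)) refl M))

    -- The factor 4 is the price of an unpaired last ring, where q² ≤ 4 q′².
    pattern-bound : ∀ n → a ^ ⌊ n /2⌋ * q ^ (2 * J * n) ≤ 4 * (patSize n * patSize n * (q ^ L) ^ ⌊ n /2⌋)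
    pattern-bound zero = ≤-trans (≤-reflexive (trans (+-identityʳ _) (cong (q ^_) (*-zeroʳ (2 * J))))) (s≤s z≤n)
    pattern-bound (suc zero) = begin
      1 * q ^ (2 * J * 1) ≡⟨ trans (+-identityʳ _) (cong (q ^_) eqJ) ⟩
      q ^ (2 + (j + j)) ≡⟨ trans (^-distribˡ-+-* q 2 (j + j)) (cong (q ^ 2 *_) (^-distribˡ-+-* q j j)) ⟩
      q ^ 2 * (q ^ j * q ^ j) ≤⟨ *-monoˡ-≤ (q ^ j * q ^ j) (^-monoˡ-≤ 2 q≤2q′) ⟩
      (2 * q′) ^ 2 * (q ^ j * q ^ j) ≡⟨ ℕS.solve 2 (λ q′ x → (ℕS.con 2 ℕS.:* q′) ℕS.:* ((ℕS.con 2 ℕS.:* q′) ℕS.:* ℕS.con 1) ℕS.:* (x ℕS.:* x) ℕS.:= ℕS.con 4 ℕS.:* ((q′ ℕS.:* x) ℕS.:* (q′ ℕS.:* x) ℕS.:* ℕS.con 1)) refl q′ (q ^ j) ⟩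
      4 * (single * single * 1) ∎
      where
      j = J ∸ 1
      eqJ : 2 * J * 1 ≡ 2 + (j + j)
      eqJ = trans (cong (λ z → 2 * z * 1) (sym (m+[n∸m]≡n {1} {J} (≤-trans (s≤s z≤n) M<J))))
        (ℕS.solve 1 (λ j → ℕS.con 2 ℕS.:* (ℕS.con 1 ℕS.:+ j) ℕS.:* ℕS.con 1 ℕS.:= ℕS.con 2 ℕS.:+ (j ℕS.:+ j)) refl j)
    pattern-bound (suc (suc n)) = begin
      (a * a ^ h) * q ^ (2 * J * (2 + n)) ≡⟨ cong ((a * a ^ h) *_) (trans (cong (q ^_) (ℕS.solve 2 (λ j n → ℕS.con 2 ℕS.:* j ℕS.:* (ℕS.con 2 ℕS.:+ n) ℕS.:= ℕS.con 4 ℕS.:* j ℕS.:+ ℕS.con 2 ℕS.:* j ℕS.:* n) refl J n)) (^-distribˡ-+-* q (4 * J) (2 * J * n))) ⟩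
      (a * a ^ h) * (q ^ (4 * J) * q ^ (2 * J * n)) ≡⟨ ℕS.solve 4 (λ a x y z → (a ℕS.:* x) ℕS.:* (y ℕS.:* z) ℕS.:= (a ℕS.:* y) ℕS.:* (x ℕS.:* z)) refl a (a ^ h) (q ^ (4 * J)) (q ^ (2 * J * n)) ⟩
      (a * q ^ (4 * J)) * (a ^ h * q ^ (2 * J * n)) ≤⟨ *-mono-≤ pair-bound (pattern-bound n) ⟩
      ((suc M * double) * (suc M * double) * q ^ L) * (4 * (patSize n * patSize n * (q ^ L) ^ h))
        ≡⟨ ℕS.solve 4 (λ d x s t → (d ℕS.:* d ℕS.:* x) ℕS.:* (ℕS.con 4 ℕS.:* (s ℕS.:* s ℕS.:* t)) ℕS.:= ℕS.con 4 ℕS.:* ((s ℕS.:* d) ℕS.:* (s ℕS.:* d) ℕS.:* (x ℕS.:* t))) refl (suc M * double) (q ^ L) (patSize n) ((q ^ L) ^ h) ⟩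
      4 * ((patSize n * (suc M * double)) * (patSize n * (suc M * double)) * (q ^ L * (q ^ L) ^ h)) ∎
      where h = ⌊ n /2⌋

  -- For m = b k the m-th power of the first inequality is X^m (2^z)^m ≤ A^(2m). Since (2^z)^m ≥ A,
  -- one factor A cancels.
  power-saving : ∀ {X A z} b k → 1 ≤ A → 1 ≤ b * k → X * 2 ^ z ≤ A * A → A ≤ 2 ^ (z * (b * k)) → X ^ (b * k) ≤ A ^ (2 * b * k ∸ 1)
  power-saving {X} {A} {z} b k 1≤A 1≤bk h h′ = *-cancelʳ-≤ (X ^ m) (A ^ (2 * b * k ∸ 1)) A {{ℕ.>-nonZero 1≤A}} (begin
      X ^ m * A ≤⟨ *-monoʳ-≤ (X ^ m) h′ ⟩
      X ^ m * 2 ^ (z * m) ≡⟨ cong (X ^ m *_) (sym (^-*-assoc 2 z m)) ⟩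
      X ^ m * (2 ^ z) ^ m ≡⟨ ^-distrib-* X (2 ^ z) m ⟨
      (X * 2 ^ z) ^ m ≤⟨ ^-monoˡ-≤ m h ⟩
      (A * A) ^ m ≡⟨ trans (^-distrib-* A A m) (sym (^-distribˡ-+-* A m m)) ⟩
      A ^ (m + m) ≡⟨ cong (A ^_) (trans (cong (_+_ m) (sym (+-identityʳ m))) (trans (sym (*-assoc 2 b k)) (sym (m∸n+n≡m {2 * b * k} {1} (≤-trans 1≤bk (≤-trans (m≤m+n m (m + 0)) (≤-reflexive (sym (*-assoc 2 b k))))))))) ⟩
      A ^ ((2 * b * k ∸ 1) + 1) ≡⟨ trans (^-distribˡ-+-* A (2 * b * k ∸ 1) 1) (cong (A ^ (2 * b * k ∸ 1) *_) (*-identityʳ A)) ⟩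
      A ^ (2 * b * k ∸ 1) * A ∎)
    where m = b * k

  module Numerics (p k σ r J M W n h q Λ ps : ℕ) (1<p : 1 < p) (p≤2^k : p ≤ 2 ^ k) (pk≤ : p * k ≤ 2 * σ) (p≤ : p ≤ 2 * σ)
    (q≡ : p * p ≡ q) (Λ≡ : Λ ≡ (J * σ + p) * r) (enough : p ^ (σ * r) ≤ q ^ n) (n≤ : n ≤ 2 * h + 1) (1≤h : 1 ≤ h)
    (W≡ : W ≡ 2 ^ 26) (2^h≤ps : 2 ^ h ≤ ps)
    (pb : ((2 * suc (M + M)) * W) ^ h * q ^ (2 * J * n) ≤ 4 * (ps * ps * (q ^ (M + M)) ^ h)) where

    private
      instance
        p≢0 : NonZero p
        p≢0 = ℕ.>-nonZero (<-trans (s≤s z≤n) 1<p)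
      q≢0 : NonZero q
      q≢0 = ℕ.>-nonZero (subst (1 ≤_) q≡ (*-mono-≤ {1} {p} {1} (<⇒≤ 1<p) (<⇒≤ 1<p)))

    K A : ℕ
    K = Λ + Λ
    A = p ^ suc Λ * ps

    σr≤2n : σ * r ≤ 2 * n
    σr≤2n = ≮⇒≥ λ lt → <⇒≱ (^-monoʳ-< p 1<p lt) (≤-trans enough (≤-reflexive
      (trans (cong (_^ n) (trans (sym q≡) (cong (p *_) (sym (*-identityʳ p))))) (^-*-assoc p 2 n))))

    σr≤ : σ * r ≤ 4 * h + 2
    σr≤ = ≤-trans σr≤2n (≤-trans (*-monoʳ-≤ 2 n≤) (≤-reflexive (ℕS.solve 1 (λ h → ℕS.con 2 ℕS.:* (ℕS.con 2 ℕS.:* h ℕS.:+ ℕS.con 1) ℕS.:= ℕS.con 4 ℕS.:* h ℕS.:+ ℕS.con 2) refl h)))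

    1≤A : 1 ≤ A
    1≤A = *-mono-≤ {1} {_} {1} (1≤^ p (suc Λ) (<⇒≤ 1<p)) (≤-trans (1≤^ 2 h (s≤s z≤n)) 2^h≤ps)

    sum-saving : ∀ {X} → X ≤ p ^ suc K → X * 2 ^ h ≤ A * A
    sum-saving {X} X≤ = begin
      X * 2 ^ h ≤⟨ *-mono-≤ X≤ (≤-trans 2^h≤ps (m≤m*n ps ps {{ℕ.>-nonZero (≤-trans (1≤^ 2 h (s≤s z≤n)) 2^h≤ps)}})) ⟩
      p ^ suc K * (ps * ps) ≤⟨ *-monoˡ-≤ (ps * ps) (^-monoʳ-≤ p (≤-trans (n≤1+n (suc K)) (≤-reflexive (cong suc (sym (+-suc Λ Λ)))))) ⟩
      p ^ (suc Λ + suc Λ) * (ps * ps) ≡⟨ cong (_* (ps * ps)) (^-distribˡ-+-* p (suc Λ) (suc Λ)) ⟩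
      (p ^ suc Λ * p ^ suc Λ) * (ps * ps) ≡⟨ ℕS.solve 2 (λ x y → (x ℕS.:* x) ℕS.:* (y ℕS.:* y) ℕS.:= (x ℕS.:* y) ℕS.:* (x ℕS.:* y)) refl (p ^ suc Λ) ps ⟩
      A * A ∎

    -- The loss p^{2 p r} caused by the genus is absorbed by W^h.
    genus-loss : 4 * p ^ (2 * (p * r)) ≤ W ^ h
    genus-loss = begin
      4 * p ^ (2 * (p * r)) ≤⟨ *-monoʳ-≤ 4 (^-monoˡ-≤ (2 * (p * r)) p≤2^k) ⟩
      4 * (2 ^ k) ^ (2 * (p * r)) ≡⟨ cong (4 *_) (^-*-assoc 2 k (2 * (p * r))) ⟩
      4 * 2 ^ (k * (2 * (p * r))) ≤⟨ *-monoʳ-≤ 4 (^-monoʳ-≤ 2 exp≤) ⟩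
      4 * 2 ^ (16 * h + 8) ≡⟨ sym (^-distribˡ-+-* 2 2 (16 * h + 8)) ⟩
      -- With h ≥ 1 the exponent 16 h + 10 is at most 26 h, which is why `W` is 2^26.
      2 ^ (2 + (16 * h + 8)) ≤⟨ ^-monoʳ-≤ 2 (≤-trans (≤-reflexive (ℕS.solve 1 (λ h → ℕS.con 2 ℕS.:+ (ℕS.con 16 ℕS.:* h ℕS.:+ ℕS.con 8) ℕS.:= ℕS.con 16 ℕS.:* h ℕS.:+ ℕS.con 10 ℕS.:* ℕS.con 1) refl h))
          (≤-trans (+-monoʳ-≤ (16 * h) (*-monoʳ-≤ 10 1≤h)) (≤-reflexive (ℕS.solve 1 (λ h → ℕS.con 16 ℕS.:* h ℕS.:+ ℕS.con 10 ℕS.:* h ℕS.:= ℕS.con 26 ℕS.:* h) refl h)))) ⟩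
      2 ^ (26 * h) ≡⟨ sym (^-*-assoc 2 26 h) ⟩
      (2 ^ 26) ^ h ≡⟨ cong (_^ h) (sym W≡) ⟩
      W ^ h ∎
      where
      exp≤ : k * (2 * (p * r)) ≤ 16 * h + 8
      exp≤ = begin
        k * (2 * (p * r)) ≡⟨ ℕS.solve 3 (λ k p r → k ℕS.:* (ℕS.con 2 ℕS.:* (p ℕS.:* r)) ℕS.:= ℕS.con 2 ℕS.:* (p ℕS.:* k) ℕS.:* r) refl k p r ⟩
        2 * (p * k) * r ≤⟨ *-monoˡ-≤ r (*-monoʳ-≤ 2 pk≤) ⟩
        2 * (2 * σ) * r ≡⟨ ℕS.solve 2 (λ s r → ℕS.con 2 ℕS.:* (ℕS.con 2 ℕS.:* s) ℕS.:* r ℕS.:= ℕS.con 4 ℕS.:* (s ℕS.:* r)) refl σ r ⟩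
        4 * (σ * r) ≤⟨ *-monoʳ-≤ 4 σr≤ ⟩
        4 * (4 * h + 2) ≡⟨ ℕS.solve 1 (λ h → ℕS.con 4 ℕS.:* (ℕS.con 4 ℕS.:* h ℕS.:+ ℕS.con 2) ℕS.:= ℕS.con 16 ℕS.:* h ℕS.:+ ℕS.con 8) refl h ⟩
        16 * h + 8 ∎

    -- The excess of 2K over K is 2Λ = 2 J σ r + 2 p r. The first part is matched by q^(2 J n)
    -- through the number of residue rings, the second by `genus-loss`, and `pb` compares the result
    -- with the patterns of A.
    product-saving : ∀ {X} → X * (q ^ (M + M)) ^ h ≤ suc (M + M) ^ h * p ^ suc (K + K) → X * 2 ^ h ≤ A * A
    product-saving {X} X≤ = *-cancelʳ-≤ (X * 2 ^ h) (A * A) (T * 4) {{ℕ.>-nonZero 1≤T4}} (begin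
        (X * 2 ^ h) * (T * 4) ≡⟨ ℕS.solve 3 (λ x z t → (x ℕS.:* z) ℕS.:* (t ℕS.:* ℕS.con 4) ℕS.:= (ℕS.con 4 ℕS.:* z) ℕS.:* (x ℕS.:* t)) refl X (2 ^ h) T ⟩
        (4 * 2 ^ h) * (X * T) ≤⟨ *-monoʳ-≤ (4 * 2 ^ h) X≤ ⟩
        (4 * 2 ^ h) * (sL ^ h * p ^ suc (K + K)) ≡⟨ cong (λ z → (4 * 2 ^ h) * (sL ^ h * z)) (trans (cong (p ^_) expK) (^-distribˡ-+-* p (suc K) (2 * (J * σ * r) + 2 * (p * r)))) ⟩
        (4 * 2 ^ h) * (sL ^ h * (p ^ suc K * p ^ (2 * (J * σ * r) + 2 * (p * r)))) ≡⟨ cong (λ z → (4 * 2 ^ h) * (sL ^ h * (p ^ suc K * z))) (^-distribˡ-+-* p (2 * (J * σ * r)) (2 * (p * r))) ⟩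
        (4 * 2 ^ h) * (sL ^ h * (p ^ suc K * (p ^ (2 * (J * σ * r)) * p ^ (2 * (p * r)))))
          ≡⟨ ℕS.solve 5 (λ z s x y g → (ℕS.con 4 ℕS.:* z) ℕS.:* (s ℕS.:* (x ℕS.:* (y ℕS.:* g))) ℕS.:= (((z ℕS.:* s) ℕS.:* (ℕS.con 4 ℕS.:* g)) ℕS.:* y) ℕS.:* x) refl (2 ^ h) (sL ^ h) (p ^ suc K) (p ^ (2 * (J * σ * r))) (p ^ (2 * (p * r))) ⟩
        (((2 ^ h * sL ^ h) * (4 * p ^ (2 * (p * r)))) * p ^ (2 * (J * σ * r))) * p ^ suc K
          ≤⟨ *-monoˡ-≤ (p ^ suc K) (*-mono-≤ (*-monoʳ-≤ (2 ^ h * sL ^ h) genus-loss) jets) ⟩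
        (((2 ^ h * sL ^ h) * W ^ h) * q ^ (2 * J * n)) * p ^ suc K ≡⟨ cong (λ z → (z * q ^ (2 * J * n)) * p ^ suc K) (trans (cong (_* W ^ h) (sym (^-distrib-* 2 sL h))) (sym (^-distrib-* (2 * sL) W h))) ⟩
        ((((2 * sL) * W) ^ h) * q ^ (2 * J * n)) * p ^ suc K ≤⟨ *-mono-≤ pb (^-monoʳ-≤ p (≤-trans (n≤1+n (suc K)) (≤-reflexive (cong suc (sym (+-suc Λ Λ)))))) ⟩
        (4 * (ps * ps * T)) * p ^ (suc Λ + suc Λ) ≡⟨ cong ((4 * (ps * ps * T)) *_) (^-distribˡ-+-* p (suc Λ) (suc Λ)) ⟩
        (4 * (ps * ps * T)) * (p ^ suc Λ * p ^ suc Λ) ≡⟨ ℕS.solve 3 (λ s t x → (ℕS.con 4 ℕS.:* (s ℕS.:* s ℕS.:* t)) ℕS.:* (x ℕS.:* x) ℕS.:= ((x ℕS.:* s) ℕS.:* (x ℕS.:* s)) ℕS.:* (t ℕS.:* ℕS.con 4)) refl ps T (p ^ suc Λ) ⟩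
        (A * A) * (T * 4) ∎)
      where
      sL = suc (M + M)
      T = (q ^ (M + M)) ^ h
      1≤T4 : 1 ≤ T * 4
      1≤T4 = *-mono-≤ {1} {T} {1} (1≤^ (q ^ (M + M)) h (1≤^ q (M + M) (ℕ.>-nonZero⁻¹ q {{q≢0}}))) (s≤s z≤n)
      expK : suc (K + K) ≡ suc K + (2 * (J * σ * r) + 2 * (p * r))
      expK = cong (_+_ (suc K)) (trans (cong₂ _+_ Λ≡ Λ≡) (ℕS.solve 4 (λ j s p r → (j ℕS.:* s ℕS.:+ p) ℕS.:* r ℕS.:+ (j ℕS.:* s ℕS.:+ p) ℕS.:* r ℕS.:= ℕS.con 2 ℕS.:* (j ℕS.:* s ℕS.:* r) ℕS.:+ ℕS.con 2 ℕS.:* (p ℕS.:* r)) refl J σ p r))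
      jets : p ^ (2 * (J * σ * r)) ≤ q ^ (2 * J * n)
      jets = begin
        p ^ (2 * (J * σ * r)) ≡⟨ cong (p ^_) (ℕS.solve 3 (λ j s r → ℕS.con 2 ℕS.:* (j ℕS.:* s ℕS.:* r) ℕS.:= (s ℕS.:* r) ℕS.:* (ℕS.con 2 ℕS.:* j)) refl J σ r) ⟩
        p ^ ((σ * r) * (2 * J)) ≡⟨ sym (^-*-assoc p (σ * r) (2 * J)) ⟩
        (p ^ (σ * r)) ^ (2 * J) ≤⟨ ^-monoˡ-≤ (2 * J) enough ⟩
        (q ^ n) ^ (2 * J) ≡⟨ trans (^-*-assoc q n (2 * J)) (cong (q ^_) (*-comm n (2 * J))) ⟩
        q ^ (2 * J * n) ∎

    -- Λ ≤ (J + 2) σ r and σ r ≤ 6 h, so the 2Λ + 1 coefficients that determine a member number at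
    -- most h b.
    b : ℕ
    b = (J + 2) * 12 + 1

    size-bound : A ≤ p ^ suc K → A ≤ 2 ^ (h * (b * k))
    size-bound A≤ = begin
      A ≤⟨ A≤ ⟩
      p ^ suc K ≤⟨ ^-monoˡ-≤ (suc K) p≤2^k ⟩
      (2 ^ k) ^ suc K ≡⟨ ^-*-assoc 2 k (suc K) ⟩
      2 ^ (k * suc K) ≤⟨ ^-monoʳ-≤ 2 (*-monoʳ-≤ k K≤) ⟩
      2 ^ (k * (h * b)) ≡⟨ cong (2 ^_) (ℕS.solve 3 (λ k h b → k ℕS.:* (h ℕS.:* b) ℕS.:= h ℕS.:* (b ℕS.:* k)) refl k h b) ⟩
      2 ^ (h * (b * k)) ∎
      where
      Λ≤ : Λ ≤ (J + 2) * (6 * h)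
      Λ≤ = begin
        Λ ≡⟨ Λ≡ ⟩
        (J * σ + p) * r ≤⟨ *-monoˡ-≤ r (+-monoʳ-≤ (J * σ) p≤) ⟩
        (J * σ + 2 * σ) * r ≡⟨ ℕS.solve 3 (λ j s r → (j ℕS.:* s ℕS.:+ ℕS.con 2 ℕS.:* s) ℕS.:* r ℕS.:= (j ℕS.:+ ℕS.con 2) ℕS.:* (s ℕS.:* r)) refl J σ r ⟩
        (J + 2) * (σ * r) ≤⟨ *-monoʳ-≤ (J + 2) (≤-trans σr≤ (≤-trans (+-monoʳ-≤ (4 * h) (*-monoʳ-≤ 2 1≤h)) (≤-reflexive (ℕS.solve 1 (λ h → ℕS.con 4 ℕS.:* h ℕS.:+ ℕS.con 2 ℕS.:* h ℕS.:= ℕS.con 6 ℕS.:* h) refl h)))) ⟩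
        (J + 2) * (6 * h) ∎
      K≤ : suc K ≤ h * b
      K≤ = begin
        1 + (Λ + Λ) ≤⟨ +-mono-≤ 1≤h (+-mono-≤ Λ≤ Λ≤) ⟩
        h + ((J + 2) * (6 * h) + (J + 2) * (6 * h)) ≡⟨ ℕS.solve 2 (λ j h → h ℕS.:+ ((j ℕS.:+ ℕS.con 2) ℕS.:* (ℕS.con 6 ℕS.:* h) ℕS.:+ (j ℕS.:+ ℕS.con 2) ℕS.:* (ℕS.con 6 ℕS.:* h)) ℕS.:= h ℕS.:* ((j ℕS.:+ ℕS.con 2) ℕS.:* ℕS.con 12 ℕS.:+ ℕS.con 1)) refl J h ⟩
        h * b ∎

open Counting using (1≤^; power-saving; module PatternCount; module Numerics)

-- Laurent series over the field with p elements

open import Defs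

module LaurentModel where
  open import Data.Nat using (_∸_; _%_; ∣_-_∣)
  open ≡ using (_≗_; refl; sym; trans; cong; cong₂)

  module Convolution where
    open import Data.Nat using (_+_; _*_)
    open ℕS using (solve; _:=_; _:+_; _:*_)

    tail : (ℕ → ℕ) → ℕ → ℕ
    tail a = a ∘ suc

    -- The Cauchy product by recursion on the first factor, which turns associativity into an
    -- induction.
    conv : (ℕ → ℕ) → (ℕ → ℕ) → ℕ → ℕ
    conv a b zero = a 0 * b 0
    conv a b (suc n) = a 0 * b (suc n) + conv (tail a) b n

    sum-conv : ∀ a b n → sum (map (λ i → a i * b (n ∸ i)) (upTo (suc n))) ≡ conv a b n
    sum-conv a b n = trans (cong sum (Listₚ.map-upTo (λ i → a i * b (n ∸ i)) (suc n))) (go a n)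
      where
      go : ∀ a n → sum (applyUpTo (λ i → a i * b (n ∸ i)) (suc n)) ≡ conv a b n
      go a zero = ℕₚ.+-identityʳ _
      go a (suc n) = cong (_+_ (a 0 * b (suc n))) (go (tail a) n)

    conv-cong : ∀ {a a′ b b′} → a ≗ a′ → b ≗ b′ → conv a b ≗ conv a′ b′
    conv-cong e f zero = cong₂ _*_ (e 0) (f 0)
    conv-cong e f (suc n) = cong₂ _+_ (cong₂ _*_ (e 0) (f (suc n))) (conv-cong (e ∘ suc) f n)

    conv-sucʳ : ∀ a b n → conv a b (suc n) ≡ conv a (tail b) n + a (suc n) * b 0
    conv-sucʳ a b zero = refl
    conv-sucʳ a b (suc n) = trans (cong (_+_ (a 0 * b (2 + n))) (conv-sucʳ (tail a) b n)) (sym (ℕₚ.+-assoc (a 0 * b (2 + n)) _ _))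

    conv-comm : ∀ a b n → conv a b n ≡ conv b a n
    conv-comm a b zero = ℕₚ.*-comm (a 0) (b 0)
    conv-comm a b (suc n) = trans (cong₂ _+_ (ℕₚ.*-comm (a 0) (b (suc n))) (conv-comm (tail a) b n))
      (trans (ℕₚ.+-comm (b (suc n) * a 0) _) (sym (conv-sucʳ b a n)))

    conv-distribʳ : ∀ a b c n → conv (λ i → a i + b i) c n ≡ conv a c n + conv b c n
    conv-distribʳ a b c zero = ℕₚ.*-distribʳ-+ (c 0) (a 0) (b 0)
    conv-distribʳ a b c (suc n) = trans (cong (_+_ ((a 0 + b 0) * c (suc n))) (conv-distribʳ (tail a) (tail b) c n))
      (solve 5 (λ a b c x y → (a :+ b) :* c :+ (x :+ y) := (a :* c :+ x) :+ (b :* c :+ y)) refl (a 0) (b 0) (c (suc n)) _ _)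

    conv-scaleˡ : ∀ k a b n → conv (λ i → k * a i) b n ≡ k * conv a b n
    conv-scaleˡ k a b zero = ℕₚ.*-assoc k (a 0) (b 0)
    conv-scaleˡ k a b (suc n) = trans (cong (_+_ (k * a 0 * b (suc n))) (conv-scaleˡ k (tail a) b n))
      (solve 4 (λ k a b x → k :* a :* b :+ k :* x := k :* (a :* b :+ x)) refl k (a 0) (b (suc n)) _)

    conv-assoc : ∀ a b c n → conv (conv a b) c n ≡ conv a (conv b c) n
    conv-assoc a b c zero = ℕₚ.*-assoc (a 0) (b 0) (c 0)
    conv-assoc a b c (suc n) = trans (cong (_+_ (a 0 * b 0 * c (suc n)))
        (trans (conv-distribʳ (λ i → a 0 * tail b i) (conv (tail a) b) c n)
          (cong₂ _+_ (conv-scaleˡ (a 0) (tail b) c n) (conv-assoc (tail a) b c n))))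
      (solve 5 (λ a b c x y → a :* b :* c :+ (a :* x :+ y) := a :* (b :* c :+ x) :+ y) refl (a 0) (b 0) (c (suc n)) _ _)

    δ : ℕ → ℕ
    δ zero = 1
    δ (suc n) = 0

    conv-zeroˡ : ∀ b n → conv (λ _ → 0) b n ≡ 0
    conv-zeroˡ b zero = refl
    conv-zeroˡ b (suc n) = conv-zeroˡ b n

    conv-δˡ : ∀ b n → conv δ b n ≡ b n
    conv-δˡ b zero = ℕₚ.*-identityˡ (b 0)
    conv-δˡ b (suc n) = trans (cong₂ _+_ (ℕₚ.*-identityˡ (b (suc n))) (conv-zeroˡ b n)) (ℕₚ.+-identityʳ _)

    ext : (ℕ → ℕ) → ℤ → ℕ
    ext a (+ n) = a n
    ext a -[1+ n ] = 0

    ext-cong : ∀ {a b} → a ≗ b → ext a ≗ ext b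
    ext-cong e (+ n) = e n
    ext-cong e -[1+ n ] = refl

    shift : ℕ → (ℕ → ℕ) → ℕ → ℕ
    shift d a n = ext a (n ⊖ d)

    shift-suc : ∀ d a n → shift (suc d) a (suc n) ≡ shift d a n
    shift-suc d a n = cong (ext a) (ℤₚ.[1+m]⊖[1+n]≡m⊖n n d)

    conv-shiftˡ : ∀ d a b n → conv (shift d a) b n ≡ shift d (conv a b) n
    conv-shiftˡ zero a b n = refl
    conv-shiftˡ (suc d) a b zero = refl
    conv-shiftˡ (suc d) a b (suc n) = trans (conv-cong (shift-suc d a) (λ _ → refl) n)
      (trans (conv-shiftˡ d a b n) (sym (shift-suc d (conv a b) n)))

    ext-shift : ∀ d a j → ext (shift d a) j ≡ ext a (j ℤ.- + d)
    ext-shift d a (+ n) = cong (ext a) (sym (ℤₚ.[+m]-[+n]≡m⊖n n d))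
    ext-shift zero a -[1+ n ] = refl
    ext-shift (suc d) a -[1+ n ] = refl

    ext-conv-shift : ∀ d e a b j → ext (conv (shift d a) (shift e b)) j ≡ ext (conv a b) (j ℤ.- (+ d ℤ.+ + e))
    ext-conv-shift d e a b j = trans (ext-cong inner j) (trans (ext-shift d (shift e (conv a b)) j)
        (trans (ext-shift e (conv a b) (j ℤ.- + d)) (cong (ext (conv a b)) (ℤS.solve 3 (λ j d e → (j ℤS.:- d) ℤS.:- e ℤS.:= j ℤS.:- (d ℤS.:+ e)) refl j (+ d) (+ e)))))
      where
      inner : conv (shift d a) (shift e b) ≗ shift d (shift e (conv a b))
      inner n = trans (conv-shiftˡ d a (shift e b) n) (ext-cong (λ m → trans (conv-comm a (shift e b) m)
        (trans (conv-shiftˡ e b a m) (ext-cong (conv-comm b a) (m ⊖ e)))) (n ⊖ d))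

  open Convolution

  coeff≡ext : ∀ x k → coeff x k ≡ ext (co x) (k ℤ.- val x)
  coeff≡ext x k with k ℤ.- val x
  ... | + n = refl
  ... | -[1+ n ] = refl

  at : ℤ → Laurent → ℕ → ℕ
  at v x n = coeff x (v ℤ.+ + n)

  difference : ∀ {v w} → v ℤ.≤ w → ∃ λ d → w ≡ v ℤ.+ + d
  difference {v} {w} v≤w = ℤ.∣ w ℤ.- v ∣ , trans (ℤS.solve 2 (λ v w → w ℤS.:= v ℤS.:+ (w ℤS.:- v)) refl v w)
    (cong (ℤ._+_ v) (sym (ℤₚ.0≤i⇒+∣i∣≡i (ℤₚ.i≤j⇒0≤j-i v≤w))))

  at-shift : ∀ x v {d} → val x ≡ v ℤ.+ + d → at v x ≗ shift d (co x)
  at-shift x v {d} e n = trans (coeff≡ext x (v ℤ.+ + n)) (cong (ext (co x)) (trans (cong (ℤ._-_ (v ℤ.+ + n)) e)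
    (trans (ℤS.solve 3 (λ v n d → (v ℤS.:+ n) ℤS.:- (v ℤS.:+ d) ℤS.:= n ℤS.:- d) refl v (+ n) (+ d)) (ℤₚ.[+m]-[+n]≡m⊖n n d))))

  coeff-at : ∀ x {v} → v ℤ.≤ val x → ∀ k → coeff x k ≡ ext (at v x) (k ℤ.- v)
  coeff-at x {v} v≤ k with difference v≤
  ... | d , e = trans (coeff≡ext x k) (sym (trans (ext-cong (at-shift x v e) (k ℤ.- v)) (trans (ext-shift d (co x) (k ℤ.- v))
    (cong (ext (co x)) (trans (ℤS.solve 3 (λ k v d → (k ℤS.:- v) ℤS.:- d ℤS.:= k ℤS.:- (v ℤS.:+ d)) refl k v (+ d)) (cong (ℤ._-_ k) (sym e)))))))

  coeff-⊕ : ∀ x y k → coeff (x ⊕ y) k ≡ coeff x k ℕ.+ coeff y k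
  coeff-⊕ x y k = trans (coeff≡ext (x ⊕ y) k) (trans (go (k ℤ.- v))
      (sym (cong₂ ℕ._+_ (coeff-at x (ℤₚ.i⊓j≤i (val x) (val y)) k) (coeff-at y (ℤₚ.i⊓j≤j (val x) (val y)) k))))
    where
    v = val x ℤ.⊓ val y
    go : ∀ j → ext (λ n → at v x n ℕ.+ at v y n) j ≡ ext (at v x) j ℕ.+ ext (at v y) j
    go (+ n) = refl
    go -[1+ n ] = refl

  -- Both factors may be expanded from below their nominal valuation. Congruent series can have
  -- different `val`, and their products are compared after expansion from a common lower start.
  coeff-⊗ : ∀ x y {v w} → v ℤ.≤ val x → w ℤ.≤ val y → ∀ k → coeff (x ⊗ y) k ≡ ext (conv (at v x) (at w y)) (k ℤ.- (v ℤ.+ w))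
  coeff-⊗ x y {v} {w} v≤ w≤ k with difference v≤ | difference w≤
  ... | d , e | d′ , e′ = trans (coeff≡ext (x ⊗ y) k) (trans (ext-cong (sum-conv (co x) (co y)) (k ℤ.- (val x ℤ.+ val y)))
    (sym (trans (ext-cong (conv-cong (at-shift x v e) (at-shift y w e′)) (k ℤ.- (v ℤ.+ w)))
      (trans (ext-conv-shift d d′ (co x) (co y) (k ℤ.- (v ℤ.+ w)))
        (cong (ext (conv (co x) (co y))) (trans (ℤS.solve 5 (λ k v w d d′ → (k ℤS.:- (v ℤS.:+ w)) ℤS.:- (d ℤS.:+ d′) ℤS.:= k ℤS.:- ((v ℤS.:+ d) ℤS.:+ (w ℤS.:+ d′))) refl k v w (+ d) (+ d′))
          (cong₂ (λ a b → k ℤ.- (a ℤ.+ b)) (sym e) (sym e′))))))))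

  coeff-⊗-co : ∀ x y k → coeff (x ⊗ y) k ≡ ext (conv (co x) (co y)) (k ℤ.- (val x ℤ.+ val y))
  coeff-⊗-co x y k = trans (coeff≡ext (x ⊗ y) k) (ext-cong (sum-conv (co x) (co y)) (k ℤ.- (val x ℤ.+ val y)))

  coeff-below : ∀ x {k} → k ℤ.< val x → coeff x k ≡ 0
  coeff-below x {k} k<v = trans (coeff≡ext x k) (go _ (ℤₚ.<-≤-trans (ℤₚ.+-monoˡ-< (ℤ.- val x) k<v) (ℤₚ.≤-reflexive (ℤₚ.+-inverseʳ (val x)))))
    where
    go : ∀ j → j ℤ.< + 0 → ext (co x) j ≡ 0
    go (+ n) (ℤ.+<+ ())
    go -[1+ n ] _ = refl

  coeff-natural : ∀ c n → coeff (laurent (+ 0) c) (+ n) ≡ c n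
  coeff-natural c n = trans (coeff≡ext (laurent (+ 0) c) (+ n)) (cong (ext c) (ℤₚ.+-identityʳ (+ n)))

  module LaurentSeries {p : ℕ} (prime : Prime p) where
    instance
      p≢0 : NonZero p
      p≢0 = prime⇒nonZero prime

    infix 4 _≋_
    _≋_ : ℕ → ℕ → Set
    a ≋ b = a % p ≡ b % p

    +-≋ : ∀ {a a′ b b′} → a ≋ a′ → b ≋ b′ → a ℕ.+ b ≋ a′ ℕ.+ b′
    +-≋ {a} {a′} {b} {b′} e f = trans (%-distribˡ-+ a b p) (trans (cong₂ (λ x y → (x ℕ.+ y) % p) e f) (sym (%-distribˡ-+ a′ b′ p)))

    *-≋ : ∀ {a a′ b b′} → a ≋ a′ → b ≋ b′ → a ℕ.* b ≋ a′ ℕ.* b′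
    *-≋ {a} {a′} {b} {b′} e f = trans (%-distribˡ-* a b p) (trans (cong₂ (λ x y → (x ℕ.* y) % p) e f) (sym (%-distribˡ-* a′ b′ p)))

    ≡⇒≋ : ∀ {a b} → a ≡ b → a ≋ b
    ≡⇒≋ = cong (_% p)

    ∣⇒≋ : ∀ {a b} → p ∣ ∣ a - b ∣ → a ≋ b
    ∣⇒≋ {a} {b} d with ℕₚ.≤-total a b
    ... | inj₁ a≤b = sym (go a≤b d)
      where
      go : ∀ {a b} → a ℕ.≤ b → p ∣ ∣ a - b ∣ → b ≋ a
      go {a} {b} a≤b (divides q e) = trans (≡⇒≋ (trans (sym (ℕₚ.m+[n∸m]≡n a≤b)) (cong (ℕ._+_ a) (trans (sym (ℕₚ.m≤n⇒∣m-n∣≡n∸m a≤b)) e)))) ([m+kn]%n≡m%n a q p)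
    ... | inj₂ b≤a with d
    ...   | divides q e = trans (≡⇒≋ (trans (sym (ℕₚ.m+[n∸m]≡n b≤a)) (cong (ℕ._+_ b) (trans (sym (ℕₚ.m≤n⇒∣n-m∣≡n∸m b≤a)) e)))) ([m+kn]%n≡m%n b q p)

    ≋⇒∣ : ∀ {a b} → a ≋ b → p ∣ ∣ a - b ∣
    ≋⇒∣ {a} {b} e = divides ∣ a ℕ./ p - b ℕ./ p ∣ (trans (cong₂ ∣_-_∣ (m≡m%n+[m/n]*n a p) (trans (m≡m%n+[m/n]*n b p) (cong (ℕ._+ (b ℕ./ p) ℕ.* p) (sym e))))
      (trans (ℕₚ.∣m+n-m+o∣≡∣n-o∣ (a % p) _ _) (sym (ℕₚ.*-distribʳ-∣-∣ p (a ℕ./ p) (b ℕ./ p)))))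

    infix 4 _≈_
    _≈_ : Laurent → Laurent → Set
    x ≈ y = x ≈[ p ] y

    ≈⇒≋ : ∀ {x y} → x ≈ y → ∀ k → coeff x k ≋ coeff y k
    ≈⇒≋ e k = ∣⇒≋ (e k)

    ≋⇒≈ : ∀ {x y} → (∀ k → coeff x k ≋ coeff y k) → x ≈ y
    ≋⇒≈ e k = ≋⇒∣ (e k)

    ≡⇒≈ : ∀ {x y} → (∀ k → coeff x k ≡ coeff y k) → x ≈ y
    ≡⇒≈ {x} {y} e = ≋⇒≈ {x} {y} (λ k → ≡⇒≋ (e k))

    ext-≋ : ∀ {a b} → (∀ n → a n ≋ b n) → ∀ j → ext a j ≋ ext b j
    ext-≋ e (+ n) = e n
    ext-≋ e -[1+ n ] = refl

    conv-≋ : ∀ {a a′ b b′} → (∀ n → a n ≋ a′ n) → (∀ n → b n ≋ b′ n) → ∀ n → conv a b n ≋ conv a′ b′ n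
    conv-≋ e f zero = *-≋ (e 0) (f 0)
    conv-≋ e f (suc n) = +-≋ (*-≋ (e 0) (f (suc n))) (conv-≋ (e ∘ suc) f n)

    𝟘 𝟙 : Laurent
    𝟘 = laurent (+ 0) (λ _ → 0)
    𝟙 = laurent (+ 0) δ

    coeff-𝟘 : ∀ k → coeff 𝟘 k ≡ 0
    coeff-𝟘 k = trans (coeff≡ext 𝟘 k) (go (k ℤ.- + 0))
      where
      go : ∀ j → ext (λ _ → 0) j ≡ 0
      go (+ n) = refl
      go -[1+ n ] = refl

    ⊝_ : Laurent → Laurent
    ⊝ x = laurent (val x) (λ n → (p ∸ 1) ℕ.* co x n)

    coeff-⊝ : ∀ x k → coeff (⊝ x) k ≡ (p ∸ 1) ℕ.* coeff x k
    coeff-⊝ x k = trans (coeff≡ext (⊝ x) k) (trans (go (k ℤ.- val x)) (cong (ℕ._*_ (p ∸ 1)) (sym (coeff≡ext x k))))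
      where
      go : ∀ j → ext (λ n → (p ∸ 1) ℕ.* co x n) j ≡ (p ∸ 1) ℕ.* ext (co x) j
      go (+ n) = refl
      go -[1+ n ] = sym (ℕₚ.*-zeroʳ (p ∸ 1))

    ⊕-cong : ∀ {x x′ y y′} → x ≈ x′ → y ≈ y′ → x ⊕ y ≈ x′ ⊕ y′
    ⊕-cong {x} {x′} {y} {y′} e f = ≋⇒≈ {x ⊕ y} {x′ ⊕ y′} λ k → trans (≡⇒≋ (coeff-⊕ x y k))
      (trans (+-≋ (≈⇒≋ {x} {x′} e k) (≈⇒≋ {y} {y′} f k)) (≡⇒≋ (sym (coeff-⊕ x′ y′ k))))

    ⊗-cong : ∀ {x x′ y y′} → x ≈ x′ → y ≈ y′ → x ⊗ y ≈ x′ ⊗ y′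
    ⊗-cong {x} {x′} {y} {y′} e f = ≋⇒≈ {x ⊗ y} {x′ ⊗ y′} λ k →
      trans (≡⇒≋ (coeff-⊗ x y (ℤₚ.i⊓j≤i (val x) (val x′)) (ℤₚ.i⊓j≤i (val y) (val y′)) k))
        (trans (ext-≋ (conv-≋ (λ n → ≈⇒≋ {x} {x′} e (v ℤ.+ + n)) (λ n → ≈⇒≋ {y} {y′} f (w ℤ.+ + n))) (k ℤ.- (v ℤ.+ w)))
          (≡⇒≋ (sym (coeff-⊗ x′ y′ (ℤₚ.i⊓j≤j (val x) (val x′)) (ℤₚ.i⊓j≤j (val y) (val y′)) k))))
      where
      v = val x ℤ.⊓ val x′
      w = val y ℤ.⊓ val y′

    ⊗-assoc : ∀ x y z → (x ⊗ y) ⊗ z ≈ x ⊗ (y ⊗ z)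
    ⊗-assoc x y z = ≡⇒≈ {(x ⊗ y) ⊗ z} {x ⊗ (y ⊗ z)} λ k → trans (coeff-⊗-co (x ⊗ y) z k)
      (trans (ext-cong (λ n → trans (conv-cong (sum-conv (co x) (co y)) (λ _ → refl) n)
          (trans (conv-assoc (co x) (co y) (co z) n) (conv-cong {co x} (λ _ → refl) (λ m → sym (sum-conv (co y) (co z) m)) n))) (k ℤ.- _))
        (trans (cong (λ v → ext (conv (co x) (co (y ⊗ z))) (k ℤ.- v)) (ℤₚ.+-assoc (val x) (val y) (val z))) (sym (coeff-⊗-co x (y ⊗ z) k))))

    ⊗-comm : ∀ x y → x ⊗ y ≈ y ⊗ x
    ⊗-comm x y = ≡⇒≈ {x ⊗ y} {y ⊗ x} λ k → trans (coeff-⊗-co x y k) (trans (ext-cong (conv-comm (co x) (co y)) (k ℤ.- (val x ℤ.+ val y)))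
      (trans (cong (λ v → ext (conv (co y) (co x)) (k ℤ.- v)) (ℤₚ.+-comm (val x) (val y))) (sym (coeff-⊗-co y x k))))

    ⊗-identityˡ : ∀ x → 𝟙 ⊗ x ≈ x
    ⊗-identityˡ x = ≡⇒≈ {𝟙 ⊗ x} {x} λ k → trans (coeff-⊗-co 𝟙 x k) (trans (ext-cong (conv-δˡ (co x)) (k ℤ.- _))
      (trans (cong (λ v → ext (co x) (k ℤ.- v)) (ℤₚ.+-identityˡ (val x))) (sym (coeff≡ext x k))))

    ⊗-distribʳ : ∀ x y z → (y ⊕ z) ⊗ x ≈ (y ⊗ x) ⊕ (z ⊗ x)
    ⊗-distribʳ x y z = ≡⇒≈ {(y ⊕ z) ⊗ x} {(y ⊗ x) ⊕ (z ⊗ x)} λ k → trans (coeff-⊗ (y ⊕ z) x {v} ℤₚ.≤-refl ℤₚ.≤-refl k)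
      (trans (ext-cong (λ n → trans (conv-cong (λ m → coeff-⊕ y z (v ℤ.+ + m)) (λ _ → refl) n) (conv-distribʳ (at v y) (at v z) (at (val x) x) n)) (k ℤ.- (v ℤ.+ val x)))
        (trans (go (conv (at v y) (at (val x) x)) (conv (at v z) (at (val x) x)) (k ℤ.- (v ℤ.+ val x)))
          (trans (cong₂ ℕ._+_ (sym (coeff-⊗ y x (ℤₚ.i⊓j≤i (val y) (val z)) ℤₚ.≤-refl k)) (sym (coeff-⊗ z x (ℤₚ.i⊓j≤j (val y) (val z)) ℤₚ.≤-refl k)))
            (sym (coeff-⊕ (y ⊗ x) (z ⊗ x) k)))))
      where
      v = val y ℤ.⊓ val z
      go : ∀ a b j → ext (λ n → a n ℕ.+ b n) j ≡ ext a j ℕ.+ ext b j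
      go a b (+ n) = refl
      go a b -[1+ n ] = refl

    ≈-trans : ∀ {x y z} → x ≈ y → y ≈ z → x ≈ z
    ≈-trans {x} {y} {z} e f = ≋⇒≈ {x} {z} λ k → trans (≈⇒≋ {x} {y} e k) (≈⇒≋ {y} {z} f k)

    ⊕-comm : ∀ x y → x ⊕ y ≈ y ⊕ x
    ⊕-comm x y = ≡⇒≈ {x ⊕ y} {y ⊕ x} λ k → trans (coeff-⊕ x y k) (trans (ℕₚ.+-comm (coeff x k) (coeff y k)) (sym (coeff-⊕ y x k)))

    ⊕-assoc : ∀ x y z → (x ⊕ y) ⊕ z ≈ x ⊕ (y ⊕ z)
    ⊕-assoc x y z = ≡⇒≈ {(x ⊕ y) ⊕ z} {x ⊕ (y ⊕ z)} λ k → trans (coeff-⊕ (x ⊕ y) z k) (trans (cong (ℕ._+ coeff z k) (coeff-⊕ x y k))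
      (trans (ℕₚ.+-assoc (coeff x k) (coeff y k) (coeff z k)) (sym (trans (coeff-⊕ x (y ⊕ z) k) (cong (ℕ._+_ (coeff x k)) (coeff-⊕ y z k))))))

    ⊕-identityˡ : ∀ x → 𝟘 ⊕ x ≈ x
    ⊕-identityˡ x = ≡⇒≈ {𝟘 ⊕ x} {x} λ k → trans (coeff-⊕ 𝟘 x k) (cong (ℕ._+ coeff x k) (coeff-𝟘 k))

    multiple : ∀ n → n ℕ.* p ≋ 0
    multiple n = trans (m*n%n≡0 n p) (sym (m*n%n≡0 0 p))

    pred*+ : ∀ n → (p ∸ 1) ℕ.* n ℕ.+ n ≋ 0
    pred*+ n = trans (≡⇒≋ (trans (ℕₚ.+-comm ((p ∸ 1) ℕ.* n) n) (trans (cong (ℕ._* n) (ℕₚ.suc-pred p)) (ℕₚ.*-comm p n)))) (multiple n)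

    ⊕-inverseˡ : ∀ x → (⊝ x) ⊕ x ≈ 𝟘
    ⊕-inverseˡ x = ≋⇒≈ {(⊝ x) ⊕ x} {𝟘} λ k → trans (≡⇒≋ (trans (coeff-⊕ (⊝ x) x k) (cong (ℕ._+ coeff x k) (coeff-⊝ x k))))
      (trans (pred*+ (coeff x k)) (≡⇒≋ (sym (coeff-𝟘 k))))

    ⊝-cong : ∀ {x y} → x ≈ y → ⊝ x ≈ ⊝ y
    ⊝-cong {x} {y} e = ≋⇒≈ {⊝ x} {⊝ y} λ k → trans (≡⇒≋ (coeff-⊝ x k)) (trans (*-≋ {p ∸ 1} refl (≈⇒≋ {x} {y} e k)) (≡⇒≋ (sym (coeff-⊝ y k))))

    commutativeRing : CommutativeRing 0ℓ 0ℓ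
    commutativeRing = record
      { Carrier = Laurent ; _≈_ = _≈_ ; _+_ = _⊕_ ; _*_ = _⊗_ ; -_ = ⊝_ ; 0# = 𝟘 ; 1# = 𝟙
      ; isCommutativeRing = record
        { isRing = record
          { +-isAbelianGroup = record
            { isGroup = record
              { isMonoid = record
                { isSemigroup = record
                  { isMagma = record
                    { isEquivalence = record
                      { refl = λ {x} → ≡⇒≈ {x} {x} λ _ → refl
                      ; sym = λ {x} {y} e → ≋⇒≈ {y} {x} λ k → sym (≈⇒≋ {x} {y} e k)
                      ; trans = λ {x} {y} {z} → ≈-trans {x} {y} {z} }
                    ; ∙-cong = λ {x} {x′} {y} {y′} → ⊕-cong {x} {x′} {y} {y′} }
                  ; assoc = ⊕-assoc }
                ; identity = ⊕-identityˡ , λ x → ≈-trans {x ⊕ 𝟘} {𝟘 ⊕ x} {x} (⊕-comm x 𝟘) (⊕-identityˡ x) }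
              ; inverse = ⊕-inverseˡ , λ x → ≈-trans {x ⊕ (⊝ x)} {(⊝ x) ⊕ x} {𝟘} (⊕-comm x (⊝ x)) (⊕-inverseˡ x)
              ; ⁻¹-cong = λ {x} {y} → ⊝-cong {x} {y} }
            ; comm = ⊕-comm }
          ; *-cong = λ {x} {x′} {y} {y′} → ⊗-cong {x} {x′} {y} {y′}
          ; *-assoc = ⊗-assoc
          ; *-identity = ⊗-identityˡ , λ x → ≈-trans {x ⊗ 𝟙} {𝟙 ⊗ x} {x} (⊗-comm x 𝟙) (⊗-identityˡ x)
          ; distrib = (λ x y z → ≈-trans {x ⊗ (y ⊕ z)} {(y ⊕ z) ⊗ x} {(x ⊗ y) ⊕ (x ⊗ z)} (⊗-comm x (y ⊕ z))
                (≈-trans {(y ⊕ z) ⊗ x} {(y ⊗ x) ⊕ (z ⊗ x)} {(x ⊗ y) ⊕ (x ⊗ z)} (⊗-distribʳ x y z)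
                  (⊕-cong {y ⊗ x} {x ⊗ y} {z ⊗ x} {x ⊗ z} (⊗-comm y x) (⊗-comm z x))))
              , ⊗-distribʳ }
        ; *-comm = ⊗-comm } }

    O : ℤ → Laurent → Set
    O i x = ∀ {k} → k ℤ.< i → coeff x k ≋ 0

    O-⊝⁺ : ∀ {i x y} → (∀ {k} → k ℤ.< i → coeff x k ≋ coeff y k) → O i (x ⊕ (⊝ y))
    O-⊝⁺ {i} {x} {y} e {k} k<i = trans (≡⇒≋ (trans (coeff-⊕ x (⊝ y) k) (trans (cong (ℕ._+_ (coeff x k)) (coeff-⊝ y k)) (ℕₚ.+-comm (coeff x k) _))))
      (trans (+-≋ {(p ∸ 1) ℕ.* coeff y k} refl (e k<i)) (pred*+ (coeff y k)))

    O-⊝⁻ : ∀ {i x y} → O i (x ⊕ (⊝ y)) → ∀ {k} → k ℤ.< i → coeff x k ≋ coeff y k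
    O-⊝⁻ {i} {x} {y} e {k} k<i = trans (≡⇒≋ (sym (ℕₚ.+-identityʳ (coeff x k)))) (trans (+-≋ {coeff x k} refl (sym (pred*+ (coeff y k))))
      (trans (≡⇒≋ (trans (sym (ℕₚ.+-assoc (coeff x k) _ _)) (cong (ℕ._+ coeff y k) (sym (trans (coeff-⊕ x (⊝ y) k) (cong (ℕ._+_ (coeff x k)) (coeff-⊝ y k)))))))
        (+-≋ {b = coeff y k} (e k<i) refl)))

    below : ∀ {i} x → i ℤ.≤ val x → O i x
    below x i≤v k<i = ≡⇒≋ (coeff-below x (ℤₚ.<-≤-trans k<i i≤v))

    -- An element of `O i` may have a smaller `val`, with first coefficients divisible by `p`. Once
    -- they are dropped, the order of a product is visible from `val`.
    truncate : ∀ {i} x → O i x → x ≈ laurent i (at i x)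
    truncate {i} x x∈ = ≋⇒≈ {x} {laurent i (at i x)} λ k → go k (k ℤₚ.<? i)
      where
      go : ∀ k → Dec (k ℤ.< i) → coeff x k ≋ coeff (laurent i (at i x)) k
      go k (yes k<i) = trans (x∈ k<i) (≡⇒≋ (sym (coeff-below (laurent i (at i x)) k<i)))
      go k (no k≮i) = ≡⇒≋ (go′ (difference (ℤₚ.≮⇒≥ k≮i)))
        where
        go′ : (∃ λ d → k ≡ i ℤ.+ + d) → coeff x k ≡ coeff (laurent i (at i x)) k
        go′ (d , refl) = sym (trans (coeff≡ext (laurent i (at i x)) (i ℤ.+ + d))
          (cong (ext (at i x)) (ℤS.solve 2 (λ i d → (i ℤS.:+ d) ℤS.:- i ℤS.:= d) refl i (+ d))))

    filtration : Filtration commutativeRing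
    filtration = record
      { O = O
      ; resp = λ {i} {a} {b} e a∈ {k} k<i → trans (sym (≈⇒≋ {a} {b} e k)) (a∈ k<i)
      ; zer = λ {i} {k} _ → ≡⇒≋ (coeff-𝟘 k)
      ; add = λ {i} {a} {b} a∈ b∈ {k} k<i → trans (≡⇒≋ (coeff-⊕ a b k)) (+-≋ {b′ = 0} (a∈ k<i) (b∈ k<i))
      ; neg = λ {i} {a} a∈ {k} k<i → trans (≡⇒≋ (coeff-⊝ a k)) (trans (*-≋ {p ∸ 1} refl (a∈ k<i)) (≡⇒≋ (ℕₚ.*-zeroʳ (p ∸ 1))))
      ; mono = λ i≤j a∈ k<i → a∈ (ℤₚ.<-≤-trans k<i i≤j)
      ; mul = λ {i} {j} {a} {b} a∈ b∈ {k} k<i+j →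
          trans (≈⇒≋ {a ⊗ b} {laurent i (at i a) ⊗ laurent j (at j b)} (⊗-cong {a} {laurent i (at i a)} {b} {laurent j (at j b)} (truncate a a∈) (truncate b b∈)) k)
            (≡⇒≋ (coeff-below (laurent i (at i a) ⊗ laurent j (at j b)) k<i+j))
      ; one = below 𝟙 ℤₚ.≤-refl }

    1<p : 1 ℕ.< p
    1<p = ℕ.nonTrivial⇒n>1 p {{prime⇒nonTrivial prime}}

    -- The coefficient of t^n no longer changes modulo `p` from `z (suc n)` on, so the diagonal is
    -- the limit.
    complete : ∀ (z : ℕ → Laurent) → (∀ k → O (+ 0) (z k)) → (∀ k → O (+ k) (z (suc k) ⊕ (⊝ z k))) →
      ∃ λ l → ∀ k → O (+ k) (l ⊕ (⊝ z k))
    complete z z∈ step = l , λ k → O-⊝⁺ {+ k} {l} {z k} (agree k)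
      where
      l = laurent (+ 0) (λ n → coeff (z (suc n)) (+ n))
      stable : ∀ n d → coeff (z (d ℕ.+ suc n)) (+ n) ≋ coeff (z (suc n)) (+ n)
      stable n zero = refl
      stable n (suc d) = trans (O-⊝⁻ {+ (d ℕ.+ suc n)} {z (suc d ℕ.+ suc n)} {z (d ℕ.+ suc n)} (step (d ℕ.+ suc n)) (ℤ.+<+ (ℕₚ.m≤n+m (suc n) d))) (stable n d)
      agree : ∀ k {j} → j ℤ.< + k → coeff l j ≋ coeff (z k) j
      agree k {+ n} (ℤ.+<+ n<k) = trans (≡⇒≋ (coeff-natural (λ n → coeff (z (suc n)) (+ n)) n)) (sym (trans (≡⇒≋ (cong (λ i → coeff (z i) (+ n)) (sym (ℕₚ.m∸n+n≡m n<k)))) (stable n (k ∸ suc n))))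
      agree k { -[1+ n ] } _ = trans (≡⇒≋ (coeff-below l { -[1+ n ] } ℤ.-<+)) (sym (z∈ k ℤ.-<+))

    open RingKit commutativeRing using (ι; ι-suc)

    coeff-ι : ∀ n k → coeff (ι n) k ≋ n ℕ.* coeff 𝟙 k
    coeff-ι zero k = ≡⇒≋ (coeff-𝟘 k)
    coeff-ι (suc n) k = trans (≈⇒≋ {ι (suc n)} {𝟙 ⊕ ι n} (ι-suc n) k) (trans (≡⇒≋ (coeff-⊕ 𝟙 (ι n) k)) (+-≋ {coeff 𝟙 k} refl (coeff-ι n k)))

    coef : ℤ → Laurent → Fin p
    coef i x = Fin.fromℕ< (m%n<n (coeff x i) p)

    toℕ-coef : ∀ i x → toℕ (coef i x) ≡ coeff x i % p
    toℕ-coef i x = Finₚ.toℕ-fromℕ< (m%n<n (coeff x i) p)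

    valuedRing : ValuedRing
    valuedRing = record
      { ring = commutativeRing ; p = p ; prime = prime
      ; char = ≋⇒≈ {ι p} {𝟘} λ k → trans (coeff-ι p k) (trans (≡⇒≋ (ℕₚ.*-comm p (coeff 𝟙 k))) (trans (multiple (coeff 𝟙 k)) (≡⇒≋ (sym (coeff-𝟘 k)))))
      ; filtration = filtration
      ; exhaustive = λ a → ℤ.∣ val a ∣ , below a (-∣i∣≤i (val a))
      ; separated = λ {a} a∈ → ≋⇒≈ {a} {𝟘} λ k → trans (a∈ (suc ℤ.∣ k ∣) (ℤₚ.≤-<-trans (i≤∣i∣ k) (ℤ.+<+ ℕₚ.≤-refl))) (≡⇒≋ (sym (coeff-𝟘 k)))
      ; complete = λ z → complete z
      ; 1∉ = λ 1∈ → contradiction (trans (sym (m<n⇒m%n≡m 1<p)) (trans (1∈ {+ 0} (ℤ.+<+ (ℕ.s≤s ℕ.z≤n))) (m*n%n≡0 0 p))) λ ()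
      ; t = t ; t⁻ = t⁻
      ; tt⁻ = ≡⇒≈ {t ⊗ t⁻} {𝟙} λ k → trans (coeff-⊗-co t t⁻ k) (trans (ext-cong (conv-δˡ δ) (k ℤ.- + 0)) (sym (coeff≡ext 𝟙 k)))
      ; t∈ = below t ℤₚ.≤-refl ; t⁻∈ = below t⁻ ℤₚ.≤-refl
      ; coef = coef
      ; coef-cong = λ {i} {a} {b} e → Finₚ.toℕ-injective (trans (toℕ-coef i a) (trans (≈⇒≋ {a} {b} e i) (sym (toℕ-coef i b))))
      ; coef-≡ = λ {i} {a} {b} e c → O-⊝⁺ {ℤ.suc i} {a} {b} (extend {i} {a} {b} (O-⊝⁻ {i} {a} {b} e) (trans (sym (toℕ-coef i a)) (trans (cong toℕ c) (toℕ-coef i b)))) }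
      where
      t = laurent (+ 1) δ
      t⁻ = laurent -[1+ 0 ] δ
      -∣i∣≤i : ∀ i → ℤ.- (+ ℤ.∣ i ∣) ℤ.≤ i
      -∣i∣≤i (+ zero) = ℤₚ.≤-refl
      -∣i∣≤i (+ suc n) = ℤ.-≤+
      -∣i∣≤i -[1+ n ] = ℤₚ.≤-refl
      extend : ∀ {i a b} → (∀ {k} → k ℤ.< i → coeff a k ≋ coeff b k) → coeff a i ≋ coeff b i → ∀ {k} → k ℤ.< ℤ.suc i → coeff a k ≋ coeff b k
      extend {i} {a} {b} e f {k} k<si with k ℤ.≟ i
      ... | yes refl = f
      ... | no k≢i = e (ℤₚ.≤∧≢⇒< (ℤₚ.≤-trans (ℤₚ.i<j⇒i≤pred[j] k<si) (ℤₚ.≤-reflexive (ℤₚ.pred-suc i))) k≢i)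

open LaurentModel using (module LaurentSeries)

-- The modulus

n≤2^⌈log₂n⌉ : ∀ n → n ℕ.≤ 2 ℕ.^ ⌈log₂ n ⌉
n≤2^⌈log₂n⌉ = <-rec _ λ where
    zero _ → ℕ.z≤n
    (suc zero) _ → ℕₚ.≤-refl
    (suc (suc n)) rec → go n (rec (ℕₚ.⌈n/2⌉<n n))
  where
  n≤2*⌈n/2⌉ : ∀ n → n ℕ.≤ 2 ℕ.* ⌈ n /2⌉
  n≤2*⌈n/2⌉ zero = ℕ.z≤n
  n≤2*⌈n/2⌉ (suc zero) = ℕ.s≤s ℕ.z≤n
  n≤2*⌈n/2⌉ (suc (suc n)) = ℕₚ.≤-trans (ℕ.s≤s (ℕ.s≤s (n≤2*⌈n/2⌉ n))) (ℕₚ.≤-reflexive (≡.sym (ℕₚ.*-suc 2 ⌈ n /2⌉)))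
  go : ∀ n → ⌈ 2 ℕ.+ n /2⌉ ℕ.≤ 2 ℕ.^ ⌈log₂ ⌈ 2 ℕ.+ n /2⌉ ⌉ → 2 ℕ.+ n ℕ.≤ 2 ℕ.^ ⌈log₂ 2 ℕ.+ n ⌉
  go n h = begin
    2 ℕ.+ n ≤⟨ n≤2*⌈n/2⌉ (2 ℕ.+ n) ⟩
    2 ℕ.* ⌈ 2 ℕ.+ n /2⌉ ≤⟨ ℕₚ.*-monoʳ-≤ 2 h ⟩
    2 ℕ.^ suc ⌈log₂ ⌈ 2 ℕ.+ n /2⌉ ⌉ ≡⟨ ≡.cong (λ k → 2 ℕ.^ suc k) (⌈log₂⌈n/2⌉⌉≡⌈log₂n⌉∸1 (2 ℕ.+ n)) ⟩
    2 ℕ.^ suc (⌈log₂ 2 ℕ.+ n ⌉ ℕ.∸ 1) ≡⟨ ≡.cong (2 ℕ.^_) (ℕₚ.m+[n∸m]≡n {1} (⌈log₂⌉-mono-≤ {2} {2 ℕ.+ n} (ℕ.s≤s (ℕ.s≤s ℕ.z≤n)))) ⟩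
    2 ℕ.^ ⌈log₂ 2 ℕ.+ n ⌉ ∎
    where open ℕₚ.≤-Reasoning

n<m^n : ∀ {m} → 1 ℕ.< m → ∀ n → n ℕ.< m ℕ.^ n
n<m^n 1<m zero = ℕₚ.≤-refl
n<m^n {m} 1<m (suc n) = ℕₚ.≤-<-trans (n<m^n 1<m n) (ℕₚ.^-monoʳ-< m 1<m (ℕₚ.n<1+n n))

prime-parity : ∀ {p} → Prime p → p ≡ 2 ⊎ ∃ λ m → p ≡ suc (2 ℕ.* suc m)
prime-parity {p} p-prime = go (p ℕ.% 2) (p ℕ./ 2) (m%n<n p 2) (m≡m%n+[m/n]*n p 2)
  where
  go : ∀ r q → r ℕ.< 2 → p ≡ r ℕ.+ q ℕ.* 2 → p ≡ 2 ⊎ ∃ λ m → p ≡ suc (2 ℕ.* suc m)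
  go zero q _ e with prime⇒irreducible p-prime (divides q e)
  ... | inj₂ 2≡p = inj₁ (≡.sym 2≡p)
  go (suc zero) zero _ ≡.refl = contradiction p-prime λ ()
  go (suc zero) (suc q) _ e = inj₂ (q , ≡.trans e (≡.cong suc (ℕₚ.*-comm (suc q) 2)))
  go (suc (suc r)) q (ℕ.s≤s (ℕ.s≤s ())) _

module SplitModulus (V : ValuedRing) where
  open ValuedRing V
  open RingKit ring
  open Char prime char
  open Polynomials ring
  open PolynomialRing V
  open Assembly V using (module Modulus; Modulus; X; φ-monic; monic-inverse)

  -- The roots are the two elements of the field with four elements outside the prime field; their
  -- trace is 1.
  modulus-2 : p ≡ 2 → ∀ x → Modulus x 2
  modulus-2 ≡.refl x = record
    { Π = x ^ 2 + (x + 1#)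
    ; monicΠ = A.presp (solve 2 (λ x y → x :+ :1 := (y :+ (x :+ :1)) :- y) refl x (x ^ 2)) (A.padd (A.presp (*-identityʳ x) (Deg-x^ x 1)) (A.p≤ (ℕ.s≤s ℕ.z≤n) (Deg-x^ x 0)))
    ; h = 1# ; h∈ = P.R1
    ; φ-root = trans (solve 1 (λ x → ((x :^ 2) :+ x) :* :1 := (:1 :+ ((x :^ 2) :+ (x :+ :1)) :* :1) :- con (ℤ.+ 2)) refl x) (minus-2 (1# + (x ^ 2 + (x + 1#)) * 1#))
    ; δ⁻ = 1# ; ρ = 1# ; δ⁻∈ = P.R1 ; ρ∈ = P.R1
    ; δδ⁻ = trans (solve 1 (λ x → (x :- (x :^ 2)) :* :1 := (:1 :+ ((x :^ 2) :+ (x :+ :1)) :* :1) :- con (ℤ.+ 2) :* (:1 :+ (x :^ 2))) refl x)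
        (trans (+-congˡ (-‿cong (trans (*-congʳ char) (zeroˡ _)))) (trans (+-congˡ -0#≈0#) (+-identityʳ _))) }
    where
    module A = Adjoin (Constants.constants V) x
    module P = Subring (pol x)
    minus-2 : ∀ a → a - ι 2 ≈ a
    minus-2 a = trans (+-congˡ (trans (-‿cong char) -0#≈0#)) (+-identityʳ a)

  -- With w = x^(p-1), the modulus (w^(p+1) - 1) / (w² - 1) has as roots the elements of the field
  -- with p² elements that lie outside the prime field and have nonzero trace. There are (p - 1)² of
  -- them.
  module Odd (m : ℕ) (p≡ : p ≡ suc (2 ℕ.* suc m)) {x φ⁻ : Carrier} (φφ⁻ : φ x * φ⁻ ≈ 1#) where
    private
      module A = Adjoin (Constants.constants V) x
      module P = Subring (pol x)

    e : ℕ
    e = 2 ℕ.* suc m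

    w : Carrier
    w = x ^ e

    w∈ : Pol x w
    w∈ = P.Rpow e (x∈Pol x)

    φ≈ : φ x ≈ x * (w + 1#)
    φ≈ = trans (+-congʳ (reflexive (≡.cong (x ^_) p≡))) (solve 2 (λ x w → x :* w :+ x := x :* (w :+ :1)) refl x w)

    -- 1 + w² + ⋯ + w^{2n}
    geometric : ℕ → Carrier
    geometric zero = 1#
    geometric (suc n) = w * w * geometric n + 1#

    geometric∈ : ∀ n → Pol x (geometric n)
    geometric∈ zero = P.R1
    geometric∈ (suc n) = P.Radd (P.Rmul (P.Rmul w∈ w∈) (geometric∈ n)) P.R1

    geometric-monic : ∀ n → MonicPol x (n ℕ.* (e ℕ.+ e)) (geometric n)
    geometric-monic zero = nil (-‿inverseʳ 1#)
    geometric-monic (suc n) = A.presp (solve 2 (λ a b → (a :- b) :+ :1 := (a :+ :1) :- b) refl (w * w * geometric n) (x ^ (e ℕ.+ e ℕ.+ n ℕ.* (e ℕ.+ e))))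
      (A.padd (monic-mul x (monic-mul x w-monic w-monic) (geometric-monic n)) (A.p≤ (ℕ.s≤s ℕ.z≤n) (Deg-x^ x 0)))
      where
      w-monic : MonicPol x e w
      w-monic = A.presp (sym (-‿inverseʳ w)) (A.pzero e)

    geometric-sum : ∀ n → geometric n * (w * w - 1#) ≈ w ^ (2 ℕ.+ n ℕ.* 2) - 1#
    geometric-sum zero = solve 1 (λ w → :1 :* (w :* w :- :1) := (w :^ 2) :- :1) refl w
    geometric-sum (suc n) = trans (solve 2 (λ w g → (w :* w :* g :+ :1) :* (w :* w :- :1) := w :* w :* (g :* (w :* w :- :1)) :+ (w :* w :- :1)) refl w (geometric n))
      (trans (+-congʳ (*-congˡ (geometric-sum n))) (solve 2 (λ w g → w :* w :* (g :- :1) :+ (w :* w :- :1) := w :* (w :* g) :- :1) refl w (w ^ (2 ℕ.+ n ℕ.* 2))))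

    geometric-quotient : ℕ → Carrier
    geometric-quotient zero = 0#
    geometric-quotient (suc n) = geometric-quotient n + (w + 1#) * geometric n

    geometric-quotient∈ : ∀ n → Pol x (geometric-quotient n)
    geometric-quotient∈ zero = P.R0
    geometric-quotient∈ (suc n) = P.Radd (geometric-quotient∈ n) (P.Rmul (P.Radd w∈ P.R1) (geometric∈ n))

    -- For n = suc m the value at w = 1 is (p + 1) / 2, the inverse of 2 modulo `p`. Hence 1 - w,
    -- and with it x - x^p, is invertible modulo the modulus.
    geometric-at-1 : ∀ n → geometric n ≈ ι (suc n) + (w - 1#) * geometric-quotient n
    geometric-at-1 zero = solve 1 (λ w → :1 := :1 :+ (w :- :1) :* :0) refl w
    geometric-at-1 (suc n) = trans (solve 2 (λ w g → w :* w :* g :+ :1 := g :+ (:1 :+ (w :- :1) :* ((w :+ :1) :* g))) refl w (geometric n))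
      (trans (+-congʳ (geometric-at-1 n)) (trans (solve 4 (λ i w q g → (i :+ (w :- :1) :* q) :+ (:1 :+ (w :- :1) :* ((w :+ :1) :* g)) := (:1 :+ i) :+ (w :- :1) :* (q :+ (w :+ :1) :* g)) refl (ι (suc n)) w (geometric-quotient n) (geometric n))
        (+-congʳ (sym (ι-suc (suc n))))))

    modulus : Modulus x (suc m ℕ.* (e ℕ.+ e))
    modulus = record
      { Π = Π₀ ; monicΠ = geometric-monic (suc m) ; h = w - 1# ; h∈ = P.Rsub w∈ P.R1
      ; φ-root = trans (reflexive (≡.cong (λ n → φ x ^ ℕ.pred n) p≡)) root
      -- x - x^p is x (1 - w). Modulo Π₀ the factor q + q inverts 1 - w, and (w + 1) φ(x)^(p-2)
      -- inverts x, because x (w + 1) = φ(x) and φ(x)^(p-1) is 1.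
      ; δ⁻ = (q + q) * ((w + 1#) * φ x ^ (m ℕ.+ suc (m ℕ.+ 0))) ; ρ = (w - 1#) - (1# + 1#) * (1# + Π₀ * (w - 1#))
      ; δ⁻∈ = P.Rmul (P.Radd (geometric-quotient∈ (suc m)) (geometric-quotient∈ (suc m))) (P.Rmul (P.Radd w∈ P.R1) (P.Rpow (m ℕ.+ suc (m ℕ.+ 0)) (P.Radd (P.Rpow p (x∈Pol x)) (x∈Pol x))))
      ; ρ∈ = P.Rsub (P.Rsub w∈ P.R1) (P.Rmul (P.Radd P.R1 P.R1) (P.Radd P.R1 (P.Rmul (geometric∈ (suc m)) (P.Rsub w∈ P.R1))))
      ; δδ⁻ = begin
          (x - x ^ p) * ((q + q) * ((w + 1#) * Φ)) ≈⟨ *-congʳ (+-congˡ (-‿cong (reflexive (≡.cong (x ^_) p≡)))) ⟩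
          (x - x * w) * ((q + q) * ((w + 1#) * Φ)) ≈⟨ solve 4 (λ x w q Φ → (x :- x :* w) :* ((q :+ q) :* ((w :+ :1) :* Φ)) := ((:1 :- w) :* (q :+ q)) :* ((x :* (w :+ :1)) :* Φ)) refl x w q Φ ⟩
          ((1# - w) * (q + q)) * ((x * (w + 1#)) * Φ) ≈⟨ *-cong double-Π (trans (*-congʳ (sym φ≈)) root) ⟩
          (1# - (Π₀ + Π₀)) * (1# + Π₀ * (w - 1#)) ≈⟨ solve 2 (λ Π h → (:1 :- (Π :+ Π)) :* (:1 :+ Π :* h) := :1 :+ Π :* (h :- (:1 :+ :1) :* (:1 :+ Π :* h))) refl Π₀ (w - 1#) ⟩
          1# + Π₀ * ((w - 1#) - (1# + 1#) * (1# + Π₀ * (w - 1#))) ∎ }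
      where
      Π₀ = geometric (suc m)
      q = geometric-quotient (suc m)
      Φ = φ x ^ (m ℕ.+ suc (m ℕ.+ 0))
      double-Π : (1# - w) * (q + q) ≈ 1# - (Π₀ + Π₀)
      double-Π = sym (begin
        1# - (Π₀ + Π₀) ≈⟨ +-congˡ (-‿cong (+-cong (geometric-at-1 (suc m)) (geometric-at-1 (suc m)))) ⟩
        1# - ((ι (2 ℕ.+ m) + (w - 1#) * q) + (ι (2 ℕ.+ m) + (w - 1#) * q))
          ≈⟨ solve 3 (λ i w q → :1 :- ((i :+ (w :- :1) :* q) :+ (i :+ (w :- :1) :* q)) := (:1 :- (i :+ i)) :+ (:1 :- w) :* (q :+ q)) refl (ι (2 ℕ.+ m)) w q ⟩
        (1# - (ι (2 ℕ.+ m) + ι (2 ℕ.+ m))) + (1# - w) * (q + q)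
          ≈⟨ +-congʳ (trans (+-congˡ (-‿cong ι-p+1)) (-‿inverseʳ 1#)) ⟩
        0# + (1# - w) * (q + q) ≈⟨ +-identityˡ _ ⟩
        (1# - w) * (q + q) ∎)
        where
        ι-p+1 : ι (2 ℕ.+ m) + ι (2 ℕ.+ m) ≈ 1#
        ι-p+1 = trans (sym (ι-+ (2 ℕ.+ m) (2 ℕ.+ m))) (trans (reflexive (≡.cong ι (≡.trans
            (ℕS.solve 1 (λ m → (ℕS.con 2 ℕS.:+ m) ℕS.:+ (ℕS.con 2 ℕS.:+ m) ℕS.:= ℕS.con 1 ℕS.:+ (ℕS.con 1 ℕS.:+ ℕS.con 2 ℕS.:* (ℕS.con 1 ℕS.:+ m))) ≡.refl m) (≡.cong suc (≡.sym p≡)))))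
          (trans (ι-suc p) (trans (+-congˡ char) (+-identityʳ 1#))))
      -- (w + 1) (φ^{p-1} - 1) = w^{p+1} - 1, as φ = x (w + 1).
      root : φ x ^ e ≈ 1# + Π₀ * (w - 1#)
      root = unit-cancelˡ {w + 1#} {x * φ⁻} (trans (trans (sym (*-assoc _ _ _)) (*-congʳ (*-comm _ x))) (trans (*-congʳ (sym φ≈)) φφ⁻)) (begin
        (w + 1#) * φ x ^ e ≈⟨ *-congˡ (trans (^-congˡ e φ≈) (^-distrib-* x (w + 1#) e)) ⟩
        (w + 1#) * (w * (w + 1#) ^ e) ≈⟨ solve 2 (λ w b → (w :+ :1) :* (w :* b) := w :* ((w :+ :1) :* b)) refl w ((w + 1#) ^ e) ⟩
        w * (w + 1#) ^ suc e ≈⟨ *-congˡ (trans (reflexive (≡.cong ((w + 1#) ^_) (≡.sym p≡))) (trans (frob-+ w 1#) (+-cong (reflexive (≡.cong (w ^_) p≡)) (1^ p)))) ⟩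
        w * (w * w ^ e + 1#) ≈⟨ *-congˡ (+-congʳ (*-congˡ (reflexive (≡.cong (w ^_) (ℕₚ.*-comm 2 (suc m)))))) ⟩
        w * (w * w ^ (suc m ℕ.* 2) + 1#) ≈⟨ solve 2 (λ w b → w :* (w :* b :+ :1) := (w :+ :1) :+ (w :* (w :* b) :- :1)) refl w (w ^ (suc m ℕ.* 2)) ⟩
        (w + 1#) + (w ^ (2 ℕ.+ suc m ℕ.* 2) - 1#) ≈⟨ +-congˡ (geometric-sum (suc m)) ⟨
        (w + 1#) + Π₀ * (w * w - 1#) ≈⟨ solve 2 (λ w g → (w :+ :1) :+ g :* (w :* w :- :1) := (w :+ :1) :* (:1 :+ g :* (w :- :1))) refl w Π₀ ⟩
        (w + 1#) * (1# + Π₀ * (w - 1#)) ∎)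

  modulus : ∀ N → Σ ℕ λ σ → Modulus (X N) σ × p ℕ.* ⌈log₂ p ⌉ ℕ.≤ 2 ℕ.* σ × p ℕ.≤ 2 ℕ.* σ
  modulus N with prime-parity prime
  ... | inj₁ p≡ = 2 , modulus-2 p≡ (X N) , ≡.subst (λ p → p ℕ.* ⌈log₂ p ⌉ ℕ.≤ 4) (≡.sym p≡) (ℕ.s≤s (ℕ.s≤s ℕ.z≤n)) , ≡.subst (ℕ._≤ 4) (≡.sym p≡) (ℕ.s≤s (ℕ.s≤s ℕ.z≤n))
  ... | inj₂ (m , p≡) = suc m ℕ.* (e ℕ.+ e) , Odd.modulus m p≡ (proj₁ (proj₂ (monic-inverse N (φ-monic (X N))))) ,
        ≡.subst (λ p → p ℕ.* ⌈log₂ p ⌉ ℕ.≤ 2 ℕ.* σ) (≡.sym p≡) (ℕₚ.≤-trans (ℕₚ.*-monoʳ-≤ (suc e) log≤) se*e≤) ,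
        ≡.subst (ℕ._≤ 2 ℕ.* σ) (≡.sym p≡) (ℕₚ.≤-trans (ℕₚ.m≤m*n (suc e) e) se*e≤)
    where
    e = 2 ℕ.* suc m
    σ = suc m ℕ.* (e ℕ.+ e)
    log≤ : ⌈log₂ suc e ⌉ ℕ.≤ e
    log≤ = ℕₚ.≤-trans (⌈log₂⌉-mono-≤ (n<m^n {2} ℕₚ.≤-refl e)) (ℕₚ.≤-reflexive (⌈log₂2^n⌉≡n e))
    se*e≤ : suc e ℕ.* e ℕ.≤ 2 ℕ.* σ
    se*e≤ = ℕₚ.≤-trans (ℕₚ.*-monoˡ-≤ e (ℕₚ.+-monoˡ-≤ e (ℕ.s≤s (ℕ.z≤n {m ℕ.+ suc (m ℕ.+ 0)})))) (ℕₚ.≤-reflexive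
      (ℕS.solve 1 (λ m → (ℕS.con 2 ℕS.:* (ℕS.con 1 ℕS.:+ m) ℕS.:+ ℕS.con 2 ℕS.:* (ℕS.con 1 ℕS.:+ m)) ℕS.:* (ℕS.con 2 ℕS.:* (ℕS.con 1 ℕS.:+ m)) ℕS.:= ℕS.con 2 ℕS.:* ((ℕS.con 1 ℕS.:+ m) ℕS.:* (ℕS.con 2 ℕS.:* (ℕS.con 1 ℕS.:+ m) ℕS.:+ ℕS.con 2 ℕS.:* (ℕS.con 1 ℕS.:+ m)))) ≡.refl m))

n≤2⌊n/2⌋+1 : ∀ n → n ℕ.≤ 2 ℕ.* ⌊ n /2⌋ ℕ.+ 1
n≤2⌊n/2⌋+1 zero = ℕ.z≤n
n≤2⌊n/2⌋+1 (suc zero) = ℕₚ.≤-refl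
n≤2⌊n/2⌋+1 (suc (suc n)) = ℕₚ.≤-trans (ℕ.s≤s (ℕ.s≤s (n≤2⌊n/2⌋+1 n))) (ℕₚ.≤-reflexive (≡.cong (ℕ._+ 1) (≡.sym (ℕₚ.*-suc 2 ⌊ n /2⌋))))

-- Choice of parameters and the final sets.

record Sample (V : ValuedRing) (r e e′ : ℕ) : Set₁ where
  open RingKit (ValuedRing.ring V) using (Carrier; _≈_; _+_; _*_)
  field
    Index    : Set
    el       : Index → Carrier
    indices  : List Index
    distinct : AllPairs (λ x y → ¬ x ≈ y) (List.map el indices)
    large    : r ℕ.≤ length (List.map el indices)
    sums     : Σ (List Carrier) λ S → (∀ x y → Any (λ s → el x + el y ≈ s) S) × length S ℕ.^ e ℕ.≤ length (List.map el indices) ℕ.^ e′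
    products : Σ (List Carrier) λ S → (∀ x y → Any (λ s → el x * el y ≈ s) S) × length S ℕ.^ e ℕ.≤ length (List.map el indices) ℕ.^ e′

module Saving (V : ValuedRing) (𝒞 : Curve V) (ℛ : ResidueRings.Residues V 𝒞) (M W : ℕ) (M≡ : suc M ≡ 64 ℕ.* W) (W≡ : W ≡ 2 ℕ.^ 26)
  (2M≤J : M ℕ.+ M ℕ.≤ Curve.J 𝒞) (M<J : M ℕ.< Curve.J 𝒞) (k : ℕ) (p≤2^k : ValuedRing.p V ℕ.≤ 2 ℕ.^ k)
  (pk≤ : ValuedRing.p V ℕ.* k ℕ.≤ 2 ℕ.* Curve.σ 𝒞) (p≤ : ValuedRing.p V ℕ.≤ 2 ℕ.* Curve.σ 𝒞) (3≤r : 3 ℕ.≤ Curve.r 𝒞) where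
  open ValuedRing V
  open RingKit ring using (Carrier; _≈_; _+_; _*_)
  open RingKit.Char ring prime char using (1<p)
  open Curve 𝒞 using (σ; r; J; Λ; Λ≡)
  open ResidueRings.Residues ℛ using (enough)
  open Construction V 𝒞 ℛ M 2M≤J M<J
  open Elements V 𝒞 ℛ M 2M≤J M<J

  private
    h : ℕ
    h = ⌊ n /2⌋

    1≤p : 1 ℕ.≤ p
    1≤p = ℕₚ.<⇒≤ 1<p

    1≤q′ : 1 ℕ.≤ q′
    1≤q′ = ℕ.s≤s⁻¹ (≡.subst (2 ℕ.≤_) q′≡ (ℕₚ.*-mono-≤ {2} {p} {1} 1<p 1≤p))

    1≤σ : 1 ℕ.≤ σ
    1≤σ = go σ p≤
      where
      go : ∀ σ → p ℕ.≤ 2 ℕ.* σ → 1 ℕ.≤ σ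
      go zero le = contradiction (ℕₚ.≤-trans 1≤p le) λ ()
      go (suc _) _ = ℕ.s≤s ℕ.z≤n

    -- Already r ≥ 3 forces two residue rings, since p^3 exceeds p^2.
    1≤h : 1 ℕ.≤ h
    1≤h = go n enough
      where
      too-small : ∀ n → n ℕ.≤ 1 → ¬ p ℕ.^ (σ ℕ.* r) ℕ.≤ (p ℕ.* p) ℕ.^ n
      too-small n n≤1 le = ℕₚ.<⇒≱ (ℕₚ.^-monoʳ-< p 1<p (ℕₚ.*-mono-≤ {1} {σ} {3} 1≤σ 3≤r))
        (ℕₚ.≤-trans le (ℕₚ.≤-trans (ℕₚ.^-monoʳ-≤ (p ℕ.* p) {{ℕ.>-nonZero (ℕₚ.*-mono-≤ {1} {p} {1} 1≤p 1≤p)}} n≤1)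
          (ℕₚ.≤-reflexive (≡.trans (ℕₚ.*-identityʳ (p ℕ.* p)) (≡.cong (p ℕ.*_) (≡.sym (ℕₚ.*-identityʳ p)))))))
      go : ∀ n → p ℕ.^ (σ ℕ.* r) ℕ.≤ (p ℕ.* p) ℕ.^ n → 1 ℕ.≤ ⌊ n /2⌋
      go zero le = contradiction le (too-small 0 ℕ.z≤n)
      go (suc zero) le = contradiction le (too-small 1 ℕₚ.≤-refl)
      go (suc (suc n)) _ = ℕ.s≤s ℕ.z≤n

    1≤k : 1 ℕ.≤ k
    1≤k = go k p≤2^k
      where
      go : ∀ k → p ℕ.≤ 2 ℕ.^ k → 1 ℕ.≤ k
      go zero le = contradiction le (ℕₚ.<⇒≱ 1<p)
      go (suc _) _ = ℕ.s≤s ℕ.z≤n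

    open PatternCount finiteQ 0Q M J M<J W M≡ 1≤q′ using (2^≤patSize; pattern-bound)

    open Numerics p k σ r J M W n h (suc q′) Λ (patSize n) 1<p p≤2^k pk≤ p≤ q′≡ Λ≡
      (≡.subst (λ q → p ℕ.^ (σ ℕ.* r) ℕ.≤ q ℕ.^ n) q′≡ enough) (n≤2⌊n/2⌋+1 n) 1≤h W≡ (2^≤patSize n) (pattern-bound n)
      using (A; 1≤A; sum-saving; product-saving; b; size-bound)

  denominator : ℕ
  denominator = (J ℕ.+ 2) ℕ.* 12 ℕ.+ 1

  private
    1≤bk : 1 ℕ.≤ denominator ℕ.* k
    1≤bk = ℕₚ.*-mono-≤ {1} {denominator} {1} (ℕₚ.m≤n+m 1 ((J ℕ.+ 2) ℕ.* 12)) 1≤k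

    key : Index → Fin (p ℕ.^ suc K)
    key x = keyAt K (el x)

    A≤ : A ℕ.≤ 2 ℕ.^ (h ℕ.* (denominator ℕ.* k))
    A≤ = size-bound (finite-≤ finite-Index (finite-Fin (p ℕ.^ suc K)) key
      (λ {x} {y} e → el-injective x y (keyAt-injective K (el-bounded x) (el-bounded y) e)))

    saving : ∀ X → X ℕ.* 2 ℕ.^ h ℕ.≤ A ℕ.* A → X ℕ.^ (denominator ℕ.* k) ℕ.≤ A ℕ.^ (2 ℕ.* denominator ℕ.* k ℕ.∸ 1)
    saving X le = power-saving {X} {A} {h} denominator k 1≤A 1≤bk le A≤

  elements : List Carrier
  elements = List.map el allIndices

  length-elements : length elements ≡ A
  length-elements = ≡.trans (Listₚ.length-map el allIndices) (≡.trans (Listₚ.length-map (Finite.decode finite-Index) (List.allFin A)) (Listₚ.length-tabulate {n = A} (λ i → i)))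

  distinct : AllPairs (λ x y → ¬ x ≈ y) elements
  distinct = AllPairsₚ.map⁺ (AllPairsₚ.map⁺ (AllPairsₚ.tabulate⁺ λ i≢j e → i≢j (Finite.decode-injective finite-Index (el-injective _ _ e))))

  large : r ℕ.≤ length elements
  large = begin
    r ≤⟨ ℕₚ.m≤n*m r (J ℕ.* σ ℕ.+ p) {{ℕ.>-nonZero (ℕₚ.≤-trans 1≤p (ℕₚ.m≤n+m p (J ℕ.* σ)))}} ⟩
    (J ℕ.* σ ℕ.+ p) ℕ.* r ≡⟨ Λ≡ ⟨
    Λ ≤⟨ ℕₚ.<⇒≤ (ℕₚ.<-trans (ℕₚ.n<1+n Λ) (n<m^n 1<p (suc Λ))) ⟩
    p ℕ.^ suc Λ ≤⟨ ℕₚ.m≤m*n (p ℕ.^ suc Λ) (patSize n) {{ℕ.>-nonZero (ℕₚ.≤-trans (1≤^ 2 h (ℕ.s≤s ℕ.z≤n)) (2^≤patSize n))}} ⟩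
    A ≡⟨ length-elements ⟨
    length elements ∎
    where open ℕₚ.≤-Reasoning

  PowerCover : (Carrier → Carrier → Carrier) → Set
  PowerCover _∙_ = Σ (List Carrier) λ S → (∀ x y → Any (λ s → (el x ∙ el y) ≈ s) S) ×
    length S ℕ.^ (denominator ℕ.* k) ℕ.≤ length elements ℕ.^ (2 ℕ.* denominator ℕ.* k ℕ.∸ 1)

  private
    powerCover : ∀ {_∙_} (S : List Carrier) → (∀ x y → Any (λ s → (el x ∙ el y) ≈ s) S) → length S ℕ.* 2 ℕ.^ h ℕ.≤ A ℕ.* A → PowerCover _∙_
    powerCover S covers le = S , covers , ≡.subst (λ A → length S ℕ.^ (denominator ℕ.* k) ℕ.≤ A ℕ.^ (2 ℕ.* denominator ℕ.* k ℕ.∸ 1)) (≡.sym length-elements) (saving (length S) le)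

  sums : PowerCover _+_
  sums = powerCover {_+_} (proj₁ sumCover) (proj₁ (proj₂ sumCover)) (sum-saving (proj₂ (proj₂ sumCover)))

  products : PowerCover _*_
  products = powerCover {_*_} (proj₁ productCover) (proj₁ (proj₂ productCover)) (product-saving {length (proj₁ productCover)} (proj₂ (proj₂ productCover)))

  sample : Sample V r (denominator ℕ.* k) (2 ℕ.* denominator ℕ.* k ℕ.∸ 1)
  sample = record { el = el ; indices = allIndices ; distinct = distinct ; large = large ; sums = sums ; products = products }

-- Jets are taken to length J = 2M + 1, beyond the orders up to 2M that occur in products. The
-- height N enters the conclusion only through r = p^N, so the exponents are the same for sets of
-- every size.
tower-sample : ∀ V M W → suc M ≡ 64 ℕ.* W → W ≡ 2 ℕ.^ 26 → ∀ N → 3 ℕ.≤ N → let k = ⌈log₂ ValuedRing.p V ⌉ in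
  Sample V (Assembly.degree V N) (((suc (M ℕ.+ M) ℕ.+ 2) ℕ.* 12 ℕ.+ 1) ℕ.* k) (2 ℕ.* ((suc (M ℕ.+ M) ℕ.+ 2) ℕ.* 12 ℕ.+ 1) ℕ.* k ℕ.∸ 1)
tower-sample V M W M≡ W≡ N 3≤N = go (SplitModulus.modulus V N)
  where
  open Assembly V using (degree; <degree; curve; Modulus; X)
  open ValuedRing V using (p)
  k = ⌈log₂ p ⌉
  go : (Σ ℕ λ σ → Modulus (X N) σ × p ℕ.* k ℕ.≤ 2 ℕ.* σ × p ℕ.≤ 2 ℕ.* σ) → Sample V (degree N) (((suc (M ℕ.+ M) ℕ.+ 2) ℕ.* 12 ℕ.+ 1) ℕ.* k) (2 ℕ.* ((suc (M ℕ.+ M) ℕ.+ 2) ℕ.* 12 ℕ.+ 1) ℕ.* k ℕ.∸ 1)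
  go (σ , mod , pk≤ , p≤) = Saving.sample V 𝒞 (ResidueRings.residues V 𝒞) M W M≡ W≡ (ℕₚ.n≤1+n (M ℕ.+ M)) (ℕ.s≤s (ℕₚ.m≤m+n M M))
      k (n≤2^⌈log₂n⌉ p) pk≤ p≤ (ℕₚ.≤-trans 3≤N (ℕₚ.<⇒≤ (<degree N)))
    where
    𝒞 : Curve V
    𝒞 = curve N mod (M ℕ.+ M)

all-pairwise : ∀ {I C : Set} {P : C → Set} (f : C → C → C) (g : I → C) (xs : List I) → (∀ x y → P (f (g x) (g y))) →
  All P (concatMap (λ a → List.map (f a) (List.map g xs)) (List.map g xs))
all-pairwise f g xs h = Allₚ.concat⁺ (Allₚ.map⁺ (Allₚ.map⁺ (All.universal (λ x → Allₚ.map⁺ (Allₚ.map⁺ (All.universal (h x) xs))) xs)))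

fromSample : ∀ {p} (prime : Prime p) {r e e′} → Sample (LaurentSeries.valuedRing prime) r e e′ → ∀ N → N ℕ.≤ r →
  Σ (List Laurent) λ A → DistinctMod p A × (N ℕ.≤ length A) × CardPowBound p (sumList A) e (length A) e′ × CardPowBound p (prodList A) e (length A) e′
fromSample p-prime S N N≤r = List.map el indices , distinct , ℕₚ.≤-trans N≤r large ,
    (proj₁ sums , all-pairwise _⊕_ el indices (proj₁ (proj₂ sums)) , proj₂ (proj₂ sums)) ,
    (proj₁ products , all-pairwise _⊗_ el indices (proj₁ (proj₂ products)) , proj₂ (proj₂ products))
  where open Sample S

-- The constants are kept as variables so that M = 2³² - 1 is never evaluated.
expanding-sets : ∀ M W → suc M ≡ 64 ℕ.* W → W ≡ 2 ℕ.^ 26 → ∀ {b} → b ≡ (suc (M ℕ.+ M) ℕ.+ 2) ℕ.* 12 ℕ.+ 1 → (p : ℕ) → Prime p → (N : ℕ) →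
  Σ (List Laurent) λ A → DistinctMod p A × (N ℕ.≤ length A) ×
    CardPowBound p (sumList A) (b ℕ.* ⌈log₂ p ⌉) (length A) (2 ℕ.* b ℕ.* ⌈log₂ p ⌉ ℕ.∸ 1) ×
    CardPowBound p (prodList A) (b ℕ.* ⌈log₂ p ⌉) (length A) (2 ℕ.* b ℕ.* ⌈log₂ p ⌉ ℕ.∸ 1)
expanding-sets M W M≡ W≡ ≡.refl p p-prime N = fromSample p-prime (tower-sample V M W M≡ W≡ (3 ℕ.+ N) (ℕₚ.m≤m+n 3 N)) N (ℕₚ.≤-trans (ℕₚ.m≤n+m N 3) (ℕₚ.<⇒≤ (Assembly.<degree V (3 ℕ.+ N))))
  where
  V : ValuedRing
  V = LaurentSeries.valuedRing p-prime

open import Data.Nat using (_+_; _*_; _∸_; _≤_; _<_)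

theorem7p7 : Σ ℕ λ a → Σ ℕ λ b → (0 < a) × (a ≤ b) ×
    ((p : ℕ) → Prime p → (N : ℕ) →
    Σ (List Laurent) λ A →
    DistinctMod p A × (N ≤ length A) ×
    CardPowBound p (sumList A) (b * ⌈log₂ p ⌉) (length A) (2 * b * ⌈log₂ p ⌉ ∸ a) ×
    CardPowBound p (prodList A) (b * ⌈log₂ p ⌉) (length A) (2 * b * ⌈log₂ p ⌉ ∸ a))
-- The exponent reached is 2 - 1 / (b k) with k the rounded-up binary logarithm of `p`, and `b`
-- depends on M alone.
theorem7p7 = 1 , b , ℕ.s≤s ℕ.z≤n , ℕₚ.m≤n+m 1 ((suc (M + M) + 2) * 12) , expanding-sets M (2 ℕ.^ 26) ≡.refl ≡.refl {b} ≡.refl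
  where
  M b : ℕ
  M = ℕ.pred (64 * 2 ℕ.^ 26)
  b = (suc (M + M) + 2) * 12 + 1
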